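{- There is a constant $\varepsilon>0$ such that for every odd prime power $q$, the coset complex $X_{link,q}=X(G_{link,q},(K_{\{i\}})_{i\in\{0,1,2\}})$ satisfies $\operatorname{Exp}^0_b(X_{link,q})\geq\varepsilon$ and $\operatorname{Exp}^1_b(X_{link,q})\geq\varepsilon$; in particular each $X_{link,q}$ is an $\varepsilon$-coboundary expander, with $\varepsilon$ independent of $q$.
   Context: For $1\le i\ne j\le 4$ and $r\in\mathbb{F}_q[t]$, $e_{i,j}(r)$ is the $4\times4$ matrix with $1$'s on the diagonal, $r$ in entry $(i,j)$ and $0$ elsewhere. $G_{link,q}$ is the group of $4\times 4$ matrices over $\mathbb{F}_q[t]$ generated by $\{e_{i,i+1}(a+bt): a,b\in\mathbb{F}_q,\ 1\le i\le 3\}$; equivalently, $A\in G_{link,q}$ iff $A(i,i)=1$, $A(i,j)=0$ for $i>j$, and for $i<j$, $A(i,j)$ is a polynomial in $t$ of degree $\le j-i$. For $i\in\{0,1,2\}$, $K_{\{i\}}=\langle e_{j,j+1}(a+bt): j\in\{1,2,3\}\setminus\{i+1\}, a,b\in\mathbb{F}_q\rangle$. Coset complex: for a group $G$ with subgroups $K_{\{i\}}$, $i\in I$ ($I$ finite), $X(G,(K_{\{i\}})_{i\in I})$ has vertex set the disjoint union of the sets $S_i=\{gK_{\{i\}}:g\in G\}$; two vertices $gK_{\{i\}}, g'K_{\{j\}}$ span an edge iff $i\ne j$ and $gK_{\{i\}}\cap g'K_{\{j\}}\ne\emptyset$; and $X$ is the clique complex of this graph. For a pure $n$-dimensional simplicial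 complex $X$ (with $X(-1)=\{\emptyset\}$): $C^k(X)$ is the $\mathbb{F}_2$-space of functions $X(k)\to\mathbb{F}_2$; $d_k:C^k\to C^{k+1}$, $d_k\phi(\sigma)=\sum_{\tau\subset\sigma,|\tau|=|\sigma|-1}\phi(\tau)$; $B^k(X)=\operatorname{Im}d_{k-1}$. For $\tau\in X(k)$, $w(\tau)=\frac{|\{\sigma\in X(n):\tau\subseteq\sigma\}|}{\binom{n+1}{k+1}|X(n)|}$, and $w(\phi)=\sum_{\tau\in\operatorname{supp}\phi}w(\tau)$. $\operatorname{Exp}^k_b(X)=\min\{\frac{w(d_k\phi)}{\min_{\psi\in B^k(X)}w(\phi+\psi)}:\phi\in C^k(X)\setminus B^k(X)\}$. $X$ is an $\varepsilon$-coboundary expander if $\operatorname{Exp}^k_b(X)\ge\varepsilon$ for all $0\le k\le n-1$. -}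

module Defs where

open import Level using (0ℓ; Level)
open import Algebra.Bundles using (Monoid; Group; CommutativeRing)
import Algebra.Properties.CommutativeSemigroup as CommutativeSemigroupProperties
import Algebra.Properties.Group as GroupProperties
import Algebra.Properties.Ring as RingProperties
import Algebra.Properties.Semiring.Sum as SemiringSum
open import Data.Bool.Base using (Bool; true; false; _xor_; if_then_else_)
import Data.Bool.Properties as Bool
open import Data.Empty using (⊥-elim)
open import Data.Fin.Base using (Fin; zero; suc; toℕ; inject₁)
import Data.Fin.Properties as Fin
open import Data.Fin.Subset using (Subset; ∣_∣; _⊆_)
  renaming (_∈_ to _∈ˢ_; ⊥ to ∅)
import Data.Fin.Subset.Properties as Subset
open import Data.Integer.Base using (+_)
open import Data.List.Base
  using (List; []; _∷_; map; foldr; length; lookup; filter; allFin; _++_; concatMap; deduplicate;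
         cartesianProduct; cartesianProductWith)
import Data.List.Extrema as Extrema
import Data.List.Membership.DecPropositional as DecMembership
import Data.List.Membership.Propositional as Membership
import Data.List.Membership.Propositional.Properties as Membership
import Data.List.Properties as List
open import Data.List.Relation.Unary.Any as Any using (Any; here; there)
import Data.List.Relation.Unary.Any.Properties as Any
open import Data.List.Relation.Unary.Enumerates.Setoid using (IsEnumeration)
open import Data.Nat.Base as ℕ using (ℕ; zero; suc; z≤n; s≤s)
open import Data.Nat.Combinatorics using () renaming (_C_ to _choose_)
open import Data.Nat.Primality using (Prime)
import Data.Nat.Properties as ℕ
open import Data.Product.Base using (Σ; Σ-syntax; ∃; ∃-syntax; ∃₂; _×_; _,_; proj₁; proj₂)
open import Data.Rational.Base as ℚ using (ℚ; 0ℚ)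
import Data.Rational.Properties as ℚ
open import Data.Sum.Base using (_⊎_; inj₁; inj₂)
open import Data.Vec.Base as Vec using (Vec; []; _∷_; zipWith)
import Data.Vec.Properties as Vec
open import Function.Base using (_∘_; _on_; case_of_)
open import Function.Bundles using (Inverse)
open import Function.Properties.Inverse using (Inverse⇒Injection)
import Function.Construct.Symmetry as Symmetry
open import Relation.Binary.Bundles using (Setoid; TotalOrder)
open import Relation.Binary.Construct.Add.Supremum.NonStrict ℚ._≤_
  using (_≤⁺_; ≤⁺-isTotalOrder-≡)
open import Relation.Binary.Definitions using () renaming (Decidable to Decidable₂)
open import Relation.Binary.PropositionalEquality as ≡ using (_≡_; _≢_)
import Relation.Binary.Reasoning.Setoid as SetoidReasoning
open import Relation.Nullary.Construct.Add.Supremum using (_⁺; ⊤⁺; [_])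
open import Relation.Nullary.Decidable
  using (Dec; yes; no; does; ¬?; _×-dec_; _→-dec_; map′; via-injection)
open import Relation.Nullary.Negation using (¬_; contradiction)
open import Relation.Unary using (Pred; Decidable; U)
open import Relation.Unary.Properties using (U?)

private variable
  a b r : Level
  A B : Set a
  n : ℕ

------------------------------------------------------------------------
-- Finite simplicial complexes and their coboundary expansion

vectors : List A → ∀ n → List (Vec A n)
vectors xs zero    = [] ∷ []
vectors xs (suc n) = cartesianProductWith _∷_ xs (vectors xs n)

vectors-complete : (R : A → B → Set r) (xs : List A) (f : Fin n → B) →
                   (∀ i → Any (λ a → R a (f i)) xs) →
                   Any (λ v → ∀ i → R (Vec.lookup v i) (f i)) (vectors xs n)
vectors-complete {n = zero}  R xs f h = here λ ()
vectors-complete {n = suc n} R xs f h = Any.cartesianProductWith⁺ _∷_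
  (λ r rs → λ { zero → r ; (suc i) → rs i })
  (h zero) (vectors-complete R xs (f ∘ suc) (h ∘ suc))

bits : ∀ n → List (Vec Bool n)
bits = vectors (false ∷ true ∷ [])

record SimplicialComplex : Set₁ where
  field
    size       : ℕ
    Face       : Pred (Subset size) 0ℓ
    Face?      : Decidable Face
    ∅-face     : Face ∅
    ⊆-closed   : ∀ {s t} → s ⊆ t → Face t → Face s

-- Division on ℚ, with p ÷₀ 0 = 0.  For nonempty pure complexes every
-- denominator below is nonzero.
infixl 7 _÷₀_
_÷₀_ : ℚ → ℚ → ℚ
p ÷₀ q with q ℚ.≟ 0ℚ
... | yes _   = 0ℚ
... | no  q≢0 = (p ℚ.÷ q) {{ℚ.≢-nonZero q≢0}}

fromℕ : ℕ → ℚ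
fromℕ n = + n ℚ./ 1

-- ⊤⁺ plays the role of +∞, the minimum of the empty set.
≤⁺-totalOrder : TotalOrder 0ℓ 0ℓ 0ℓ
≤⁺-totalOrder = record { isTotalOrder = ≤⁺-isTotalOrder-≡ ℚ.≤-isTotalOrder }

minℚ : ℚ → List ℚ → ℚ
minℚ = Extrema.min (record { isTotalOrder = ℚ.≤-isTotalOrder })

minℚ⁺ : List ℚ → ℚ ⁺
minℚ⁺ = Extrema.min ≤⁺-totalOrder ⊤⁺ ∘ map [_]

-- Faces and cochains are indexed by the number of vertices of a face, so
-- X(k) is faces (k + 1), and X(-1) = {∅} is faces 0.
module Expansion (X : SimplicialComplex) where
  open SimplicialComplex X

  faces : ℕ → List (Subset size)
  faces m = filter (λ s → Face? s ×-dec ∣ s ∣ ℕ.≟ m) (bits size)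

  #faces : ℕ → ℕ
  #faces m = length (faces m)

  face : ∀ {m} → Fin (#faces m) → Subset size
  face {m} = lookup (faces m)

  -- 𝔽₂ is Bool with _xor_ as addition.
  Cochain : ℕ → Set
  Cochain m = Vec Bool (#faces m)

  cochains : ∀ m → List (Cochain m)
  cochains m = bits (#faces m)

  infixl 6 _⊕_
  _⊕_ : ∀ {m} → Cochain m → Cochain m → Cochain m
  _⊕_ = zipWith _xor_

  d : ∀ {m} → Cochain m → Cochain (suc m)
  d {m} φ = Vec.tabulate λ σ →
    foldr _xor_ false
      (map (Vec.lookup φ) (filter (λ τ → face τ Subset.⊆? face σ) (allFin (#faces m))))

  coboundaries : ∀ m → List (Cochain (suc m))
  coboundaries m = map d (cochains m)

  module _ {m : ℕ} where
    open DecMembership (Vec.≡-dec {n = #faces m} Bool._≟_) public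
      using (_∈_; _∉_; _∈?_; _∉?_)

  module Weighted (n : ℕ) where

    faceWeight : ∀ {m} → Fin (#faces m) → ℚ
    faceWeight {m} τ =
      fromℕ (length (filter (face τ Subset.⊆?_) (faces (suc n))))
        ÷₀ fromℕ ((suc n choose m) ℕ.* #faces (suc n))

    weight : ∀ {m} → Cochain m → ℚ
    weight {m} φ =
      foldr ℚ._+_ 0ℚ
        (map faceWeight (filter (λ τ → Vec.lookup φ τ Bool.≟ true) (allFin (#faces m))))

    -- The starting value weight φ is attained by ψ = 0.
    distanceToB : ∀ {m} → Cochain (suc m) → ℚ
    distanceToB {m} φ = minℚ (weight φ) (map (λ ψ → weight (φ ⊕ ψ)) (coboundaries m))

    Exp : ℕ → ℚ ⁺
    Exp k = minℚ⁺ (map (λ φ → weight (d φ) ÷₀ distanceToB φ)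
                       (filter (_∉? coboundaries k) (cochains (suc k))))

Exp : ∀ (n : ℕ) → SimplicialComplex → ℕ → ℚ ⁺
Exp n X = Expansion.Weighted.Exp X n

IsPure : ℕ → SimplicialComplex → Set
IsPure n X = ∀ {s} → Face s → ∃[ t ] (s ⊆ t × Face t × ∣ t ∣ ≡ suc n)
                            × ∣ s ∣ ℕ.≤ suc n
  where open SimplicialComplex X

IsCoboundaryExpander : (n : ℕ) → ℚ → SimplicialComplex → Set
IsCoboundaryExpander n ε X = IsPure n X × (∀ k → k ℕ.< n → [ ε ] ≤⁺ Exp n X k)

cliqueComplex : (N : ℕ) (_~_ : Fin N → Fin N → Set) → Decidable₂ _~_ → SimplicialComplex
cliqueComplex N _~_ _~?_ = record
  { size     = N
  ; Face     = λ s → ∀ u v → u ∈ˢ s → v ∈ˢ s → u ≢ v → u ~ v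
  ; Face?    = λ s → Fin.all? λ u → Fin.all? λ v →
                 (u Subset.∈? s) →-dec (v Subset.∈? s) →-dec ¬? (u Fin.≟ v) →-dec (u ~? v)
  ; ∅-face   = λ u v u∈∅ → contradiction u∈∅ Subset.∉⊥
  ; ⊆-closed = λ s⊆t clique u v u∈s v∈s → clique u v (s⊆t u∈s) (s⊆t v∈s)
  }

------------------------------------------------------------------------
-- Coset complexes

record FiniteGroup : Set₁ where
  field
    group : Group 0ℓ 0ℓ
  open Group group public
  field
    _≟_      : Decidable₂ _≈_
    elements : List Carrier
    complete : IsEnumeration setoid elements

record DecSubgroup (G : Group 0ℓ 0ℓ) : Set₁ where
  open Group G
  field
    Member   : Pred Carrier 0ℓ
    Member?  : Decidable Member
    resp     : ∀ {x y} → x ≈ y → Member x → Member y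
    ε-mem    : Member ε
    ∙-mem    : ∀ {x y} → Member x → Member y → Member (x ∙ y)
    ⁻¹-mem   : ∀ {x} → Member x → Member (x ⁻¹)

module CosetComplex (G : FiniteGroup) {m : ℕ}
                    (K : Fin m → DecSubgroup (FiniteGroup.group G)) where
  open FiniteGroup G
  private module K i = DecSubgroup (K i)

  -- The pair (i , g) represents the coset g K_i.
  Coset : Set
  Coset = Fin m × Carrier

  infix 4 _∈ᶜ_ _≈ᶜ_ _~_ _∈ᶜ?_ _≈ᶜ?_ _~?_

  _∈ᶜ_ : Carrier → Coset → Set
  x ∈ᶜ (i , g) = K.Member i (g ⁻¹ ∙ x)

  _≈ᶜ_ : Coset → Coset → Set
  (i , g) ≈ᶜ (j , h) = i ≡ j × h ∈ᶜ (i , g)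

  _~_ : Coset → Coset → Set
  u ~ v = proj₁ u ≢ proj₁ v × ∃[ x ] (x ∈ᶜ u × x ∈ᶜ v)

  _∈ᶜ?_ : Decidable₂ _∈ᶜ_
  x ∈ᶜ? (i , g) = K.Member? i (g ⁻¹ ∙ x)

  ∈ᶜ-resp : ∀ {x y} u → x ≈ y → x ∈ᶜ u → y ∈ᶜ u
  ∈ᶜ-resp (i , g) x≈y = K.resp i (∙-congˡ x≈y)

  _≈ᶜ?_ : Decidable₂ _≈ᶜ_
  (i , g) ≈ᶜ? (j , h) = (i Fin.≟ j) ×-dec (h ∈ᶜ? (i , g))

  _~?_ : Decidable₂ _~_
  u ~? v = ¬? (proj₁ u Fin.≟ proj₁ v) ×-dec
    map′ Any.satisfied
         (λ { (x , x∈u , x∈v) → Any.map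
              (λ x≈y → ∈ᶜ-resp u x≈y x∈u , ∈ᶜ-resp v x≈y x∈v) (complete x) })
         (Any.any? (λ x → (x ∈ᶜ? u) ×-dec (x ∈ᶜ? v)) elements)

  -- One representative of each coset.
  vertices : List Coset
  vertices = deduplicate _≈ᶜ?_ (cartesianProduct (allFin m) elements)

  vertex : Fin (length vertices) → Coset
  vertex = lookup vertices

  cosetComplex : SimplicialComplex
  cosetComplex = cliqueComplex (length vertices) (_~_ on vertex) (λ u v → vertex u ~? vertex v)

open CosetComplex public using (cosetComplex)

------------------------------------------------------------------------
-- Subgroups generated by a family of elements

module Generated (Γ : Group 0ℓ 0ℓ) where
  open Group Γ

  data ⟨_⟩ {I : Set} (g : I → Carrier) : Pred Carrier 0ℓ where
    gen    : ∀ i → ⟨ g ⟩ (g i)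
    resp   : ∀ {x y} → x ≈ y → ⟨ g ⟩ x → ⟨ g ⟩ y
    ε-mem  : ⟨ g ⟩ ε
    ∙-mem  : ∀ {x y} → ⟨ g ⟩ x → ⟨ g ⟩ y → ⟨ g ⟩ (x ∙ y)
    ⁻¹-mem : ∀ {x} → ⟨ g ⟩ x → ⟨ g ⟩ (x ⁻¹)

  ⟨_⟩-group : ∀ {I : Set} → (I → Carrier) → Group 0ℓ 0ℓ
  ⟨ g ⟩-group = record
    { Carrier = Σ Carrier ⟨ g ⟩
    ; _≈_     = _≈_ on proj₁
    ; _∙_     = λ (x , p) (y , q) → x ∙ y , ∙-mem p q
    ; ε       = ε , ε-mem
    ; _⁻¹     = λ (x , p) → x ⁻¹ , ⁻¹-mem p
    ; isGroup = record
      { isMonoid = record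
        { isSemigroup = record
          { isMagma = record
            { isEquivalence = record { refl = refl ; sym = sym ; trans = trans }
            ; ∙-cong        = ∙-cong
            }
          ; assoc = λ x y z → assoc _ _ _
          }
        ; identity = (λ x → identityˡ _) , (λ x → identityʳ _)
        }
      ; inverse = (λ x → inverseˡ _) , (λ x → inverseʳ _)
      ; ⁻¹-cong = ⁻¹-cong
      }
    }

  word : {I : Set} → (I → Carrier) → List I → Carrier
  word g = foldr (λ i → g i ∙_) ε

  private
    word-++ : ∀ {I : Set} (g : I → Carrier) is js →
              word g (is ++ js) ≈ word g is ∙ word g js
    word-++ g []       js = sym (identityˡ _)
    word-++ g (i ∷ is) js = trans (∙-congˡ (word-++ g is js)) (sym (assoc _ _ _))

  -- When the family is closed under inversion and finite up to _≈_, and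
  -- the words in it are covered by a finite list, the generated subgroup
  -- can be enumerated.
  module Enumerate {I : Set} (g : I → Carrier) (_≟_ : Decidable₂ _≈_)
      {M : Set} (_≋_ : M → Carrier → Set) (_≋?_ : ∀ u x → Dec (u ≋ x))
      (≋-resp : ∀ u x y → x ≈ y → u ≋ x → u ≋ y)
      (≋-det : ∀ u x y → u ≋ x → u ≋ y → x ≈ y)
      (inv : I → I) (inv-correct : ∀ i → (g i) ⁻¹ ≈ g (inv i))
      (is : List I) (is-complete : ∀ i → Any (λ j → g i ≈ g j) is)
      (cover : List M) (covers : ∀ (js : List I) → Any (_≋ word g js) cover)
    where

    open GroupProperties Γ using (ε⁻¹≈ε; ⁻¹-anti-homo-∙)

    private
      word-inv : ∀ js → ∃[ ks ] (word g js) ⁻¹ ≈ word g ks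
      word-inv []       = [] , ε⁻¹≈ε
      word-inv (j ∷ js) with ks , eq ← word-inv js =
        ks ++ (inv j ∷ []) ,
        trans (⁻¹-anti-homo-∙ _ _) (trans
          (∙-cong eq (trans (inv-correct j) (sym (identityʳ _))))
          (sym (word-++ g ks (inv j ∷ []))))

      toWord : ∀ {x} → ⟨ g ⟩ x → ∃[ js ] x ≈ word g js
      toWord (gen i)    = i ∷ [] , sym (identityʳ _)
      toWord (resp e p) with js , eq ← toWord p = js , trans (sym e) eq
      toWord ε-mem      = [] , refl
      toWord (∙-mem p q) with js , eq ← toWord p | ks , eq′ ← toWord q =
        js ++ ks , trans (∙-cong eq eq′) (sym (word-++ g js ks))
      toWord (⁻¹-mem p) with js , eq ← toWord p with ks , eq′ ← word-inv js =
        ks , trans (⁻¹-cong eq) eq′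

      Elt = Σ Carrier ⟨ g ⟩

      _∈̂_ : Carrier → List Elt → Set
      x ∈̂ xs = Any (λ y → x ≈ proj₁ y) xs

      representative : ∀ {x xs} → x ∈̂ xs → Σ[ y ∈ Elt ] x ≈ proj₁ y
      representative = Any.satisfied

      Closed : List Elt → Set
      Closed C = ∀ {x} i → x ∈̂ C → (g i ∙ x) ∈̂ C

      -- U lists what may still be missing from C.
      Invariant : List M → List Elt → Set
      Invariant U C = ∀ x → ⟨ g ⟩ x → Any (_≋ x) U ⊎ x ∈̂ C

      grow : ∀ n U (C : List Elt) → length U ℕ.≤ n → ε ∈̂ C → Invariant U C →
             Σ[ D ∈ List Elt ] (ε ∈̂ D × Closed D)
      grow n U C ∣U∣≤n ε∈C inC with
        Any.any? (λ u → Any.any? (λ x → Any.any? (λ i → u ≋? (g i ∙ proj₁ x)) is) C) U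
      ... | no none = C , ε∈C , closed
        where
        closed : Closed C
        closed {x} i x∈C with (y , p) , x≈y ← representative x∈C
                         with inC (g i ∙ x) (∙-mem (gen i) (resp (sym x≈y) p))
        ... | inj₂ gx∈C = gx∈C
        ... | inj₁ gx∈U = ⊥-elim (none (Any.map
                (λ u≋gx → Any.map (λ x≈z → Any.map
                   (λ gi≈gj → ≋-resp _ _ _ (∙-cong gi≈gj x≈z) u≋gx) (is-complete i)) x∈C) gx∈U))
      ... | yes found with u , u∈U , q ← Membership.find found
                      with (x , p) , q′ ← Any.satisfied q
                      with i , u≋z ← Any.satisfied q′ = step n ∣U∣≤n
        where
        z = g i ∙ x

        new? : Decidable (λ v → ¬ v ≋ z)
        new? v = ¬? (v ≋? z)

        U′ = filter new? U

        ∣U′∣<∣U∣ : length U′ ℕ.< length U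
        ∣U′∣<∣U∣ = List.filter-notAll new? U
          (Any.map (λ { ≡.refl ¬u≋z → ¬u≋z u≋z }) u∈U)

        C′ = (z , ∙-mem (gen i) p) ∷ C

        inC′ : Invariant U′ C′
        inC′ y y∈ with y ≟ z
        ... | yes y≈z = inj₂ (here y≈z)
        ... | no  y≉z with inC y y∈
        ... | inj₂ y∈C = inj₂ (there y∈C)
        ... | inj₁ y∈U with Any.filter⁺ new? y∈U
        ... | inj₁ y∈U′ = inj₁ y∈U′
        ... | inj₂ old  = ⊥-elim (old λ v≋z → y≉z (≋-det _ _ _ (Any.lookup-result y∈U) v≋z))

        step : ∀ n → length U ℕ.≤ n → Σ[ D ∈ List Elt ] (ε ∈̂ D × Closed D)
        step zero    ∣U∣≤n = contradiction (ℕ.<-≤-trans ∣U′∣<∣U∣ ∣U∣≤n) λ ()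
        step (suc n) ∣U∣≤n =
          grow n U′ C′ (ℕ.≤-pred (ℕ.<-≤-trans ∣U′∣<∣U∣ ∣U∣≤n)) (there ε∈C) inC′

      closure : Σ[ D ∈ List Elt ] (ε ∈̂ D × Closed D)
      closure = grow _ cover ((ε , ε-mem) ∷ []) ℕ.≤-refl (here refl) λ x p →
        let js , eq = toWord p in inj₁ (Any.map (≋-resp _ _ _ (sym eq)) (covers js))

    elements : List Elt
    elements = proj₁ closure

    complete : IsEnumeration (Group.setoid ⟨ g ⟩-group) elements
    complete (x , p) with js , eq ← toWord p = Any.map (trans eq) (words js)
      where
      words : ∀ js → word g js ∈̂ elements
      words []       = proj₁ (proj₂ closure)
      words (j ∷ js) = proj₂ (proj₂ closure) j (words js)

    member? : Decidable ⟨ g ⟩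
    member? x = map′ (λ q → let (y , p) , x≈y = representative q in resp (sym x≈y) p)
                     (λ p → complete (x , p))
                     (Any.any? (λ y → x ≟ proj₁ y) elements)

------------------------------------------------------------------------
-- Univariate polynomials

-- A polynomial is its list of coefficients, constant term first; lists
-- with the same coefficients are identified.
module Polynomials (R : CommutativeRing 0ℓ 0ℓ) where
  open CommutativeRing R hiding (zero)
  open RingProperties ring using (-0#≈0#)
  open CommutativeSemigroupProperties +-commutativeSemigroup using (interchange)
  private module ≈-R = SetoidReasoning setoid

  Poly : Set
  Poly = List Carrier

  coeff : Poly → ℕ → Carrier
  coeff []      n       = 0#
  coeff (a ∷ p) zero    = a
  coeff (a ∷ p) (suc n) = coeff p n

  infix 4 _≈ₚ_
  record _≈ₚ_ (p q : Poly) : Set where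
    constructor mk≈
    field at : ∀ n → coeff p n ≈ coeff q n
  open _≈ₚ_ public

  infixl 6 _+ₚ_
  infixl 7 _*ₚ_ _·ₚ_

  _+ₚ_ : Poly → Poly → Poly
  []      +ₚ q       = q
  (a ∷ p) +ₚ []      = a ∷ p
  (a ∷ p) +ₚ (b ∷ q) = (a + b) ∷ (p +ₚ q)

  -ₚ_ : Poly → Poly
  -ₚ_ = map λ a → - a

  _·ₚ_ : Carrier → Poly → Poly
  a ·ₚ p = map (a *_) p

  _*ₚ_ : Poly → Poly → Poly
  []      *ₚ q = []
  (a ∷ p) *ₚ q = a ·ₚ q +ₚ (0# ∷ p *ₚ q)

  0ₚ 1ₚ : Poly
  0ₚ = []
  1ₚ = 1# ∷ []

  coeff-+ : ∀ p q n → coeff (p +ₚ q) n ≈ coeff p n + coeff q n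
  coeff-+ []      q       n       = sym (+-identityˡ _)
  coeff-+ (a ∷ p) []      n       = sym (+-identityʳ _)
  coeff-+ (a ∷ p) (b ∷ q) zero    = refl
  coeff-+ (a ∷ p) (b ∷ q) (suc n) = coeff-+ p q n

  coeff-neg : ∀ p n → coeff (-ₚ p) n ≈ - coeff p n
  coeff-neg []      n       = sym -0#≈0#
  coeff-neg (a ∷ p) zero    = refl
  coeff-neg (a ∷ p) (suc n) = coeff-neg p n

  coeff-· : ∀ a p n → coeff (a ·ₚ p) n ≈ a * coeff p n
  coeff-· a []      n       = sym (zeroʳ a)
  coeff-· a (b ∷ p) zero    = refl
  coeff-· a (b ∷ p) (suc n) = coeff-· a p n

  coeff-∷* : ∀ a p q n → coeff ((a ∷ p) *ₚ q) n ≈ a * coeff q n + coeff (0# ∷ p *ₚ q) n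
  coeff-∷* a p q n = trans (coeff-+ (a ·ₚ q) _ n) (+-congʳ (coeff-· a q n))

  coeff-*-zero : ∀ p q n → (∀ i j → i ℕ.+ j ≡ n → coeff p i ≈ 0# ⊎ coeff q j ≈ 0#) →
                 coeff (p *ₚ q) n ≈ 0#
  coeff-*-zero []      q n h = refl
  coeff-*-zero (a ∷ p) q n h = trans (coeff-∷* a p q n)
    (trans (+-cong (first (h 0 n ≡.refl)) (rest n h)) (+-identityˡ 0#))
    where
    first : a ≈ 0# ⊎ coeff q n ≈ 0# → a * coeff q n ≈ 0#
    first (inj₁ a≈0) = trans (*-congʳ a≈0) (zeroˡ _)
    first (inj₂ q≈0) = trans (*-congˡ q≈0) (zeroʳ _)

    rest : ∀ n → (∀ i j → i ℕ.+ j ≡ n → coeff (a ∷ p) i ≈ 0# ⊎ coeff q j ≈ 0#) →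
           coeff (0# ∷ p *ₚ q) n ≈ 0#
    rest zero    h = refl
    rest (suc n) h = coeff-*-zero p q n λ i j i+j≡n → h (suc i) j (≡.cong suc i+j≡n)

  reflₚ : ∀ {p} → p ≈ₚ p
  reflₚ = mk≈ λ n → refl

  symₚ : ∀ {p q} → p ≈ₚ q → q ≈ₚ p
  symₚ e = mk≈ λ n → sym (at e n)

  transₚ : ∀ {p q r} → p ≈ₚ q → q ≈ₚ r → p ≈ₚ r
  transₚ e f = mk≈ λ n → trans (at e n) (at f n)

  polySetoid : Setoid 0ℓ 0ℓ
  polySetoid = record
    { _≈_ = _≈ₚ_
    ; isEquivalence = record { refl = reflₚ ; sym = symₚ ; trans = transₚ } }

  +ₚ-cong : ∀ {p p′ q q′} → p ≈ₚ p′ → q ≈ₚ q′ → p +ₚ q ≈ₚ p′ +ₚ q′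
  +ₚ-cong {p} {p′} {q} {q′} e f = mk≈ λ n →
    trans (coeff-+ p q n) (trans (+-cong (at e n) (at f n)) (sym (coeff-+ p′ q′ n)))

  -ₚ-cong : ∀ {p p′} → p ≈ₚ p′ → -ₚ p ≈ₚ -ₚ p′
  -ₚ-cong {p} {p′} e = mk≈ λ n →
    trans (coeff-neg p n) (trans (-‿cong (at e n)) (sym (coeff-neg p′ n)))

  ∷-cong : ∀ {a b p q} → a ≈ b → p ≈ₚ q → a ∷ p ≈ₚ b ∷ q
  ∷-cong e f = mk≈ λ { zero → e ; (suc n) → at f n }

  ·-cong : ∀ {a b p q} → a ≈ b → p ≈ₚ q → a ·ₚ p ≈ₚ b ·ₚ q
  ·-cong {a} {b} {p} {q} e f = mk≈ λ n →
    trans (coeff-· a p n) (trans (*-cong e (at f n)) (sym (coeff-· b q n)))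

  +ₚ-assoc : ∀ p q r → (p +ₚ q) +ₚ r ≈ₚ p +ₚ (q +ₚ r)
  +ₚ-assoc p q r = mk≈ λ n → begin
    coeff ((p +ₚ q) +ₚ r) n               ≈⟨ coeff-+ (p +ₚ q) r n ⟩
    coeff (p +ₚ q) n + coeff r n          ≈⟨ +-congʳ (coeff-+ p q n) ⟩
    coeff p n + coeff q n + coeff r n     ≈⟨ +-assoc _ _ _ ⟩
    coeff p n + (coeff q n + coeff r n)   ≈⟨ +-congˡ (coeff-+ q r n) ⟨
    coeff p n + coeff (q +ₚ r) n          ≈⟨ coeff-+ p (q +ₚ r) n ⟨
    coeff (p +ₚ (q +ₚ r)) n               ∎
    where open ≈-R

  +ₚ-comm : ∀ p q → p +ₚ q ≈ₚ q +ₚ p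
  +ₚ-comm p q = mk≈ λ n →
    trans (coeff-+ p q n) (trans (+-comm _ _) (sym (coeff-+ q p n)))

  +ₚ-identityʳ : ∀ p → p +ₚ 0ₚ ≈ₚ p
  +ₚ-identityʳ []      = reflₚ
  +ₚ-identityʳ (a ∷ p) = reflₚ

  -ₚ-inverseʳ : ∀ p → p +ₚ (-ₚ p) ≈ₚ 0ₚ
  -ₚ-inverseʳ p = mk≈ λ n →
    trans (coeff-+ p (-ₚ p) n) (trans (+-congˡ (coeff-neg p n)) (-‿inverseʳ _))

  +ₚ-interchange : ∀ p q r s → (p +ₚ q) +ₚ (r +ₚ s) ≈ₚ (p +ₚ r) +ₚ (q +ₚ s)
  +ₚ-interchange p q r s = mk≈ λ n → begin
    coeff ((p +ₚ q) +ₚ (r +ₚ s)) n                            ≈⟨ coeff-+ (p +ₚ q) (r +ₚ s) n ⟩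
    coeff (p +ₚ q) n + coeff (r +ₚ s) n                       ≈⟨ +-cong (coeff-+ p q n) (coeff-+ r s n) ⟩
    (coeff p n + coeff q n) + (coeff r n + coeff s n)         ≈⟨ interchange _ _ _ _ ⟩
    (coeff p n + coeff r n) + (coeff q n + coeff s n)         ≈⟨ +-cong (coeff-+ p r n) (coeff-+ q s n) ⟨
    coeff (p +ₚ r) n + coeff (q +ₚ s) n                       ≈⟨ coeff-+ (p +ₚ r) (q +ₚ s) n ⟨
    coeff ((p +ₚ r) +ₚ (q +ₚ s)) n                            ∎
    where open ≈-R

  0∷[]≈0 : 0# ∷ [] ≈ₚ 0ₚ
  0∷[]≈0 = mk≈ λ { zero → refl ; (suc n) → refl }

  ∷-+ : ∀ p q → 0# ∷ (p +ₚ q) ≈ₚ (0# ∷ p) +ₚ (0# ∷ q)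
  ∷-+ p q = ∷-cong (sym (+-identityˡ 0#)) reflₚ

  ·-distribˡ : ∀ a p q → a ·ₚ (p +ₚ q) ≈ₚ a ·ₚ p +ₚ a ·ₚ q
  ·-distribˡ a p q = mk≈ λ n → begin
    coeff (a ·ₚ (p +ₚ q)) n                 ≈⟨ coeff-· a (p +ₚ q) n ⟩
    a * coeff (p +ₚ q) n                    ≈⟨ *-congˡ (coeff-+ p q n) ⟩
    a * (coeff p n + coeff q n)             ≈⟨ distribˡ _ _ _ ⟩
    a * coeff p n + a * coeff q n           ≈⟨ +-cong (coeff-· a p n) (coeff-· a q n) ⟨
    coeff (a ·ₚ p) n + coeff (a ·ₚ q) n     ≈⟨ coeff-+ (a ·ₚ p) (a ·ₚ q) n ⟨
    coeff (a ·ₚ p +ₚ a ·ₚ q) n              ∎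
    where open ≈-R

  ·-distribʳ : ∀ a b p → (a + b) ·ₚ p ≈ₚ a ·ₚ p +ₚ b ·ₚ p
  ·-distribʳ a b p = mk≈ λ n → begin
    coeff ((a + b) ·ₚ p) n                  ≈⟨ coeff-· (a + b) p n ⟩
    (a + b) * coeff p n                     ≈⟨ distribʳ _ _ _ ⟩
    a * coeff p n + b * coeff p n           ≈⟨ +-cong (coeff-· a p n) (coeff-· b p n) ⟨
    coeff (a ·ₚ p) n + coeff (b ·ₚ p) n     ≈⟨ coeff-+ (a ·ₚ p) (b ·ₚ p) n ⟨
    coeff (a ·ₚ p +ₚ b ·ₚ p) n              ∎
    where open ≈-R

  ·-assoc : ∀ a b p → (a * b) ·ₚ p ≈ₚ a ·ₚ (b ·ₚ p)
  ·-assoc a b p = mk≈ λ n → begin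
    coeff ((a * b) ·ₚ p) n     ≈⟨ coeff-· (a * b) p n ⟩
    a * b * coeff p n          ≈⟨ *-assoc _ _ _ ⟩
    a * (b * coeff p n)        ≈⟨ *-congˡ (coeff-· b p n) ⟨
    a * coeff (b ·ₚ p) n       ≈⟨ coeff-· a (b ·ₚ p) n ⟨
    coeff (a ·ₚ (b ·ₚ p)) n    ∎
    where open ≈-R

  ·-zero : ∀ p → 0# ·ₚ p ≈ₚ 0ₚ
  ·-zero p = mk≈ λ n → trans (coeff-· 0# p n) (zeroˡ _)

  ·-identity : ∀ p → 1# ·ₚ p ≈ₚ p
  ·-identity p = mk≈ λ n → trans (coeff-· 1# p n) (*-identityˡ _)

  module ≈-P = SetoidReasoning polySetoid

  *ₚ-zeroʳ : ∀ p → p *ₚ 0ₚ ≈ₚ 0ₚ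
  *ₚ-zeroʳ []      = reflₚ
  *ₚ-zeroʳ (a ∷ p) = transₚ (∷-cong refl (*ₚ-zeroʳ p)) 0∷[]≈0

  *ₚ-∷ : ∀ p b q → p *ₚ (b ∷ q) ≈ₚ b ·ₚ p +ₚ (0# ∷ p *ₚ q)
  *ₚ-∷ []      b q = symₚ 0∷[]≈0
  *ₚ-∷ (a ∷ p) b q = ∷-cong (+-congʳ (*-comm a b)) (begin
    a ·ₚ q +ₚ p *ₚ (b ∷ q)                ≈⟨ +ₚ-cong reflₚ (*ₚ-∷ p b q) ⟩
    a ·ₚ q +ₚ (b ·ₚ p +ₚ (0# ∷ p *ₚ q))   ≈⟨ +ₚ-assoc (a ·ₚ q) (b ·ₚ p) _ ⟨
    a ·ₚ q +ₚ b ·ₚ p +ₚ (0# ∷ p *ₚ q)     ≈⟨ +ₚ-cong (+ₚ-comm (a ·ₚ q) (b ·ₚ p)) reflₚ ⟩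
    b ·ₚ p +ₚ a ·ₚ q +ₚ (0# ∷ p *ₚ q)     ≈⟨ +ₚ-assoc (b ·ₚ p) (a ·ₚ q) _ ⟩
    b ·ₚ p +ₚ (a ·ₚ q +ₚ (0# ∷ p *ₚ q))   ∎)
    where open ≈-P

  *ₚ-comm : ∀ p q → p *ₚ q ≈ₚ q *ₚ p
  *ₚ-comm []      q = symₚ (*ₚ-zeroʳ q)
  *ₚ-comm (a ∷ p) q =
    transₚ (+ₚ-cong reflₚ (∷-cong refl (*ₚ-comm p q))) (symₚ (*ₚ-∷ q a p))

  *ₚ-congˡ : ∀ p {q q′} → q ≈ₚ q′ → p *ₚ q ≈ₚ p *ₚ q′
  *ₚ-congˡ []      e = reflₚ
  *ₚ-congˡ (a ∷ p) e = +ₚ-cong (·-cong refl e) (∷-cong refl (*ₚ-congˡ p e))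

  *ₚ-cong : ∀ {p p′ q q′} → p ≈ₚ p′ → q ≈ₚ q′ → p *ₚ q ≈ₚ p′ *ₚ q′
  *ₚ-cong {p} {p′} {q} {q′} e f = begin
    p *ₚ q     ≈⟨ *ₚ-congˡ p f ⟩
    p *ₚ q′    ≈⟨ *ₚ-comm p q′ ⟩
    q′ *ₚ p    ≈⟨ *ₚ-congˡ q′ e ⟩
    q′ *ₚ p′   ≈⟨ *ₚ-comm q′ p′ ⟩
    p′ *ₚ q′   ∎
    where open ≈-P

  *ₚ-distribˡ : ∀ p q r → p *ₚ (q +ₚ r) ≈ₚ p *ₚ q +ₚ p *ₚ r
  *ₚ-distribˡ []      q r = reflₚ
  *ₚ-distribˡ (a ∷ p) q r = begin
    a ·ₚ (q +ₚ r) +ₚ (0# ∷ p *ₚ (q +ₚ r))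
      ≈⟨ +ₚ-cong (·-distribˡ a q r) (transₚ (∷-cong refl (*ₚ-distribˡ p q r)) (∷-+ (p *ₚ q) (p *ₚ r))) ⟩
    (a ·ₚ q +ₚ a ·ₚ r) +ₚ ((0# ∷ p *ₚ q) +ₚ (0# ∷ p *ₚ r))
      ≈⟨ +ₚ-interchange (a ·ₚ q) (a ·ₚ r) _ _ ⟩
    (a ∷ p) *ₚ q +ₚ (a ∷ p) *ₚ r ∎
    where open ≈-P

  *ₚ-distribʳ : ∀ r p q → (p +ₚ q) *ₚ r ≈ₚ p *ₚ r +ₚ q *ₚ r
  *ₚ-distribʳ r p q = begin
    (p +ₚ q) *ₚ r       ≈⟨ *ₚ-comm (p +ₚ q) r ⟩
    r *ₚ (p +ₚ q)       ≈⟨ *ₚ-distribˡ r p q ⟩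
    r *ₚ p +ₚ r *ₚ q    ≈⟨ +ₚ-cong (*ₚ-comm r p) (*ₚ-comm r q) ⟩
    p *ₚ r +ₚ q *ₚ r    ∎
    where open ≈-P

  ·-*-assoc : ∀ a p q → (a ·ₚ p) *ₚ q ≈ₚ a ·ₚ (p *ₚ q)
  ·-*-assoc a []      q = reflₚ
  ·-*-assoc a (b ∷ p) q = begin
    (a * b) ·ₚ q +ₚ (0# ∷ (a ·ₚ p) *ₚ q)
      ≈⟨ +ₚ-cong (·-assoc a b q) (∷-cong (sym (zeroʳ a)) (·-*-assoc a p q)) ⟩
    a ·ₚ (b ·ₚ q) +ₚ a ·ₚ (0# ∷ p *ₚ q)
      ≈⟨ ·-distribˡ a (b ·ₚ q) _ ⟨
    a ·ₚ ((b ∷ p) *ₚ q) ∎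
    where open ≈-P

  *ₚ-assoc : ∀ p q r → (p *ₚ q) *ₚ r ≈ₚ p *ₚ (q *ₚ r)
  *ₚ-assoc []      q r = reflₚ
  *ₚ-assoc (a ∷ p) q r = begin
    (a ·ₚ q +ₚ (0# ∷ p *ₚ q)) *ₚ r
      ≈⟨ *ₚ-distribʳ r (a ·ₚ q) _ ⟩
    (a ·ₚ q) *ₚ r +ₚ (0# ·ₚ r +ₚ (0# ∷ (p *ₚ q) *ₚ r))
      ≈⟨ +ₚ-cong (·-*-assoc a q r) (+ₚ-cong (·-zero r) (∷-cong refl (*ₚ-assoc p q r))) ⟩
    (a ∷ p) *ₚ (q *ₚ r) ∎
    where open ≈-P

  *ₚ-identityˡ : ∀ p → 1ₚ *ₚ p ≈ₚ p
  *ₚ-identityˡ p = transₚ (+ₚ-cong (·-identity p) 0∷[]≈0) (+ₚ-identityʳ p)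

  polyRing : CommutativeRing 0ℓ 0ℓ
  polyRing = record
    { Carrier = Poly ; _≈_ = _≈ₚ_ ; _+_ = _+ₚ_ ; _*_ = _*ₚ_ ; -_ = -ₚ_ ; 0# = 0ₚ ; 1# = 1ₚ
    ; isCommutativeRing = record
      { isRing = record
        { +-isAbelianGroup = record
          { isGroup = record
            { isMonoid = record
              { isSemigroup = record
                { isMagma = record
                  { isEquivalence = Setoid.isEquivalence polySetoid ; ∙-cong = +ₚ-cong }
                ; assoc = +ₚ-assoc }
              ; identity = (λ p → reflₚ) , +ₚ-identityʳ }
            ; inverse = (λ p → transₚ (+ₚ-comm (-ₚ p) p) (-ₚ-inverseʳ p)) , -ₚ-inverseʳ
            ; ⁻¹-cong = -ₚ-cong }
          ; comm = +ₚ-comm }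
        ; *-cong = *ₚ-cong
        ; *-assoc = *ₚ-assoc
        ; *-identity = *ₚ-identityˡ , λ p → transₚ (*ₚ-comm p 1ₚ) (*ₚ-identityˡ p)
        ; distrib = *ₚ-distribˡ , *ₚ-distribʳ }
      ; *-comm = *ₚ-comm } }

  module _ (_≟_ : Decidable₂ _≈_) where
    _≟ₚ_ : Decidable₂ _≈ₚ_
    []      ≟ₚ []      = yes reflₚ
    []      ≟ₚ (b ∷ q) = map′ (λ (e , f) → transₚ (symₚ 0∷[]≈0) (∷-cong e f))
                              (λ e → at e 0 , mk≈ (at e ∘ suc))
                              ((0# ≟ b) ×-dec ([] ≟ₚ q))
    (a ∷ p) ≟ₚ []      = map′ (λ (e , f) → transₚ (∷-cong e f) 0∷[]≈0)
                              (λ e → at e 0 , mk≈ (at e ∘ suc))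
                              ((a ≟ 0#) ×-dec (p ≟ₚ []))
    (a ∷ p) ≟ₚ (b ∷ q) = map′ (λ (e , f) → ∷-cong e f)
                              (λ e → at e 0 , mk≈ (at e ∘ suc))
                              ((a ≟ b) ×-dec (p ≟ₚ q))

------------------------------------------------------------------------
-- Matrices and invertible matrices

module Matrices (R : CommutativeRing 0ℓ 0ℓ) (n : ℕ) where
  open CommutativeRing R hiding (zero)
  open SemiringSum semiring using (sum; sum-cong-≋; ∑-comm; *-distribˡ-sum; *-distribʳ-sum; ∑-distrib-+)
  open SetoidReasoning setoid

  Matrix : Set
  Matrix = Fin n → Fin n → Carrier

  infix 4 _≈ₘ_
  record _≈ₘ_ (A B : Matrix) : Set where
    constructor mk≈
    field at : ∀ i j → A i j ≈ B i j
  open _≈ₘ_ public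

  δ : ∀ {m} → Fin m → Fin m → Carrier
  δ i j = if does (i Fin.≟ j) then 1# else 0#

  1ₘ : Matrix
  1ₘ = δ

  infixl 7 _*ₘ_
  _*ₘ_ : Matrix → Matrix → Matrix
  (A *ₘ B) i j = sum λ k → A i k * B k j

  elementary : Fin n → Fin n → Carrier → Matrix
  elementary i j r a b with a Fin.≟ i | b Fin.≟ j
  ... | yes _ | yes _ = r
  ... | _     | _     = 1ₘ a b

  sum-zero : ∀ {m} (x : Fin m → Carrier) → (∀ k → x k ≈ 0#) → sum x ≈ 0#
  sum-zero {zero}  x h = refl
  sum-zero {suc m} x h =
    trans (+-cong (h zero) (sum-zero (x ∘ suc) (h ∘ suc))) (+-identityˡ 0#)

  sum-δˡ : ∀ {m} i (x : Fin m → Carrier) → sum (λ k → δ i k * x k) ≈ x i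
  sum-δˡ zero    x = trans
    (+-cong (*-identityˡ _) (sum-zero (λ k → δ zero (suc k) * x (suc k)) λ k → zeroˡ _))
    (+-identityʳ _)
  sum-δˡ (suc i) x = trans (+-cong (zeroˡ _) (sum-δˡ i (x ∘ suc))) (+-identityˡ _)

  δ-comm : ∀ {m} (i j : Fin m) → δ i j ≡ δ j i
  δ-comm zero    zero    = ≡.refl
  δ-comm zero    (suc j) = ≡.refl
  δ-comm (suc i) zero    = ≡.refl
  δ-comm (suc i) (suc j) = δ-comm i j

  sum-δʳ : ∀ {m} j (x : Fin m → Carrier) → sum (λ k → x k * δ k j) ≈ x j
  sum-δʳ j x = trans
    (sum-cong-≋ (λ k → trans (*-comm _ _) (*-congʳ (reflexive (δ-comm k j)))))
    (sum-δˡ j x)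

  δ-≡ : ∀ {m} (i : Fin m) → δ i i ≈ 1#
  δ-≡ i with i Fin.≟ i
  ... | yes _   = refl
  ... | no  i≢i = contradiction ≡.refl i≢i

  δ-≢ : ∀ {m} {i j : Fin m} → i ≢ j → δ i j ≈ 0#
  δ-≢ {i = i} {j} i≢j with i Fin.≟ j
  ... | yes i≡j = contradiction i≡j i≢j
  ... | no  _   = refl

  *ₘ-assoc : ∀ A B C → (A *ₘ B) *ₘ C ≈ₘ A *ₘ (B *ₘ C)
  *ₘ-assoc A B C = mk≈ λ i j → begin
    sum (λ k → sum (λ l → A i l * B l k) * C k j)
      ≈⟨ sum-cong-≋ (λ k → *-distribʳ-sum (C k j) (λ l → A i l * B l k)) ⟩
    sum (λ k → sum (λ l → A i l * B l k * C k j))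
      ≈⟨ ∑-comm (λ k l → A i l * B l k * C k j) ⟩
    sum (λ l → sum (λ k → A i l * B l k * C k j))
      ≈⟨ sum-cong-≋ (λ l → sum-cong-≋ (λ k → *-assoc (A i l) (B l k) (C k j))) ⟩
    sum (λ l → sum (λ k → A i l * (B l k * C k j)))
      ≈⟨ sum-cong-≋ (λ l → *-distribˡ-sum (A i l) (λ k → B l k * C k j)) ⟨
    sum (λ l → A i l * sum (λ k → B l k * C k j)) ∎

  matrixMonoid : Monoid 0ℓ 0ℓ
  matrixMonoid = record
    { Carrier = Matrix ; _≈_ = _≈ₘ_ ; _∙_ = _*ₘ_ ; ε = 1ₘ
    ; isMonoid = record
      { isSemigroup = record
        { isMagma = record
          { isEquivalence = record
            { refl  = mk≈ λ i j → refl
            ; sym   = λ e → mk≈ λ i j → sym (at e i j)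
            ; trans = λ e f → mk≈ λ i j → trans (at e i j) (at f i j) }
          ; ∙-cong = λ e f → mk≈ λ i j → sum-cong-≋ λ k → *-cong (at e i k) (at f k j) }
        ; assoc = *ₘ-assoc }
      ; identity = (λ A → mk≈ λ i j → sum-δˡ i (λ k → A k j))
                 , (λ A → mk≈ λ i j → sum-δʳ j (A i)) } }

  module ≈ₘ = Monoid matrixMonoid

  record InvertibleMatrix : Set where
    field
      matrix   : Matrix
      inverse  : Matrix
      inverseʳ : matrix *ₘ inverse ≈ₘ 1ₘ
      inverseˡ : inverse *ₘ matrix ≈ₘ 1ₘ
  open InvertibleMatrix public

  cancel : ∀ A B {C D} → A *ₘ B ≈ₘ 1ₘ → C *ₘ D ≈ₘ 1ₘ → (C *ₘ A) *ₘ (B *ₘ D) ≈ₘ 1ₘ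
  cancel A B {C} {D} e f = ≈ₘ.trans (≈ₘ.assoc C A (B *ₘ D))
    (≈ₘ.trans (≈ₘ.∙-congˡ (≈ₘ.trans (≈ₘ.sym (≈ₘ.assoc A B D))
      (≈ₘ.trans (≈ₘ.∙-congʳ e) (≈ₘ.identityˡ D)))) f)

  inverse-unique : ∀ A B → matrix A ≈ₘ matrix B → inverse A ≈ₘ inverse B
  inverse-unique A B e =
    ≈ₘ.trans (≈ₘ.sym (≈ₘ.identityʳ _))
    (≈ₘ.trans (≈ₘ.∙-congˡ (≈ₘ.sym (inverseʳ B)))
    (≈ₘ.trans (≈ₘ.sym (≈ₘ.assoc _ _ _))
    (≈ₘ.trans (≈ₘ.∙-congʳ (≈ₘ.trans (≈ₘ.∙-congˡ (≈ₘ.sym e)) (inverseˡ A)))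
              (≈ₘ.identityˡ _))))

  GL : Group 0ℓ 0ℓ
  GL = record
    { Carrier = InvertibleMatrix
    ; _≈_     = _≈ₘ_ on matrix
    ; _∙_     = λ A B → record
      { matrix   = matrix A *ₘ matrix B
      ; inverse  = inverse B *ₘ inverse A
      ; inverseʳ = cancel (matrix B) (inverse B) (inverseʳ B) (inverseʳ A)
      ; inverseˡ = cancel (inverse A) (matrix A) (inverseˡ A) (inverseˡ B) }
    ; ε       = record
      { matrix = 1ₘ ; inverse = 1ₘ
      ; inverseʳ = ≈ₘ.identityˡ 1ₘ ; inverseˡ = ≈ₘ.identityˡ 1ₘ }
    ; _⁻¹     = λ A → record
      { matrix = inverse A ; inverse = matrix A
      ; inverseʳ = inverseˡ A ; inverseˡ = inverseʳ A }
    ; isGroup = record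
      { isMonoid = record
        { isSemigroup = record
          { isMagma = record
            { isEquivalence = record
              { refl = ≈ₘ.refl ; sym = ≈ₘ.sym ; trans = ≈ₘ.trans }
            ; ∙-cong = ≈ₘ.∙-cong }
          ; assoc = λ A B C → ≈ₘ.assoc _ _ _ }
        ; identity = (λ A → ≈ₘ.identityˡ _) , (λ A → ≈ₘ.identityʳ _) }
      ; inverse = inverseˡ , inverseʳ
      ; ⁻¹-cong = λ {A} {B} → inverse-unique A B } }

  elementary-row : ∀ {i j} r → i ≢ j → ∀ k → elementary i j r i k ≈ δ i k + r * δ j k
  elementary-row {i} {j} r i≢j k with i Fin.≟ i | k Fin.≟ j
  ... | no i≢i | _ = contradiction ≡.refl i≢i
  ... | yes _ | yes ≡.refl = sym (trans
        (+-cong (δ-≢ i≢j) (trans (*-congˡ (δ-≡ k)) (*-identityʳ r))) (+-identityˡ r))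
  ... | yes _ | no k≢j = sym (trans
        (+-congˡ (trans (*-congˡ (δ-≢ (k≢j ∘ ≡.sym))) (zeroʳ r))) (+-identityʳ _))

  elementary-other : ∀ {i j a} r → a ≢ i → ∀ k → elementary i j r a k ≈ δ a k
  elementary-other {i} {j} {a} r a≢i k with a Fin.≟ i | k Fin.≟ j
  ... | yes a≡i | _ = contradiction a≡i a≢i
  ... | no _ | yes _ = refl
  ... | no _ | no _ = refl

  elementary-inverse : ∀ {i j} r s → i ≢ j → s + r ≈ 0# →
                       elementary i j r *ₘ elementary i j s ≈ₘ 1ₘ
  elementary-inverse {i} {j} r s i≢j s+r≈0 = mk≈ λ a b → entry a b (a Fin.≟ i)
    where
    E = elementary i j s
    entry : ∀ a b → Dec (a ≡ i) → sum (λ k → elementary i j r a k * E k b) ≈ δ a b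
    entry a b (no a≢i) = begin
      sum (λ k → elementary i j r a k * E k b)
        ≈⟨ sum-cong-≋ (λ k → *-congʳ {x = E k b} (elementary-other r a≢i k)) ⟩
      sum (λ k → δ a k * E k b)   ≈⟨ sum-δˡ a (λ k → E k b) ⟩
      E a b                       ≈⟨ elementary-other s a≢i b ⟩
      δ a b                       ∎
    entry a b (yes ≡.refl) = begin
      sum (λ k → elementary i j r i k * E k b)
        ≈⟨ sum-cong-≋ (λ k → trans (*-congʳ (elementary-row r i≢j k))
             (trans (distribʳ (E k b) _ _) (+-congˡ (*-assoc r (δ j k) (E k b))))) ⟩
      sum (λ k → δ i k * E k b + r * (δ j k * E k b))
        ≈⟨ ∑-distrib-+ (λ k → δ i k * E k b) _ ⟩
      sum (λ k → δ i k * E k b) + sum (λ k → r * (δ j k * E k b))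
        ≈⟨ +-cong (sum-δˡ i (λ k → E k b))
             (trans (sym (*-distribˡ-sum r (λ k → δ j k * E k b)))
                    (*-congˡ (sum-δˡ j (λ k → E k b)))) ⟩
      E i b + r * E j b
        ≈⟨ +-cong (elementary-row s i≢j b) (*-congˡ (elementary-other s (i≢j ∘ ≡.sym) b)) ⟩
      (δ i b + s * δ j b) + r * δ j b
        ≈⟨ +-assoc _ _ _ ⟩
      δ i b + (s * δ j b + r * δ j b)
        ≈⟨ +-congˡ (sym (distribʳ (δ j b) s r)) ⟩
      δ i b + (s + r) * δ j b
        ≈⟨ +-congˡ (trans (*-congʳ s+r≈0) (zeroˡ _)) ⟩
      δ i b + 0#
        ≈⟨ +-identityʳ _ ⟩
      δ i b ∎

  e : ∀ i j → i ≢ j → Carrier → InvertibleMatrix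
  e i j i≢j r = record
    { matrix   = elementary i j r
    ; inverse  = elementary i j (- r)
    ; inverseʳ = elementary-inverse r (- r) i≢j (-‿inverseˡ r)
    ; inverseˡ = elementary-inverse (- r) r i≢j (-‿inverseʳ r) }

  elementary-cong : ∀ i j {r s} → r ≈ s → elementary i j r ≈ₘ elementary i j s
  elementary-cong i j {r} {s} r≈s = mk≈ entry
    where
    entry : ∀ a b → elementary i j r a b ≈ elementary i j s a b
    entry a b with a Fin.≟ i | b Fin.≟ j
    ... | yes _ | yes _ = r≈s
    ... | yes _ | no _  = refl
    ... | no _  | yes _ = refl
    ... | no _  | no _  = refl

  module _ (_≟_ : Decidable₂ _≈_) where
    _≟ₘ_ : Decidable₂ _≈ₘ_
    A ≟ₘ B = map′ mk≈ at (Fin.all? λ i → Fin.all? λ j → A i j ≟ B i j)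

------------------------------------------------------------------------
-- Finite fields

record FiniteField (q : ℕ) : Set₁ where
  field
    commutativeRing : CommutativeRing 0ℓ 0ℓ
  open CommutativeRing commutativeRing public hiding (zero)
  field
    1≉0         : ¬ 1# ≈ 0#
    invertible  : ∀ x → ¬ x ≈ 0# → ∃[ y ] x * y ≈ 1#
    enumeration : Inverse (≡.setoid (Fin q)) setoid

  _≟_ : Decidable₂ _≈_
  _≟_ = via-injection (Inverse⇒Injection (Symmetry.inverse enumeration)) Fin._≟_

  scalars : List Carrier
  scalars = map (Inverse.to enumeration) (allFin q)

IsPrimePower : ℕ → Set
IsPrimePower q = ∃₂ λ p m → Prime p × q ≡ p ℕ.^ suc m

------------------------------------------------------------------------
-- The complex X_link

-- Indices are shifted down by one: the matrix index set {1,…,4} is Fin 4,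
-- and j : Fin 3 stands for the generators e_{j,j+1}(a + bt).
module Link {q : ℕ} (F : FiniteField q) where
  open FiniteField F
  open Polynomials commutativeRing using (Poly; coeff; coeff-+; coeff-*-zero; mk≈; _≈ₚ_; _≟ₚ_; polyRing)
    renaming (at to coeff-at)
  private module P = CommutativeRing polyRing
  open SemiringSum P.semiring using (sum)
  open Matrices polyRing 4 renaming (mk≈ to mk≈ₘ)
  open Generated GL

  _≟M_ : Decidable₂ _≈ₘ_
  _≟M_ = _≟ₘ_ (_≟ₚ_ _≟_)

  _≈GL?_ : Decidable₂ (_≈ₘ_ on matrix)
  A ≈GL? B = matrix A ≟M matrix B

  _isMatrixOf_ : Matrix → InvertibleMatrix → Set
  A isMatrixOf B = A ≈ₘ matrix B

  _isMatrixOf?_ : ∀ A B → Dec (A isMatrixOf B)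
  A isMatrixOf? B = A ≟M matrix B

  isMatrixOf-resp : ∀ A B C → matrix B ≈ₘ matrix C → A isMatrixOf B → A isMatrixOf C
  isMatrixOf-resp A B C B≈C A≈B = ≈ₘ.trans A≈B B≈C

  isMatrixOf-det : ∀ A B C → A isMatrixOf B → A isMatrixOf C → matrix B ≈ₘ matrix C
  isMatrixOf-det A B C A≈B A≈C = ≈ₘ.trans (≈ₘ.sym A≈B) A≈C

  superdiagonal : Fin 3 → Poly → InvertibleMatrix
  superdiagonal j = e (inject₁ j) (suc j) (Fin.<⇒≢ (Fin.≤̄⇒inject₁< {i = j} ℕ.≤-refl))

  Generators : Pred (Fin 3) 0ℓ → Set
  Generators J = Σ (Fin 3) J × Carrier × Carrier

  generator : ∀ {J} → Generators J → InvertibleMatrix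
  generator ((j , _) , a , b) = superdiagonal j (a ∷ b ∷ [])

  -- The (i , j) entry has degree at most j - i, and vanishes if j < i.
  Bounded : Matrix → Set
  Bounded A = ∀ i j n → toℕ j ℕ.< toℕ i ℕ.+ n → coeff (A i j) n ≈ 0#

  bounded-1 : Bounded 1ₘ
  bounded-1 i j n j<i+n with i Fin.≟ j
  ... | no _ = refl
  bounded-1 i j zero    j<i+n | yes ≡.refl =
    contradiction (≡.subst (toℕ j ℕ.<_) (ℕ.+-identityʳ _) j<i+n) (ℕ.<-irrefl ≡.refl)
  bounded-1 i j (suc n) j<i+n | yes _ = refl

  bounded-generator : ∀ {J} (g : Generators J) → Bounded (matrix (generator g))
  bounded-generator ((k , _) , a , b) i j n j<i+n with i Fin.≟ inject₁ k | j Fin.≟ suc k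
  ... | no _       | yes _      = bounded-1 i j n j<i+n
  ... | no _       | no _       = bounded-1 i j n j<i+n
  ... | yes _      | no _       = bounded-1 i j n j<i+n
  ... | yes ≡.refl | yes ≡.refl = large n (ℕ.+-cancelˡ-< (toℕ k) 1 n
    (≡.subst₂ ℕ._<_ (ℕ.+-comm 1 (toℕ k)) (≡.cong (ℕ._+ n) (Fin.toℕ-inject₁ k)) j<i+n))
    where
    large : ∀ n → 1 ℕ.< n → coeff (a ∷ b ∷ []) n ≈ 0#
    large (suc (suc n)) _ = refl
    large (suc zero) (s≤s ())

  coeff-sum : ∀ {m} n (x : Fin m → Poly) → (∀ k → coeff (x k) n ≈ 0#) →
              coeff (sum x) n ≈ 0#
  coeff-sum {zero}  n x h = refl
  coeff-sum {suc m} n x h = trans (coeff-+ (x zero) (sum (x ∘ suc)) n)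
    (trans (+-cong (h zero) (coeff-sum n (x ∘ suc) (h ∘ suc))) (+-identityˡ 0#))

  bounded-* : ∀ {A B} → Bounded A → Bounded B → Bounded (A *ₘ B)
  bounded-* {A} {B} hA hB i j n j<i+n = coeff-sum n (λ k → A i k P.* B k j) λ k →
    coeff-*-zero (A i k) (B k j) n λ r s r+s≡n →
      case toℕ k ℕ.<? toℕ i ℕ.+ r of λ where
        (yes k<i+r) → inj₁ (hA i k r k<i+r)
        (no  k≮i+r) → inj₂ (hB k j s (ℕ.<-≤-trans j<i+n (ℕ.≤-trans
          (ℕ.≤-reflexive (≡.trans (≡.cong (toℕ i ℕ.+_) (≡.sym r+s≡n))
                                  (≡.sym (ℕ.+-assoc (toℕ i) r s))))
          (ℕ.+-monoˡ-≤ s (ℕ.≮⇒≥ k≮i+r)))))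

  bounded-word : ∀ {J} (gs : List (Generators J)) → Bounded (matrix (word generator gs))
  bounded-word []       = bounded-1
  bounded-word (g ∷ gs) =
    bounded-* {matrix (generator g)} {matrix (word generator gs)}
      (bounded-generator g) (bounded-word gs)

  scalars-complete : ∀ x → Any (_≈ x) scalars
  scalars-complete x = Any.map⁺ (Any.map
    (λ { ≡.refl → Inverse.inverseˡ enumeration ≡.refl })
    (Membership.∈-allFin (Inverse.from enumeration x)))

  truncate : ∀ m (as : Vec Carrier m) (f : ℕ → Carrier) →
             (∀ i → Vec.lookup as i ≈ f (toℕ i)) → (∀ n → m ℕ.≤ n → f n ≈ 0#) →
             ∀ n → coeff (Vec.toList as) n ≈ f n
  truncate zero    []       f h small n       = sym (small n z≤n)
  truncate (suc m) (a ∷ as) f h small zero    = h zero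
  truncate (suc m) (a ∷ as) f h small (suc n) =
    truncate m as (f ∘ suc) (h ∘ suc) (λ n m≤n → small (suc n) (s≤s m≤n)) n

  polys : List Poly
  polys = map Vec.toList (vectors scalars 4)

  polys-complete : ∀ p → (∀ n → 4 ℕ.≤ n → coeff p n ≈ 0#) → Any (_≈ₚ p) polys
  polys-complete p small = Any.map⁺ (Any.map
    (λ {as} h → mk≈ (truncate 4 as (coeff p) h small))
    (vectors-complete _≈_ scalars (coeff p ∘ toℕ) (λ i → scalars-complete _)))

  matrices : List Matrix
  matrices = map (λ v i j → Vec.lookup (Vec.lookup v i) j) (vectors (vectors polys 4) 4)

  matrices-complete : ∀ A → Bounded A → Any (_≈ₘ A) matrices
  matrices-complete A hA = Any.map⁺ (Any.map (λ h → mk≈ₘ h)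
    (vectors-complete (λ v x → ∀ j → Vec.lookup v j ≈ₚ x j) (vectors polys 4) A λ i →
      vectors-complete _≈ₚ_ polys (A i) λ j →
        polys-complete (A i j) λ n 4≤n → hA i j n
          (ℕ.<-≤-trans (Fin.toℕ<n j) (ℕ.≤-trans 4≤n (ℕ.m≤n+m n (toℕ i))))))

  module _ {J : Pred (Fin 3) 0ℓ} (J? : Decidable J) where
    index : Fin 3 → List (Σ (Fin 3) J)
    index j with J? j
    ... | yes p = (j , p) ∷ []
    ... | no  _ = []

    indices : List (Σ (Fin 3) J)
    indices = concatMap index (allFin 3)

    indices-complete : ∀ ((j , _) : Σ (Fin 3) J) → Any (λ (i , _) → j ≡ i) indices
    indices-complete (j , p) = Any.concatMap⁺ index (Any.map
      (λ { ≡.refl → found }) (Membership.∈-allFin j))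
      where
      found : Any (λ (i , _) → j ≡ i) (index j)
      found with J? j
      ... | yes _ = here ≡.refl
      ... | no ¬p = contradiction p ¬p

    generators : List (Generators J)
    generators = cartesianProduct indices (cartesianProduct scalars scalars)

    generators-complete : ∀ g → Any (λ h → matrix (generator g) ≈ₘ matrix (generator h)) generators
    generators-complete (i , a , b) = Any.cartesianProductWith⁺ _,_
      (λ { {i , _} {c , d} ≡.refl (a≈c , b≈d) → elementary-cong (inject₁ i) (suc i) (mk≈ λ where
           zero          → sym a≈c
           (suc zero)    → sym b≈d
           (suc (suc n)) → refl) })
      (indices-complete i)
      (Any.cartesianProduct⁺ (scalars-complete a) (scalars-complete b))

    negate : Generators J → Generators J
    negate (i , a , b) = i , - a , - b

    negate-inverse : ∀ g → inverse (generator g) ≈ₘ matrix (generator (negate g))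
    negate-inverse g = ≈ₘ.refl

    words-covered : ∀ gs → Any (_≈ₘ matrix (word (generator {J}) gs)) matrices
    words-covered gs = matrices-complete _ (bounded-word gs)

    module Gen = Enumerate (generator {J}) _≈GL?_ _isMatrixOf_ _isMatrixOf?_
      isMatrixOf-resp isMatrixOf-det negate negate-inverse
      generators generators-complete matrices words-covered

  G-link : FiniteGroup
  G-link = record
    { group    = ⟨ generator {U} ⟩-group
    ; _≟_      = λ (A , _) (B , _) → A ≈GL? B
    ; elements = Gen.elements U?
    ; complete = Gen.complete U?
    }

  K-link : Fin 3 → DecSubgroup (FiniteGroup.group G-link)
  K-link i = record
    { Member  = λ (A , _) → ⟨ generator {_≢ i} ⟩ A
    ; Member? = λ (A , _) → Gen.member? (λ j → ¬? (j Fin.≟ i)) A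
    ; resp    = λ {(A , _)} {(B , _)} A≈B → resp {x = A} {y = B} A≈B
    ; ε-mem   = ε-mem
    ; ∙-mem   = ∙-mem
    ; ⁻¹-mem  = ⁻¹-mem
    }

  X-link : SimplicialComplex
  X-link = cosetComplex G-link K-link

open Link public using (X-link)

-- Coboundary expansion by averaged cones.  Triangles of X are the flags x ∈ G, x ↦ (xK₀ , xK₁ , xK₂),
-- so weights are averages over G and G acts transitively.  Choose for every h ∈ G a path of boundedly
-- many flags from 1 to h such that for h⁻¹h′ ∈ K_i the loop through h and h′ bounds at most n
-- triangles.  Integrating a cochain φ along the paths translated by g gives ψ_g, and averaging over g
-- bounds the weight of φ + dψ_g for some g by (1 + 6n) times that of dφ.
--
-- The paths come from a presentation of G: it is the amalgam of the K_i, and the relations that are not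
-- in some K_i follow from those that are.  The one hard relation is [e₁₃ , e₂₄] = 1.  Writing x , y , z
-- for the generators in e₁₂ , e₂₃ , e₃₄ and a = [x , y] , b = [y , z], conjugation of b by x gives
-- xbx⁻¹ = a b z a⁻¹ z⁻¹.  Replacing (y , z) by (y⁻¹ , z⁻¹) fixes b and inverts a and z, whence
-- b⁻¹a²b = (z⁻¹az)(zaz⁻¹).  Doubling x shows that the two factors commute, and inverting z that a² and
-- b² commute; as q is odd, all entries are doubles.  That n does not depend on q is automatic when
-- this calculation is done for families of matrices over all fields at once, modulo relations with
-- uniformly bounded area.
{-# OPTIONS --safe #-}
module Submission where

-- The bound has to be uniform in the flag `h` and in the step to `h′` as well as in the field. An
-- index of a family is therefore a field together with a flag and a target in each star. A family
-- of matrix entries is an element of a product ring, and of this ring the calculation may use only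
-- that it is commutative and contains 1/2. The path to `h` is a word of fixed shape in the entries
-- of `h`, and a filling expresses that such words multiply like matrices. Discs are never built. A
-- filling is recorded by its effect on cochains: the sums of `φ` along two paths from `g` differ by
-- at most a sum of values of dφ at flags `g ∙ y`, where the list of the `y` is fixed before `φ` and
-- `g`. This order of choices is what averaging over `g` needs, and it makes areas additive. All
-- paths run between vertices of type 0, so among the elementary homotopies only the change between
-- the stars of types 1 and 2 costs triangles. The constant 6 comes from dimension one: a triangle
-- has three edges, and each of them meets two fillings.

module CommutatorRelations where
  open import Algebra.Bundles using (CommutativeRing; Group)
  import Algebra.Construct.DirectProduct as DirectProduct
  import Algebra.Properties.Group as GroupProperties
  import Algebra.Properties.Ring as RingProperties
  import Algebra.Solver.Ring.NaturalCoefficients.Default as SemiringSolver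
  open import Data.Bool.Base using (Bool; false; not; true)
  import Data.Bool.Properties as Bool
  open import Data.Fin.Base using (Fin)
  open import Data.Fin.Patterns using (0F; 1F; 2F)
  import Data.Fin.Properties as Fin
  open import Data.List.Base using (List; []; _∷_; foldr)
  open import Data.Nat.Base using (ℕ)
  open import Data.Product.Base using (_,_; _×_)
  open import Data.Vec.Base using (Vec; lookup)
  open import Level using (_⊔_)
  open import Relation.Binary.PropositionalEquality as ≡ using (_≡_)
  import Relation.Binary.Reasoning.Setoid as SetoidReasoning
  import Relation.Binary.Reflection as Reflection
  open import Relation.Nullary.Decidable using (no; yes)

  -- Identities valid in all groups, by free reduction

  module FreeGroupSolver {c ℓ} (G : Group c ℓ) where
    open Group G
    open GroupProperties G using (⁻¹-anti-homo-∙; ⁻¹-involutive; ε⁻¹≈ε)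
    open SetoidReasoning setoid

    infixl 7 _⊙_
    infix  8 _⁻
    data Expr (n : ℕ) : Set where
      var  : Fin n → Expr n
      ι    : Expr n
      _⊙_  : Expr n → Expr n → Expr n
      _⁻   : Expr n → Expr n

    ⟦_⟧ : ∀ {n} → Expr n → Vec Carrier n → Carrier
    ⟦ var i ⟧ ρ = lookup ρ i
    ⟦ ι ⟧     ρ = ε
    ⟦ e ⊙ f ⟧ ρ = ⟦ e ⟧ ρ ∙ ⟦ f ⟧ ρ
    ⟦ e ⁻ ⟧   ρ = ⟦ e ⟧ ρ ⁻¹

    Letter : ℕ → Set
    Letter n = Bool × Fin n

    letter : ∀ {n} → Vec Carrier n → Letter n → Carrier
    letter ρ (false , i) = lookup ρ i
    letter ρ (true  , i) = lookup ρ i ⁻¹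

    push : ∀ {n} → Letter n → List (Letter n) → List (Letter n)
    push l [] = l ∷ []
    push (s , i) ((t , j) ∷ w) with not s Bool.≟ t | i Fin.≟ j
    ... | yes _ | yes _ = w
    ... | _     | _     = (s , i) ∷ (t , j) ∷ w

    -- The Boolean records whether the expression is to be inverted.
    reduce : ∀ {n} → Bool → Expr n → List (Letter n) → List (Letter n)
    reduce s     (var i) w = push (s , i) w
    reduce s     ι       w = w
    reduce false (e ⊙ f) w = reduce false e (reduce false f w)
    reduce true  (e ⊙ f) w = reduce true f (reduce true e w)
    reduce s     (e ⁻)   w = reduce (not s) e w

    word : ∀ {n} → Vec Carrier n → List (Letter n) → Carrier
    word ρ = foldr (λ l → letter ρ l ∙_) ε

    signed : Bool → Carrier → Carrier
    signed false x = x
    signed true  x = x ⁻¹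

    letter-signed : ∀ {n} (ρ : Vec Carrier n) s i → letter ρ (s , i) ≈ signed s (lookup ρ i)
    letter-signed ρ false i = refl
    letter-signed ρ true  i = refl

    cancelˡ : ∀ s x y → signed s x ∙ (signed (not s) x ∙ y) ≈ y
    cancelˡ false x y = trans (sym (assoc _ _ _)) (trans (∙-congʳ (inverseʳ x)) (identityˡ y))
    cancelˡ true  x y = trans (sym (assoc _ _ _)) (trans (∙-congʳ (inverseˡ x)) (identityˡ y))

    push-correct : ∀ {n} (ρ : Vec Carrier n) l w → word ρ (push l w) ≈ letter ρ l ∙ word ρ w
    push-correct ρ l [] = refl
    push-correct ρ (s , i) ((t , j) ∷ w) with not s Bool.≟ t | i Fin.≟ j
    ... | no _       | yes _      = refl
    ... | no _       | no _       = refl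
    ... | yes _      | no _       = refl
    ... | yes ≡.refl | yes ≡.refl = sym (trans
      (∙-cong (letter-signed ρ s i) (∙-congʳ (letter-signed ρ (not s) i))) (cancelˡ s _ _))

    signed-not : ∀ s x → signed (not s) x ≈ signed s (x ⁻¹)
    signed-not false x = refl
    signed-not true  x = sym (⁻¹-involutive x)

    reduce-correct : ∀ {n} (ρ : Vec Carrier n) s e w →
                     word ρ (reduce s e w) ≈ signed s (⟦ e ⟧ ρ) ∙ word ρ w
    reduce-correct ρ s (var i) w = trans (push-correct ρ (s , i) w) (∙-congʳ (letter-signed ρ s i))
    reduce-correct ρ false ι w = sym (identityˡ _)
    reduce-correct ρ true  ι w = sym (trans (∙-congʳ ε⁻¹≈ε) (identityˡ _))
    reduce-correct ρ false (e ⊙ f) w = begin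
      word ρ (reduce false e (reduce false f w)) ≈⟨ reduce-correct ρ false e _ ⟩
      ⟦ e ⟧ ρ ∙ word ρ (reduce false f w)        ≈⟨ ∙-congˡ (reduce-correct ρ false f w) ⟩
      ⟦ e ⟧ ρ ∙ (⟦ f ⟧ ρ ∙ word ρ w)             ≈⟨ assoc _ _ _ ⟨
      ⟦ e ⟧ ρ ∙ ⟦ f ⟧ ρ ∙ word ρ w               ∎
    reduce-correct ρ true (e ⊙ f) w = begin
      word ρ (reduce true f (reduce true e w))   ≈⟨ reduce-correct ρ true f _ ⟩
      ⟦ f ⟧ ρ ⁻¹ ∙ word ρ (reduce true e w)      ≈⟨ ∙-congˡ (reduce-correct ρ true e w) ⟩
      ⟦ f ⟧ ρ ⁻¹ ∙ (⟦ e ⟧ ρ ⁻¹ ∙ word ρ w)       ≈⟨ assoc _ _ _ ⟨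
      ⟦ f ⟧ ρ ⁻¹ ∙ ⟦ e ⟧ ρ ⁻¹ ∙ word ρ w         ≈⟨ ∙-congʳ (⁻¹-anti-homo-∙ _ _) ⟨
      (⟦ e ⟧ ρ ∙ ⟦ f ⟧ ρ) ⁻¹ ∙ word ρ w          ∎
    reduce-correct ρ s (e ⁻) w = trans (reduce-correct ρ (not s) e w) (∙-congʳ (signed-not s _))

    ⟦_⇓⟧ : ∀ {n} → Expr n → Vec Carrier n → Carrier
    ⟦ e ⇓⟧ ρ = word ρ (reduce false e [])

    correct : ∀ {n} (e : Expr n) ρ → ⟦ e ⇓⟧ ρ ≈ ⟦ e ⟧ ρ
    correct e ρ = trans (reduce-correct ρ false e []) (identityʳ _)

    open Reflection setoid var ⟦_⟧ ⟦_⇓⟧ correct public using (solve; _⊜_)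

  -- Commutator identities

  module Commutation {c ℓ} (G : Group c ℓ) where
    open Group G
    open FreeGroupSolver G
    open SetoidReasoning setoid

    Commute : Carrier → Carrier → Set ℓ
    Commute g h = g ∙ h ≈ h ∙ g

    commutator : Carrier → Carrier → Carrier
    commutator g h = g ∙ h ∙ g ⁻¹ ∙ h ⁻¹

    commute-resp : ∀ {g g′ h h′} → g ≈ g′ → h ≈ h′ → Commute g h → Commute g′ h′
    commute-resp e f p = trans (∙-cong (sym e) (sym f)) (trans p (∙-cong f e))

    commute-∙ : ∀ {g h h′} → Commute g h → Commute g h′ → Commute g (h ∙ h′)
    commute-∙ {g} {h} {h′} p q = begin
      g ∙ (h ∙ h′)   ≈⟨ assoc _ _ _ ⟨
      g ∙ h ∙ h′     ≈⟨ ∙-congʳ p ⟩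
      h ∙ g ∙ h′     ≈⟨ assoc _ _ _ ⟩
      h ∙ (g ∙ h′)   ≈⟨ ∙-congˡ q ⟩
      h ∙ (h′ ∙ g)   ≈⟨ assoc _ _ _ ⟨
      h ∙ h′ ∙ g     ∎

    commute-⁻¹ : ∀ {g h} → Commute g h → Commute g (h ⁻¹)
    commute-⁻¹ {g} {h} p = begin
      g ∙ h ⁻¹                   ≈⟨ solve 2 (λ g h → g ⊙ h ⁻ ⊜ h ⁻ ⊙ (h ⊙ g) ⊙ h ⁻) refl g h ⟩
      h ⁻¹ ∙ (h ∙ g) ∙ h ⁻¹      ≈⟨ ∙-congʳ (∙-congˡ p) ⟨
      h ⁻¹ ∙ (g ∙ h) ∙ h ⁻¹      ≈⟨ solve 2 (λ g h → h ⁻ ⊙ (g ⊙ h) ⊙ h ⁻ ⊜ h ⁻ ⊙ g) refl g h ⟩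
      h ⁻¹ ∙ g                   ∎

    commute-∙ˡ : ∀ {g g′ h} → Commute g h → Commute g′ h → Commute (g ∙ g′) h
    commute-∙ˡ p q = sym (commute-∙ (sym p) (sym q))

    commute-commutator : ∀ {g h h′} → Commute g h → Commute g h′ → Commute g (commutator h h′)
    commute-commutator p q = commute-∙ (commute-∙ (commute-∙ p q) (commute-⁻¹ p)) (commute-⁻¹ q)

    commutator-cong : ∀ {g g′ h h′} → g ≈ g′ → h ≈ h′ → commutator g h ≈ commutator g′ h′
    commutator-cong e f = ∙-cong (∙-cong (∙-cong e f) (⁻¹-cong e)) (⁻¹-cong f)

    commutator-swap : ∀ g h → g ∙ h ≈ commutator g h ∙ (h ∙ g)
    commutator-swap = solve 2 (λ g h → g ⊙ h ⊜ g ⊙ h ⊙ g ⁻ ⊙ h ⁻ ⊙ (h ⊙ g)) refl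

    swap-commutator : ∀ {g h k} → g ∙ h ≈ k ∙ (h ∙ g) → k ≈ commutator g h
    swap-commutator {g} {h} {k} e = begin
      k                              ≈⟨ solve 3 (λ g h k → k ⊜ k ⊙ (h ⊙ g) ⊙ g ⁻ ⊙ h ⁻) refl g h k ⟩
      k ∙ (h ∙ g) ∙ g ⁻¹ ∙ h ⁻¹      ≈⟨ ∙-congʳ (∙-congʳ e) ⟨
      commutator g h                 ∎

    conj-commute : ∀ {g h} → Commute g h → h ∙ g ∙ h ⁻¹ ≈ g
    conj-commute {g} {h} p = begin
      h ∙ g ∙ h ⁻¹    ≈⟨ ∙-congʳ p ⟨
      g ∙ h ∙ h ⁻¹    ≈⟨ solve 2 (λ g h → g ⊙ h ⊙ h ⁻ ⊜ g) refl g h ⟩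
      g               ∎

    -- In any group [gg′, h] = g[g′, h]g⁻¹ · [g, h], and the hypothesis removes the conjugation.
    -- This is also the origin of the reversed order on the right. `commutator-∙ʳ` rests in the same
    -- way on [g, hh′] = [g, h] · h[g, h′]h⁻¹.
    commutator-∙ˡ : ∀ {g g′ h} → Commute g (commutator g′ h) →
                    commutator (g ∙ g′) h ≈ commutator g′ h ∙ commutator g h
    commutator-∙ˡ {g} {g′} {h} p = begin
      commutator (g ∙ g′) h
        ≈⟨ solve 3 (λ g g′ h → g ⊙ g′ ⊙ h ⊙ (g ⊙ g′) ⁻ ⊙ h ⁻ ⊜
             g ⊙ (g′ ⊙ h ⊙ g′ ⁻ ⊙ h ⁻) ⊙ (h ⊙ g ⁻ ⊙ h ⁻)) refl g g′ h ⟩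
      g ∙ k ∙ (h ∙ g ⁻¹ ∙ h ⁻¹)
        ≈⟨ ∙-congʳ p ⟩
      k ∙ g ∙ (h ∙ g ⁻¹ ∙ h ⁻¹)
        ≈⟨ solve 3 (λ k g h → k ⊙ g ⊙ (h ⊙ g ⁻ ⊙ h ⁻) ⊜ k ⊙ (g ⊙ h ⊙ g ⁻ ⊙ h ⁻)) refl k g h ⟩
      k ∙ commutator g h ∎
      where
      k = commutator g′ h

    commutator-∙ʳ : ∀ {g h h′} → Commute h (commutator g h′) →
                    commutator g (h ∙ h′) ≈ commutator g h ∙ commutator g h′
    commutator-∙ʳ {g} {h} {h′} p = begin
      commutator g (h ∙ h′)
        ≈⟨ solve 3 (λ g h h′ → g ⊙ (h ⊙ h′) ⊙ g ⁻ ⊙ (h ⊙ h′) ⁻ ⊜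
             g ⊙ h ⊙ g ⁻ ⊙ h ⁻ ⊙ (h ⊙ (g ⊙ h′ ⊙ g ⁻ ⊙ h′ ⁻) ⊙ h ⁻)) refl g h h′ ⟩
      commutator g h ∙ (h ∙ commutator g h′ ∙ h ⁻¹)
        ≈⟨ ∙-congˡ (conj-commute (sym p)) ⟩
      commutator g h ∙ commutator g h′ ∎

    module _ {x y z a b} (xy : x ∙ y ≈ a ∙ (y ∙ x)) (yz : y ∙ z ≈ b ∙ (z ∙ y)) (xz : Commute x z)
      where

      -- Conjugate b = [y , z] by x, which fixes z and multiplies y by a.
      conj-x-b : x ∙ b ∙ x ⁻¹ ≈ a ∙ b ∙ z ∙ a ⁻¹ ∙ z ⁻¹
      conj-x-b = begin
        x ∙ b ∙ x ⁻¹
          ≈⟨ ∙-congʳ (∙-congˡ (swap-commutator yz)) ⟩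
        x ∙ commutator y z ∙ x ⁻¹
          ≈⟨ solve 3 (λ x y z → x ⊙ (y ⊙ z ⊙ y ⁻ ⊙ z ⁻) ⊙ x ⁻ ⊜
               (x ⊙ y) ⊙ x ⁻ ⊙ (x ⊙ z ⊙ x ⁻) ⊙ ((x ⊙ y) ⊙ x ⁻) ⁻ ⊙ (x ⊙ z ⊙ x ⁻) ⁻) refl x y z ⟩
        (x ∙ y) ∙ x ⁻¹ ∙ (x ∙ z ∙ x ⁻¹) ∙ ((x ∙ y) ∙ x ⁻¹) ⁻¹ ∙ (x ∙ z ∙ x ⁻¹) ⁻¹
          ≈⟨ ∙-cong (∙-cong (∙-cong (∙-congʳ xy) z-fixed) (⁻¹-cong (∙-congʳ xy))) (⁻¹-cong z-fixed) ⟩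
        a ∙ (y ∙ x) ∙ x ⁻¹ ∙ z ∙ (a ∙ (y ∙ x) ∙ x ⁻¹) ⁻¹ ∙ z ⁻¹
          ≈⟨ solve 4 (λ x y z a →
               a ⊙ (y ⊙ x) ⊙ x ⁻ ⊙ z ⊙ (a ⊙ (y ⊙ x) ⊙ x ⁻) ⁻ ⊙ z ⁻ ⊜
               a ⊙ (y ⊙ z) ⊙ y ⁻ ⊙ a ⁻ ⊙ z ⁻) refl x y z a ⟩
        a ∙ (y ∙ z) ∙ y ⁻¹ ∙ a ⁻¹ ∙ z ⁻¹
          ≈⟨ ∙-congʳ (∙-congʳ (∙-congʳ (∙-congˡ yz))) ⟩
        a ∙ (b ∙ (z ∙ y)) ∙ y ⁻¹ ∙ a ⁻¹ ∙ z ⁻¹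
          ≈⟨ solve 4 (λ y z a b → a ⊙ (b ⊙ (z ⊙ y)) ⊙ y ⁻ ⊙ a ⁻ ⊙ z ⁻ ⊜
               a ⊙ b ⊙ z ⊙ a ⁻ ⊙ z ⁻) refl y z a b ⟩
        a ∙ b ∙ z ∙ a ⁻¹ ∙ z ⁻¹ ∎
        where
        z-fixed : x ∙ z ∙ x ⁻¹ ≈ z
        z-fixed = conj-commute (sym xz)

    Sandwich : Carrier → Carrier → Carrier → Set ℓ
    Sandwich a b z = b ⁻¹ ∙ (a ∙ a) ∙ b ≈ (z ⁻¹ ∙ a ∙ z) ∙ (z ∙ a ∙ z ⁻¹)

    -- The hypothesis equates the two values that `conj-x-b` gives to xbx⁻¹, one for y and z and one
    -- for their inverses.
    sandwich : ∀ {a b z} → a ∙ b ∙ z ∙ a ⁻¹ ∙ z ⁻¹ ≈ a ⁻¹ ∙ b ∙ z ⁻¹ ∙ a ∙ z → Sandwich a b z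
    sandwich {a} {b} {z} e = begin
      b ⁻¹ ∙ (a ∙ a) ∙ b
        ≈⟨ solve 3 (λ a b z → b ⁻ ⊙ (a ⊙ a) ⊙ b ⊜
             b ⁻ ⊙ a ⊙ (a ⊙ b ⊙ z ⊙ a ⁻ ⊙ z ⁻) ⊙ (z ⊙ a ⊙ z ⁻)) refl a b z ⟩
      b ⁻¹ ∙ a ∙ (a ∙ b ∙ z ∙ a ⁻¹ ∙ z ⁻¹) ∙ (z ∙ a ∙ z ⁻¹)
        ≈⟨ ∙-congʳ (∙-congˡ e) ⟩
      b ⁻¹ ∙ a ∙ (a ⁻¹ ∙ b ∙ z ⁻¹ ∙ a ∙ z) ∙ (z ∙ a ∙ z ⁻¹)
        ≈⟨ solve 3 (λ a b z → b ⁻ ⊙ a ⊙ (a ⁻ ⊙ b ⊙ z ⁻ ⊙ a ⊙ z) ⊙ (z ⊙ a ⊙ z ⁻) ⊜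
             (z ⁻ ⊙ a ⊙ z) ⊙ (z ⊙ a ⊙ z ⁻)) refl a b z ⟩
      (z ⁻¹ ∙ a ∙ z) ∙ (z ∙ a ∙ z ⁻¹) ∎

    -- The second hypothesis says (u v)² = u² v² for u = z⁻¹az and v = zaz⁻¹, so u and v
    -- commute, and then the first and the third one show that b² commutes with a².
    squares-commute : ∀ {a b z} → Sandwich a b z → Sandwich (a ∙ a) b z → Sandwich a (b ⁻¹) (z ⁻¹) →
                      Commute (a ∙ a) (b ∙ b)
    squares-commute {a} {b} {z} s s² s⁻ = begin
      a ∙ a ∙ (b ∙ b)
        ≈⟨ solve 2 (λ a b → a ⊙ a ⊙ (b ⊙ b) ⊜ b ⊙ (b ⁻ ⊙ (a ⊙ a) ⊙ b) ⊙ b) refl a b ⟩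
      b ∙ (b ⁻¹ ∙ (a ∙ a) ∙ b) ∙ b
        ≈⟨ ∙-congʳ (∙-congˡ (trans s (trans uv (trans vu-form (sym s⁻))))) ⟩
      b ∙ (b ⁻¹ ⁻¹ ∙ (a ∙ a) ∙ b ⁻¹) ∙ b
        ≈⟨ solve 2 (λ a b → b ⊙ (b ⁻ ⁻ ⊙ (a ⊙ a) ⊙ b ⁻) ⊙ b ⊜ b ⊙ b ⊙ (a ⊙ a)) refl a b ⟩
      b ∙ b ∙ (a ∙ a) ∎
      where
      u = z ⁻¹ ∙ a ∙ z
      v = z ∙ a ∙ z ⁻¹

      vu-form : v ∙ u ≈ (z ⁻¹ ⁻¹ ∙ a ∙ z ⁻¹) ∙ (z ⁻¹ ∙ a ∙ z ⁻¹ ⁻¹)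
      vu-form = solve 2 (λ a z → (z ⊙ a ⊙ z ⁻) ⊙ (z ⁻ ⊙ a ⊙ z) ⊜
        (z ⁻ ⁻ ⊙ a ⊙ z ⁻) ⊙ (z ⁻ ⊙ a ⊙ z ⁻ ⁻)) refl a z

      uv : Commute u v
      uv = begin
        u ∙ v
          ≈⟨ solve 2 (λ u v → u ⊙ v ⊜ u ⁻ ⊙ ((u ⊙ u) ⊙ (v ⊙ v)) ⊙ v ⁻) refl u v ⟩
        u ⁻¹ ∙ ((u ∙ u) ∙ (v ∙ v)) ∙ v ⁻¹
          ≈⟨ ∙-congʳ (∙-congˡ (solve 2 (λ a z →
               ((z ⁻ ⊙ a ⊙ z) ⊙ (z ⁻ ⊙ a ⊙ z)) ⊙ ((z ⊙ a ⊙ z ⁻) ⊙ (z ⊙ a ⊙ z ⁻)) ⊜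
               (z ⁻ ⊙ (a ⊙ a) ⊙ z) ⊙ (z ⊙ (a ⊙ a) ⊙ z ⁻)) refl a z)) ⟩
        u ⁻¹ ∙ ((z ⁻¹ ∙ (a ∙ a) ∙ z) ∙ (z ∙ (a ∙ a) ∙ z ⁻¹)) ∙ v ⁻¹
          ≈⟨ ∙-congʳ (∙-congˡ s²) ⟨
        u ⁻¹ ∙ (b ⁻¹ ∙ (a ∙ a ∙ (a ∙ a)) ∙ b) ∙ v ⁻¹
          ≈⟨ ∙-congʳ (∙-congˡ (solve 2 (λ a b → b ⁻ ⊙ (a ⊙ a ⊙ (a ⊙ a)) ⊙ b ⊜
               (b ⁻ ⊙ (a ⊙ a) ⊙ b) ⊙ (b ⁻ ⊙ (a ⊙ a) ⊙ b)) refl a b)) ⟩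
        u ⁻¹ ∙ ((b ⁻¹ ∙ (a ∙ a) ∙ b) ∙ (b ⁻¹ ∙ (a ∙ a) ∙ b)) ∙ v ⁻¹
          ≈⟨ ∙-congʳ (∙-congˡ (∙-cong s s)) ⟩
        u ⁻¹ ∙ ((u ∙ v) ∙ (u ∙ v)) ∙ v ⁻¹
          ≈⟨ solve 2 (λ u v → u ⁻ ⊙ ((u ⊙ v) ⊙ (u ⊙ v)) ⊙ v ⁻ ⊜ v ⊙ u) refl u v ⟩
        v ∙ u ∎

  record Hom {a ℓ₁ b ℓ₂} (A : Group a ℓ₁) (B : Group b ℓ₂) : Set (a ⊔ ℓ₁ ⊔ b ⊔ ℓ₂) where
    private
      module A = Group A
      module B = Group B
    field
      map    : A.Carrier → B.Carrier
      cong   : ∀ {x y} → x A.≈ y → map x B.≈ map y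
      ∙-homo : ∀ x y → map (x A.∙ y) B.≈ map x B.∙ map y

    ε-homo : map A.ε B.≈ B.ε
    ε-homo = GroupProperties.identityˡ-unique B _ _
      (B.trans (B.sym (∙-homo _ _)) (cong (A.identityˡ A.ε)))

    ⁻¹-homo : ∀ x → map (x A.⁻¹) B.≈ map x B.⁻¹
    ⁻¹-homo x = GroupProperties.inverseˡ-unique B _ _
      (B.trans (B.sym (∙-homo _ _)) (B.trans (cong (A.inverseˡ _)) ε-homo))

  -- Unitriangular matrices of bounded degree, in coordinates

  module Truncated {c ℓ} (R : CommutativeRing c ℓ) where
    open CommutativeRing R

    -- Polynomials of degree at most 1, 2 and 3 as coefficient tuples, constant term first, so that
    -- the degree bound of each matrix entry is part of its type. No product below loses a term:
    -- each lands in a tuple that is long enough for its degree.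
    Deg1 Deg2 Deg3 : Group c ℓ
    Deg1 = DirectProduct.group +-group +-group
    Deg2 = DirectProduct.group +-group Deg1
    Deg3 = DirectProduct.group +-group Deg2

    Poly1 Poly2 Poly3 : Set c
    Poly1 = Group.Carrier Deg1
    Poly2 = Group.Carrier Deg2
    Poly3 = Group.Carrier Deg3

    infixl 7 _*¹¹_ _*¹²_ _*²¹_

    _*¹¹_ : Poly1 → Poly1 → Poly2
    (p₀ , p₁) *¹¹ (q₀ , q₁) = p₀ * q₀ , p₀ * q₁ + p₁ * q₀ , p₁ * q₁

    _*¹²_ : Poly1 → Poly2 → Poly3
    (p₀ , p₁) *¹² (v₀ , v₁ , v₂) = p₀ * v₀ , p₀ * v₁ + p₁ * v₀ , p₀ * v₂ + p₁ * v₁ , p₁ * v₂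

    _*²¹_ : Poly2 → Poly1 → Poly3
    (u₀ , u₁ , u₂) *²¹ (r₀ , r₁) = u₀ * r₀ , u₀ * r₁ + u₁ * r₀ , u₁ * r₁ + u₂ * r₀ , u₂ * r₁

    -- In the order 12 , 23 , 34 , 13 , 24 , 14 of matrix entries.
    Coordinates : Set c
    Coordinates = Poly1 × Poly1 × Poly1 × Poly2 × Poly2 × Poly3

    infix 4 _≈ᵤ_
    _≈ᵤ_ : Coordinates → Coordinates → Set ℓ
    (p , q , r , u , v , s) ≈ᵤ (p′ , q′ , r′ , u′ , v′ , s′) =
      (p D1.≈ p′) × (q D1.≈ q′) × (r D1.≈ r′) × (u D2.≈ u′) × (v D2.≈ v′) × (s D3.≈ s′)
      where
      module D1 = Group Deg1
      module D2 = Group Deg2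
      module D3 = Group Deg3

    infixl 7 _*ᵤ_
    -- Matrix multiplication, read off above the diagonal.
    _*ᵤ_ : Coordinates → Coordinates → Coordinates
    (p , q , r , u , v , s) *ᵤ (p′ , q′ , r′ , u′ , v′ , s′) =
      p D1.∙ p′ , q D1.∙ q′ , r D1.∙ r′ , u D2.∙ (p *¹¹ q′) D2.∙ u′ , v D2.∙ (q *¹¹ r′) D2.∙ v′ ,
      s D3.∙ (u *²¹ r′) D3.∙ (p *¹² v′) D3.∙ s′
      where
      module D1 = Group Deg1
      module D2 = Group Deg2
      module D3 = Group Deg3

    -- The coordinates that vanish on K_i.
    InK : Fin 3 → Coordinates → Set ℓ
    InK 0F (p , q , r , u , v , s) =
      Group._≈_ Deg1 p (Group.ε Deg1) × Group._≈_ Deg2 u (Group.ε Deg2) × Group._≈_ Deg3 s (Group.ε Deg3)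
    InK 1F (p , q , r , u , v , s) =
      Group._≈_ Deg1 q (Group.ε Deg1) × Group._≈_ Deg2 u (Group.ε Deg2) ×
      Group._≈_ Deg2 v (Group.ε Deg2) × Group._≈_ Deg3 s (Group.ε Deg3)
    InK 2F (p , q , r , u , v , s) =
      Group._≈_ Deg1 r (Group.ε Deg1) × Group._≈_ Deg2 v (Group.ε Deg2) × Group._≈_ Deg3 s (Group.ε Deg3)

    private module S = SemiringSolver commutativeSemiring
    open S using (con; _:+_; _:*_; _:=_)

    -- A cubic is 1 · (its part of degree at most 2) + t · s₃t². Accordingly the entry (1,4) is
    -- produced by two commutators of a linear and a quadratic entry, both for paths and for
    -- matrices.
    split³ : ∀ s₀ s₁ s₂ s₃ → Group._≈_ Deg3
      (Group._∙_ Deg3 ((1# , 0#) *¹² (s₀ , s₁ , s₂)) ((0# , 1#) *¹² (0# , 0# , s₃))) (s₀ , s₁ , s₂ , s₃)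
    split³ s₀ s₁ s₂ s₃ =
        S.solve 1 (λ s₀ → con 1 :* s₀ :+ con 0 :* con 0 := s₀) refl s₀
      , S.solve 2 (λ s₀ s₁ → (con 1 :* s₁ :+ con 0 :* s₀) :+
          (con 0 :* con 0 :+ con 1 :* con 0) := s₁) refl s₀ s₁
      , S.solve 3 (λ s₁ s₂ s₃ → (con 1 :* s₂ :+ con 0 :* s₁) :+
          (con 0 :* s₃ :+ con 1 :* con 0) := s₂) refl s₁ s₂ s₃
      , S.solve 2 (λ s₂ s₃ → con 0 :* s₂ :+ con 1 :* s₃ := s₃) refl s₂ s₃

  -- x , y , z play the role of e₁₂ , e₂₃ , e₃₄ and a , b that of e₁₃ , e₂₄.
  record Relations {c ℓ h ℓ′} (R : CommutativeRing c ℓ) (H : Group h ℓ′) : Set (c ⊔ ℓ ⊔ h ⊔ ℓ′) where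
    open Group H
    open Truncated R
    open Commutation H
    field
      x-hom y-hom z-hom : Hom Deg1 H
      a-hom b-hom       : Hom Deg2 H
    module X = Hom x-hom
    module Y = Hom y-hom
    module Z = Hom z-hom
    module A = Hom a-hom
    module B = Hom b-hom
    open X public using () renaming (map to x)
    open Y public using () renaming (map to y)
    open Z public using () renaming (map to z)
    open A public using () renaming (map to a)
    open B public using () renaming (map to b)
    field
      xy : ∀ p q → x p ∙ y q ≈ a (p *¹¹ q) ∙ (y q ∙ x p)
      yz : ∀ q r → y q ∙ z r ≈ b (q *¹¹ r) ∙ (z r ∙ y q)
      xz : ∀ p r → Commute (x p) (z r)
      ax : ∀ u p → Commute (a u) (x p)
      ay : ∀ u q → Commute (a u) (y q)
      by : ∀ v q → Commute (b v) (y q)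
      bz : ∀ v r → Commute (b v) (z r)

  -- Deriving the missing relations and the entry (1,4)

  module Central {c₁ ℓ₁ c₂ ℓ₂} {R : CommutativeRing c₁ ℓ₁} {H : Group c₂ ℓ₂} (rels : Relations R H)
                 (half : CommutativeRing.Carrier R)
                 (half+half≈1 : CommutativeRing._≈_ R (CommutativeRing._+_ R half half) (CommutativeRing.1# R))
    where
    open Relations rels
    open Truncated R
    open Commutation H
    open Group H
    private module R = CommutativeRing R
    open R using (0#; 1#; _+_; _*_; -_)
    open RingProperties R.ring using (-‿distribʳ-*; -‿distribˡ-*; -‿involutive; -‿+-comm)
    module S = SemiringSolver R.commutativeSemiring
    open S using (_:+_; _:*_; _:=_)
    open SetoidReasoning setoid
    open FreeGroupSolver H using (solve; _⊜_; _⊙_; _⁻; ι)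
    open GroupProperties H using (⁻¹-involutive)
    private
      module D1 = Group Deg1
      module D2 = Group Deg2
      module D3 = Group Deg3

    sandwich-pqr : ∀ p q r → Sandwich (a (p *¹¹ q)) (b (q *¹¹ r)) (z r)
    sandwich-pqr p q r = sandwich (begin
      a pq ∙ b qr ∙ z r ∙ a pq ⁻¹ ∙ z r ⁻¹
        ≈⟨ conj-x-b (xy p q) (yz q r) (xz p r) ⟨
      x p ∙ b qr ∙ x p ⁻¹
        ≈⟨ ∙-congʳ (∙-congˡ (B.cong neg-neg)) ⟩
      x p ∙ b (q D1.⁻¹ *¹¹ r D1.⁻¹) ∙ x p ⁻¹
        ≈⟨ conj-x-b (xy p (q D1.⁻¹)) (yz (q D1.⁻¹) (r D1.⁻¹)) (xz p (r D1.⁻¹)) ⟩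
      a (p *¹¹ q D1.⁻¹) ∙ b (q D1.⁻¹ *¹¹ r D1.⁻¹) ∙ z (r D1.⁻¹) ∙ a (p *¹¹ q D1.⁻¹) ⁻¹ ∙ z (r D1.⁻¹) ⁻¹
        ≈⟨ ∙-cong (∙-cong (∙-cong (∙-cong a-neg (B.cong (D2.sym neg-neg))) (Z.⁻¹-homo r))
             (trans (⁻¹-cong a-neg) (⁻¹-involutive _)))
             (trans (⁻¹-cong (Z.⁻¹-homo r)) (⁻¹-involutive _)) ⟩
      a pq ⁻¹ ∙ b qr ∙ z r ⁻¹ ∙ a pq ∙ z r ∎)
      where
      pq = p *¹¹ q
      qr = q *¹¹ r

      neg₂ : ∀ s t → - s * - t R.≈ s * t
      neg₂ s t = R.trans (R.sym (-‿distribˡ-* s (- t)))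
        (R.trans (R.-‿cong (R.sym (-‿distribʳ-* s t))) (-‿involutive _))

      neg-neg : q *¹¹ r D2.≈ q D1.⁻¹ *¹¹ r D1.⁻¹
      neg-neg = R.sym (neg₂ _ _) , R.+-cong (R.sym (neg₂ _ _)) (R.sym (neg₂ _ _)) , R.sym (neg₂ _ _)

      a-neg : a (p *¹¹ q D1.⁻¹) ≈ a pq ⁻¹
      a-neg = trans (A.cong
        ( R.sym (-‿distribʳ-* _ _)
        , R.trans (R.+-cong (R.sym (-‿distribʳ-* _ _)) (R.sym (-‿distribʳ-* _ _)))
            (-‿+-comm _ _)
        , R.sym (-‿distribʳ-* _ _))) (A.⁻¹-homo _)

    double-half : ∀ s → half * s + half * s R.≈ s
    double-half s = R.trans (R.sym (R.distribʳ s half half))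
      (R.trans (R.*-congʳ half+half≈1) (R.*-identityˡ s))

    -- The sandwich relation is only available when the two entries share a factor `q`. With
    -- `p′ = p / 2` and `r′ = r / 2` both elements are squares, so `squares-commute` applies; its
    -- second and third hypotheses are the sandwich for `2p′` and the one for `- r′`.
    ab-diagonal : ∀ p q r → Commute (a (p *¹¹ q)) (b (q *¹¹ r))
    ab-diagonal p@(p₀ , p₁) q@(q₀ , q₁) r@(r₀ , r₁) = commute-resp
      (trans (sym (A.∙-homo (p′ *¹¹ q) (p′ *¹¹ q)))
        (A.cong (dbl p₀ q₀ , (R.trans (interchange _ _ _ _) (R.+-cong (dbl p₀ q₁) (dbl p₁ q₀))) , dbl p₁ q₁)))
      (trans (sym (B.∙-homo (q *¹¹ r′) (q *¹¹ r′)))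
        (B.cong (dbr q₀ r₀ , (R.trans (interchange _ _ _ _) (R.+-cong (dbr q₀ r₁) (dbr q₁ r₀))) , dbr q₁ r₁)))
      (squares-commute (sandwich-pqr p′ q r′)
        (sandwich-resp (trans (A.cong (D2.sym
            (R.sym (R.distribʳ _ _ _) , lem , R.sym (R.distribʳ _ _ _)))) (A.∙-homo _ _))
          refl refl (sandwich-pqr (p′ D1.∙ p′) q r′))
        (sandwich-resp refl (trans (B.cong
            ( R.sym (-‿distribʳ-* _ _)
            , R.trans (R.+-cong (R.sym (-‿distribʳ-* _ _)) (R.sym (-‿distribʳ-* _ _))) (-‿+-comm _ _)
            , R.sym (-‿distribʳ-* _ _))) (B.⁻¹-homo _)) (Z.⁻¹-homo r′)
          (sandwich-pqr p′ q (r′ D1.⁻¹))))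
      where
      p′ = half * p₀ , half * p₁
      r′ = half * r₀ , half * r₁
      sandwich-resp : ∀ {g g′ h h′ k k′} → g ≈ g′ → h ≈ h′ → k ≈ k′ → Sandwich g h k → Sandwich g′ h′ k′
      sandwich-resp e f i s = trans (sym (∙-cong (∙-cong (⁻¹-cong f) (∙-cong e e)) f))
        (trans s (∙-cong (∙-cong (∙-cong (⁻¹-cong i) e) i) (∙-cong (∙-cong i e) (⁻¹-cong i))))
      interchange : ∀ s t u v → (s + t) + (u + v) R.≈ (s + u) + (t + v)
      interchange = S.solve 4 (λ s t u v → (s :+ t) :+ (u :+ v) := (s :+ u) :+ (t :+ v)) R.refl
      lem : (half * p₀ * q₁ + half * p₁ * q₀) + (half * p₀ * q₁ + half * p₁ * q₀)
            R.≈ (half * p₀ + half * p₀) * q₁ + (half * p₁ + half * p₁) * q₀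
      lem = R.trans (interchange _ _ _ _) (R.+-cong (R.sym (R.distribʳ _ _ _)) (R.sym (R.distribʳ _ _ _)))
      dbl : ∀ s t → half * s * t + half * s * t R.≈ s * t
      dbl s t = R.trans (R.sym (R.distribʳ t _ _)) (R.*-congʳ (double-half s))
      dbr : ∀ s t → s * (half * t) + s * (half * t) R.≈ s * t
      dbr s t = R.trans (R.sym (R.distribˡ s _ _)) (R.*-congˡ (double-half t))

    const : ∀ s t → (s , t) *¹¹ (1# , 0#) D2.≈ (s , t , 0#)
    const s t = R.*-identityʳ s
              , R.trans (R.+-cong (R.zeroʳ s) (R.*-identityʳ t)) (R.+-identityˡ t)
              , R.zeroʳ t

    shift : ∀ s t → (s , t) *¹¹ (0# , 1#) D2.≈ (0# , s , t)
    shift s t = R.zeroʳ s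
              , R.trans (R.+-cong (R.*-identityʳ s) (R.zeroʳ t)) (R.+-identityʳ s)
              , R.*-identityʳ t

    *¹¹-comm : ∀ p q → p *¹¹ q D2.≈ q *¹¹ p
    *¹¹-comm p q = R.*-comm _ _ , R.trans (R.+-comm _ _) (R.+-cong (R.*-comm _ _) (R.*-comm _ _)) , R.*-comm _ _

    -- The common factors 1 and t reach all pairs of monomials except (1, t²) and (t², 1). These two
    -- need the common factor 1 + t of `ab-mixed`.
    ab-low : ∀ s t s′ t′ → Commute (a (s , t , 0#)) (b (s′ , t′ , 0#))
    ab-low s t s′ t′ = commute-resp (A.cong (const s t))
      (B.cong (D2.trans (*¹¹-comm _ _) (const s′ t′))) (ab-diagonal (s , t) (1# , 0#) (s′ , t′))

    ab-high : ∀ s t s′ t′ → Commute (a (0# , s , t)) (b (0# , s′ , t′))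
    ab-high s t s′ t′ = commute-resp (A.cong (shift s t))
      (B.cong (D2.trans (*¹¹-comm _ _) (shift s′ t′))) (ab-diagonal (s , t) (0# , 1#) (s′ , t′))

    ab-mixed : ∀ s t s′ t′ → Commute (a (s , t + s , t)) (b (s′ , t′ + s′ , t′))
    ab-mixed s t s′ t′ = commute-resp (A.cong (lem s t))
      (B.cong (D2.trans (*¹¹-comm _ _) (lem s′ t′))) (ab-diagonal (s , t) (1# , 1#) (s′ , t′))
      where
      lem : ∀ s t → (s , t) *¹¹ (1# , 1#) D2.≈ (s , t + s , t)
      lem s t = R.*-identityʳ s
              , R.trans (R.+-comm _ _) (R.+-cong (R.*-identityʳ t) (R.*-identityʳ s))
              , R.*-identityʳ t

    split-low : ∀ u₀ u₁ u₂ → (u₀ , u₁ , u₂) D2.≈ ((u₀ , u₁ , 0#) D2.∙ (0# , 0# , u₂))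
    split-low u₀ u₁ u₂ = R.sym (R.+-identityʳ _) , R.sym (R.+-identityʳ _) , R.sym (R.+-identityˡ _)

    split-high : ∀ u₀ u₁ u₂ → (u₀ , u₁ , u₂) D2.≈ ((u₀ , 0# , 0#) D2.∙ (0# , u₁ , u₂))
    split-high u₀ u₁ u₂ = R.sym (R.+-identityʳ _) , R.sym (R.+-identityˡ _) , R.sym (R.+-identityˡ _)

    -- `ab-mixed` yields the pair with entries s + sX and tX + tX² in the polynomial variable X. The
    -- linear terms are then cancelled one after the other; the pairs that this brings in are
    -- covered by `ab-high` and `ab-low`.
    ab-02 : ∀ s t → Commute (a (s , 0# , 0#)) (b (0# , 0# , t))
    ab-02 s t = commute-resp refl
      (trans (sym (B.∙-homo _ _)) (B.cong (R.+-identityʳ _ , R.-‿inverseʳ t , R.+-identityʳ _)))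
      (commute-∙
        (commute-resp (trans (sym (A.∙-homo _ _)) (A.cong (R.+-identityʳ _ , R.-‿inverseʳ s , R.+-identityʳ _))) refl
          (commute-∙ˡ
            (commute-resp (A.cong (R.refl , R.+-identityˡ s , R.refl)) (B.cong (R.refl , R.+-identityʳ t , R.refl))
               (ab-mixed s 0# 0# t))
            (ab-high (- s) 0# t t)))
        (ab-low s 0# 0# (- t)))

    ab-20 : ∀ s t → Commute (a (0# , 0# , s)) (b (t , 0# , 0#))
    ab-20 s t = commute-resp refl
      (trans (sym (B.∙-homo _ _)) (B.cong (R.+-identityʳ _ , R.-‿inverseʳ t , R.+-identityʳ _)))
      (commute-∙
        (commute-resp (trans (sym (A.∙-homo _ _)) (A.cong (R.+-identityʳ _ , R.-‿inverseʳ s , R.+-identityʳ _))) refl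
          (commute-∙ˡ
            (commute-resp (A.cong (R.refl , R.+-identityʳ s , R.refl)) (B.cong (R.refl , R.+-identityˡ t , R.refl))
               (ab-mixed 0# s t 0#))
            (ab-low 0# (- s) t t)))
        (ab-high 0# s (- t) 0#))

    ab : ∀ u v → Commute (a u) (b v)
    ab (u₀ , u₁ , u₂) (v₀ , v₁ , v₂) = commute-resp
      (trans (sym (A.∙-homo _ _)) (A.cong (D2.sym (split-low u₀ u₁ u₂))))
      (trans (sym (B.∙-homo _ _)) (B.cong (D2.sym (split-low v₀ v₁ v₂))))
      (commute-∙
        (commute-∙ˡ (ab-low u₀ u₁ v₀ v₁)
          (commute-resp refl (trans (sym (B.∙-homo _ _)) (B.cong (D2.sym (split-high v₀ v₁ 0#))))
            (commute-∙ (ab-20 u₂ v₀) (ab-high 0# u₂ v₁ 0#))))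
        (commute-∙ˡ
          (commute-resp (trans (sym (A.∙-homo _ _)) (A.cong (D2.sym (split-high u₀ u₁ 0#)))) refl
            (commute-∙ˡ (ab-02 u₀ v₂) (ab-high u₁ 0# 0# v₂)))
          (ab-high 0# u₂ 0# v₂)))

    f : Poly2 → Poly1 → Carrier
    f u r = commutator (a u) (z r)

    g : Poly1 → Poly2 → Carrier
    g p v = commutator (x p) (b v)

    -- Both `f` and `g` are candidates for e₁₄. As `a` and `b` commute, `conj-x-b` turns the right
    -- side into the conjugate of the left side by `b`, and `b` commutes with `a` and with `z`.
    f≈g : ∀ p q r → f (p *¹¹ q) r ≈ g p (q *¹¹ r)
    f≈g p q r = sym (begin
      x p ∙ B′ ∙ x p ⁻¹ ∙ B′ ⁻¹
        ≈⟨ ∙-congʳ (conj-x-b (xy p q) (yz q r) (xz p r)) ⟩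
      A′ ∙ B′ ∙ z r ∙ A′ ⁻¹ ∙ z r ⁻¹ ∙ B′ ⁻¹
        ≈⟨ ∙-congʳ (∙-congʳ (∙-congʳ (∙-congʳ (ab _ _)))) ⟩
      B′ ∙ A′ ∙ z r ∙ A′ ⁻¹ ∙ z r ⁻¹ ∙ B′ ⁻¹
        ≈⟨ solve 3 (λ A B z → B ⊙ A ⊙ z ⊙ A ⁻ ⊙ z ⁻ ⊙ B ⁻ ⊜
             B ⊙ (A ⊙ z ⊙ A ⁻ ⊙ z ⁻) ⊙ B ⁻) refl A′ B′ (z r) ⟩
      B′ ∙ commutator A′ (z r) ∙ B′ ⁻¹
        ≈⟨ conj-commute (sym (commute-commutator (sym (ab _ _)) (bz _ r))) ⟩
      commutator A′ (z r) ∎)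
      where
      A′ = a (p *¹¹ q)
      B′ = b (q *¹¹ r)

    -- Central relative to the subgroup generated by `x`, `y`, `z`. The group of paths, to which
    -- this is applied, contains much more.
    record IsCentral (k : Carrier) : Set (c₁ ⊔ ℓ₂) where
      field
        with-x : ∀ p → Commute (x p) k
        with-y : ∀ q → Commute (y q) k
        with-z : ∀ r → Commute (z r) k

      with-xy : ∀ p q → Commute (commutator (x p) (y q)) k
      with-xy p q = sym (commute-commutator (sym (with-x p)) (sym (with-y q)))

      with-yz : ∀ q r → Commute (commutator (y q) (z r)) k
      with-yz q r = sym (commute-commutator (sym (with-y q)) (sym (with-z r)))
    open IsCentral

    central-resp : ∀ {k k′} → k ≈ k′ → IsCentral k → IsCentral k′
    central-resp e k .with-x p = commute-resp refl e (with-x k p)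
    central-resp e k .with-y p = commute-resp refl e (with-y k p)
    central-resp e k .with-z p = commute-resp refl e (with-z k p)

    central-∙ : ∀ {k k′} → IsCentral k → IsCentral k′ → IsCentral (k ∙ k′)
    central-∙ k k′ .with-x p = commute-∙ (with-x k p) (with-x k′ p)
    central-∙ k k′ .with-y p = commute-∙ (with-y k p) (with-y k′ p)
    central-∙ k k′ .with-z p = commute-∙ (with-z k p) (with-z k′ p)

    -- A quadratic polynomial need not be a product of linear ones, but it is a sum of two such
    -- products. This extends what is known about `a (p *¹¹ q)`, which is a commutator, to all
    -- `a u`, and likewise for `b`.
    split-products : ∀ u₀ u₁ u₂ → (u₀ , u₁ , u₂) D2.≈
                     ((u₀ , u₁) *¹¹ (1# , 0#)) D2.∙ ((0# , u₂) *¹¹ (0# , 1#))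
    split-products u₀ u₁ u₂ = D2.trans (split-low u₀ u₁ u₂)
      (D2.sym (D2.∙-cong (const u₀ u₁) (shift 0# u₂)))

    with-a : ∀ {k} → IsCentral k → ∀ u → Commute (a u) k
    with-a k (u₀ , u₁ , u₂) = commute-resp
      (trans (sym (A.∙-homo _ _)) (A.cong (D2.sym (split-products u₀ u₁ u₂)))) refl
      (commute-∙ˡ (part _ _) (part _ _))
      where
      part : ∀ p q → Commute (a (p *¹¹ q)) _
      part p q = commute-resp (sym (swap-commutator (xy p q))) refl (with-xy k p q)

    with-b : ∀ {k} → IsCentral k → ∀ u → Commute (b u) k
    with-b k (u₀ , u₁ , u₂) = commute-resp
      (trans (sym (B.∙-homo _ _)) (B.cong (D2.sym (split-products u₀ u₁ u₂)))) refl
      (commute-∙ˡ (part _ _) (part _ _))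
      where
      part : ∀ p q → Commute (b (p *¹¹ q)) _
      part p q = commute-resp (sym (swap-commutator (yz p q))) refl (with-yz k p q)

    -- The two expressions f (pq) r and g p (qr) of the same element show that it commutes
    -- with x and with z, respectively; conjugation by y multiplies z by some b.
    central-f-product : ∀ p q r → IsCentral (f (p *¹¹ q) r)
    central-f-product p q r .with-x p′ = commute-commutator (sym (ax _ p′)) (xz p′ r)
    central-f-product p q r .with-z r′ = commute-resp refl (sym (f≈g p q r))
      (commute-commutator (sym (xz p r′)) (sym (bz _ r′)))
    central-f-product p q r .with-y q′ = begin
      Y ∙ f pq r
        ≈⟨ solve 3 (λ Y A Z → Y ⊙ (A ⊙ Z ⊙ A ⁻ ⊙ Z ⁻) ⊜
             (Y ⊙ A ⊙ Y ⁻) ⊙ (Y ⊙ Z ⊙ Y ⁻) ⊙ (Y ⊙ A ⊙ Y ⁻) ⁻ ⊙ (Y ⊙ Z ⊙ Y ⁻) ⁻ ⊙ Y)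
             refl Y (a pq) (z r) ⟩
      commutator (Y ∙ a pq ∙ Y ⁻¹) (Y ∙ z r ∙ Y ⁻¹) ∙ Y
        ≈⟨ ∙-congʳ (commutator-cong (conj-commute (ay _ q′)) y-z) ⟩
      commutator (a pq) (b (q′ *¹¹ r) ∙ z r) ∙ Y
        ≈⟨ ∙-congʳ (commutator-∙ʳ (commute-commutator (sym (ab _ _)) (bz _ r))) ⟩
      commutator (a pq) (b (q′ *¹¹ r)) ∙ f pq r ∙ Y
        ≈⟨ ∙-congʳ (∙-congʳ (sym (swap-commutator (trans (ab _ _) (sym (identityˡ _)))))) ⟩
      ε ∙ f pq r ∙ Y
        ≈⟨ ∙-congʳ (identityˡ _) ⟩
      f pq r ∙ Y ∎
      where
      pq = p *¹¹ q
      Y = y q′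

      y-z : Y ∙ z r ∙ Y ⁻¹ ≈ b (q′ *¹¹ r) ∙ z r
      y-z = trans (∙-congʳ (yz q′ r)) (solve 3 (λ b z Y → b ⊙ (z ⊙ Y) ⊙ Y ⁻ ⊜ b ⊙ z)
        refl (b (q′ *¹¹ r)) (z r) Y)

    central-g-product : ∀ p q r → IsCentral (g p (q *¹¹ r))
    central-g-product p q r = central-resp (f≈g p q r) (central-f-product p q r)

    g-cong : ∀ {p p′ v v′} → p D1.≈ p′ → v D2.≈ v′ → g p v ≈ g p′ v′
    g-cong e e′ = commutator-cong (X.cong e) (B.cong e′)

    f-cong : ∀ {u u′ r r′} → u D2.≈ u′ → r D1.≈ r′ → f u r ≈ f u′ r′
    f-cong e e′ = commutator-cong (A.cong e) (Z.cong e′)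

    central-g : ∀ p v → IsCentral (g p v)
    central-g p (v₀ , v₁ , v₂) = central-resp
      (trans (sym (commutator-∙ʳ (with-b (central-g-product p _ _) _)))
        (commutator-cong refl (trans (sym (B.∙-homo _ _)) (B.cong (D2.sym split′)))))
      (central-∙ (central-g-product p (1# , 0#) (v₀ , v₁)) (central-g-product p (0# , 1#) (0# , v₂)))
      where
      split′ : (v₀ , v₁ , v₂) D2.≈ ((1# , 0#) *¹¹ (v₀ , v₁)) D2.∙ ((0# , 1#) *¹¹ (0# , v₂))
      split′ = D2.trans (split-products v₀ v₁ v₂) (D2.∙-cong (*¹¹-comm _ _) (*¹¹-comm _ _))

    central-f : ∀ u r → IsCentral (f u r)
    central-f (u₀ , u₁ , u₂) r = central-resp
      (trans (sym (commutator-∙ˡ (with-a (central-f-product (0# , u₂) (0# , 1#) r) _)))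
        (commutator-cong (trans (sym (A.∙-homo _ _)) (A.cong (D2.sym (split-products u₀ u₁ u₂)))) refl))
      (central-∙ (central-f-product (0# , u₂) (0# , 1#) r) (central-f-product (u₀ , u₁) (1# , 0#) r))

    g-∙ʳ : ∀ p v v′ → g p (v D2.∙ v′) ≈ g p v ∙ g p v′
    g-∙ʳ p v v′ = trans (commutator-cong refl (B.∙-homo v v′)) (commutator-∙ʳ (with-b (central-g p v′) v))

    g-∙ˡ : ∀ p p′ v → g (p D1.∙ p′) v ≈ g p v ∙ g p′ v
    g-∙ˡ p p′ v = trans (commutator-cong (X.∙-homo p p′) refl)
      (trans (commutator-∙ˡ (with-x (central-g p′ v) p)) (sym (central-comm (central-g p′ v) p v)))
      where
      central-comm : ∀ {k} → IsCentral k → ∀ p v → Commute (g p v) k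
      central-comm k p v = sym (commute-commutator (sym (with-x k p)) (sym (with-b k v)))

    f-∙ˡ : ∀ u u′ r → f (u D2.∙ u′) r ≈ f u r ∙ f u′ r
    f-∙ˡ u u′ r = trans (commutator-cong (A.∙-homo u u′) refl)
      (trans (commutator-∙ˡ (with-a (central-f u′ r) u))
        (commute-commutator (sym (with-a (central-f u′ r) u)) (sym (with-z (central-f u′ r) r)) ))

    -- By `f≈g` the factors `p` and `q` enter only through their product, so factors can be moved
    -- from one argument of `g` to the other. Together with bilinearity this is why `g p v` depends
    -- only on the product of `p` and `v`, as `g≈c` states.
    g-assoc : ∀ {p p′ q q′} r → p *¹¹ q D2.≈ p′ *¹¹ q′ → g p (q *¹¹ r) ≈ g p′ (q′ *¹¹ r)
    g-assoc {p} {p′} {q} {q′} r e =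
      trans (sym (f≈g p q r)) (trans (commutator-cong (A.cong e) refl) (f≈g p′ q′ r))

    g-central-comm : ∀ p v {k} → IsCentral k → Commute (g p v) k
    g-central-comm p v k = sym (commute-commutator (sym (with-x k p)) (sym (with-b k v)))

    t⁰ t¹ : Poly1
    t⁰ = 1# , 0#
    t¹ = 0# , 1#

    low : Poly3 → Poly2
    low (s₀ , s₁ , s₂ , _) = s₀ , s₁ , s₂

    top : Poly3 → Poly2
    top (_ , _ , _ , s₃) = 0# , 0# , s₃

    -- The first argument of `g` is normalised to 1 for the terms of degree at most 2 and to t for
    -- the cubic term, following `split³`. It is additive because `g` is additive in its second
    -- argument with central values.
    c-hom : Hom Deg3 H
    c-hom = record
      { map    = λ s → g t⁰ (low s) ∙ g t¹ (top s)
      ; cong   = λ (e₀ , e₁ , e₂ , e₃) → ∙-cong (g-cong D1.refl (e₀ , e₁ , e₂)) (g-cong D1.refl (R.refl , R.refl , e₃))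
      ; ∙-homo = λ s s′ → begin
          g t⁰ (low (s D3.∙ s′)) ∙ g t¹ (top (s D3.∙ s′))
            ≈⟨ ∙-cong (g-∙ʳ t⁰ (low s) (low s′))
                 (trans (g-cong D1.refl (R.sym (R.+-identityˡ _) , R.sym (R.+-identityˡ _) , R.refl))
                        (g-∙ʳ t¹ (top s) (top s′))) ⟩
          (g t⁰ (low s) ∙ g t⁰ (low s′)) ∙ (g t¹ (top s) ∙ g t¹ (top s′))
            ≈⟨ interchange (g-central-comm t⁰ (low s′) (central-g t¹ (top s))) ⟩
          (g t⁰ (low s) ∙ g t¹ (top s)) ∙ (g t⁰ (low s′) ∙ g t¹ (top s′)) ∎
      }
      where
      interchange : ∀ {k l m n} → Commute l m → (k ∙ l) ∙ (m ∙ n) ≈ (k ∙ m) ∙ (l ∙ n)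
      interchange {k} {l} {m} {n} e = begin
        (k ∙ l) ∙ (m ∙ n)   ≈⟨ solve 4 (λ k l m n → (k ⊙ l) ⊙ (m ⊙ n) ⊜ k ⊙ (l ⊙ m) ⊙ n) refl k l m n ⟩
        k ∙ (l ∙ m) ∙ n     ≈⟨ ∙-congʳ (∙-congˡ e) ⟩
        k ∙ (m ∙ l) ∙ n     ≈⟨ solve 4 (λ k l m n → k ⊙ (m ⊙ l) ⊙ n ⊜ (k ⊙ m) ⊙ (l ⊙ n)) refl k l m n ⟩
        (k ∙ m) ∙ (l ∙ n)   ∎

    module C = Hom c-hom
    open C public using () renaming (map to c)

    central-c : ∀ s → IsCentral (c s)
    central-c s = central-∙ (central-g t⁰ (low s)) (central-g t¹ (top s))

    scalar-g : ∀ s v₀ v₁ v₂ → g (s , 0#) (v₀ , v₁ , v₂) ≈ g t⁰ (s * v₀ , s * v₁ , s * v₂)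
    scalar-g s v₀ v₁ v₂ = begin
      g (s , 0#) (v₀ , v₁ , v₂)
        ≈⟨ trans (g-cong D1.refl (D2.trans (split-products v₀ v₁ v₂) (D2.∙-cong (*¹¹-comm _ _) (*¹¹-comm _ _)))) (g-∙ʳ _ _ _) ⟩
      g (s , 0#) (t⁰ *¹¹ (v₀ , v₁)) ∙ g (s , 0#) (t¹ *¹¹ (0# , v₂))
        ≈⟨ ∙-cong
             (trans (g-assoc (v₀ , v₁) (*¹¹-comm _ _)) (g-cong D1.refl e₁))
             (trans (g-assoc {q′ = 0# , s} (0# , v₂) (D2.trans (shift s 0#) (D2.sym (D2.trans (*¹¹-comm _ _) (const 0# s))))) (g-cong D1.refl e₂)) ⟩
      g t⁰ (s * v₀ , s * v₁ , 0#) ∙ g t⁰ (0# , 0# , s * v₂)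
        ≈⟨ trans (sym (g-∙ʳ t⁰ _ _)) (g-cong D1.refl (D2.sym (split-low _ _ _))) ⟩
      g t⁰ (s * v₀ , s * v₁ , s * v₂) ∎
      where
      e₁ : (s , 0#) *¹¹ (v₀ , v₁) D2.≈ (s * v₀ , s * v₁ , 0#)
      e₁ = R.refl , R.trans (R.+-congˡ (R.zeroˡ _)) (R.+-identityʳ _) , R.zeroˡ _
      e₂ : (0# , s) *¹¹ (0# , v₂) D2.≈ (0# , 0# , s * v₂)
      e₂ = R.zeroˡ _ , R.trans (R.+-cong (R.zeroˡ _) (R.zeroʳ _)) (R.+-identityʳ _) , R.refl

    shift-g : ∀ s v₀ v₁ v₂ → g (0# , s) (v₀ , v₁ , v₂) ≈ c (0# , s * v₀ , s * v₁ , s * v₂)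
    shift-g s v₀ v₁ v₂ = begin
      g (0# , s) (v₀ , v₁ , v₂)
        ≈⟨ trans (g-cong D1.refl (D2.trans (split-products v₀ v₁ v₂) (D2.∙-cong (*¹¹-comm _ _) (*¹¹-comm _ _)))) (g-∙ʳ _ _ _) ⟩
      g (0# , s) (t⁰ *¹¹ (v₀ , v₁)) ∙ g (0# , s) (t¹ *¹¹ (0# , v₂))
        ≈⟨ ∙-cong
             (trans (g-assoc (v₀ , v₁) (*¹¹-comm _ _)) (g-cong D1.refl e₁))
             (trans (g-assoc (0# , v₂) (*¹¹-comm _ _)) (g-cong D1.refl e₂)) ⟩
      c (0# , s * v₀ , s * v₁ , s * v₂) ∎
      where
      e₁ : (0# , s) *¹¹ (v₀ , v₁) D2.≈ (0# , s * v₀ , s * v₁)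
      e₁ = R.zeroˡ _ , R.trans (R.+-congʳ (R.zeroˡ _)) (R.+-identityˡ _) , R.refl
      e₂ : (0# , s) *¹¹ (0# , v₂) D2.≈ (0# , 0# , s * v₂)
      e₂ = R.zeroˡ _ , R.trans (R.+-cong (R.zeroˡ _) (R.zeroʳ _)) (R.+-identityʳ _) , R.refl

    c-low : ∀ v₀ v₁ v₂ → g t⁰ (v₀ , v₁ , v₂) ≈ c (v₀ , v₁ , v₂ , 0#)
    c-low v₀ v₁ v₂ = sym (trans (∙-congˡ (trans (commutator-cong refl B.ε-homo)
      (solve 1 (λ x → x ⊙ ι ⊙ x ⁻ ⊙ ι ⁻ ⊜ ι) refl (x t¹)))) (identityʳ _))

    g≈c : ∀ p v → g p v ≈ c (p *¹² v)
    g≈c (p₀ , p₁) (v₀ , v₁ , v₂) = begin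
      g (p₀ , p₁) (v₀ , v₁ , v₂)
        ≈⟨ trans (g-cong (R.sym (R.+-identityʳ p₀) , R.sym (R.+-identityˡ p₁)) D2.refl) (g-∙ˡ (p₀ , 0#) (0# , p₁) _) ⟩
      g (p₀ , 0#) (v₀ , v₁ , v₂) ∙ g (0# , p₁) (v₀ , v₁ , v₂)
        ≈⟨ ∙-cong (trans (scalar-g p₀ v₀ v₁ v₂) (c-low _ _ _)) (shift-g p₁ v₀ v₁ v₂) ⟩
      c (p₀ * v₀ , p₀ * v₁ , p₀ * v₂ , 0#) ∙ c (0# , p₁ * v₀ , p₁ * v₁ , p₁ * v₂)
        ≈⟨ trans (sym (C.∙-homo _ _)) (C.cong (R.+-identityʳ _ , R.refl , R.refl , R.+-identityˡ _)) ⟩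
      c ((p₀ , p₁) *¹² (v₀ , v₁ , v₂)) ∎

    f≈c : ∀ u r → f u r ≈ c (u *²¹ r)
    f≈c (u₀ , u₁ , u₂) (r₀ , r₁) = begin
      f (u₀ , u₁ , u₂) (r₀ , r₁)
        ≈⟨ trans (f-cong (D2.trans (split-products u₀ u₁ u₂) (D2.∙-cong (*¹¹-comm _ _) (*¹¹-comm _ _))) D1.refl) (f-∙ˡ _ _ _) ⟩
      f (t⁰ *¹¹ (u₀ , u₁)) (r₀ , r₁) ∙ f (t¹ *¹¹ (0# , u₂)) (r₀ , r₁)
        ≈⟨ ∙-cong (trans (f≈g _ _ _) (c-low _ _ _)) (trans (f≈g _ _ _) (trans (g≈c _ _) (C.cong e))) ⟩
      c (u₀ * r₀ , u₀ * r₁ + u₁ * r₀ , u₁ * r₁ , 0#) ∙ c (0# , 0# , u₂ * r₀ , u₂ * r₁)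
        ≈⟨ trans (sym (C.∙-homo _ _)) (C.cong (R.+-identityʳ _ , R.+-identityʳ _ , R.refl , R.+-identityˡ _)) ⟩
      c ((u₀ , u₁ , u₂) *²¹ (r₀ , r₁)) ∎
      where
      e : t¹ *¹² ((0# , u₂) *¹¹ (r₀ , r₁)) D3.≈ (0# , 0# , u₂ * r₀ , u₂ * r₁)
      e = R.zeroˡ _
        , R.trans (R.+-cong (R.zeroˡ _) (R.trans (R.*-identityˡ _) (R.zeroˡ _))) (R.+-identityʳ _)
        , R.trans (R.+-cong (R.zeroˡ _) (R.*-identityˡ _)) (R.trans (R.+-identityˡ _) (R.trans (R.+-congʳ (R.zeroˡ _)) (R.+-identityˡ _)))
        , R.*-identityˡ _

    xb : ∀ p v → x p ∙ b v ≈ c (p *¹² v) ∙ (b v ∙ x p)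
    xb p v = trans (commutator-swap _ _) (∙-congʳ (g≈c p v))

    az : ∀ u r → a u ∙ z r ≈ c (u *²¹ r) ∙ (z r ∙ a u)
    az u r = trans (commutator-swap _ _) (∙-congʳ (f≈c u r))

    -- Normal forms

    opaque
      -- The factors follow the rows of the matrix, the last row first. In this order no cross terms
      -- arise, so the coordinates are the matrix entries themselves.
      nf : Coordinates → Carrier
      nf (p , q , r , u , v , s) = z r ∙ (b v ∙ (y q ∙ (c s ∙ (a u ∙ x p))))

      nf-cong : ∀ {t t′} → t ≈ᵤ t′ → nf t ≈ nf t′
      nf-cong (e₁ , e₂ , e₃ , e₄ , e₅ , e₆) =
        ∙-cong (Z.cong e₃) (∙-cong (B.cong e₅) (∙-cong (Y.cong e₂) (∙-cong (C.cong e₆) (∙-cong (A.cong e₄) (X.cong e₁)))))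

      nf-∙-x : ∀ p q r u v s p′ → nf (p , q , r , u , v , s) ∙ x p′ ≈ nf (p D1.∙ p′ , q , r , u , v , s)
      nf-∙-x p q r u v s p′ = trans
        (solve 7 (λ z b y c a x x′ → (z ⊙ (b ⊙ (y ⊙ (c ⊙ (a ⊙ x))))) ⊙ x′ ⊜
          z ⊙ (b ⊙ (y ⊙ (c ⊙ (a ⊙ (x ⊙ x′)))))) refl _ _ _ _ _ _ _)
        (∙-congˡ (∙-congˡ (∙-congˡ (∙-congˡ (∙-congˡ (sym (X.∙-homo p p′)))))))

      nf-∙-a : ∀ p q r u v s u′ → nf (p , q , r , u , v , s) ∙ a u′ ≈ nf (p , q , r , u D2.∙ u′ , v , s)
      nf-∙-a p q r u v s u′ = trans
        (solve 7 (λ z b y c a x a′ → (z ⊙ (b ⊙ (y ⊙ (c ⊙ (a ⊙ x))))) ⊙ a′ ⊜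
          z ⊙ (b ⊙ (y ⊙ (c ⊙ (a ⊙ (x ⊙ a′)))))) refl _ _ _ _ _ _ _)
        (∙-congˡ (∙-congˡ (∙-congˡ (∙-congˡ (trans (∙-congˡ (sym (ax u′ p)))
          (trans (sym (assoc _ _ _)) (∙-congʳ (sym (A.∙-homo u u′)))))))))

      nf-∙-c : ∀ p q r u v s s′ → nf (p , q , r , u , v , s) ∙ c s′ ≈ nf (p , q , r , u , v , s D3.∙ s′)
      nf-∙-c p q r u v s s′ = trans
        (solve 7 (λ z b y c a x c′ → (z ⊙ (b ⊙ (y ⊙ (c ⊙ (a ⊙ x))))) ⊙ c′ ⊜
          z ⊙ (b ⊙ (y ⊙ (c ⊙ ((a ⊙ x) ⊙ c′))))) refl _ _ _ _ _ _ _)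
        (∙-congˡ (∙-congˡ (∙-congˡ (trans (∙-congˡ
            (commute-∙ˡ (with-a (central-c s′) u) (with-x (central-c s′) p)))
          (trans (sym (assoc _ _ _)) (∙-congʳ (sym (C.∙-homo s s′))))))))

      nf-∙-y : ∀ p q r u v s q′ → nf (p , q , r , u , v , s) ∙ y q′ ≈
               nf (p , q D1.∙ q′ , r , u D2.∙ (p *¹¹ q′) , v , s)
      nf-∙-y p q r u v s q′ = begin
        nf (p , q , r , u , v , s) ∙ y q′
          ≈⟨ solve 7 (λ z b y c a x y′ → (z ⊙ (b ⊙ (y ⊙ (c ⊙ (a ⊙ x))))) ⊙ y′ ⊜
               z ⊙ (b ⊙ (y ⊙ ((c ⊙ a) ⊙ (x ⊙ y′))))) refl _ _ _ _ _ _ _ ⟩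
        z r ∙ (b v ∙ (y q ∙ ((c s ∙ a u) ∙ (x p ∙ y q′))))
          ≈⟨ ∙-congˡ (∙-congˡ (∙-congˡ (∙-congˡ (xy p q′)))) ⟩
        z r ∙ (b v ∙ (y q ∙ ((c s ∙ a u) ∙ (a (p *¹¹ q′) ∙ (y q′ ∙ x p)))))
          ≈⟨ ∙-congˡ (∙-congˡ (∙-congˡ (solve 5 (λ c a a′ y′ x →
               (c ⊙ a) ⊙ (a′ ⊙ (y′ ⊙ x)) ⊜ (c ⊙ (a ⊙ a′)) ⊙ y′ ⊙ x) refl _ _ _ _ _))) ⟩
        z r ∙ (b v ∙ (y q ∙ ((c s ∙ (a u ∙ a (p *¹¹ q′))) ∙ y q′ ∙ x p)))
          ≈⟨ ∙-congˡ (∙-congˡ (∙-congˡ (∙-congʳ (commute-∙ˡ (sym (with-y (central-c s) q′))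
               (commute-∙ˡ (ay u q′) (ay _ q′)))))) ⟩
        z r ∙ (b v ∙ (y q ∙ (y q′ ∙ (c s ∙ (a u ∙ a (p *¹¹ q′))) ∙ x p)))
          ≈⟨ ∙-congˡ (∙-congˡ (solve 6 (λ y y′ c a a′ x →
               y ⊙ (y′ ⊙ (c ⊙ (a ⊙ a′)) ⊙ x) ⊜ (y ⊙ y′) ⊙ (c ⊙ ((a ⊙ a′) ⊙ x)))
               refl _ _ _ _ _ _)) ⟩
        z r ∙ (b v ∙ ((y q ∙ y q′) ∙ (c s ∙ ((a u ∙ a (p *¹¹ q′)) ∙ x p))))
          ≈⟨ ∙-congˡ (∙-congˡ (∙-cong (sym (Y.∙-homo _ _)) (∙-congˡ (∙-congʳ (sym (A.∙-homo _ _)))))) ⟩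
        nf (p , q D1.∙ q′ , r , u D2.∙ (p *¹¹ q′) , v , s) ∎

      nf-∙-b : ∀ p q r u v s v′ → nf (p , q , r , u , v , s) ∙ b v′ ≈
               nf (p , q , r , u , v D2.∙ v′ , s D3.∙ (p *¹² v′))
      nf-∙-b p q r u v s v′ = begin
        nf (p , q , r , u , v , s) ∙ b v′
          ≈⟨ solve 7 (λ z b y c a x b′ → (z ⊙ (b ⊙ (y ⊙ (c ⊙ (a ⊙ x))))) ⊙ b′ ⊜
               z ⊙ (b ⊙ ((y ⊙ (c ⊙ a)) ⊙ (x ⊙ b′)))) refl _ _ _ _ _ _ _ ⟩
        z r ∙ (b v ∙ ((y q ∙ (c s ∙ a u)) ∙ (x p ∙ b v′)))
          ≈⟨ ∙-congˡ (∙-congˡ (∙-congˡ (xb p v′))) ⟩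
        z r ∙ (b v ∙ ((y q ∙ (c s ∙ a u)) ∙ (c′ ∙ (b v′ ∙ x p))))
          ≈⟨ ∙-congˡ (∙-congˡ (solve 6 (λ y c a c′ b′ x →
               (y ⊙ (c ⊙ a)) ⊙ (c′ ⊙ (b′ ⊙ x)) ⊜ y ⊙ (c ⊙ (a ⊙ c′)) ⊙ b′ ⊙ x) refl _ _ _ _ _ _)) ⟩
        z r ∙ (b v ∙ (y q ∙ (c s ∙ (a u ∙ c′)) ∙ b v′ ∙ x p))
          ≈⟨ ∙-congˡ (∙-congˡ (∙-congʳ (commute-∙ˡ (sym (by v′ q)) (commute-∙ˡ (sym (with-b (central-c s) v′))
               (commute-∙ˡ (ab u v′) (sym (with-b (central-c _) v′))))))) ⟩
        z r ∙ (b v ∙ (b v′ ∙ (y q ∙ (c s ∙ (a u ∙ c′))) ∙ x p))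
          ≈⟨ ∙-congˡ (∙-congˡ (∙-congʳ (∙-congˡ (∙-congˡ (∙-congˡ (with-a (central-c _) u)))))) ⟩
        z r ∙ (b v ∙ (b v′ ∙ (y q ∙ (c s ∙ (c′ ∙ a u))) ∙ x p))
          ≈⟨ ∙-congˡ (solve 7 (λ b b′ y c c′ a x →
               b ⊙ (b′ ⊙ (y ⊙ (c ⊙ (c′ ⊙ a))) ⊙ x) ⊜
               (b ⊙ b′) ⊙ (y ⊙ ((c ⊙ c′) ⊙ (a ⊙ x)))) refl _ _ _ _ _ _ _) ⟩
        z r ∙ ((b v ∙ b v′) ∙ (y q ∙ ((c s ∙ c′) ∙ (a u ∙ x p))))
          ≈⟨ ∙-congˡ (∙-cong (sym (B.∙-homo _ _)) (∙-congˡ (∙-congʳ (sym (C.∙-homo _ _))))) ⟩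
        nf (p , q , r , u , v D2.∙ v′ , s D3.∙ (p *¹² v′)) ∎
        where
        c′ : Carrier
        c′ = c (p *¹² v′)

      nf-∙-z : ∀ p q r u v s r′ → nf (p , q , r , u , v , s) ∙ z r′ ≈
               nf (p , q , r D1.∙ r′ , u , v D2.∙ (q *¹¹ r′) , s D3.∙ (u *²¹ r′))
      nf-∙-z p q r u v s r′ = begin
        nf (p , q , r , u , v , s) ∙ z r′
          ≈⟨ solve 7 (λ z b y c a x z′ → (z ⊙ (b ⊙ (y ⊙ (c ⊙ (a ⊙ x))))) ⊙ z′ ⊜
               z ⊙ (b ⊙ (y ⊙ (c ⊙ (a ⊙ (x ⊙ z′)))))) refl _ _ _ _ _ _ _ ⟩
        z r ∙ (b v ∙ (y q ∙ (c s ∙ (a u ∙ (x p ∙ z r′)))))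
          ≈⟨ ∙-congˡ (∙-congˡ (∙-congˡ (∙-congˡ (trans (∙-congˡ (xz p r′))
               (trans (sym (assoc _ _ _)) (trans (∙-congʳ (az u r′)) (assoc _ _ _))))))) ⟩
        z r ∙ (b v ∙ (y q ∙ (c s ∙ (c′ ∙ ((z r′ ∙ a u) ∙ x p)))))
          ≈⟨ ∙-congˡ (∙-congˡ (∙-congˡ (solve 5 (λ c c′ z′ a x → c ⊙ (c′ ⊙ ((z′ ⊙ a) ⊙ x)) ⊜
               (c ⊙ c′) ⊙ z′ ⊙ (a ⊙ x)) refl _ _ _ _ _))) ⟩
        z r ∙ (b v ∙ (y q ∙ ((c s ∙ c′) ∙ z r′ ∙ (a u ∙ x p))))
          ≈⟨ ∙-congˡ (∙-congˡ (∙-congˡ (∙-congʳ (sym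
               (commute-∙ (with-z (central-c _) r′) (with-z (central-c _) r′)))))) ⟩
        z r ∙ (b v ∙ (y q ∙ (z r′ ∙ (c s ∙ c′) ∙ (a u ∙ x p))))
          ≈⟨ ∙-congˡ (∙-congˡ (trans (solve 4 (λ y z′ c k → y ⊙ (z′ ⊙ c ⊙ k) ⊜ (y ⊙ z′) ⊙ (c ⊙ k)) refl _ _ _ _)
               (∙-congʳ (yz q r′)))) ⟩
        z r ∙ (b v ∙ ((b′ ∙ (z r′ ∙ y q)) ∙ ((c s ∙ c′) ∙ (a u ∙ x p))))
          ≈⟨ ∙-congˡ (solve 5 (λ b b′ z′ y k → b ⊙ ((b′ ⊙ (z′ ⊙ y)) ⊙ k) ⊜
               ((b ⊙ b′) ⊙ z′) ⊙ (y ⊙ k)) refl _ _ _ _ _) ⟩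
        z r ∙ (((b v ∙ b′) ∙ z r′) ∙ (y q ∙ ((c s ∙ c′) ∙ (a u ∙ x p))))
          ≈⟨ ∙-congˡ (∙-congʳ (commute-∙ˡ (bz _ r′) (bz _ r′))) ⟩
        z r ∙ ((z r′ ∙ (b v ∙ b′)) ∙ (y q ∙ ((c s ∙ c′) ∙ (a u ∙ x p))))
          ≈⟨ solve 4 (λ z z′ b k → z ⊙ ((z′ ⊙ b) ⊙ k) ⊜ (z ⊙ z′) ⊙ (b ⊙ k)) refl _ _ _ _ ⟩
        (z r ∙ z r′) ∙ ((b v ∙ b′) ∙ (y q ∙ ((c s ∙ c′) ∙ (a u ∙ x p))))
          ≈⟨ ∙-cong (sym (Z.∙-homo _ _)) (∙-cong (sym (B.∙-homo _ _)) (∙-congˡ (∙-congʳ (sym (C.∙-homo _ _))))) ⟩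
        nf (p , q , r D1.∙ r′ , u , v D2.∙ (q *¹¹ r′) , s D3.∙ (u *²¹ r′)) ∎
        where
        c′ b′ : Carrier
        c′ = c (u *²¹ r′)
        b′ = b (q *¹¹ r′)

      -- The factors of `nf t′` are absorbed one at a time, each acting on the coordinates as a
      -- column operation. Their order is the one in which `*ᵤ` adds up its terms.
      nf-homo : ∀ t t′ → nf t ∙ nf t′ ≈ nf (t *ᵤ t′)
      nf-homo (p , q , r , u , v , s) (p′ , q′ , r′ , u′ , v′ , s′) = begin
        nf (p , q , r , u , v , s) ∙ nf (p′ , q′ , r′ , u′ , v′ , s′)
          ≈⟨ solve 7 (λ n z b y c a x → n ⊙ (z ⊙ (b ⊙ (y ⊙ (c ⊙ (a ⊙ x))))) ⊜
               n ⊙ z ⊙ b ⊙ y ⊙ c ⊙ a ⊙ x) refl _ _ _ _ _ _ _ ⟩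
        nf (p , q , r , u , v , s) ∙ z r′ ∙ b v′ ∙ y q′ ∙ c s′ ∙ a u′ ∙ x p′
          ≈⟨ ∙-congʳ (∙-congʳ (∙-congʳ (∙-congʳ (∙-congʳ (nf-∙-z _ _ _ _ _ _ _))))) ⟩
        nf _ ∙ b v′ ∙ y q′ ∙ c s′ ∙ a u′ ∙ x p′
          ≈⟨ ∙-congʳ (∙-congʳ (∙-congʳ (∙-congʳ (nf-∙-b _ _ _ _ _ _ _)))) ⟩
        nf _ ∙ y q′ ∙ c s′ ∙ a u′ ∙ x p′
          ≈⟨ ∙-congʳ (∙-congʳ (∙-congʳ (nf-∙-y _ _ _ _ _ _ _))) ⟩
        nf _ ∙ c s′ ∙ a u′ ∙ x p′
          ≈⟨ ∙-congʳ (∙-congʳ (nf-∙-c _ _ _ _ _ _ _)) ⟩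
        nf _ ∙ a u′ ∙ x p′
          ≈⟨ ∙-congʳ (nf-∙-a _ _ _ _ _ _ _) ⟩
        nf _ ∙ x p′
          ≈⟨ nf-∙-x _ _ _ _ _ _ _ ⟩
        nf ((p , q , r , u , v , s) *ᵤ (p′ , q′ , r′ , u′ , v′ , s′)) ∎

      -- On each K_i the normal form uses only elements of K_i, which is what allows it to be
      -- compared with a single step inside one star.
      nf-K₀ : ∀ {t} → InK 0F t → let (p , q , r , u , v , s) = t in nf t ≈ z r ∙ (b v ∙ y q)
      nf-K₀ (p≈0 , u≈0 , s≈0) = ∙-congˡ (∙-congˡ
        (trans (∙-congˡ (trans (∙-cong (trans (C.cong s≈0) C.ε-homo)
          (trans (∙-cong (trans (A.cong u≈0) A.ε-homo) (trans (X.cong p≈0) X.ε-homo))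
            (identityˡ ε))) (identityˡ ε))) (identityʳ _)))

      nf-K₁ : ∀ {t} → InK 1F t → let (p , q , r , u , v , s) = t in nf t ≈ z r ∙ x p
      nf-K₁ (q≈0 , u≈0 , v≈0 , s≈0) = ∙-congˡ
        (trans (∙-cong (trans (B.cong v≈0) B.ε-homo)
          (trans (∙-cong (trans (Y.cong q≈0) Y.ε-homo)
            (trans (∙-cong (trans (C.cong s≈0) C.ε-homo)
              (trans (∙-congʳ (trans (A.cong u≈0) A.ε-homo)) (identityˡ _)))
              (identityˡ _))) (identityˡ _))) (identityˡ _))

      nf-K₂ : ∀ {t} → InK 2F t → let (p , q , r , u , v , s) = t in nf t ≈ y q ∙ (a u ∙ x p)
      nf-K₂ (r≈0 , v≈0 , s≈0) =
        trans (∙-cong (trans (Z.cong r≈0) Z.ε-homo)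
          (trans (∙-cong (trans (B.cong v≈0) B.ε-homo)
            (∙-congˡ (trans (∙-congʳ (trans (C.cong s≈0) C.ε-homo)) (identityˡ _))))
            (identityˡ _))) (identityˡ _)

-- Paths of flags, lengths and areas

module FlagPaths where
  open import Algebra.Bundles using (Group)
  open import Data.Bool.Base using (Bool; T; _xor_; _∧_; false; if_then_else_; not; true)
  import Data.Bool.Properties as Bool
  open import Data.Fin.Base using (Fin; suc; zero)
  open import Data.Fin.Patterns using (0F; 1F; 2F)
  open import Data.List.Base using (List; []; _++_; _∷_; length; map)
  import Data.List.Properties as List
  open import Data.Nat.Base as ℕ using (_+_; _≤_; suc; s≤s; zero; z≤n; ℕ)
  open import Data.Nat.ListAction using (sum)
  import Data.Nat.ListAction.Properties as ℕ
  import Data.Nat.Properties as ℕ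
  open import Data.Product.Base using (_,_; _×_; proj₁; proj₂; Σ-syntax)
  open import Data.Vec.Base as Vec using (Vec; []; _∷_)
  open import Defs
  open import Function.Base using (_∘_)
  open import Function.Bundles using (module Equivalence)
  open import Level as Level using (0ℓ)
  open import Relation.Binary.PropositionalEquality as ≡ using (_≡_; cong; cong₂)

  𝟙 : Bool → ℕ
  𝟙 b = if b then 1 else 0

  𝟙-xor : ∀ a b → 𝟙 (a xor b) ≤ 𝟙 a + 𝟙 b
  𝟙-xor false b     = ℕ.≤-refl
  𝟙-xor true  false = ℕ.≤-refl
  𝟙-xor true  true  = z≤n

  everywhere : ∀ n → (Vec Bool n → Bool) → Bool
  everywhere zero    P = P []
  everywhere (suc n) P = everywhere n (P ∘ (false ∷_)) ∧ everywhere n (P ∘ (true ∷_))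

  everywhere-sound : ∀ n P → T (everywhere n P) → ∀ v → T (P v)
  everywhere-sound zero    P h []          = h
  everywhere-sound (suc n) P h (false ∷ v) = everywhere-sound n _ (proj₁ (Equivalence.to Bool.T-∧ h)) v
  everywhere-sound (suc n) P h (true  ∷ v) = everywhere-sound n _ (proj₂ (Equivalence.to Bool.T-∧ h)) v

  -- Proof by truth table: for a true identity the hidden argument evaluates to the unit type and is
  -- filled in automatically.
  xor-identity : ∀ n (f g : Vec Bool n → Bool) {_ : T (everywhere n λ v → not (f v xor g v))} → ∀ v → f v ≡ g v
  xor-identity n f g {h} v = agree (f v) (g v) (everywhere-sound n _ h v)
    where
    agree : ∀ a b → T (not (a xor b)) → a ≡ b
    agree false false _ = ≡.refl
    agree true  true  _ = ≡.refl

  module Covering (G : Group 0ℓ 0ℓ) {A : Set} (Q : A → Group.Carrier G → ℕ)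
                  (Q-resp : ∀ φ {x y} → Group._≈_ G x y → Q φ x ≡ Q φ y) where
    open Group G hiding (_-_)

    total : A → Carrier → List Carrier → ℕ
    total φ g ys = sum (map (λ y → Q φ (g ∙ y)) ys)

    total-++ : ∀ φ g ys zs → total φ g (ys ++ zs) ≡ total φ g ys + total φ g zs
    total-++ φ g ys zs = ≡.trans (cong sum (List.map-++ _ ys zs)) (ℕ.sum-++ (map _ ys) _)

    total-shift : ∀ φ g e ys → total φ g (map (e ∙_) ys) ≡ total φ (g ∙ e) ys
    total-shift φ g e []       = ≡.refl
    total-shift φ g e (y ∷ ys) = cong₂ _+_ (Q-resp φ (sym (assoc g e y))) (total-shift φ g e ys)

    -- `Q` is a local defect of a cochain at a flag. The translates `ys` are chosen before `φ` and
    -- `g`; hence the sum of `P φ g` over all `g` is at most `n` times that of `Q φ g`, right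
    -- translation being a bijection.
    Covered : ℕ → (A → Carrier → ℕ) → Set
    Covered n P = Σ[ ys ∈ List Carrier ] (length ys ≤ n × ∀ φ g → P φ g ≤ total φ g ys)

    covered-≤ : ∀ {m n P} → m ≤ n → Covered m P → Covered n P
    covered-≤ m≤n (ys , l , h) = ys , ℕ.≤-trans l m≤n , h

    covered-mono : ∀ {n P P′} → (∀ φ g → P′ φ g ≤ P φ g) → Covered n P → Covered n P′
    covered-mono le (ys , l , h) = ys , l , λ φ g → ℕ.≤-trans (le φ g) (h φ g)

    covered-0 : Covered 0 (λ _ _ → 0)
    covered-0 = [] , z≤n , λ _ _ → z≤n

    covered-+ : ∀ {m n P P′} → Covered m P → Covered n P′ → Covered (m + n) (λ φ g → P φ g + P′ φ g)
    covered-+ (ys , l , h) (zs , l′ , h′) =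
      ys ++ zs ,
      ℕ.≤-trans (ℕ.≤-reflexive (List.length-++ ys)) (ℕ.+-mono-≤ l l′) ,
      λ φ g → ℕ.≤-trans (ℕ.+-mono-≤ (h φ g) (h′ φ g)) (ℕ.≤-reflexive (≡.sym (total-++ φ g ys zs)))

    covered-shift : ∀ {n P} e → Covered n P → Covered n (λ φ g → P φ (g ∙ e))
    covered-shift e (ys , l , h) =
      map (e ∙_) ys ,
      ℕ.≤-trans (ℕ.≤-reflexive (List.length-map (e ∙_) ys)) l ,
      λ φ g → ℕ.≤-trans (h φ (g ∙ e)) (ℕ.≤-reflexive (≡.sym (total-shift φ g e ys)))

    covered-Q : Covered 1 Q
    covered-Q = ε ∷ [] , s≤s z≤n , λ φ g → ℕ.≤-reflexive
      (≡.trans (Q-resp φ (sym (identityʳ g))) (≡.sym (ℕ.+-identityʳ _)))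

  module Flags (G : FiniteGroup) (K : Fin 3 → DecSubgroup (FiniteGroup.group G)) where
    open FiniteGroup G
    private module K i = DecSubgroup (K i)

    -- Cochains on the vertices x K_i and the edges (x K_i , x K_j), as functions of the flag x.
    record VertexCochain : Set where
      field
        at  : Fin 3 → Carrier → Bool
        inv : ∀ i {x y} → K.Member i (x ⁻¹ ∙ y) → at i x ≡ at i y

      at-resp : ∀ i {x y} → x ≈ y → at i x ≡ at i y
      at-resp i {x} {y} x≈y = inv i (K.resp i (trans (sym (inverseˡ x)) (∙-congˡ x≈y)) (K.ε-mem i))

    record EdgeCochain : Set where
      field
        at  : Fin 3 → Fin 3 → Carrier → Bool
        inv : ∀ i j {x y} → K.Member i (x ⁻¹ ∙ y) → K.Member j (x ⁻¹ ∙ y) → at i j x ≡ at i j y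

      at-resp : ∀ i j {x y} → x ≈ y → at i j x ≡ at i j y
      at-resp i j {x} {y} x≈y = inv i j (mem i) (mem j)
        where
        mem : ∀ i → K.Member i (x ⁻¹ ∙ y)
        mem i = K.resp i (trans (sym (inverseˡ x)) (∙-congˡ x≈y)) (K.ε-mem i)

    -- The number of edges of the triangle `x` on which dφ is 1. Summed over all flags it is the
    -- weight of dφ up to normalisation.
    D : VertexCochain → Carrier → ℕ
    D φ x = 𝟙 (at 0F x xor at 1F x) + (𝟙 (at 0F x xor at 2F x) + 𝟙 (at 1F x xor at 2F x))
      where open VertexCochain φ

    ∂ : EdgeCochain → Carrier → Bool
    ∂ φ x = at 0F 1F x xor (at 0F 2F x xor at 1F 2F x)
      where open EdgeCochain φ

    D-resp : ∀ φ {x y} → x ≈ y → D φ x ≡ D φ y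
    D-resp φ e = cong₂ _+_ (cong 𝟙 (cong₂ _xor_ (at-resp 0F e) (at-resp 1F e)))
      (cong₂ _+_ (cong 𝟙 (cong₂ _xor_ (at-resp 0F e) (at-resp 2F e)))
                 (cong 𝟙 (cong₂ _xor_ (at-resp 1F e) (at-resp 2F e))))
      where open VertexCochain φ

    ∂-resp : ∀ φ {x y} → x ≈ y → 𝟙 (∂ φ x) ≡ 𝟙 (∂ φ y)
    ∂-resp φ e = cong 𝟙 (cong₂ _xor_ (at-resp 0F 1F e) (cong₂ _xor_ (at-resp 0F 2F e) (at-resp 1F 2F e)))
      where open EdgeCochain φ

    module V = Covering group D D-resp
    module E = Covering group (λ φ x → 𝟙 (∂ φ x)) ∂-resp

    -- The value on the edge from x K_0 to x K_i, which is degenerate for i = 0.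
    root : EdgeCochain → Fin 3 → Carrier → Bool
    root φ 0F      x = false
    root φ (suc i) x = EdgeCochain.at φ 0F (suc i) x

    root-resp : ∀ φ i {x y} → x ≈ y → root φ i x ≡ root φ i y
    root-resp φ 0F      e = ≡.refl
    root-resp φ (suc i) e = EdgeCochain.at-resp φ 0F (suc i) e

    -- A path of flags from any g to g ∙ end, together with the sum of a cochain along it.
    record Path : Set where
      field
        end       : Carrier
        cost      : EdgeCochain → Carrier → Bool
        cost-resp : ∀ φ {x y} → x ≈ y → cost φ x ≡ cost φ y
    open Path public

    infixl 7 _∙ₚ_
    _∙ₚ_ : Path → Path → Path
    (u ∙ₚ v) .end           = end u ∙ end v
    (u ∙ₚ v) .cost φ g      = cost u φ g xor cost v φ (g ∙ end u)
    (u ∙ₚ v) .cost-resp φ e = cong₂ _xor_ (cost-resp u φ e) (cost-resp v φ (∙-congʳ e))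

    εₚ : Path
    εₚ .end             = ε
    εₚ .cost φ g        = false
    εₚ .cost-resp φ e   = ≡.refl

    -- The reversed path from `g` is the original one that starts at `g ∙ end u ⁻¹` and ends at `g`.
    -- Over 𝔽₂ reversal changes no sign.
    _⁻¹ₚ : Path → Path
    (u ⁻¹ₚ) .end           = end u ⁻¹
    (u ⁻¹ₚ) .cost φ g      = cost u φ (g ∙ end u ⁻¹)
    (u ⁻¹ₚ) .cost-resp φ e = cost-resp u φ (∙-congʳ e)

    -- From the flag g to the flag g ∙ k in the star of their common vertex g K_i.
    step : Fin 3 → Carrier → Path
    step i k .end           = k
    step i k .cost φ g      = root φ i g xor root φ i (g ∙ k)
    step i k .cost-resp φ e = cong₂ _xor_ (root-resp φ i e) (root-resp φ i (∙-congʳ e))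

    -- The dual of a filling with `n` triangles: `u` and `v` bound a loop, and the sum of `φ` around
    -- it is controlled by dφ at `n` translates of the starting flag.
    record Homotopic (n : ℕ) (u v : Path) : Set where
      field
        ends : end u ≈ end v
        area : E.Covered n (λ φ g → 𝟙 (cost u φ g xor cost v φ g))
    open Homotopic public

    -- Length in the same dual form: how much a vertex cochain can change between the ends, measured
    -- by its coboundary along the way.
    Short : ℕ → Path → Set
    Short n u = V.Covered n (λ φ g → 𝟙 (VertexCochain.at φ 0F g xor VertexCochain.at φ 0F (g ∙ end u)))

    private
      xor-triangle : ∀ a b c → 𝟙 (a xor c) ≤ 𝟙 (a xor b) + 𝟙 (b xor c)
      xor-triangle a b c = ℕ.≤-trans
        (ℕ.≤-reflexive (cong 𝟙 (xor-identity 3 (λ { (a ∷ b ∷ c ∷ []) → a xor c })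
          (λ { (a ∷ b ∷ c ∷ []) → (a xor b) xor (b xor c) }) (a ∷ b ∷ c ∷ []))))
        (𝟙-xor (a xor b) (b xor c))

    exact : ∀ {u v} → end u ≈ end v → (∀ φ g → cost u φ g ≡ cost v φ g) → Homotopic 0 u v
    exact e h .ends = e
    exact {u} {v} e h .area = E.covered-mono (λ φ g → ℕ.≤-reflexive
      (≡.trans (cong (λ c → 𝟙 (c xor cost v φ g)) (h φ g)) (cong 𝟙 (Bool.xor-same (cost v φ g))))) E.covered-0

    homotopic-sym : ∀ {n u v} → Homotopic n u v → Homotopic n v u
    homotopic-sym h .ends = sym (ends h)
    homotopic-sym {u = u} {v} h .area =
      E.covered-mono (λ φ g → ℕ.≤-reflexive (cong 𝟙 (Bool.xor-comm (cost v φ g) (cost u φ g)))) (area h)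

    homotopic-trans : ∀ {m n u v w} → Homotopic m u v → Homotopic n v w → Homotopic (m + n) u w
    homotopic-trans h h′ .ends = trans (ends h) (ends h′)
    homotopic-trans {u = u} {v} {w} h h′ .area =
      E.covered-mono (λ φ g → xor-triangle (cost u φ g) (cost v φ g) (cost w φ g)) (E.covered-+ (area h) (area h′))

    homotopic-∙ : ∀ {m n u u′ v v′} → Homotopic m u u′ → Homotopic n v v′ → Homotopic (m + n) (u ∙ₚ v) (u′ ∙ₚ v′)
    homotopic-∙ h h′ .ends = ∙-cong (ends h) (ends h′)
    homotopic-∙ {u = u} {u′} {v} {v′} h h′ .area =
      E.covered-mono
        (λ φ g → ℕ.≤-trans (ℕ.≤-reflexive (cong 𝟙 (≡.trans
            (cong (λ c → (cost u φ g xor cost v φ (g ∙ end u)) xor (cost u′ φ g xor c))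
               (cost-resp v′ φ (∙-congˡ (sym (ends h)))))
            (xor-identity 4 (λ { (a ∷ b ∷ c ∷ d ∷ []) → (a xor b) xor (c xor d) })
               (λ { (a ∷ b ∷ c ∷ d ∷ []) → (a xor c) xor (b xor d) })
               (cost u φ g ∷ cost v φ (g ∙ end u) ∷ cost u′ φ g ∷ cost v′ φ (g ∙ end u) ∷ [])))))
          (𝟙-xor (cost u φ g xor cost u′ φ g) _))
        (E.covered-+ (area h) (E.covered-shift (end u) (area h′)))

    homotopic-⁻¹ : ∀ {n u v} → Homotopic n u v → Homotopic n (u ⁻¹ₚ) (v ⁻¹ₚ)
    homotopic-⁻¹ h .ends = ⁻¹-cong (ends h)
    homotopic-⁻¹ {u = u} {v} h .area =
      E.covered-mono (λ φ g → ℕ.≤-reflexive (cong (λ c → 𝟙 (cost u φ (g ∙ end u ⁻¹) xor c))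
          (cost-resp v φ (∙-congˡ (⁻¹-cong (sym (ends h)))))))
        (E.covered-shift (end u ⁻¹) (area h))

    ∙ₚ-assoc : ∀ u v w → Homotopic 0 (u ∙ₚ v ∙ₚ w) (u ∙ₚ (v ∙ₚ w))
    ∙ₚ-assoc u v w = exact (assoc _ _ _) λ φ g → ≡.trans
      (Bool.xor-assoc (cost u φ g) _ _)
      (cong (λ c → cost u φ g xor (cost v φ (g ∙ end u) xor c)) (cost-resp w φ (sym (assoc _ _ _))))

    ∙ₚ-identityˡ : ∀ u → Homotopic 0 (εₚ ∙ₚ u) u
    ∙ₚ-identityˡ u = exact (identityˡ _) λ φ g → cost-resp u φ (identityʳ g)

    ∙ₚ-identityʳ : ∀ u → Homotopic 0 (u ∙ₚ εₚ) u
    ∙ₚ-identityʳ u = exact (identityʳ _) λ φ g → Bool.xor-identityʳ (cost u φ g)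

    ∙ₚ-inverseˡ : ∀ u → Homotopic 0 (u ⁻¹ₚ ∙ₚ u) εₚ
    ∙ₚ-inverseˡ u = exact (inverseˡ _) λ φ g → Bool.xor-same (cost u φ (g ∙ end u ⁻¹))

    ∙ₚ-inverseʳ : ∀ u → Homotopic 0 (u ∙ₚ u ⁻¹ₚ) εₚ
    ∙ₚ-inverseʳ u = exact (inverseʳ _) λ φ g → ≡.trans
      (cong (cost u φ g xor_) (cost-resp u φ (trans (assoc _ _ _) (trans (∙-congˡ (inverseʳ _)) (identityʳ g)))))
      (Bool.xor-same (cost u φ g))

    short-ε : Short 0 εₚ
    short-ε = V.covered-mono (λ φ g → ℕ.≤-reflexive (≡.trans
      (cong (λ c → 𝟙 (VertexCochain.at φ 0F g xor c)) (VertexCochain.at-resp φ 0F (identityʳ g)))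
      (cong 𝟙 (Bool.xor-same (VertexCochain.at φ 0F g))))) V.covered-0

    short-∙ : ∀ {m n u v} → Short m u → Short n v → Short (m + n) (u ∙ₚ v)
    short-∙ {u = u} {v} p q = V.covered-mono
      (λ φ g → ℕ.≤-trans (xor-triangle (VertexCochain.at φ 0F g) (VertexCochain.at φ 0F (g ∙ end u)) _)
        (ℕ.+-monoʳ-≤ _ (ℕ.≤-reflexive (cong (λ c → 𝟙 (VertexCochain.at φ 0F (g ∙ end u) xor c))
          (VertexCochain.at-resp φ 0F (sym (assoc _ _ _)))))))
      (V.covered-+ p (V.covered-shift (end u) q))

    short-⁻¹ : ∀ {n u} → Short n u → Short n (u ⁻¹ₚ)
    short-⁻¹ {u = u} p = V.covered-mono
      (λ φ g → ℕ.≤-reflexive (cong 𝟙 (≡.trans (Bool.xor-comm (VertexCochain.at φ 0F g) _)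
        (cong (VertexCochain.at φ 0F (g ∙ end u ⁻¹) xor_) (VertexCochain.at-resp φ 0F
          (sym (trans (assoc _ _ _) (trans (∙-congˡ (inverseˡ _)) (identityʳ g)))))))))
      (V.covered-shift (end u ⁻¹) p)

    step-mem : ∀ i g {k} → K.Member i k → K.Member i (g ⁻¹ ∙ (g ∙ k))
    step-mem i g {k} = K.resp i (sym (trans (sym (assoc _ _ _)) (trans (∙-congʳ (inverseˡ g)) (identityˡ k))))

    -- The path goes from g K_0 to g K_i by an edge of the flag `g`, and from there to gk K_0 by an
    -- edge of the flag `g ∙ k`: two edges.
    short-step : ∀ i {k} → K.Member i k → Short 2 (step i k)
    short-step i {k} k∈ = V.covered-mono bound (V.covered-+ V.covered-Q (V.covered-shift k V.covered-Q))
      where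
      spoke : ∀ φ i x → 𝟙 (VertexCochain.at φ 0F x xor VertexCochain.at φ i x) ≤ D φ x
      spoke φ 0F x = ℕ.≤-trans (ℕ.≤-reflexive (cong 𝟙 (Bool.xor-same (VertexCochain.at φ 0F x)))) z≤n
      spoke φ 1F x = ℕ.m≤m+n _ _
      spoke φ 2F x = ℕ.≤-trans (ℕ.m≤m+n _ _) (ℕ.m≤n+m _ (𝟙 (VertexCochain.at φ 0F x xor VertexCochain.at φ 1F x)))

      bound : ∀ φ g → 𝟙 (VertexCochain.at φ 0F g xor VertexCochain.at φ 0F (g ∙ k)) ≤ D φ g + D φ (g ∙ k)
      bound φ g = ℕ.≤-trans (xor-triangle (at 0F g) (at i g) (at 0F (g ∙ k)))
        (ℕ.+-mono-≤ (spoke φ i g) (ℕ.≤-trans (ℕ.≤-reflexive (cong 𝟙 (≡.trans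
            (cong (_xor at 0F (g ∙ k)) (inv i (step-mem i g k∈))) (Bool.xor-comm (at i (g ∙ k)) _))))
          (spoke φ i (g ∙ k))))
        where open VertexCochain φ

    step-cong : ∀ i {k l} → k ≈ l → Homotopic 0 (step i k) (step i l)
    step-cong i e = exact e λ φ g → cong (root φ i g xor_) (root-resp φ i (∙-congˡ e))

    -- The broken path visits the edge of the middle flag twice, and the two contributions cancel.
    step-∙ : ∀ i k l → Homotopic 0 (step i (k ∙ l)) (step i k ∙ₚ step i l)
    step-∙ i k l = exact refl λ φ g → ≡.trans
      (cong (root φ i g xor_) (root-resp φ i (sym (assoc g k l))))
      (xor-identity 3 (λ { (a ∷ b ∷ c ∷ []) → a xor c }) (λ { (a ∷ b ∷ c ∷ []) → (a xor b) xor (b xor c) })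
        (root φ i g ∷ root φ i (g ∙ k) ∷ root φ i (g ∙ k ∙ l) ∷ []))

    -- The edge from g K_i to g K_j does not change, so the two ways around it bound two triangles.
    step-glue : ∀ {k} → K.Member 1F k → K.Member 2F k → Homotopic 2 (step 1F k) (step 2F k)
    step-glue k∈ k∈′ .ends = refl
    step-glue {k} k∈ k∈′ .area = E.covered-mono
      (λ φ g → let open EdgeCochain φ in ℕ.≤-trans
        (ℕ.≤-reflexive (cong 𝟙 (≡.trans
          (xor-identity 5 (λ { (a ∷ b ∷ c ∷ d ∷ e ∷ []) → (a xor b) xor (c xor d) })
            (λ { (a ∷ b ∷ c ∷ d ∷ e ∷ []) → (a xor (c xor e)) xor (b xor (d xor e)) })
            (at 0F 1F g ∷ at 0F 1F (g ∙ k) ∷ at 0F 2F g ∷ at 0F 2F (g ∙ k) ∷ at 1F 2F g ∷ []))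
          (cong (λ c → ∂ φ g xor (at 0F 1F (g ∙ k) xor (at 0F 2F (g ∙ k) xor c)))
            (inv 1F 2F (step-mem 1F g k∈) (step-mem 2F g k∈′))))))
        (𝟙-xor (∂ φ g) (∂ φ (g ∙ k))))
      (E.covered-+ E.covered-Q (E.covered-shift k E.covered-Q))

    -- Edges at the base vertex g K_0 are free.
    step-glue₀ : ∀ i {k} → K.Member 0F k → K.Member i k → Homotopic 0 (step 0F k) (step i k)
    step-glue₀ 0F k∈ k∈′ = exact refl λ φ g → ≡.refl
    step-glue₀ (suc i) {k} k∈ k∈′ = exact refl λ φ g → let open EdgeCochain φ in
      ≡.sym (≡.trans (cong (_xor at 0F (suc i) (g ∙ k)) (inv 0F (suc i) (step-mem 0F g k∈) (step-mem (suc i) g k∈′)))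
        (Bool.xor-same (at 0F (suc i) (g ∙ k))))

    -- Bounded cones from every flag: short paths to all flags, which fill with
    -- boundedly many triangles along every step.
    record Contractible (n : ℕ) : Set where
      field
        path    : Carrier → Path
        path-to : ∀ h → end (path h) ≈ h
        short   : ∀ h → Short n (path h)
        filling : ∀ i h h′ → K.Member i (h ⁻¹ ∙ h′) → Homotopic n (path h ∙ₚ step i (h ⁻¹ ∙ h′)) (path h′)

  -- Since areas add up in every group law, families of paths modulo homotopies whose area is
  -- bounded uniformly over the family form an honest group, in which no constants have to be tracked.
  module Uniform {I : Set₁} (G : I → FiniteGroup) (K : ∀ i → Fin 3 → DecSubgroup (FiniteGroup.group (G i))) where
    private
      module F ι = Flags (G ι) (K ι)
      module Γ ι = FiniteGroup (G ι)
    open F using (Path; Short; Homotopic)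

    record Family : Set₁ where
      field
        path   : ∀ ι → Path ι
        diameter : ℕ
        short  : ∀ ι → Short ι diameter (path ι)
    open Family public

    record _≃_ (u v : Family) : Set₁ where
      constructor uniformly
      field
        bound    : ℕ
        homotopy : ∀ ι → Homotopic ι bound (path u ι) (path v ι)
    open _≃_ public

    uniform : Group (Level.suc 0ℓ) (Level.suc 0ℓ)
    uniform = record
      { Carrier = Family
      ; _≈_     = _≃_
      ; _∙_     = λ u v → record
        { path = λ ι → F._∙ₚ_ ι (path u ι) (path v ι) ; diameter = diameter u + diameter v
        ; short = λ ι → F.short-∙ ι {u = path u ι} {path v ι} (short u ι) (short v ι) }
      ; ε       = record { path = F.εₚ ; diameter = 0 ; short = F.short-ε }
      ; _⁻¹     = λ u → record
        { path = λ ι → F._⁻¹ₚ ι (path u ι) ; diameter = diameter u ; short = λ ι → F.short-⁻¹ ι {u = path u ι} (short u ι) }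
      ; isGroup = record
        { isMonoid = record
          { isSemigroup = record
            { isMagma = record
              { isEquivalence = record
                { refl  = λ {u} → uniformly 0 λ ι → F.exact ι {path u ι} {path u ι} (Γ.refl ι) λ φ g → ≡.refl
                ; sym   = λ (uniformly n h) → uniformly n λ ι → F.homotopic-sym ι (h ι)
                ; trans = λ (uniformly m h) (uniformly n h′) → uniformly (m + n) λ ι → F.homotopic-trans ι (h ι) (h′ ι) }
              ; ∙-cong = λ {u} {u′} {v} {v′} (uniformly m h) (uniformly n h′) → uniformly (m + n) λ ι →
                  F.homotopic-∙ ι {u = path u ι} {path u′ ι} {path v ι} {path v′ ι} (h ι) (h′ ι) }
            ; assoc = λ u v w → uniformly 0 λ ι → F.∙ₚ-assoc ι (path u ι) (path v ι) (path w ι) }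
          ; identity = (λ u → uniformly 0 λ ι → F.∙ₚ-identityˡ ι (path u ι))
                     , (λ u → uniformly 0 λ ι → F.∙ₚ-identityʳ ι (path u ι)) }
        ; inverse = (λ u → uniformly 0 λ ι → F.∙ₚ-inverseˡ ι (path u ι))
                  , (λ u → uniformly 0 λ ι → F.∙ₚ-inverseʳ ι (path u ι))
        ; ⁻¹-cong = λ {u} {v} (uniformly n h) → uniformly n λ ι → F.homotopic-⁻¹ ι {u = path u ι} {path v ι} (h ι) } }

    steps : ∀ i (k : ∀ ι → Γ.Carrier ι) → (∀ ι → DecSubgroup.Member (K ι i) (k ι)) → Family
    steps i k k∈ = record { path = λ ι → F.step ι i (k ι) ; diameter = 2 ; short = λ ι → F.short-step ι i (k∈ ι) }

-- Cone paths and fillings for all fields at once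

module UniformFilling where
  open import Algebra.Bundles using (CommutativeRing; Group)
  open import Data.Fin.Base using (Fin; suc)
  open import Data.Fin.Patterns using (0F; 1F; 2F)
  import Data.Fin.Properties as Fin
  open import Data.Nat.Base as ℕ using (suc; ℕ)
  import Data.Nat.Properties as ℕ
  open import Data.Product.Base using (_,_; _×_; proj₁; proj₂; Σ-syntax; ∃-syntax)
  open import Defs
  open import Level as Level using (0ℓ)
  open import Relation.Binary.PropositionalEquality as ≡ using (_≡_)
  import Relation.Binary.Reasoning.Setoid as SetoidReasoning
  open import Relation.Nullary.Decidable using (no; yes)
  open import Relation.Nullary.Negation using (contradiction)
  open CommutatorRelations
  open FlagPaths

  -- All that the filling needs to know about the matrix group. Except for `xb`, the two sides of
  -- each relation lie in a common K_i, so that the relation lifts to paths. `xb` is a relation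
  -- between end points only; it identifies the end of the path that is built for e₁₄.
  record Chart (R : CommutativeRing 0ℓ 0ℓ) (G : FiniteGroup)
               (K : Fin 3 → DecSubgroup (FiniteGroup.group G)) : Set₁ where
    open FiniteGroup G using (Carrier; _≈_; _∙_; ε; group)
    open Truncated R
    open Commutation group
    private module K i = DecSubgroup (K i)
    field
      e₁₂ e₂₃ e₃₄ : Hom Deg1 group
      e₁₃ e₂₄     : Hom Deg2 group
      e₁₄         : Hom Deg3 group
    open Hom e₁₂ public using () renaming (map to x)
    open Hom e₂₃ public using () renaming (map to y)
    open Hom e₃₄ public using () renaming (map to z)
    open Hom e₁₃ public using () renaming (map to a)
    open Hom e₂₄ public using () renaming (map to b)
    open Hom e₁₄ public using () renaming (map to c)
    field
      xy : ∀ p q → x p ∙ y q ≈ a (p *¹¹ q) ∙ (y q ∙ x p)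
      yz : ∀ q r → y q ∙ z r ≈ b (q *¹¹ r) ∙ (z r ∙ y q)
      xb : ∀ p v → x p ∙ b v ≈ c (p *¹² v) ∙ (b v ∙ x p)
      xz : ∀ p r → Commute (x p) (z r)
      ax : ∀ u p → Commute (a u) (x p)
      ay : ∀ u q → Commute (a u) (y q)
      by : ∀ v q → Commute (b v) (y q)
      bz : ∀ v r → Commute (b v) (z r)

      x∈K₁ : ∀ p → K.Member 1F (x p)
      x∈K₂ : ∀ p → K.Member 2F (x p)
      y∈K₀ : ∀ q → K.Member 0F (y q)
      y∈K₂ : ∀ q → K.Member 2F (y q)
      z∈K₀ : ∀ r → K.Member 0F (z r)
      z∈K₁ : ∀ r → K.Member 1F (z r)
      a∈K₂ : ∀ u → K.Member 2F (a u)
      b∈K₀ : ∀ v → K.Member 0F (b v)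

    fromCoord : Coordinates → Carrier
    fromCoord (p , q , r , u , v , s) = z r ∙ (b v ∙ (y q ∙ (c s ∙ (a u ∙ x p))))

    field
      coord      : Carrier → Coordinates
      from-coord : ∀ g → g ≈ fromCoord (coord g)
      coord-cong : ∀ {g h} → g ≈ h → coord g ≈ᵤ coord h
      coord-*    : ∀ g h → coord (g ∙ h) ≈ᵤ coord g *ᵤ coord h
      coord-InK  : ∀ i {g} → K.Member i g → InK i (coord g)

  -- A product of fields has zero divisors. This is why the commutator calculus is carried out over
  -- a commutative ring with 1/2.
  familyRing : ∀ {i} {I : Set i} → (I → CommutativeRing 0ℓ 0ℓ) → CommutativeRing i i
  familyRing {I = I} R = record
    { Carrier = ∀ ι → R.Carrier ι
    ; _≈_ = λ f g → ∀ ι → R._≈_ ι (f ι) (g ι)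
    ; _+_ = λ f g ι → R._+_ ι (f ι) (g ι)
    ; _*_ = λ f g ι → R._*_ ι (f ι) (g ι)
    ; -_  = λ f ι → R.-_ ι (f ι)
    ; 0#  = R.0#
    ; 1#  = R.1#
    ; isCommutativeRing = record
      { isRing = record
        { +-isAbelianGroup = record
          { isGroup = record
            { isMonoid = record
              { isSemigroup = record
                { isMagma = record
                  { isEquivalence = record
                    { refl  = λ ι → R.refl ι
                    ; sym   = λ e ι → R.sym ι (e ι)
                    ; trans = λ e f ι → R.trans ι (e ι) (f ι) }
                  ; ∙-cong = λ e f ι → R.+-cong ι (e ι) (f ι) }
                ; assoc = λ f g h ι → R.+-assoc ι (f ι) (g ι) (h ι) }
              ; identity = (λ f ι → R.+-identityˡ ι (f ι)) , (λ f ι → R.+-identityʳ ι (f ι)) }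
            ; inverse = (λ f ι → R.-‿inverseˡ ι (f ι)) , (λ f ι → R.-‿inverseʳ ι (f ι))
            ; ⁻¹-cong = λ e ι → R.-‿cong ι (e ι) }
          ; comm = λ f g ι → R.+-comm ι (f ι) (g ι) }
        ; *-cong = λ e f ι → R.*-cong ι (e ι) (f ι)
        ; *-assoc = λ f g h ι → R.*-assoc ι (f ι) (g ι) (h ι)
        ; *-identity = (λ f ι → R.*-identityˡ ι (f ι)) , (λ f ι → R.*-identityʳ ι (f ι))
        ; distrib = (λ f g h ι → R.distribˡ ι (f ι) (g ι) (h ι)) , (λ f g h ι → R.distribʳ ι (f ι) (g ι) (h ι)) }
      ; *-comm = λ f g ι → R.*-comm ι (f ι) (g ι) } }
    where module R ι = CommutativeRing (R ι)

  record ChartedGroup : Set₁ where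
    field
      R           : CommutativeRing 0ℓ 0ℓ
      G           : FiniteGroup
      K           : Fin 3 → DecSubgroup (FiniteGroup.group G)
      chart       : Chart R G K
      half        : CommutativeRing.Carrier R
      half+half≈1 : CommutativeRing._≈_ R (CommutativeRing._+_ R half half) (CommutativeRing.1# R)

  module ChartFacts {R : CommutativeRing 0ℓ 0ℓ} {G : FiniteGroup} {K : Fin 3 → DecSubgroup (FiniteGroup.group G)}
                    (chart : Chart R G K) where
    open FiniteGroup G
    open Chart chart
    open Truncated R
    private module K i = DecSubgroup (K i)

    factor₀ : ∀ {g} → K.Member 0F g → let (p , q , r , u , v , s) = coord g in g ≈ z r ∙ (b v ∙ y q)
    factor₀ {g} g∈ with p≈0 , u≈0 , s≈0 ← coord-InK 0F g∈ = trans (from-coord g) (∙-congˡ (∙-congˡ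
      (trans (∙-congˡ (trans (∙-cong (trans (Hom.cong e₁₄ s≈0) (Hom.ε-homo e₁₄))
        (trans (∙-cong (trans (Hom.cong e₁₃ u≈0) (Hom.ε-homo e₁₃)) (trans (Hom.cong e₁₂ p≈0) (Hom.ε-homo e₁₂)))
          (identityˡ ε))) (identityˡ ε))) (identityʳ _))))

    factor₁ : ∀ {g} → K.Member 1F g → let (p , q , r , u , v , s) = coord g in g ≈ z r ∙ x p
    factor₁ {g} g∈ with q≈0 , u≈0 , v≈0 , s≈0 ← coord-InK 1F g∈ = trans (from-coord g) (∙-congˡ
      (trans (∙-cong (trans (Hom.cong e₂₄ v≈0) (Hom.ε-homo e₂₄))
        (trans (∙-cong (trans (Hom.cong e₂₃ q≈0) (Hom.ε-homo e₂₃))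
          (trans (∙-cong (trans (Hom.cong e₁₄ s≈0) (Hom.ε-homo e₁₄))
            (trans (∙-congʳ (trans (Hom.cong e₁₃ u≈0) (Hom.ε-homo e₁₃))) (identityˡ _)))
            (identityˡ _))) (identityˡ _))) (identityˡ _)))

    factor₂ : ∀ {g} → K.Member 2F g → let (p , q , r , u , v , s) = coord g in g ≈ y q ∙ (a u ∙ x p)
    factor₂ {g} g∈ with r≈0 , v≈0 , s≈0 ← coord-InK 2F g∈ = trans (from-coord g)
      (trans (∙-cong (trans (Hom.cong e₃₄ r≈0) (Hom.ε-homo e₃₄))
        (trans (∙-cong (trans (Hom.cong e₂₄ v≈0) (Hom.ε-homo e₂₄))
          (∙-congˡ (trans (∙-congʳ (trans (Hom.cong e₁₄ s≈0) (Hom.ε-homo e₁₄))) (identityˡ _))))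
          (identityˡ _))) (identityˡ _))

    -- K₁ is the product of the subgroups of the `z r` and of the `x p`. This factorisation is what
    -- provides pairwise adjacent vertices with a common flag.
    K₁-product : ∀ {g} → K.Member 1F g → ∃[ h ] ∃[ k ]
                 ((K.Member 0F h × K.Member 1F h) × (K.Member 1F k × K.Member 2F k) × g ≈ h ∙ k)
    K₁-product {g} g∈ = let (p , q , r , u , v , s) = coord g in
      z r , x p , (z∈K₀ r , z∈K₁ r) , (x∈K₁ p , x∈K₂ p) , factor₁ g∈

    -- An element of K₁ is `z r ∙ x p`; membership in K₂ kills `r`, membership in K₀ kills `p`.
    -- Hence different group elements are different triangles.
    trivial-intersection : ∀ {g} → (∀ i → K.Member i g) → g ≈ ε
    trivial-intersection {g} g∈ with r≈0 , _ ← coord-InK 2F (g∈ 2F) | p≈0 , _ ← coord-InK 0F (g∈ 0F) =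
      trans (factor₁ (g∈ 1F)) (trans (∙-cong (trans (Hom.cong e₃₄ r≈0) (Hom.ε-homo e₃₄))
        (trans (Hom.cong e₁₂ p≈0) (Hom.ε-homo e₁₂))) (identityˡ ε))

  -- A bound for a family over this index set depends neither on the field nor on the flag nor on
  -- the step. One target for each type lets a single index set serve the three kinds of steps.
  record Index : Set₁ where
    field charted : ChartedGroup
    open ChartedGroup charted public
    open FiniteGroup G using (Carrier; _∙_; _⁻¹)
    field
      flag    : Carrier
      target  : Fin 3 → Carrier
      target∈ : ∀ i → DecSubgroup.Member (K i) (flag ⁻¹ ∙ target i)

    move : Fin 3 → Carrier
    move i = flag ⁻¹ ∙ target i

  private
    module I = Index
    module Γ ι = FiniteGroup (I.G ι)
    module C ι = Chart (I.chart ι)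
    module KI ι i = DecSubgroup (I.K ι i)

  open Uniform I.G I.K
  private
    𝓡 : CommutativeRing (Level.suc 0ℓ) (Level.suc 0ℓ)
    𝓡 = familyRing I.R
    module F ι = Flags (I.G ι) (I.K ι)
    module U = Group uniform
    module 𝓣 = Truncated 𝓡
    module 𝓡 = CommutativeRing 𝓡

  Moves : Fin 3 → Set₁
  Moves i = Σ[ k ∈ (∀ ι → Γ.Carrier ι) ] (∀ ι → KI.Member ι i (k ι))

  infixl 7 _∙ᵐ_
  _∙ᵐ_ : ∀ {i} → Moves i → Moves i → Moves i
  _∙ᵐ_ {i} (k , k∈) (l , l∈) = (λ ι → Γ._∙_ ι (k ι) (l ι)) , λ ι → KI.∙-mem ι i (k∈ ι) (l∈ ι)

  infix 4 _≈ᵐ_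
  _≈ᵐ_ : ∀ {i} → Moves i → Moves i → Set₁
  (k , _) ≈ᵐ (l , _) = ∀ ι → Γ._≈_ ι (k ι) (l ι)

  opaque
    walk : ∀ i → Moves i → Family
    walk i (k , k∈) = steps i k k∈

    walk-cong : ∀ i k l → k ≈ᵐ l → walk i k U.≈ walk i l
    walk-cong i k l e = uniformly 0 λ ι → F.step-cong ι i (e ι)

    walk-∙ : ∀ i k l → walk i (k ∙ᵐ l) U.≈ walk i k U.∙ walk i l
    walk-∙ i (k , _) (l , _) = uniformly 0 λ ι → F.step-∙ ι i (k ι) (l ι)

    walk-glue₀ : ∀ i k k∈ k∈′ → walk 0F (k , k∈) U.≈ walk i (k , k∈′)
    walk-glue₀ i k k∈ k∈′ = uniformly 0 λ ι → F.step-glue₀ ι i (k∈ ι) (k∈′ ι)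

    walk-glue : ∀ k k∈ k∈′ → walk 1F (k , k∈) U.≈ walk 2F (k , k∈′)
    walk-glue k k∈ k∈′ = uniformly 2 λ ι → F.step-glue ι (k∈ ι) (k∈′ ι)

  -- A relation inside one K_i holds for walks because a product of walks in one star is a single
  -- walk to the same end.
  walk-swap : ∀ i k l m → k ∙ᵐ l ≈ᵐ m ∙ᵐ (l ∙ᵐ k) →
              walk i k U.∙ walk i l U.≈ walk i m U.∙ (walk i l U.∙ walk i k)
  walk-swap i k l m e =
    U.trans {walk i k U.∙ walk i l} {walk i (k ∙ᵐ l)} (U.sym {walk i (k ∙ᵐ l)} (walk-∙ i k l))
    (U.trans {walk i (k ∙ᵐ l)} {walk i (m ∙ᵐ (l ∙ᵐ k))} (walk-cong i (k ∙ᵐ l) (m ∙ᵐ (l ∙ᵐ k)) e)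
    (U.trans {walk i (m ∙ᵐ (l ∙ᵐ k))} {walk i m U.∙ walk i (l ∙ᵐ k)} (walk-∙ i m (l ∙ᵐ k))
      (U.∙-congˡ {walk i m} {walk i (l ∙ᵐ k)} {walk i l U.∙ walk i k} (walk-∙ i l k))))

  walk-commute : ∀ i k l → k ∙ᵐ l ≈ᵐ l ∙ᵐ k → walk i k U.∙ walk i l U.≈ walk i l U.∙ walk i k
  walk-commute i k l e =
    U.trans {walk i k U.∙ walk i l} {walk i (k ∙ᵐ l)} (U.sym {walk i (k ∙ᵐ l)} (walk-∙ i k l))
    (U.trans {walk i (k ∙ᵐ l)} {walk i (l ∙ᵐ k)} (walk-cong i (k ∙ᵐ l) (l ∙ᵐ k) e) (walk-∙ i l k))

  walk-hom : ∀ i {a ℓ} (D : Group a ℓ) (f : Group.Carrier D → Moves i) →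
             (∀ p q → Group._≈_ D p q → f p ≈ᵐ f q) →
             (∀ p q → f (Group._∙_ D p q) ≈ᵐ f p ∙ᵐ f q) → Hom D uniform
  walk-hom i D f f-cong f-∙ = record
    { map    = λ p → walk i (f p)
    ; cong   = λ {p} {q} e → walk-cong i (f p) (f q) (f-cong p q e)
    ; ∙-homo = λ p q → U.trans {walk i (f (p D.∙ q))} {walk i (f p ∙ᵐ f q)} {walk i (f p) U.∙ walk i (f q)}
        (walk-cong i (f (p D.∙ q)) (f p ∙ᵐ f q) (f-∙ p q)) (walk-∙ i (f p) (f q)) }
    where module D = Group D

  at₁ : 𝓣.Poly1 → ∀ ι → Truncated.Poly1 (I.R ι)
  at₁ (p₀ , p₁) ι = p₀ ι , p₁ ι

  at₂ : 𝓣.Poly2 → ∀ ι → Truncated.Poly2 (I.R ι)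
  at₂ (p₀ , p) ι = p₀ ι , at₁ p ι

  at₃ : 𝓣.Poly3 → ∀ ι → Truncated.Poly3 (I.R ι)
  at₃ (p₀ , p) ι = p₀ ι , at₂ p ι

  -- The subscript is the type of the star that is walked in. `x`, `y`, `z` each lie in two of the
  -- K_i, so each has two walks, which have to be glued; `x` is represented in star 2, `y` and `z`
  -- in star 0.
  x₁ : 𝓣.Poly1 → Moves 1F
  x₁ p = (λ ι → C.x ι (at₁ p ι)) , λ ι → C.x∈K₁ ι (at₁ p ι)

  x₂ y₂ : 𝓣.Poly1 → Moves 2F
  x₂ p = (λ ι → C.x ι (at₁ p ι)) , λ ι → C.x∈K₂ ι (at₁ p ι)
  y₂ p = (λ ι → C.y ι (at₁ p ι)) , λ ι → C.y∈K₂ ι (at₁ p ι)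

  y₀ z₀ : 𝓣.Poly1 → Moves 0F
  y₀ p = (λ ι → C.y ι (at₁ p ι)) , λ ι → C.y∈K₀ ι (at₁ p ι)
  z₀ p = (λ ι → C.z ι (at₁ p ι)) , λ ι → C.z∈K₀ ι (at₁ p ι)

  z₁ : 𝓣.Poly1 → Moves 1F
  z₁ p = (λ ι → C.z ι (at₁ p ι)) , λ ι → C.z∈K₁ ι (at₁ p ι)

  a₂ : 𝓣.Poly2 → Moves 2F
  a₂ u = (λ ι → C.a ι (at₂ u ι)) , λ ι → C.a∈K₂ ι (at₂ u ι)

  b₀ : 𝓣.Poly2 → Moves 0F
  b₀ v = (λ ι → C.b ι (at₂ v ι)) , λ ι → C.b∈K₀ ι (at₂ v ι)

  X₁≈X₂ : ∀ p → walk 1F (x₁ p) U.≈ walk 2F (x₂ p)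
  X₁≈X₂ p = walk-glue (λ ι → C.x ι (at₁ p ι)) (proj₂ (x₁ p)) (proj₂ (x₂ p))

  Y₀≈Y₂ : ∀ q → walk 0F (y₀ q) U.≈ walk 2F (y₂ q)
  Y₀≈Y₂ q = walk-glue₀ 2F (λ ι → C.y ι (at₁ q ι)) (proj₂ (y₀ q)) (proj₂ (y₂ q))

  Z₀≈Z₁ : ∀ r → walk 0F (z₀ r) U.≈ walk 1F (z₁ r)
  Z₀≈Z₁ r = walk-glue₀ 1F (λ ι → C.z ι (at₁ r ι)) (proj₂ (z₀ r)) (proj₂ (z₁ r))

  xy-relation : ∀ p q → walk 2F (x₂ p) U.∙ walk 0F (y₀ q) U.≈
                walk 2F (a₂ (p 𝓣.*¹¹ q)) U.∙ (walk 0F (y₀ q) U.∙ walk 2F (x₂ p))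
  xy-relation p q =
    U.trans {X U.∙ Y} {X U.∙ Y′} {A U.∙ (Y U.∙ X)} (U.∙-congˡ {X} {Y} {Y′} (Y₀≈Y₂ q))
    (U.trans {X U.∙ Y′} {A U.∙ (Y′ U.∙ X)} {A U.∙ (Y U.∙ X)}
      (walk-swap 2F (x₂ p) (y₂ q) (a₂ (p 𝓣.*¹¹ q)) λ ι → C.xy ι (at₁ p ι) (at₁ q ι))
      (U.∙-congˡ {A} {Y′ U.∙ X} {Y U.∙ X} (U.∙-congʳ {X} {Y′} {Y} (U.sym {Y} {Y′} (Y₀≈Y₂ q)))))
    where
    X = walk 2F (x₂ p)
    Y = walk 0F (y₀ q)
    Y′ = walk 2F (y₂ q)
    A = walk 2F (a₂ (p 𝓣.*¹¹ q))

  relations : Relations 𝓡 uniform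
  relations = record
    { x-hom = walk-hom 2F 𝓣.Deg1 x₂ (λ _ _ (e₀ , e₁) ι → Hom.cong (C.e₁₂ ι) (e₀ ι , e₁ ι))
        λ p q ι → Hom.∙-homo (C.e₁₂ ι) (at₁ p ι) (at₁ q ι)
    ; y-hom = walk-hom 0F 𝓣.Deg1 y₀ (λ _ _ (e₀ , e₁) ι → Hom.cong (C.e₂₃ ι) (e₀ ι , e₁ ι))
        λ p q ι → Hom.∙-homo (C.e₂₃ ι) (at₁ p ι) (at₁ q ι)
    ; z-hom = walk-hom 0F 𝓣.Deg1 z₀ (λ _ _ (e₀ , e₁) ι → Hom.cong (C.e₃₄ ι) (e₀ ι , e₁ ι))
        λ p q ι → Hom.∙-homo (C.e₃₄ ι) (at₁ p ι) (at₁ q ι)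
    ; a-hom = walk-hom 2F 𝓣.Deg2 a₂ (λ _ _ (e₀ , e₁ , e₂) ι → Hom.cong (C.e₁₃ ι) (e₀ ι , e₁ ι , e₂ ι))
        λ p q ι → Hom.∙-homo (C.e₁₃ ι) (at₂ p ι) (at₂ q ι)
    ; b-hom = walk-hom 0F 𝓣.Deg2 b₀ (λ _ _ (e₀ , e₁ , e₂) ι → Hom.cong (C.e₂₄ ι) (e₀ ι , e₁ ι , e₂ ι))
        λ p q ι → Hom.∙-homo (C.e₂₄ ι) (at₂ p ι) (at₂ q ι)
    ; xy = xy-relation
    ; yz = λ q r → walk-swap 0F (y₀ q) (z₀ r) (b₀ (q 𝓣.*¹¹ r)) λ ι → C.yz ι (at₁ q ι) (at₁ r ι)
    -- `x` and `z` have only K₁ in common, so both walks are moved to the star of type 1.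
    ; xz = λ p r → commute-resp {walk 1F (x₁ p)} {walk 2F (x₂ p)} {walk 1F (z₁ r)} {walk 0F (z₀ r)}
        (X₁≈X₂ p) (U.sym {walk 0F (z₀ r)} {walk 1F (z₁ r)} (Z₀≈Z₁ r))
        (walk-commute 1F (x₁ p) (z₁ r) λ ι → C.xz ι (at₁ p ι) (at₁ r ι))
    ; ax = λ u p → walk-commute 2F (a₂ u) (x₂ p) λ ι → C.ax ι (at₂ u ι) (at₁ p ι)
    ; ay = λ u q → commute-resp {walk 2F (a₂ u)} {walk 2F (a₂ u)} {walk 2F (y₂ q)} {walk 0F (y₀ q)}
        (U.refl {walk 2F (a₂ u)}) (U.sym {walk 0F (y₀ q)} {walk 2F (y₂ q)} (Y₀≈Y₂ q))
        (walk-commute 2F (a₂ u) (y₂ q) λ ι → C.ay ι (at₂ u ι) (at₁ q ι))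
    ; by = λ v q → walk-commute 0F (b₀ v) (y₀ q) λ ι → C.by ι (at₂ v ι) (at₁ q ι)
    ; bz = λ v r → walk-commute 0F (b₀ v) (z₀ r) λ ι → C.bz ι (at₂ v ι) (at₁ r ι)
    }
    where open Commutation uniform

  private
    module Rel = Relations relations
    module N = Central relations (λ ι → I.half ι) (λ ι → I.half+half≈1 ι)

  ends : Family → ∀ ι → Γ.Carrier ι
  ends u ι = F.end {ι} (path u ι)

  opaque
    unfolding walk
    ends-walk : ∀ i k ι → ends (walk i k) ι ≡ proj₁ k ι
    ends-walk i k ι = ≡.refl

  module _ (ι : Index) where
    open Γ ι
    open C ι
    open Commutation group using (commutator; commutator-cong; swap-commutator)
    private
      module T = Truncated (I.R ι)
      module R = CommutativeRing (I.R ι)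

    ends-commutator : ∀ p v → ends (Commutation.commutator uniform (Rel.x p) (Rel.b v)) ι ≈ c (at₁ p ι T.*¹² at₂ v ι)
    ends-commutator p v = trans
      (commutator-cong (reflexive (ends-walk 2F (x₂ p) ι)) (reflexive (ends-walk 0F (b₀ v) ι)))
      (sym (swap-commutator (xb (at₁ p ι) (at₂ v ι))))

    -- The path was built from commutators of walks; `xb` evaluates each of them in the group and
    -- `split³` adds up the results.
    ends-c : ∀ s → ends (N.c s) ι ≈ c (at₃ s ι)
    ends-c s@(s₀ , s₁ , s₂ , s₃) = trans
      (∙-cong (ends-commutator N.t⁰ (N.low s)) (ends-commutator N.t¹ (N.top s)))
      (trans (sym (Hom.∙-homo e₁₄ _ _)) (Hom.cong e₁₄ (T.split³ _ _ _ _)))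

    opaque
     unfolding Central.nf
     ends-nf : ∀ p q r u v s → ends (N.nf (p , q , r , u , v , s)) ι ≈
               fromCoord (at₁ p ι , at₁ q ι , at₁ r ι , at₂ u ι , at₂ v ι , at₃ s ι)
     ends-nf p q r u v s =
       ∙-cong (reflexive (ends-walk 0F (z₀ r) ι)) (∙-cong (reflexive (ends-walk 0F (b₀ v) ι))
         (∙-cong (reflexive (ends-walk 0F (y₀ q) ι)) (∙-cong (ends-c s)
           (∙-cong (reflexive (ends-walk 2F (a₂ u) ι)) (reflexive (ends-walk 2F (x₂ p) ι))))))

  Chosen : Set₁
  Chosen = ∀ ι → Truncated.Coordinates (I.R ι)

  collect : Chosen → 𝓣.Coordinates
  collect t = (c₁ , c₂) , (c₃ , c₄) , (c₅ , c₆) , (c₇ , c₈ , c₉) , (d₁ , d₂ , d₃) , (d₄ , d₅ , d₆ , d₇)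
    where
    c₁ = λ ι → let ((x , _) , _) = t ι in x
    c₂ = λ ι → let ((_ , x) , _) = t ι in x
    c₃ = λ ι → let (_ , (x , _) , _) = t ι in x
    c₄ = λ ι → let (_ , (_ , x) , _) = t ι in x
    c₅ = λ ι → let (_ , _ , (x , _) , _) = t ι in x
    c₆ = λ ι → let (_ , _ , (_ , x) , _) = t ι in x
    c₇ = λ ι → let (_ , _ , _ , (x , _) , _) = t ι in x
    c₈ = λ ι → let (_ , _ , _ , (_ , x , _) , _) = t ι in x
    c₉ = λ ι → let (_ , _ , _ , (_ , _ , x) , _) = t ι in x
    d₁ = λ ι → let (_ , _ , _ , _ , (x , _) , _) = t ι in x
    d₂ = λ ι → let (_ , _ , _ , _ , (_ , x , _) , _) = t ι in x
    d₃ = λ ι → let (_ , _ , _ , _ , (_ , _ , x) , _) = t ι in x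
    d₄ = λ ι → let (_ , _ , _ , _ , _ , (x , _)) = t ι in x
    d₅ = λ ι → let (_ , _ , _ , _ , _ , (_ , x , _)) = t ι in x
    d₆ = λ ι → let (_ , _ , _ , _ , _ , (_ , _ , x , _)) = t ι in x
    d₇ = λ ι → let (_ , _ , _ , _ , _ , (_ , _ , _ , x)) = t ι in x

  collect-cong : ∀ t t′ → (∀ ι → Truncated._≈ᵤ_ (I.R ι) (t ι) (t′ ι)) → collect t 𝓣.≈ᵤ collect t′
  collect-cong t t′ e =
     ((λ ι → let ((x , _) , _) = e ι in x) ,
      (λ ι → let ((_ , x) , _) = e ι in x)) ,
     ((λ ι → let (_ , (x , _) , _) = e ι in x) ,
      (λ ι → let (_ , (_ , x) , _) = e ι in x)) ,
     ((λ ι → let (_ , _ , (x , _) , _) = e ι in x) ,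
      (λ ι → let (_ , _ , (_ , x) , _) = e ι in x)) ,
     ((λ ι → let (_ , _ , _ , (x , _) , _) = e ι in x) ,
      (λ ι → let (_ , _ , _ , (_ , x , _) , _) = e ι in x) ,
      (λ ι → let (_ , _ , _ , (_ , _ , x) , _) = e ι in x)) ,
     ((λ ι → let (_ , _ , _ , _ , (x , _) , _) = e ι in x) ,
      (λ ι → let (_ , _ , _ , _ , (_ , x , _) , _) = e ι in x) ,
      (λ ι → let (_ , _ , _ , _ , (_ , _ , x) , _) = e ι in x)) ,
     ((λ ι → let (_ , _ , _ , _ , _ , (x , _)) = e ι in x) ,
      (λ ι → let (_ , _ , _ , _ , _ , (_ , x , _)) = e ι in x) ,
      (λ ι → let (_ , _ , _ , _ , _ , (_ , _ , x , _)) = e ι in x) ,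
      (λ ι → let (_ , _ , _ , _ , _ , (_ , _ , _ , x)) = e ι in x))

  members : ∀ i → Moves i
  members i = (λ ι → I.move ι i) , (λ ι → I.target∈ ι i)

  before after : Fin 3 → Chosen
  before _ ι = C.coord ι (I.flag ι)
  after i ι = C.coord ι (I.target ι i)

  step-coord : Fin 3 → Chosen
  step-coord i ι = C.coord ι (I.move ι i)

  private
    open SetoidReasoning U.setoid

    module Parts (i : Fin 3) where
      t = collect (step-coord i)
      p q r : 𝓣.Poly1
      p = let (p , _) = t in p
      q = let (_ , q , _) = t in q
      r = let (_ , _ , r , _) = t in r
      u v : 𝓣.Poly2
      u = let (_ , _ , _ , u , _) = t in u
      v = let (_ , _ , _ , _ , v , _) = t in v

  collect-InK : ∀ i → 𝓣.InK i (collect (step-coord i))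
  collect-InK 0F =
    ((λ ι → let ((x , _) , _) = e ι in x) , (λ ι → let ((_ , x) , _) = e ι in x)) ,
    ((λ ι → let (_ , (x , _) , _) = e ι in x) , (λ ι → let (_ , (_ , x , _) , _) = e ι in x) ,
     (λ ι → let (_ , (_ , _ , x) , _) = e ι in x)) ,
    ((λ ι → let (_ , _ , (x , _)) = e ι in x) , (λ ι → let (_ , _ , (_ , x , _)) = e ι in x) ,
     (λ ι → let (_ , _ , (_ , _ , x , _)) = e ι in x) , (λ ι → let (_ , _ , (_ , _ , _ , x)) = e ι in x))
    where
    e : ∀ ι → Truncated.InK (I.R ι) 0F (step-coord 0F ι)
    e ι = C.coord-InK ι 0F (I.target∈ ι 0F)
  collect-InK 1F =
    ((λ ι → let ((x , _) , _) = e ι in x) , (λ ι → let ((_ , x) , _) = e ι in x)) ,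
    ((λ ι → let (_ , (x , _) , _) = e ι in x) , (λ ι → let (_ , (_ , x , _) , _) = e ι in x) ,
     (λ ι → let (_ , (_ , _ , x) , _) = e ι in x)) ,
    ((λ ι → let (_ , _ , (x , _) , _) = e ι in x) , (λ ι → let (_ , _ , (_ , x , _) , _) = e ι in x) ,
     (λ ι → let (_ , _ , (_ , _ , x) , _) = e ι in x)) ,
    ((λ ι → let (_ , _ , _ , (x , _)) = e ι in x) , (λ ι → let (_ , _ , _ , (_ , x , _)) = e ι in x) ,
     (λ ι → let (_ , _ , _ , (_ , _ , x , _)) = e ι in x) , (λ ι → let (_ , _ , _ , (_ , _ , _ , x)) = e ι in x))
    where
    e : ∀ ι → Truncated.InK (I.R ι) 1F (step-coord 1F ι)
    e ι = C.coord-InK ι 1F (I.target∈ ι 1F)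
  collect-InK 2F =
    ((λ ι → let ((x , _) , _) = e ι in x) , (λ ι → let ((_ , x) , _) = e ι in x)) ,
    ((λ ι → let (_ , (x , _) , _) = e ι in x) , (λ ι → let (_ , (_ , x , _) , _) = e ι in x) ,
     (λ ι → let (_ , (_ , _ , x) , _) = e ι in x)) ,
    ((λ ι → let (_ , _ , (x , _)) = e ι in x) , (λ ι → let (_ , _ , (_ , x , _)) = e ι in x) ,
     (λ ι → let (_ , _ , (_ , _ , x , _)) = e ι in x) , (λ ι → let (_ , _ , (_ , _ , _ , x)) = e ι in x))
    where
    e : ∀ ι → Truncated.InK (I.R ι) 2F (step-coord 2F ι)
    e ι = C.coord-InK ι 2F (I.target∈ ι 2F)

  -- An element of K_i factors into generators inside K_i, so the step splits into walks in the same
  -- star. Gluing then moves each of them to the star that represents its generator.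
  walk-nf : ∀ i → walk i (members i) U.≈ N.nf (collect (step-coord i))
  walk-nf 0F = begin
    walk 0F (members 0F)
      ≈⟨ walk-cong 0F (members 0F) (z₀ r ∙ᵐ (b₀ v ∙ᵐ y₀ q)) (λ ι → ChartFacts.factor₀ (I.chart ι) (I.target∈ ι 0F)) ⟩
    walk 0F (z₀ r ∙ᵐ (b₀ v ∙ᵐ y₀ q))
      ≈⟨ walk-∙ 0F (z₀ r) (b₀ v ∙ᵐ y₀ q) ⟩
    Rel.z r U.∙ walk 0F (b₀ v ∙ᵐ y₀ q)
      ≈⟨ U.∙-congˡ {Rel.z r} (walk-∙ 0F (b₀ v) (y₀ q)) ⟩
    Rel.z r U.∙ (Rel.b v U.∙ Rel.y q)
      ≈⟨ N.nf-K₀ {t} (collect-InK 0F) ⟨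
    N.nf t ∎
    where open Parts 0F
  walk-nf 1F = begin
    walk 1F (members 1F)
      ≈⟨ walk-cong 1F (members 1F) (z₁ r ∙ᵐ x₁ p) (λ ι → ChartFacts.factor₁ (I.chart ι) (I.target∈ ι 1F)) ⟩
    walk 1F (z₁ r ∙ᵐ x₁ p)
      ≈⟨ walk-∙ 1F (z₁ r) (x₁ p) ⟩
    walk 1F (z₁ r) U.∙ walk 1F (x₁ p)
      ≈⟨ U.∙-cong {walk 1F (z₁ r)} {Rel.z r} {walk 1F (x₁ p)} {Rel.x p}
           (U.sym {Rel.z r} {walk 1F (z₁ r)} (Z₀≈Z₁ r)) (X₁≈X₂ p) ⟩
    Rel.z r U.∙ Rel.x p
      ≈⟨ N.nf-K₁ {t} (collect-InK 1F) ⟨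
    N.nf t ∎
    where open Parts 1F
  walk-nf 2F = begin
    walk 2F (members 2F)
      ≈⟨ walk-cong 2F (members 2F) (y₂ q ∙ᵐ (a₂ u ∙ᵐ x₂ p)) (λ ι → ChartFacts.factor₂ (I.chart ι) (I.target∈ ι 2F)) ⟩
    walk 2F (y₂ q ∙ᵐ (a₂ u ∙ᵐ x₂ p))
      ≈⟨ walk-∙ 2F (y₂ q) (a₂ u ∙ᵐ x₂ p) ⟩
    walk 2F (y₂ q) U.∙ walk 2F (a₂ u ∙ᵐ x₂ p)
      ≈⟨ U.∙-cong {walk 2F (y₂ q)} {Rel.y q} {walk 2F (a₂ u ∙ᵐ x₂ p)} {Rel.a u U.∙ Rel.x p}
           (U.sym {Rel.y q} {walk 2F (y₂ q)} (Y₀≈Y₂ q)) (walk-∙ 2F (a₂ u) (x₂ p)) ⟩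
    Rel.y q U.∙ (Rel.a u U.∙ Rel.x p)
      ≈⟨ N.nf-K₂ {t} (collect-InK 2F) ⟨
    N.nf t ∎
    where open Parts 2F

  after-≈ : ∀ i ι → Truncated._≈ᵤ_ (I.R ι) (after i ι) (Truncated._*ᵤ_ (I.R ι) (before i ι) (step-coord i ι))
  after-≈ i ι = ≈ᵤ-trans (coord-cong (sym (trans (sym (assoc _ _ _)) (trans (∙-congʳ (inverseʳ _)) (identityˡ _)))))
    (coord-* (I.flag ι) (I.move ι i))
    where
    open Γ ι
    open C ι
    open Truncated (I.R ι)
    ≈ᵤ-trans : ∀ {t t′ t″} → t ≈ᵤ t′ → t′ ≈ᵤ t″ → t ≈ᵤ t″
    ≈ᵤ-trans (e₁ , e₂ , e₃ , e₄ , e₅ , e₆) (f₁ , f₂ , f₃ , f₄ , f₅ , f₆) =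
      Group.trans Deg1 e₁ f₁ , Group.trans Deg1 e₂ f₂ , Group.trans Deg1 e₃ f₃ ,
      Group.trans Deg2 e₄ f₄ , Group.trans Deg2 e₅ f₅ , Group.trans Deg3 e₆ f₆

  -- The fillings of the cone, simultaneously for all fields, flags and steps of type `i`. The bound
  -- contained in this equality is a single natural number.
  nf-step : ∀ i → N.nf (collect (before i)) U.∙ walk i (members i) U.≈ N.nf (collect (after i))
  nf-step i = begin
    N.nf (collect (before i)) U.∙ walk i (members i)
      ≈⟨ U.∙-congˡ {N.nf (collect (before i))} (walk-nf i) ⟩
    N.nf (collect (before i)) U.∙ N.nf (collect (step-coord i))
      ≈⟨ N.nf-homo (collect (before i)) (collect (step-coord i)) ⟩
    N.nf (collect (before i) 𝓣.*ᵤ collect (step-coord i))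
      ≈⟨ N.nf-cong {collect (after i)} {collect (before i) 𝓣.*ᵤ collect (step-coord i)}
           (collect-cong (after i) (λ ι → Truncated._*ᵤ_ (I.R ι) (before i ι) (step-coord i ι))
             (after-≈ i)) ⟨
    N.nf (collect (after i)) ∎

  -- Trivial steps in all three stars; this suffices for reading off the path to `h`.
  index : (Q : ChartedGroup) → FiniteGroup.Carrier (ChartedGroup.G Q) → Index
  index Q h = record
    { charted = Q ; flag = h ; target = λ _ → h
    ; target∈ = λ i → DecSubgroup.resp (ChartedGroup.K Q i) (FiniteGroup.sym (ChartedGroup.G Q)
        (FiniteGroup.inverseˡ (ChartedGroup.G Q) h)) (DecSubgroup.ε-mem (ChartedGroup.K Q i)) }

  module _ (Q : ChartedGroup) where
    open ChartedGroup Q using (G; K)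
    open Flags G K using (Path)

    path-to : FiniteGroup.Carrier G → Path
    path-to h = path (N.nf (collect (before 0F))) (index Q h)

  opaque
    unfolding walk Central.nf
    -- At an index the normal form is computed from the coordinates at this index alone. So the path
    -- found at the end of a step is the chosen cone path to the target, however the target was
    -- reached.
    path-after : ∀ i ι → path (N.nf (collect (after i))) ι ≡ path-to (I.charted ι) (I.target ι i)
    path-after i ι = ≡.refl

    path-start : ∀ i ι → path (N.nf (collect (before i))) ι ≡ path-to (I.charted ι) (I.flag ι)
    path-start i ι = ≡.refl

    path-walk : ∀ i ι → path (walk i (members i)) ι ≡ F.step ι i (I.move ι i)
    path-walk i ι = ≡.refl

  private
    cone : Family
    cone = N.nf (collect (before 0F))

    area : Fin 3 → ℕ
    area i = _≃_.bound (nf-step i)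

  -- A common upper bound of the three areas and of the length of the cone paths.
  bound-n : ℕ
  bound-n = area 0F ℕ.+ area 1F ℕ.+ area 2F ℕ.+ diameter cone

  area≤n : ∀ i → area i ℕ.≤ bound-n
  area≤n 0F = ℕ.≤-trans (ℕ.m≤m+n _ (area 1F)) (ℕ.≤-trans (ℕ.m≤m+n _ (area 2F)) (ℕ.m≤m+n _ _))
  area≤n 1F = ℕ.≤-trans (ℕ.m≤n+m _ (area 0F)) (ℕ.≤-trans (ℕ.m≤m+n _ (area 2F)) (ℕ.m≤m+n _ _))
  area≤n 2F = ℕ.≤-trans (ℕ.m≤n+m _ (area 0F ℕ.+ area 1F)) (ℕ.m≤m+n _ _)

  module _ (Q : ChartedGroup) where
    open ChartedGroup Q
    open Flags G K using (Homotopic; Contractible; _∙ₚ_; step; module E; module V)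
    open FiniteGroup G using (Carrier; _∙_; _⁻¹; ε; trans; sym)
    open DecSubgroup using (Member; ε-mem)

    filling : ∀ i h h′ → Member (K i) (h ⁻¹ ∙ h′) →
              Homotopic bound-n (path-to Q h ∙ₚ step i (h ⁻¹ ∙ h′)) (path-to Q h′)
    filling i h h′ h′∈ = record { ends = Homotopic.ends H ; area = E.covered-≤ (area≤n i) (Homotopic.area H) }
      where
      -- An index has a target in every star: `h′` for the type of the given step, and `h` itself
      -- for the other two.
      only : ∀ j → Σ[ l ∈ Carrier ] Member (K j) (h ⁻¹ ∙ l)
      only j with j Fin.≟ i
      ... | yes ≡.refl = h′ , h′∈
      ... | no  _      = h , Index.target∈ (index Q h) j

      only-i : proj₁ (only i) ≡ h′
      only-i with i Fin.≟ i
      ... | yes ≡.refl = ≡.refl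
      ... | no  i≢i    = contradiction ≡.refl i≢i

      ι : Index
      ι = record { charted = Q ; flag = h ; target = λ j → proj₁ (only j) ; target∈ = λ j → proj₂ (only j) }

      H : Homotopic (area i) (path-to Q h ∙ₚ step i (h ⁻¹ ∙ h′)) (path-to Q h′)
      H = ≡.subst (λ k → Homotopic (area i) (path-to Q h ∙ₚ step i (h ⁻¹ ∙ k)) (path-to Q k)) only-i
        (≡.subst₂ (Homotopic (area i)) (≡.cong₂ _∙ₚ_ (path-start i ι) (path-walk i ι)) (path-after i ι)
          (_≃_.homotopy (nf-step i) ι))

    contraction : Contractible bound-n
    contraction = record
      { path    = path-to Q
      ; path-to = λ h → trans (ends-nf (index Q h) _ _ _ _ _ _) (sym (Chart.from-coord chart h))
      ; short   = λ h → V.covered-≤ (ℕ.m≤n+m _ _) (Family.short cone (index Q h))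
      ; filling = filling }

-- The link group in coordinates

module LinkChart where
  open import Algebra.Bundles using (CommutativeRing; Group)
  import Algebra.Properties.Group as GroupProperties
  import Algebra.Solver.Ring.NaturalCoefficients.Default as SemiringSolver
  open import Data.Fin using (#_)
  open import Data.Fin.Base using (Fin; suc; zero)
  open import Data.Fin.Patterns using (0F; 1F; 2F; 3F)
  open import Data.List.Base using ([]; _∷_)
  open import Data.Nat.Base as ℕ using (suc; zero; ℕ)
  open import Data.Product.Base using (_,_; _×_; ∃-syntax)
  open import Data.Unit.Base using (tt; ⊤)
  open import Data.Vec.Base as Vec using (Vec; []; _∷_)
  import Data.Vec.Functional as Vector
  open import Defs
  open import Level using (0ℓ)
  open import Relation.Binary.PropositionalEquality as ≡ using (_≡_; _≢_)
  open import Relation.Nullary.Negation using (contradiction)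
  open import Relation.Unary using (Pred; U)
  open CommutatorRelations
  open FlagPaths
  open UniformFilling using (Chart)

  Entries : ∀ {a} → Set a → Set a
  Entries A = A × A × A × A × A × A

  upper : ∀ {a} {A : Set a} → A → A → Entries A → Fin 4 → Fin 4 → A
  upper o l (p , q , r , u , v , s) 0F 0F = l
  upper o l (p , q , r , u , v , s) 0F 1F = p
  upper o l (p , q , r , u , v , s) 0F 2F = u
  upper o l (p , q , r , u , v , s) 0F 3F = s
  upper o l (p , q , r , u , v , s) 1F 0F = o
  upper o l (p , q , r , u , v , s) 1F 1F = l
  upper o l (p , q , r , u , v , s) 1F 2F = q
  upper o l (p , q , r , u , v , s) 1F 3F = v
  upper o l (p , q , r , u , v , s) 2F 0F = o
  upper o l (p , q , r , u , v , s) 2F 1F = o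
  upper o l (p , q , r , u , v , s) 2F 2F = l
  upper o l (p , q , r , u , v , s) 2F 3F = r
  upper o l (p , q , r , u , v , s) 3F 0F = o
  upper o l (p , q , r , u , v , s) 3F 1F = o
  upper o l (p , q , r , u , v , s) 3F 2F = o
  upper o l (p , q , r , u , v , s) 3F 3F = l

  all₄ : ∀ {p} {P : Fin 4 → Set p} → P 0F → P 1F → P 2F → P 3F → ∀ i → P i
  all₄ a b c d = λ where
    0F → a
    1F → b
    2F → c
    3F → d

  module Unitriangular (S : CommutativeRing 0ℓ 0ℓ) where
    open CommutativeRing S hiding (zero)
    open Matrices S 4 renaming (mk≈ to mk≈ₘ)
    private module P = SemiringSolver commutativeSemiring

    unitriangular : Entries Carrier → Matrix
    unitriangular = upper 0# 1#

    infixl 7 _*ₑ_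
    _*ₑ_ : Entries Carrier → Entries Carrier → Entries Carrier
    (p , q , r , u , v , s) *ₑ (p′ , q′ , r′ , u′ , v′ , s′) =
      p + p′ , q + q′ , r + r′ , u + p * q′ + u′ , v + q * r′ + v′ , s + u * r′ + p * v′ + s′

    infix 4 _≈ₑ_
    _≈ₑ_ : Entries Carrier → Entries Carrier → Set
    (p , q , r , u , v , s) ≈ₑ (p′ , q′ , r′ , u′ , v′ , s′) =
      p ≈ p′ × q ≈ q′ × r ≈ r′ × u ≈ u′ × v ≈ v′ × s ≈ s′

    unitriangular-cong : ∀ {t t′} → t ≈ₑ t′ → unitriangular t ≈ₘ unitriangular t′
    unitriangular-cong (e₁ , e₂ , e₃ , e₄ , e₅ , e₆) = mk≈ₘ (all₄
      (all₄ refl e₁ e₄ e₆) (all₄ refl refl e₂ e₅) (all₄ refl refl refl e₃) (all₄ refl refl refl refl))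

    unitriangular-* : ∀ t t′ → unitriangular t *ₘ unitriangular t′ ≈ₘ unitriangular (t *ₑ t′)
    unitriangular-* (p , q , r , u , v , s) (p′ , q′ , r′ , u′ , v′ , s′) = mk≈ₘ (all₄
      (all₄ (cell 0F 0F refl) (cell 0F 1F refl) (cell 0F 2F refl) (cell 0F 3F refl))
      (all₄ (cell 1F 0F refl) (cell 1F 1F refl) (cell 1F 2F refl) (cell 1F 3F refl))
      (all₄ (cell 2F 0F refl) (cell 2F 1F refl) (cell 2F 2F refl) (cell 2F 3F refl))
      (all₄ (cell 3F 0F refl) (cell 3F 1F refl) (cell 3F 2F refl) (cell 3F 3F refl)))
      where
      ρ : Vec Carrier 12
      ρ = p ∷ q ∷ r ∷ u ∷ v ∷ s ∷ p′ ∷ q′ ∷ r′ ∷ u′ ∷ v′ ∷ s′ ∷ []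

      x : Fin 12 → P.Polynomial 12
      x = P.var

      A B C : Fin 4 → Fin 4 → P.Polynomial 12
      A = upper (P.con 0) (P.con 1) (x (# 0) , x (# 1) , x (# 2) , x (# 3) , x (# 4) , x (# 5))
      B = upper (P.con 0) (P.con 1) (x (# 6) , x (# 7) , x (# 8) , x (# 9) , x (# 10) , x (# 11))
      C = upper (P.con 0) (P.con 1)
        ( A 0F 1F P.:+ B 0F 1F , A 1F 2F P.:+ B 1F 2F , A 2F 3F P.:+ B 2F 3F
        , A 0F 2F P.:+ A 0F 1F P.:* B 1F 2F P.:+ B 0F 2F
        , A 1F 3F P.:+ A 1F 2F P.:* B 2F 3F P.:+ B 1F 3F
        , A 0F 3F P.:+ A 0F 2F P.:* B 2F 3F P.:+ A 0F 1F P.:* B 1F 3F P.:+ B 0F 3F)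

      -- Folded in the same way as the sum in `*ₘ`, so that its evaluation is the matrix entry on
      -- the nose.
      AB : Fin 4 → Fin 4 → P.Polynomial 12
      AB i j = Vector.foldr P._:+_ (P.con 0) {4} (λ k → A i k P.:* B k j)

      cell : ∀ i j → P.⟦ AB i j ⟧↓ ρ ≈ P.⟦ C i j ⟧↓ ρ → P.⟦ AB i j ⟧ ρ ≈ P.⟦ C i j ⟧ ρ
      cell i j = P.prove ρ (AB i j) (C i j)

    -- Back substitution: in each entry of `t *ₑ t′` the entry of `t′` at the same place is the last
    -- summand, so it can be solved for once the other summands are known. Every equation of
    -- `inverseₑ` then has the form x - x = 0.
    -ₑ_ : Entries Carrier → Entries Carrier
    -ₑ (p , q , r , u , v , s) = - p , - q , - r , - (u + p * - q) , v′ , - (s + u * - r + p * v′)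
      where v′ = - (v + q * - r)

    0ₑ : Entries Carrier
    0ₑ = 0# , 0# , 0# , 0# , 0# , 0#

    unitriangular-1 : unitriangular 0ₑ ≈ₘ 1ₘ
    unitriangular-1 = mk≈ₘ (all₄
      (all₄ refl refl refl refl) (all₄ refl refl refl refl)
      (all₄ refl refl refl refl) (all₄ refl refl refl refl))

    inverseₑ : ∀ t → unitriangular t *ₘ unitriangular (-ₑ t) ≈ₘ 1ₘ
    inverseₑ t@(p , q , r , u , v , s) = ≈ₘ.trans (unitriangular-* t (-ₑ t)) (≈ₘ.trans
      (unitriangular-cong (-‿inverseʳ _ , -‿inverseʳ _ , -‿inverseʳ _ , -‿inverseʳ _ , -‿inverseʳ _ , -‿inverseʳ _))
      unitriangular-1)

    *ₘ-congˡ : ∀ M {N N′} → N ≈ₘ N′ → M *ₘ N ≈ₘ M *ₘ N′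
    *ₘ-congˡ M = ≈ₘ.∙-congˡ {M}

    invertible : Entries Carrier → InvertibleMatrix
    invertible t = record
      { matrix   = X
      ; inverse  = Y
      ; inverseʳ = inverseₑ t
      -- `Y` has the right inverse `Z`, hence YX = (YX)(YZ) = Y(XY)Z = YZ = 1.
      ; inverseˡ = ≈ₘ.trans (≈ₘ.sym (≈ₘ.identityʳ (Y *ₘ X))) (≈ₘ.trans
          (*ₘ-congˡ (Y *ₘ X) (≈ₘ.sym (inverseₑ (-ₑ t)))) (cancel X Y {Y} {Z} (inverseₑ t) (inverseₑ (-ₑ t)))) }
      where
      X = unitriangular t
      Y = unitriangular (-ₑ t)
      Z = unitriangular (-ₑ (-ₑ t))

    open Group GL using () renaming (_≈_ to _≈ᴳ_; _∙_ to _∙ᴳ_; refl to reflᴳ; sym to symᴳ; trans to transᴳ;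
      ∙-congˡ to ∙-congᴳˡ)
    open Commutation GL using () renaming (Commute to Commuteᴳ)

    X Y Z A B C : Carrier → InvertibleMatrix
    X p = invertible (p , 0# , 0# , 0# , 0# , 0#)
    Y q = invertible (0# , q , 0# , 0# , 0# , 0#)
    Z r = invertible (0# , 0# , r , 0# , 0# , 0#)
    A u = invertible (0# , 0# , 0# , u , 0# , 0#)
    B v = invertible (0# , 0# , 0# , 0# , v , 0#)
    C s = invertible (0# , 0# , 0# , 0# , 0# , s)

    private
      Expr : ℕ → Set
      Expr n = Entries (P.Polynomial n)

      module _ {n : ℕ} where
        o : P.Polynomial n
        o = P.con 0

        xₑ yₑ zₑ aₑ bₑ cₑ : P.Polynomial n → Expr n
        xₑ p = p , o , o , o , o , o
        yₑ q = o , q , o , o , o , o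
        zₑ r = o , o , r , o , o , o
        aₑ u = o , o , o , u , o , o
        bₑ v = o , o , o , o , v , o
        cₑ s = o , o , o , o , o , s

        infixl 7 _⊛_
        _⊛_ : Expr n → Expr n → Expr n
        (p , q , r , u , v , s) ⊛ (p′ , q′ , r′ , u′ , v′ , s′) =
          p P.:+ p′ , q P.:+ q′ , r P.:+ r′ , u P.:+ p P.:* q′ P.:+ u′ , v P.:+ q P.:* r′ P.:+ v′ ,
          s P.:+ u P.:* r′ P.:+ p P.:* v′ P.:+ s′

        ⟦_⟧ₑ ⟦_⟧ₑ↓ : Expr n → Vec Carrier n → Entries Carrier
        ⟦ p , q , r , u , v , s ⟧ₑ ρ =
          P.⟦ p ⟧ ρ , P.⟦ q ⟧ ρ , P.⟦ r ⟧ ρ , P.⟦ u ⟧ ρ , P.⟦ v ⟧ ρ , P.⟦ s ⟧ ρ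
        ⟦ p , q , r , u , v , s ⟧ₑ↓ ρ =
          P.⟦ p ⟧↓ ρ , P.⟦ q ⟧↓ ρ , P.⟦ r ⟧↓ ρ , P.⟦ u ⟧↓ ρ , P.⟦ v ⟧↓ ρ , P.⟦ s ⟧↓ ρ

        proveₑ : ∀ ρ (e f : Expr n) → ⟦ e ⟧ₑ↓ ρ ≈ₑ ⟦ f ⟧ₑ↓ ρ → invertible (⟦ e ⟧ₑ ρ) ≈ᴳ invertible (⟦ f ⟧ₑ ρ)
        proveₑ ρ (e₁ , e₂ , e₃ , e₄ , e₅ , e₆) (f₁ , f₂ , f₃ , f₄ , f₅ , f₆) (h₁ , h₂ , h₃ , h₄ , h₅ , h₆) =
          unitriangular-cong (P.prove ρ e₁ f₁ h₁ , P.prove ρ e₂ f₂ h₂ , P.prove ρ e₃ f₃ h₃ ,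
            P.prove ρ e₄ f₄ h₄ , P.prove ρ e₅ f₅ h₅ , P.prove ρ e₆ f₆ h₆)

      refls : ∀ {t} → t ≈ₑ t
      refls = refl , refl , refl , refl , refl , refl

    private
      v₀ : ∀ {n} → P.Polynomial (suc n)
      v₀ = P.var 0F

      v₁ : ∀ {n} → P.Polynomial (suc (suc n))
      v₁ = P.var 1F

    swap-product : ∀ t t′ t″ → invertible (t *ₑ t′) ≈ᴳ invertible (t″ *ₑ (t′ *ₑ t)) →
                   invertible t ∙ᴳ invertible t′ ≈ᴳ invertible t″ ∙ᴳ (invertible t′ ∙ᴳ invertible t)
    swap-product t t′ t″ e = ≈ₘ.trans (unitriangular-* t t′) (≈ₘ.trans e (≈ₘ.sym
      (≈ₘ.trans (*ₘ-congˡ (unitriangular t″) (unitriangular-* t′ t)) (unitriangular-* t″ (t′ *ₑ t)))))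

    commute-product : ∀ t t′ → invertible (t *ₑ t′) ≈ᴳ invertible (t′ *ₑ t) → Commuteᴳ (invertible t) (invertible t′)
    commute-product t t′ e = ≈ₘ.trans (unitriangular-* t t′) (≈ₘ.trans e (≈ₘ.sym (unitriangular-* t′ t)))

    XY : ∀ p q → X p ∙ᴳ Y q ≈ᴳ A (p * q) ∙ᴳ (Y q ∙ᴳ X p)
    XY p q = swap-product _ _ _ (proveₑ (p ∷ q ∷ []) (xₑ v₀ ⊛ yₑ v₁) (aₑ (v₀ P.:* v₁) ⊛ (yₑ v₁ ⊛ xₑ v₀)) refls)

    YZ : ∀ q r → Y q ∙ᴳ Z r ≈ᴳ B (q * r) ∙ᴳ (Z r ∙ᴳ Y q)
    YZ q r = swap-product _ _ _ (proveₑ (q ∷ r ∷ []) (yₑ v₀ ⊛ zₑ v₁) (bₑ (v₀ P.:* v₁) ⊛ (zₑ v₁ ⊛ yₑ v₀)) refls)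

    XB : ∀ p v → X p ∙ᴳ B v ≈ᴳ C (p * v) ∙ᴳ (B v ∙ᴳ X p)
    XB p v = swap-product _ _ _ (proveₑ (p ∷ v ∷ []) (xₑ v₀ ⊛ bₑ v₁) (cₑ (v₀ P.:* v₁) ⊛ (bₑ v₁ ⊛ xₑ v₀)) refls)

    XZ : ∀ p r → Commuteᴳ (X p) (Z r)
    XZ p r = commute-product _ _ (proveₑ (p ∷ r ∷ []) (xₑ v₀ ⊛ zₑ v₁) (zₑ v₁ ⊛ xₑ v₀) refls)

    AX : ∀ u p → Commuteᴳ (A u) (X p)
    AX u p = commute-product _ _ (proveₑ (u ∷ p ∷ []) (aₑ v₀ ⊛ xₑ v₁) (xₑ v₁ ⊛ aₑ v₀) refls)

    AY : ∀ u q → Commuteᴳ (A u) (Y q)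
    AY u q = commute-product _ _ (proveₑ (u ∷ q ∷ []) (aₑ v₀ ⊛ yₑ v₁) (yₑ v₁ ⊛ aₑ v₀) refls)

    BY : ∀ v q → Commuteᴳ (B v) (Y q)
    BY v q = commute-product _ _ (proveₑ (v ∷ q ∷ []) (bₑ v₀ ⊛ yₑ v₁) (yₑ v₁ ⊛ bₑ v₀) refls)

    BZ : ∀ v r → Commuteᴳ (B v) (Z r)
    BZ v r = commute-product _ _ (proveₑ (v ∷ r ∷ []) (bₑ v₀ ⊛ zₑ v₁) (zₑ v₁ ⊛ bₑ v₀) refls)

    X-+ : ∀ s t → X (s + t) ≈ᴳ X s ∙ᴳ X t
    X-+ s t = ≈ₘ.sym (≈ₘ.trans (unitriangular-* _ _) (proveₑ (s ∷ t ∷ []) (xₑ v₀ ⊛ xₑ v₁) (xₑ (v₀ P.:+ v₁)) refls))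

    Y-+ : ∀ s t → Y (s + t) ≈ᴳ Y s ∙ᴳ Y t
    Y-+ s t = ≈ₘ.sym (≈ₘ.trans (unitriangular-* _ _) (proveₑ (s ∷ t ∷ []) (yₑ v₀ ⊛ yₑ v₁) (yₑ (v₀ P.:+ v₁)) refls))

    Z-+ : ∀ s t → Z (s + t) ≈ᴳ Z s ∙ᴳ Z t
    Z-+ s t = ≈ₘ.sym (≈ₘ.trans (unitriangular-* _ _) (proveₑ (s ∷ t ∷ []) (zₑ v₀ ⊛ zₑ v₁) (zₑ (v₀ P.:+ v₁)) refls))

    A-+ : ∀ s t → A (s + t) ≈ᴳ A s ∙ᴳ A t
    A-+ s t = ≈ₘ.sym (≈ₘ.trans (unitriangular-* _ _) (proveₑ (s ∷ t ∷ []) (aₑ v₀ ⊛ aₑ v₁) (aₑ (v₀ P.:+ v₁)) refls))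

    B-+ : ∀ s t → B (s + t) ≈ᴳ B s ∙ᴳ B t
    B-+ s t = ≈ₘ.sym (≈ₘ.trans (unitriangular-* _ _) (proveₑ (s ∷ t ∷ []) (bₑ v₀ ⊛ bₑ v₁) (bₑ (v₀ P.:+ v₁)) refls))

    C-+ : ∀ s t → C (s + t) ≈ᴳ C s ∙ᴳ C t
    C-+ s t = ≈ₘ.sym (≈ₘ.trans (unitriangular-* _ _) (proveₑ (s ∷ t ∷ []) (cₑ v₀ ⊛ cₑ v₁) (cₑ (v₀ P.:+ v₁)) refls))

    -- A unitriangular matrix is the product of its rows, the last one first.
    rows : ∀ p q r u v s → Z r ∙ᴳ (B v ∙ᴳ (Y q ∙ᴳ (C s ∙ᴳ (A u ∙ᴳ X p)))) ≈ᴳ invertible (p , q , r , u , v , s)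
    rows p q r u v s = ≈ₘ.trans
      (times (0# , 0# , r , 0# , 0# , 0#) (times (0# , 0# , 0# , 0# , v , 0#) (times (0# , q , 0# , 0# , 0# , 0#)
        (times (0# , 0# , 0# , 0# , 0# , s)
          (unitriangular-* (0# , 0# , 0# , u , 0# , 0#) (p , 0# , 0# , 0# , 0# , 0#))))))
      (proveₑ (p ∷ q ∷ r ∷ u ∷ v ∷ s ∷ [])
        (zₑ (P.var 2F) ⊛ (bₑ (P.var (# 4)) ⊛ (yₑ v₁ ⊛ (cₑ (P.var (# 5)) ⊛ (aₑ (P.var 3F) ⊛ xₑ v₀)))))
        (v₀ , v₁ , P.var 2F , P.var 3F , P.var (# 4) , P.var (# 5)) refls)
      where
      times : ∀ t {M t′} → M ≈ₘ unitriangular t′ → unitriangular t *ₘ M ≈ₘ unitriangular (t *ₑ t′)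
      times t {t′ = t′} e = ≈ₘ.trans (*ₘ-congˡ (unitriangular t) e) (unitriangular-* t t′)

  -- Coordinates of the generated subgroups

  module LinkCoordinates {q : ℕ} (F : FiniteField q) where
    open FiniteField F using (Carrier; _≈_; 0#; 1#; _+_; _*_; -_; refl; sym; trans; commutativeRing)
    open Polynomials commutativeRing renaming (mk≈ to mk≈ₚ; at to atₚ)
    open Matrices polyRing 4 renaming (mk≈ to mk≈ₘ; at to atₘ)
    open Unitriangular polyRing
    open Truncated commutativeRing
    open Generated GL
    open Link F
    private
      module R = CommutativeRing commutativeRing
      module S = SemiringSolver R.commutativeSemiring
      open S using (con; _:+_; _:*_; _:=_)
      module Γ = Group GL
      module D1 = Group Deg1
      module D2 = Group Deg2
      module D3 = Group Deg3
    open Commutation GL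

    ⟦_⟧₁ : Poly1 → Poly
    ⟦ p₀ , p₁ ⟧₁ = p₀ ∷ p₁ ∷ []

    ⟦_⟧₂ : Poly2 → Poly
    ⟦ p₀ , p ⟧₂ = p₀ ∷ ⟦ p ⟧₁

    ⟦_⟧₃ : Poly3 → Poly
    ⟦ p₀ , p ⟧₃ = p₀ ∷ ⟦ p ⟧₂

    ⟦⟧₁-cong : ∀ {p p′} → p D1.≈ p′ → ⟦ p ⟧₁ ≈ₚ ⟦ p′ ⟧₁
    ⟦⟧₁-cong (e₀ , e₁) = ∷-cong e₀ (∷-cong e₁ reflₚ)

    ⟦⟧₂-cong : ∀ {p p′} → p D2.≈ p′ → ⟦ p ⟧₂ ≈ₚ ⟦ p′ ⟧₂
    ⟦⟧₂-cong (e₀ , e) = ∷-cong e₀ (⟦⟧₁-cong e)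

    ⟦⟧₃-cong : ∀ {p p′} → p D3.≈ p′ → ⟦ p ⟧₃ ≈ₚ ⟦ p′ ⟧₃
    ⟦⟧₃-cong (e₀ , e) = ∷-cong e₀ (⟦⟧₂-cong e)

    *¹¹-correct : ∀ p q → ⟦ p ⟧₁ *ₚ ⟦ q ⟧₁ ≈ₚ ⟦ p *¹¹ q ⟧₂
    *¹¹-correct p q = ∷-cong (R.+-identityʳ _) (∷-cong (R.+-congˡ (R.+-identityʳ _)) reflₚ)

    *¹²-correct : ∀ p v → ⟦ p ⟧₁ *ₚ ⟦ v ⟧₂ ≈ₚ ⟦ p *¹² v ⟧₃
    *¹²-correct p v = ∷-cong (R.+-identityʳ _) (∷-cong (R.+-congˡ (R.+-identityʳ _)) reflₚ)

    *²¹-correct : ∀ u r → ⟦ u ⟧₂ *ₚ ⟦ r ⟧₁ ≈ₚ ⟦ u *²¹ r ⟧₃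
    *²¹-correct u r = ∷-cong (R.+-identityʳ _)
      (∷-cong (R.+-congˡ (R.+-identityʳ _)) (∷-cong (R.+-congˡ (R.+-identityʳ _)) reflₚ))

    embed : Coordinates → Entries Poly
    embed (p , q , r , u , v , s) = ⟦ p ⟧₁ , ⟦ q ⟧₁ , ⟦ r ⟧₁ , ⟦ u ⟧₂ , ⟦ v ⟧₂ , ⟦ s ⟧₃

    embed-cong : ∀ {t t′} → t ≈ᵤ t′ → embed t ≈ₑ embed t′
    embed-cong (e₁ , e₂ , e₃ , e₄ , e₅ , e₆) =
      ⟦⟧₁-cong e₁ , ⟦⟧₁-cong e₂ , ⟦⟧₁-cong e₃ , ⟦⟧₂-cong e₄ , ⟦⟧₂-cong e₅ , ⟦⟧₃-cong e₆

    embed-* : ∀ t t′ → embed t *ₑ embed t′ ≈ₑ embed (t *ᵤ t′)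
    embed-* (p , q , r , u , v , s) (p′ , q′ , r′ , u′ , v′ , s′) =
      reflₚ , reflₚ , reflₚ ,
      +ₚ-cong (+ₚ-cong (reflₚ {⟦ u ⟧₂}) (*¹¹-correct p q′)) (reflₚ {⟦ u′ ⟧₂}) ,
      +ₚ-cong (+ₚ-cong (reflₚ {⟦ v ⟧₂}) (*¹¹-correct q r′)) (reflₚ {⟦ v′ ⟧₂}) ,
      +ₚ-cong (+ₚ-cong (+ₚ-cong (reflₚ {⟦ s ⟧₃}) (*²¹-correct u r′)) (*¹²-correct p v′)) (reflₚ {⟦ s′ ⟧₃})

    0ᵤ : Coordinates
    0ᵤ = D1.ε , D1.ε , D1.ε , D2.ε , D2.ε , D3.ε

    -ᵤ_ : Coordinates → Coordinates
    -ᵤ (p , q , r , u , v , s) =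
      p D1.⁻¹ , q D1.⁻¹ , r D1.⁻¹ , (u D2.∙ (p *¹¹ q D1.⁻¹)) D2.⁻¹ , v′ ,
      (s D3.∙ (u *²¹ r D1.⁻¹) D3.∙ (p *¹² v′)) D3.⁻¹
      where v′ = (v D2.∙ (q *¹¹ r D1.⁻¹)) D2.⁻¹

    embed-0 : embed 0ᵤ ≈ₑ 0ₑ
    embed-0 = z₁ , z₁ , z₁ , z₂ , z₂ , z₃
      where
      0∷ : ∀ {p} → p ≈ₚ 0ₚ → 0# ∷ p ≈ₚ 0ₚ
      0∷ e = transₚ (∷-cong refl e) 0∷[]≈0
      z₁ = 0∷ 0∷[]≈0
      z₂ = 0∷ z₁
      z₃ = 0∷ z₂

    embed-neg : ∀ t → -ₑ embed t ≈ₑ embed (-ᵤ t)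
    embed-neg (p , q , r , u , v , s) =
      reflₚ , reflₚ , reflₚ ,
      -ₚ-cong (+ₚ-cong (reflₚ {⟦ u ⟧₂}) (*¹¹-correct p (q D1.⁻¹))) , v-eq ,
      -ₚ-cong (+ₚ-cong (+ₚ-cong (reflₚ {⟦ s ⟧₃}) (*²¹-correct u (r D1.⁻¹)))
        (transₚ (*ₚ-congˡ ⟦ p ⟧₁ v-eq) (*¹²-correct p _)))
      where
      v-eq : -ₚ (⟦ v ⟧₂ +ₚ ⟦ q ⟧₁ *ₚ (-ₚ ⟦ r ⟧₁)) ≈ₚ ⟦ (v D2.∙ (q *¹¹ r D1.⁻¹)) D2.⁻¹ ⟧₂
      v-eq = -ₚ-cong (+ₚ-cong (reflₚ {⟦ v ⟧₂}) (*¹¹-correct q (r D1.⁻¹)))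

    gl : Coordinates → InvertibleMatrix
    gl t = invertible (embed t)

    gl-* : ∀ t t′ → gl t Γ.∙ gl t′ Γ.≈ gl (t *ᵤ t′)
    gl-* t t′ = ≈ₘ.trans (unitriangular-* (embed t) (embed t′)) (unitriangular-cong (embed-* t t′))

    gl-0 : gl 0ᵤ Γ.≈ Γ.ε
    gl-0 = ≈ₘ.trans (unitriangular-cong embed-0) unitriangular-1

    gl-neg : ∀ t → gl t Γ.⁻¹ Γ.≈ gl (-ᵤ t)
    gl-neg t = unitriangular-cong (embed-neg t)

    gl-cong : ∀ {t t′} → t ≈ᵤ t′ → gl t Γ.≈ gl t′
    gl-cong e = unitriangular-cong (embed-cong e)

    coord : Matrix → Coordinates
    coord M = c₁ 0F 1F , c₁ 1F 2F , c₁ 2F 3F , c₂ 0F 2F , c₂ 1F 3F , (c 0F 3F 0 , c 0F 3F 1 , c 0F 3F 2 , c 0F 3F 3)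
      where
      c : Fin 4 → Fin 4 → ℕ → Carrier
      c i j n = coeff (M i j) n
      c₁ : Fin 4 → Fin 4 → Poly1
      c₁ i j = c i j 0 , c i j 1
      c₂ : Fin 4 → Fin 4 → Poly2
      c₂ i j = c i j 0 , c i j 1 , c i j 2

    coord-cong : ∀ {M N} → M ≈ₘ N → coord M ≈ᵤ coord N
    coord-cong {M} {N} e = c₁ , c₁ , c₁ , c₂ , c₂ , (atₚ (atₘ e _ _) 0 , atₚ (atₘ e _ _) 1 , atₚ (atₘ e _ _) 2 , atₚ (atₘ e _ _) 3)
      where
      c₁ : ∀ {i j} → coeff (M i j) 0 ≈ coeff (N i j) 0 × coeff (M i j) 1 ≈ coeff (N i j) 1
      c₁ {i} {j} = atₚ (atₘ e i j) 0 , atₚ (atₘ e i j) 1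
      c₂ : ∀ {i j} → coeff (M i j) 0 ≈ coeff (N i j) 0 × coeff (M i j) 1 ≈ coeff (N i j) 1 × coeff (M i j) 2 ≈ coeff (N i j) 2
      c₂ {i} {j} = atₚ (atₘ e i j) 0 , atₚ (atₘ e i j) 1 , atₚ (atₘ e i j) 2

    single : Fin 3 → Poly1 → Coordinates
    single 0F p = p , D1.ε , D1.ε , D2.ε , D2.ε , D3.ε
    single 1F p = D1.ε , p , D1.ε , D2.ε , D2.ε , D3.ε
    single 2F p = D1.ε , D1.ε , p , D2.ε , D2.ε , D3.ε

    superdiagonal-X : ∀ p → superdiagonal 0F p Γ.≈ X p
    superdiagonal-X p = mk≈ₘ (all₄
      (all₄ reflₚ reflₚ reflₚ reflₚ) (all₄ reflₚ reflₚ reflₚ reflₚ)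
      (all₄ reflₚ reflₚ reflₚ reflₚ) (all₄ reflₚ reflₚ reflₚ reflₚ))

    superdiagonal-Y : ∀ p → superdiagonal 1F p Γ.≈ Y p
    superdiagonal-Y p = mk≈ₘ (all₄
      (all₄ reflₚ reflₚ reflₚ reflₚ) (all₄ reflₚ reflₚ reflₚ reflₚ)
      (all₄ reflₚ reflₚ reflₚ reflₚ) (all₄ reflₚ reflₚ reflₚ reflₚ))

    superdiagonal-Z : ∀ p → superdiagonal 2F p Γ.≈ Z p
    superdiagonal-Z p = mk≈ₘ (all₄
      (all₄ reflₚ reflₚ reflₚ reflₚ) (all₄ reflₚ reflₚ reflₚ reflₚ)
      (all₄ reflₚ reflₚ reflₚ reflₚ) (all₄ reflₚ reflₚ reflₚ reflₚ))

    superdiagonal-single : ∀ j p → superdiagonal j ⟦ p ⟧₁ Γ.≈ gl (single j p)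
    superdiagonal-single j p with embed-0
    superdiagonal-single 0F p | z₁ , z₂ , z₃ , z₄ , z₅ , z₆ = ≈ₘ.trans (superdiagonal-X ⟦ p ⟧₁)
      (unitriangular-cong (reflₚ , symₚ z₂ , symₚ z₃ , symₚ z₄ , symₚ z₅ , symₚ z₆))
    superdiagonal-single 1F p | z₁ , z₂ , z₃ , z₄ , z₅ , z₆ = ≈ₘ.trans (superdiagonal-Y ⟦ p ⟧₁)
      (unitriangular-cong (symₚ z₁ , reflₚ , symₚ z₃ , symₚ z₄ , symₚ z₅ , symₚ z₆))
    superdiagonal-single 2F p | z₁ , z₂ , z₃ , z₄ , z₅ , z₆ = ≈ₘ.trans (superdiagonal-Z ⟦ p ⟧₁)
      (unitriangular-cong (symₚ z₁ , symₚ z₂ , reflₚ , symₚ z₄ , symₚ z₅ , symₚ z₆))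

    -- One induction over generated elements for all four groups: with the trivial predicate it
    -- gives coordinates on G, with `InK i` the vanishing of entries on K_i.
    module Coordinatized {J : Pred (Fin 3) 0ℓ} (P : Coordinates → Set)
        (P-0 : P 0ᵤ) (P-* : ∀ {t t′} → P t → P t′ → P (t *ᵤ t′)) (P-neg : ∀ {t} → P t → P (-ᵤ t))
        (P-single : ∀ j p → J j → P (single j p)) where

      coordinates : ∀ {g} → ⟨ generator {J} ⟩ g → ∃[ t ] (P t × g Γ.≈ gl t)
      coordinates (gen ((j , j∈J) , p)) = single j p , P-single j p j∈J , superdiagonal-single j p
      coordinates {g′} (resp {g} {g′} e g∈) with t , Pt , e′ ← coordinates g∈ =
        t , Pt , ≈ₘ.trans (≈ₘ.sym e) e′
      coordinates ε-mem = 0ᵤ , P-0 , ≈ₘ.sym gl-0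
      coordinates (∙-mem {g} {h} g∈ h∈) with t , Pt , e ← coordinates g∈ | t′ , Pt′ , e′ ← coordinates h∈ =
        t *ᵤ t′ , P-* Pt Pt′ , Γ.trans {g Γ.∙ h} {gl t Γ.∙ gl t′} {gl (t *ᵤ t′)} (Γ.∙-cong {g} {gl t} {h} {gl t′} e e′) (gl-* t t′)
      coordinates (⁻¹-mem {g} g∈) with t , Pt , e ← coordinates g∈ =
        -ᵤ t , P-neg Pt , Γ.trans {g Γ.⁻¹} {gl t Γ.⁻¹} {gl (-ᵤ t)} (Γ.⁻¹-cong {g} {gl t} e) (gl-neg t)

      coord-correct : ∀ {g} → ⟨ generator {J} ⟩ g → g Γ.≈ gl (coord (matrix g))
      coord-correct {g} g∈ with t , _ , e ← coordinates g∈ =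
        -- `coord` recovers `t` from `gl t` by computation.
        Γ.trans {g} {gl t} {gl (coord (matrix g))} e (gl-cong {t} {coord (matrix g)} (coord-cong {matrix (gl t)} {matrix g} (≈ₘ.sym e)))



    private
      module Zero {c ℓ} (D : Group c ℓ) where
        open Group D renaming (trans to transᴰ; _≈_ to _≈ᴰ_)
        infixl 6 _⊕_
        _⊕_ : ∀ {x y} → x ≈ᴰ ε → y ≈ᴰ ε → x ∙ y ≈ᴰ ε
        e ⊕ f = transᴰ (∙-cong e f) (identityˡ ε)

        ⊖_ : ∀ {x} → x ≈ᴰ ε → x ⁻¹ ≈ᴰ ε
        ⊖ e = transᴰ (⁻¹-cong e) (GroupProperties.ε⁻¹≈ε D)

      open Zero Deg1 using () renaming (_⊕_ to _⊕₁_; ⊖_ to ⊖₁_)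
      open Zero Deg2 using () renaming (_⊕_ to _⊕₂_; ⊖_ to ⊖₂_)
      open Zero Deg3 using () renaming (_⊕_ to _⊕₃_; ⊖_ to ⊖₃_)

      0+0 : ∀ {s t} → s ≈ 0# → t ≈ 0# → s + t ≈ 0#
      0+0 e f = trans (R.+-cong e f) (R.+-identityˡ 0#)

      0*_ : ∀ {s} → s ≈ 0# → ∀ {t} → s * t ≈ 0#
      (0* e) {t} = trans (R.*-congʳ e) (R.zeroˡ t)

      *0_ : ∀ {s} → s ≈ 0# → ∀ {t} → t * s ≈ 0#
      (*0 e) {t} = trans (R.*-congˡ e) (R.zeroʳ t)

      zero¹¹ˡ : ∀ {p q} → p D1.≈ D1.ε → p *¹¹ q D2.≈ D2.ε
      zero¹¹ˡ (e , f) = 0* e , 0+0 (0* e) (0* f) , 0* f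

      zero¹¹ʳ : ∀ {p q} → q D1.≈ D1.ε → p *¹¹ q D2.≈ D2.ε
      zero¹¹ʳ (e , f) = *0 e , 0+0 (*0 f) (*0 e) , *0 f

      zero¹²ˡ : ∀ {p v} → p D1.≈ D1.ε → p *¹² v D3.≈ D3.ε
      zero¹²ˡ (e , f) = 0* e , 0+0 (0* e) (0* f) , 0+0 (0* e) (0* f) , 0* f

      zero¹²ʳ : ∀ {p v} → v D2.≈ D2.ε → p *¹² v D3.≈ D3.ε
      zero¹²ʳ (e , f , g) = *0 e , 0+0 (*0 f) (*0 e) , 0+0 (*0 g) (*0 f) , *0 g

      zero²¹ˡ : ∀ {u r} → u D2.≈ D2.ε → u *²¹ r D3.≈ D3.ε
      zero²¹ˡ (e , f , g) = 0* e , 0+0 (0* e) (0* f) , 0+0 (0* f) (0* g) , 0* g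

      zero²¹ʳ : ∀ {u r} → r D1.≈ D1.ε → u *²¹ r D3.≈ D3.ε
      zero²¹ʳ (e , f) = *0 e , 0+0 (*0 f) (*0 e) , 0+0 (*0 f) (*0 e) , *0 f

    InK-0 : ∀ i → InK i 0ᵤ
    InK-0 0F = D1.refl , D2.refl , D3.refl
    InK-0 1F = D1.refl , D2.refl , D2.refl , D3.refl
    InK-0 2F = D1.refl , D2.refl , D3.refl

    InK-* : ∀ i {t t′} → InK i t → InK i t′ → InK i (t *ᵤ t′)
    InK-* 0F (p , u , s) (p′ , u′ , s′) =
      p ⊕₁ p′ , u ⊕₂ zero¹¹ˡ p ⊕₂ u′ , s ⊕₃ zero²¹ˡ u ⊕₃ zero¹²ˡ p ⊕₃ s′
    InK-* 1F (q , u , v , s) (q′ , u′ , v′ , s′) =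
      q ⊕₁ q′ , u ⊕₂ zero¹¹ʳ q′ ⊕₂ u′ , v ⊕₂ zero¹¹ˡ q ⊕₂ v′ , s ⊕₃ zero²¹ˡ u ⊕₃ zero¹²ʳ v′ ⊕₃ s′
    InK-* 2F (r , v , s) (r′ , v′ , s′) =
      r ⊕₁ r′ , v ⊕₂ zero¹¹ʳ r′ ⊕₂ v′ , s ⊕₃ zero²¹ʳ r′ ⊕₃ zero¹²ʳ v′ ⊕₃ s′

    InK-neg : ∀ i {t} → InK i t → InK i (-ᵤ t)
    InK-neg 0F (p , u , s) = ⊖₁ p , ⊖₂ (u ⊕₂ zero¹¹ˡ p) , ⊖₃ (s ⊕₃ zero²¹ˡ u ⊕₃ zero¹²ˡ p)
    InK-neg 1F (q , u , v , s) =
      ⊖₁ q , ⊖₂ (u ⊕₂ zero¹¹ʳ (⊖₁ q)) , v′ , ⊖₃ (s ⊕₃ zero²¹ˡ u ⊕₃ zero¹²ʳ v′)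
      where v′ = ⊖₂ (v ⊕₂ zero¹¹ˡ q)
    InK-neg 2F (r , v , s) = ⊖₁ r , v′ , ⊖₃ (s ⊕₃ zero²¹ʳ (⊖₁ r) ⊕₃ zero¹²ʳ v′)
      where v′ = ⊖₂ (v ⊕₂ zero¹¹ʳ (⊖₁ r))

    InK-single : ∀ i j p → j ≢ i → InK i (single j p)
    InK-single 0F 0F p j≢i = contradiction ≡.refl j≢i
    InK-single 0F 1F p j≢i = D1.refl , D2.refl , D3.refl
    InK-single 0F 2F p j≢i = D1.refl , D2.refl , D3.refl
    InK-single 1F 0F p j≢i = D1.refl , D2.refl , D2.refl , D3.refl
    InK-single 1F 1F p j≢i = contradiction ≡.refl j≢i
    InK-single 1F 2F p j≢i = D1.refl , D2.refl , D2.refl , D3.refl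
    InK-single 2F 0F p j≢i = D1.refl , D2.refl , D3.refl
    InK-single 2F 1F p j≢i = D1.refl , D2.refl , D3.refl
    InK-single 2F 2F p j≢i = contradiction ≡.refl j≢i

    InK-resp : ∀ i {t t′} → t ≈ᵤ t′ → InK i t → InK i t′
    InK-resp 0F (e₁ , e₂ , e₃ , e₄ , e₅ , e₆) (p , u , s) =
      D1.trans (D1.sym e₁) p , D2.trans (D2.sym e₄) u , D3.trans (D3.sym e₆) s
    InK-resp 1F (e₁ , e₂ , e₃ , e₄ , e₅ , e₆) (q , u , v , s) =
      D1.trans (D1.sym e₂) q , D2.trans (D2.sym e₄) u , D2.trans (D2.sym e₅) v , D3.trans (D3.sym e₆) s
    InK-resp 2F (e₁ , e₂ , e₃ , e₄ , e₅ , e₆) (r , v , s) =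
      D1.trans (D1.sym e₃) r , D2.trans (D2.sym e₅) v , D3.trans (D3.sym e₆) s

    module InG = Coordinatized {U} (λ _ → ⊤) tt (λ _ _ → tt) (λ _ → tt) (λ _ _ _ → tt)
    module InKᵢ i = Coordinatized {_≢ i} (InK i) (InK-0 i)
      (λ {t} {t′} → InK-* i {t} {t′}) (λ {t} → InK-neg i {t}) (InK-single i)

    coord-InK : ∀ i {g} → ⟨ generator {_≢ i} ⟩ g → InK i (coord (matrix g))
    coord-InK i {g} g∈ with t , t∈ , e ← InKᵢ.coordinates i g∈ =
      InK-resp i {t} {coord (matrix g)} (coord-cong {matrix (gl t)} {matrix g} (≈ₘ.sym e)) t∈

    coord-* : ∀ {g h} → ⟨ generator {U} ⟩ g → ⟨ generator {U} ⟩ h →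
              coord (matrix (g Γ.∙ h)) ≈ᵤ coord (matrix g) *ᵤ coord (matrix h)
    coord-* {g} {h} g∈ h∈ = coord-cong {matrix (g Γ.∙ h)} {matrix (gl (t *ᵤ t′))} (Γ.trans {g Γ.∙ h} {gl t Γ.∙ gl t′} {gl (t *ᵤ t′)}
      (Γ.∙-cong {g} {gl t} {h} {gl t′} (InG.coord-correct g∈) (InG.coord-correct h∈)) (gl-* t t′))
      where
      t = coord (matrix g)
      t′ = coord (matrix h)

    weaken : ∀ {J : Pred (Fin 3) 0ℓ} {g} → ⟨ generator {J} ⟩ g → ⟨ generator {U} ⟩ g
    weaken (gen ((j , _) , p)) = gen ((j , tt) , p)
    weaken (resp {x} {y} e g∈) = resp {x = x} {y} e (weaken g∈)
    weaken ε-mem               = ε-mem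
    weaken (∙-mem {x} {y} g∈ h∈) = ∙-mem {x = x} {y} (weaken g∈) (weaken h∈)
    weaken (⁻¹-mem {x} g∈)     = ⁻¹-mem {x = x} (weaken g∈)

    commutator-mem : ∀ {J : Pred (Fin 3) 0ℓ} {g h} → ⟨ generator {J} ⟩ g → ⟨ generator {J} ⟩ h →
                     ⟨ generator {J} ⟩ (commutator g h)
    commutator-mem {J} {g} {h} g∈ h∈ =
      ∙-mem {x = g Γ.∙ h Γ.∙ g Γ.⁻¹} {h Γ.⁻¹}
        (∙-mem {x = g Γ.∙ h} {g Γ.⁻¹} (∙-mem {x = g} {h} g∈ h∈) (⁻¹-mem {x = g} g∈)) (⁻¹-mem {x = h} h∈)

    e₁₂ e₂₃ e₃₄ : Poly1 → InvertibleMatrix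
    e₁₂ p = superdiagonal 0F ⟦ p ⟧₁
    e₂₃ q = superdiagonal 1F ⟦ q ⟧₁
    e₃₄ r = superdiagonal 2F ⟦ r ⟧₁

    product-decomposition : ∀ u₀ u₁ u₂ →
      ⟦ u₀ , u₁ ⟧₁ *ₚ ⟦ 1# , 0# ⟧₁ +ₚ ⟦ 0# , u₂ ⟧₁ *ₚ ⟦ 0# , 1# ⟧₁ ≈ₚ ⟦ u₀ , u₁ , u₂ ⟧₂
    product-decomposition u₀ u₁ u₂ = ∷-cong
      (S.solve 2 (λ u₀ u₁ → u₀ :* con 1 :+ con 0 :+ (con 0 :* con 0 :+ con 0) := u₀) refl u₀ u₁)
      (∷-cong (S.solve 3 (λ u₀ u₁ u₂ →
          u₀ :* con 0 :+ (u₁ :* con 1 :+ con 0) :+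
          (con 0 :* con 1 :+ (u₂ :* con 0 :+ con 0)) := u₁) refl u₀ u₁ u₂)
        (∷-cong (S.solve 2 (λ u₁ u₂ → u₁ :* con 0 :+ u₂ :* con 1 := u₂) refl u₁ u₂) reflₚ))

    e₁₂≈X : ∀ p → e₁₂ p Γ.≈ X ⟦ p ⟧₁
    e₁₂≈X p = superdiagonal-X ⟦ p ⟧₁

    e₂₃≈Y : ∀ p → e₂₃ p Γ.≈ Y ⟦ p ⟧₁
    e₂₃≈Y p = superdiagonal-Y ⟦ p ⟧₁

    e₃₄≈Z : ∀ p → e₃₄ p Γ.≈ Z ⟦ p ⟧₁
    e₃₄≈Z p = superdiagonal-Z ⟦ p ⟧₁

    commutator-of : ∀ {g g′ h h′ k} → g Γ.≈ g′ → h Γ.≈ h′ → g′ Γ.∙ h′ Γ.≈ k Γ.∙ (h′ Γ.∙ g′) → commutator g h Γ.≈ k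
    commutator-of {g} {g′} {h} {h′} {k} e f eq = Γ.trans {commutator g h} {commutator g′ h′} {k}
      (commutator-cong {g} {g′} {h} {h′} e f) (Γ.sym {k} {commutator g′ h′} (swap-commutator {g′} {h′} {k} eq))

    module _ {J : Pred (Fin 3) 0ℓ} where
      e₁₂∈ : J 0F → ∀ p → ⟨ generator {J} ⟩ (e₁₂ p)
      e₁₂∈ j p = gen ((0F , j) , p)

      e₂₃∈ : J 1F → ∀ p → ⟨ generator {J} ⟩ (e₂₃ p)
      e₂₃∈ j p = gen ((1F , j) , p)

      e₃₄∈ : J 2F → ∀ p → ⟨ generator {J} ⟩ (e₃₄ p)
      e₃₄∈ j p = gen ((2F , j) , p)

    opaque
      -- Written as commutators of generators instead of elementary matrices, so that membership in
      -- the generated subgroups is immediate. A second commutator is needed because a quadratic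
      -- entry is in general a sum of two products.
      e₁₃ e₂₄ : Poly2 → InvertibleMatrix
      e₁₃ (u₀ , u₁ , u₂) = commutator (e₁₂ (u₀ , u₁)) (e₂₃ (1# , 0#)) Γ.∙ commutator (e₁₂ (0# , u₂)) (e₂₃ (0# , 1#))
      e₂₄ (v₀ , v₁ , v₂) = commutator (e₂₃ (v₀ , v₁)) (e₃₄ (1# , 0#)) Γ.∙ commutator (e₂₃ (0# , v₂)) (e₃₄ (0# , 1#))

      e₁₃≈A : ∀ u → e₁₃ u Γ.≈ A ⟦ u ⟧₂
      e₁₃≈A u@(u₀ , u₁ , u₂) = ≈ₘ.trans
        (Γ.∙-cong {commutator (e₁₂ (u₀ , u₁)) (e₂₃ (1# , 0#))} {A (⟦ u₀ , u₁ ⟧₁ *ₚ ⟦ 1# , 0# ⟧₁)}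
                  {commutator (e₁₂ (0# , u₂)) (e₂₃ (0# , 1#))} {A (⟦ 0# , u₂ ⟧₁ *ₚ ⟦ 0# , 1# ⟧₁)}
          (part (u₀ , u₁) (1# , 0#)) (part (0# , u₂) (0# , 1#)))
        (≈ₘ.trans (≈ₘ.sym (A-+ (⟦ u₀ , u₁ ⟧₁ *ₚ ⟦ 1# , 0# ⟧₁) (⟦ 0# , u₂ ⟧₁ *ₚ ⟦ 0# , 1# ⟧₁)))
          (unitriangular-cong (reflₚ , reflₚ , reflₚ , product-decomposition u₀ u₁ u₂ , reflₚ , reflₚ)))
        where
        part : ∀ p q → commutator (e₁₂ p) (e₂₃ q) Γ.≈ A (⟦ p ⟧₁ *ₚ ⟦ q ⟧₁)
        part p q = commutator-of {e₁₂ p} {X ⟦ p ⟧₁} {e₂₃ q} {Y ⟦ q ⟧₁} {A (⟦ p ⟧₁ *ₚ ⟦ q ⟧₁)}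
          (e₁₂≈X p) (e₂₃≈Y q) (XY ⟦ p ⟧₁ ⟦ q ⟧₁)

      e₂₄≈B : ∀ v → e₂₄ v Γ.≈ B ⟦ v ⟧₂
      e₂₄≈B u@(u₀ , u₁ , u₂) = ≈ₘ.trans
        (Γ.∙-cong {commutator (e₂₃ (u₀ , u₁)) (e₃₄ (1# , 0#))} {B (⟦ u₀ , u₁ ⟧₁ *ₚ ⟦ 1# , 0# ⟧₁)}
                  {commutator (e₂₃ (0# , u₂)) (e₃₄ (0# , 1#))} {B (⟦ 0# , u₂ ⟧₁ *ₚ ⟦ 0# , 1# ⟧₁)}
          (part (u₀ , u₁) (1# , 0#)) (part (0# , u₂) (0# , 1#)))
        (≈ₘ.trans (≈ₘ.sym (B-+ (⟦ u₀ , u₁ ⟧₁ *ₚ ⟦ 1# , 0# ⟧₁) (⟦ 0# , u₂ ⟧₁ *ₚ ⟦ 0# , 1# ⟧₁)))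
          (unitriangular-cong (reflₚ , reflₚ , reflₚ , reflₚ , product-decomposition u₀ u₁ u₂ , reflₚ)))
        where
        part : ∀ p q → commutator (e₂₃ p) (e₃₄ q) Γ.≈ B (⟦ p ⟧₁ *ₚ ⟦ q ⟧₁)
        part p q = commutator-of {e₂₃ p} {Y ⟦ p ⟧₁} {e₃₄ q} {Z ⟦ q ⟧₁} {B (⟦ p ⟧₁ *ₚ ⟦ q ⟧₁)}
          (e₂₃≈Y p) (e₃₄≈Z q) (YZ ⟦ p ⟧₁ ⟦ q ⟧₁)

      e₁₃∈ : ∀ {J : Pred (Fin 3) 0ℓ} → J 0F → J 1F → ∀ u → ⟨ generator {J} ⟩ (e₁₃ u)
      e₁₃∈ i j (u₀ , u₁ , u₂) =
        ∙-mem {x = commutator (e₁₂ (u₀ , u₁)) (e₂₃ (1# , 0#))} {commutator (e₁₂ (0# , u₂)) (e₂₃ (0# , 1#))}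
          (commutator-mem {g = e₁₂ (u₀ , u₁)} {e₂₃ (1# , 0#)} (e₁₂∈ i _) (e₂₃∈ j _))
          (commutator-mem {g = e₁₂ (0# , u₂)} {e₂₃ (0# , 1#)} (e₁₂∈ i _) (e₂₃∈ j _))

      e₂₄∈ : ∀ {J : Pred (Fin 3) 0ℓ} → J 1F → J 2F → ∀ v → ⟨ generator {J} ⟩ (e₂₄ v)
      e₂₄∈ i j (v₀ , v₁ , v₂) =
        ∙-mem {x = commutator (e₂₃ (v₀ , v₁)) (e₃₄ (1# , 0#))} {commutator (e₂₃ (0# , v₂)) (e₃₄ (0# , 1#))}
          (commutator-mem {g = e₂₃ (v₀ , v₁)} {e₃₄ (1# , 0#)} (e₂₃∈ i _) (e₃₄∈ j _))
          (commutator-mem {g = e₂₃ (0# , v₂)} {e₃₄ (0# , 1#)} (e₂₃∈ i _) (e₃₄∈ j _))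

    opaque
      e₁₄ : Poly3 → InvertibleMatrix
      e₁₄ (s₀ , s₁ , s₂ , s₃) =
        commutator (e₁₂ (1# , 0#)) (e₂₄ (s₀ , s₁ , s₂)) Γ.∙ commutator (e₁₂ (0# , 1#)) (e₂₄ (0# , 0# , s₃))

      e₁₄≈C : ∀ s → e₁₄ s Γ.≈ C ⟦ s ⟧₃
      e₁₄≈C s@(s₀ , s₁ , s₂ , s₃) = ≈ₘ.trans
        (Γ.∙-cong {commutator (e₁₂ (1# , 0#)) (e₂₄ (s₀ , s₁ , s₂))} {C (⟦ 1# , 0# ⟧₁ *ₚ ⟦ s₀ , s₁ , s₂ ⟧₂)}
                  {commutator (e₁₂ (0# , 1#)) (e₂₄ (0# , 0# , s₃))} {C (⟦ 0# , 1# ⟧₁ *ₚ ⟦ 0# , 0# , s₃ ⟧₂)}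
          (part (1# , 0#) (s₀ , s₁ , s₂)) (part (0# , 1#) (0# , 0# , s₃)))
        (≈ₘ.trans (≈ₘ.sym (C-+ (⟦ 1# , 0# ⟧₁ *ₚ ⟦ s₀ , s₁ , s₂ ⟧₂) (⟦ 0# , 1# ⟧₁ *ₚ ⟦ 0# , 0# , s₃ ⟧₂)))
          (unitriangular-cong (reflₚ , reflₚ , reflₚ , reflₚ , reflₚ , decomposition)))
        where
        part : ∀ p v → commutator (e₁₂ p) (e₂₄ v) Γ.≈ C (⟦ p ⟧₁ *ₚ ⟦ v ⟧₂)
        part p v = commutator-of {e₁₂ p} {X ⟦ p ⟧₁} {e₂₄ v} {B ⟦ v ⟧₂} {C (⟦ p ⟧₁ *ₚ ⟦ v ⟧₂)}
          (e₁₂≈X p) (e₂₄≈B v) (XB ⟦ p ⟧₁ ⟦ v ⟧₂)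

        decomposition : ⟦ 1# , 0# ⟧₁ *ₚ ⟦ s₀ , s₁ , s₂ ⟧₂ +ₚ ⟦ 0# , 1# ⟧₁ *ₚ ⟦ 0# , 0# , s₃ ⟧₂ ≈ₚ ⟦ s ⟧₃
        decomposition = transₚ
          (+ₚ-cong (*¹²-correct (1# , 0#) (s₀ , s₁ , s₂)) (*¹²-correct (0# , 1#) (0# , 0# , s₃)))
          (⟦⟧₃-cong {((1# , 0#) *¹² (s₀ , s₁ , s₂)) D3.∙ ((0# , 1#) *¹² (0# , 0# , s₃))} {s} (split³ s₀ s₁ s₂ s₃))

      e₁₄∈ : ∀ {J : Pred (Fin 3) 0ℓ} → J 0F → J 1F → J 2F → ∀ s → ⟨ generator {J} ⟩ (e₁₄ s)
      e₁₄∈ i j k (s₀ , s₁ , s₂ , s₃) =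
        ∙-mem {x = commutator (e₁₂ (1# , 0#)) (e₂₄ (s₀ , s₁ , s₂))} {commutator (e₁₂ (0# , 1#)) (e₂₄ (0# , 0# , s₃))}
          (commutator-mem {g = e₁₂ (1# , 0#)} {e₂₄ (s₀ , s₁ , s₂)} (e₁₂∈ i _) (e₂₄∈ j k _))
          (commutator-mem {g = e₁₂ (0# , 1#)} {e₂₄ (0# , 0# , s₃)} (e₁₂∈ i _) (e₂₄∈ j k _))

    private module GL = FiniteGroup G-link

    homFrom : ∀ (D : Group 0ℓ 0ℓ) (e : Group.Carrier D → InvertibleMatrix) → (∀ p → ⟨ generator {U} ⟩ (e p)) →
              (M : Poly → InvertibleMatrix) (emb : Group.Carrier D → Poly) → (∀ p → e p Γ.≈ M (emb p)) →
              (∀ {P Q} → P ≈ₚ Q → M P Γ.≈ M Q) → (∀ P Q → M (P +ₚ Q) Γ.≈ M P Γ.∙ M Q) →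
              (∀ {p q} → Group._≈_ D p q → emb p ≈ₚ emb q) → (∀ p q → emb (Group._∙_ D p q) ≈ₚ emb p +ₚ emb q) →
              Hom D GL.group
    homFrom D e e∈ M emb e≈M M-cong M-+ emb-cong emb-+ = record
      { map    = λ p → e p , e∈ p
      ; cong   = λ {p} {q} eq → Γ.trans {e p} {M (emb p)} {e q} (e≈M p)
          (Γ.trans {M (emb p)} {M (emb q)} {e q} (M-cong (emb-cong eq)) (Γ.sym {e q} {M (emb q)} (e≈M q)))
      ; ∙-homo = λ p q → let pq = Group._∙_ D p q in
          Γ.trans {e pq} {M (emb pq)} {e p Γ.∙ e q} (e≈M pq)
          (Γ.trans {M (emb pq)} {M (emb p +ₚ emb q)} {e p Γ.∙ e q} (M-cong (emb-+ p q))
          (Γ.trans {M (emb p +ₚ emb q)} {M (emb p) Γ.∙ M (emb q)} {e p Γ.∙ e q} (M-+ (emb p) (emb q))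
            (Γ.sym {e p Γ.∙ e q} {M (emb p) Γ.∙ M (emb q)} (Γ.∙-cong {e p} {M (emb p)} {e q} {M (emb q)} (e≈M p) (e≈M q))))) }

    swap-resp : ∀ {g g′ h h′ k k′} → g Γ.≈ g′ → h Γ.≈ h′ → k Γ.≈ k′ →
                g′ Γ.∙ h′ Γ.≈ k′ Γ.∙ (h′ Γ.∙ g′) → g Γ.∙ h Γ.≈ k Γ.∙ (h Γ.∙ g)
    swap-resp {g} {g′} {h} {h′} {k} {k′} e f i eq =
      Γ.trans {g Γ.∙ h} {g′ Γ.∙ h′} {k Γ.∙ (h Γ.∙ g)} (Γ.∙-cong {g} {g′} {h} {h′} e f)
      (Γ.trans {g′ Γ.∙ h′} {k′ Γ.∙ (h′ Γ.∙ g′)} {k Γ.∙ (h Γ.∙ g)} eq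
        (Γ.sym {k Γ.∙ (h Γ.∙ g)} {k′ Γ.∙ (h′ Γ.∙ g′)} (Γ.∙-cong {k} {k′} {h Γ.∙ g} {h′ Γ.∙ g′} i (Γ.∙-cong {h} {h′} {g} {g′} f e))))

    commuteᴳ-resp : ∀ {g g′ h h′} → g Γ.≈ g′ → h Γ.≈ h′ → Commute g′ h′ → Commute g h
    commuteᴳ-resp {g} {g′} {h} {h′} e f = commute-resp {g′} {g} {h′} {h} (Γ.sym {g} {g′} e) (Γ.sym {h} {h′} f)

    chart : Chart commutativeRing G-link K-link
    chart = record
      { e₁₂ = homFrom Deg1 e₁₂ (e₁₂∈ tt) X ⟦_⟧₁ e₁₂≈X
          (λ e → unitriangular-cong (e , reflₚ , reflₚ , reflₚ , reflₚ , reflₚ)) X-+ ⟦⟧₁-cong (λ _ _ → reflₚ)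
      ; e₂₃ = homFrom Deg1 e₂₃ (e₂₃∈ tt) Y ⟦_⟧₁ e₂₃≈Y
          (λ e → unitriangular-cong (reflₚ , e , reflₚ , reflₚ , reflₚ , reflₚ)) Y-+ ⟦⟧₁-cong (λ _ _ → reflₚ)
      ; e₃₄ = homFrom Deg1 e₃₄ (e₃₄∈ tt) Z ⟦_⟧₁ e₃₄≈Z
          (λ e → unitriangular-cong (reflₚ , reflₚ , e , reflₚ , reflₚ , reflₚ)) Z-+ ⟦⟧₁-cong (λ _ _ → reflₚ)
      ; e₁₃ = homFrom Deg2 e₁₃ (e₁₃∈ tt tt) A ⟦_⟧₂ e₁₃≈A
          (λ e → unitriangular-cong (reflₚ , reflₚ , reflₚ , e , reflₚ , reflₚ)) A-+ ⟦⟧₂-cong (λ _ _ → reflₚ)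
      ; e₂₄ = homFrom Deg2 e₂₄ (e₂₄∈ tt tt) B ⟦_⟧₂ e₂₄≈B
          (λ e → unitriangular-cong (reflₚ , reflₚ , reflₚ , reflₚ , e , reflₚ)) B-+ ⟦⟧₂-cong (λ _ _ → reflₚ)
      ; e₁₄ = homFrom Deg3 e₁₄ (e₁₄∈ tt tt tt) C ⟦_⟧₃ e₁₄≈C
          (λ e → unitriangular-cong (reflₚ , reflₚ , reflₚ , reflₚ , reflₚ , e)) C-+ ⟦⟧₃-cong (λ _ _ → reflₚ)
      ; xy = λ p q → swap-resp {e₁₂ p} {X ⟦ p ⟧₁} {e₂₃ q} {Y ⟦ q ⟧₁} {e₁₃ (p *¹¹ q)} {A (⟦ p ⟧₁ *ₚ ⟦ q ⟧₁)}
          (e₁₂≈X p) (e₂₃≈Y q) (≈ₘ.trans (e₁₃≈A (p *¹¹ q))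
            (unitriangular-cong (reflₚ , reflₚ , reflₚ , symₚ (*¹¹-correct p q) , reflₚ , reflₚ))) (XY ⟦ p ⟧₁ ⟦ q ⟧₁)
      ; yz = λ p q → swap-resp {e₂₃ p} {Y ⟦ p ⟧₁} {e₃₄ q} {Z ⟦ q ⟧₁} {e₂₄ (p *¹¹ q)} {B (⟦ p ⟧₁ *ₚ ⟦ q ⟧₁)}
          (e₂₃≈Y p) (e₃₄≈Z q) (≈ₘ.trans (e₂₄≈B (p *¹¹ q))
            (unitriangular-cong (reflₚ , reflₚ , reflₚ , reflₚ , symₚ (*¹¹-correct p q) , reflₚ))) (YZ ⟦ p ⟧₁ ⟦ q ⟧₁)
      ; xb = λ p v → swap-resp {e₁₂ p} {X ⟦ p ⟧₁} {e₂₄ v} {B ⟦ v ⟧₂} {e₁₄ (p *¹² v)} {C (⟦ p ⟧₁ *ₚ ⟦ v ⟧₂)}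
          (e₁₂≈X p) (e₂₄≈B v) (≈ₘ.trans (e₁₄≈C (p *¹² v))
            (unitriangular-cong (reflₚ , reflₚ , reflₚ , reflₚ , reflₚ , symₚ (*¹²-correct p v)))) (XB ⟦ p ⟧₁ ⟦ v ⟧₂)
      ; xz = λ p r → commuteᴳ-resp {e₁₂ p} {X ⟦ p ⟧₁} {e₃₄ r} {Z ⟦ r ⟧₁} (e₁₂≈X p) (e₃₄≈Z r) (XZ ⟦ p ⟧₁ ⟦ r ⟧₁)
      ; ax = λ u p → commuteᴳ-resp {e₁₃ u} {A ⟦ u ⟧₂} {e₁₂ p} {X ⟦ p ⟧₁} (e₁₃≈A u) (e₁₂≈X p) (AX ⟦ u ⟧₂ ⟦ p ⟧₁)
      ; ay = λ u p → commuteᴳ-resp {e₁₃ u} {A ⟦ u ⟧₂} {e₂₃ p} {Y ⟦ p ⟧₁} (e₁₃≈A u) (e₂₃≈Y p) (AY ⟦ u ⟧₂ ⟦ p ⟧₁)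
      ; by = λ u p → commuteᴳ-resp {e₂₄ u} {B ⟦ u ⟧₂} {e₂₃ p} {Y ⟦ p ⟧₁} (e₂₄≈B u) (e₂₃≈Y p) (BY ⟦ u ⟧₂ ⟦ p ⟧₁)
      ; bz = λ u p → commuteᴳ-resp {e₂₄ u} {B ⟦ u ⟧₂} {e₃₄ p} {Z ⟦ p ⟧₁} (e₂₄≈B u) (e₃₄≈Z p) (BZ ⟦ u ⟧₂ ⟦ p ⟧₁)
      ; x∈K₁ = e₁₂∈ (λ ())
      ; x∈K₂ = e₁₂∈ (λ ())
      ; y∈K₀ = e₂₃∈ (λ ())
      ; y∈K₂ = e₂₃∈ (λ ())
      ; z∈K₀ = e₃₄∈ (λ ())
      ; z∈K₁ = e₃₄∈ (λ ())
      ; a∈K₂ = e₁₃∈ (λ ()) (λ ())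
      ; b∈K₀ = e₂₄∈ (λ ()) (λ ())
      ; coord      = λ (g , _) → coord (matrix g)
      ; from-coord = λ (g , g∈) → let (p , q , r , u , v , s) = coord (matrix g) in
          Γ.trans {g} {gl (coord (matrix g))} {e₃₄ r Γ.∙ (e₂₄ v Γ.∙ (e₂₃ q Γ.∙ (e₁₄ s Γ.∙ (e₁₃ u Γ.∙ e₁₂ p))))}
            (InG.coord-correct g∈) (factor p q r u v s)
      ; coord-cong = λ {(g , _)} {(h , _)} e → coord-cong {matrix g} {matrix h} e
      ; coord-*    = λ (g , g∈) (h , h∈) → coord-* {g} {h} g∈ h∈
      ; coord-InK  = λ i {(g , _)} g∈ → coord-InK i {g} g∈
      }
      where
      factor : ∀ p q r u v s → gl (p , q , r , u , v , s) Γ.≈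
               e₃₄ r Γ.∙ (e₂₄ v Γ.∙ (e₂₃ q Γ.∙ (e₁₄ s Γ.∙ (e₁₃ u Γ.∙ e₁₂ p))))
      factor p q r u v s = Γ.trans {gl (p , q , r , u , v , s)} {w₅} {w₅′}
        (Γ.sym {w₅} {gl (p , q , r , u , v , s)} (rows ⟦ p ⟧₁ ⟦ q ⟧₁ ⟦ r ⟧₁ ⟦ u ⟧₂ ⟦ v ⟧₂ ⟦ s ⟧₃))
        (Γ.sym {w₅′} {w₅}
          (Γ.∙-cong {e₃₄ r} {Z ⟦ r ⟧₁} {w₄′} {w₄} (e₃₄≈Z r)
          (Γ.∙-cong {e₂₄ v} {B ⟦ v ⟧₂} {w₃′} {w₃} (e₂₄≈B v)
          (Γ.∙-cong {e₂₃ q} {Y ⟦ q ⟧₁} {w₂′} {w₂} (e₂₃≈Y q)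
          (Γ.∙-cong {e₁₄ s} {C ⟦ s ⟧₃} {w₁′} {w₁} (e₁₄≈C s)
          (Γ.∙-cong {e₁₃ u} {A ⟦ u ⟧₂} {e₁₂ p} {X ⟦ p ⟧₁} (e₁₃≈A u) (e₁₂≈X p)))))))
        where
        w₁ = A ⟦ u ⟧₂ Γ.∙ X ⟦ p ⟧₁
        w₂ = C ⟦ s ⟧₃ Γ.∙ w₁
        w₃ = Y ⟦ q ⟧₁ Γ.∙ w₂
        w₄ = B ⟦ v ⟧₂ Γ.∙ w₃
        w₅ = Z ⟦ r ⟧₁ Γ.∙ w₄
        w₁′ = e₁₃ u Γ.∙ e₁₂ p
        w₂′ = e₁₄ s Γ.∙ w₁′
        w₃′ = e₂₃ q Γ.∙ w₂′
        w₄′ = e₂₄ v Γ.∙ w₃′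
        w₅′ = e₃₄ r Γ.∙ w₄′

-- Counting, averaging and rational weights

module AveragedCones where
  open import Algebra.Bundles using (Group)
  import Algebra.Properties.Semiring.Sum as SemiringSum
  open import Data.Bool.Base using (Bool; _xor_; _∧_; false; true)
  import Data.Bool.Properties as Bool
  open import Data.Fin.Base using (Fin; suc; zero)
  open import Data.Fin.Patterns using (0F; 1F; 2F)
  open import Data.Fin.Permutation using (Permutation; permutation)
  import Data.Fin.Properties as Fin
  open import Data.Fin.Subset using (Subset; _∪_; _⊆_; ⁅_⁆; ∣_∣) renaming (_∈_ to _∈ˢ_; ⊤ to full; ⊥ to ∅)
  import Data.Fin.Subset.Properties as Subset
  import Data.Integer.Base as ℤ
  import Data.Integer.Properties as ℤ
  open import Data.List.Base using (List; []; _∷_; allFin; cartesianProduct; filter; foldr; length; lookup;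
    map; tabulate)
  import Data.List.Extrema as Extrema
  open import Data.List.Membership.Propositional using (_∈_)
  import Data.List.Membership.Propositional.Properties as Membership
  open import Data.List.Membership.Propositional.Properties.WithK using (unique∧set⇒bag)
  import Data.List.Properties as List
  open import Data.List.Relation.Binary.BagAndSetEquality using (∼bag⇒↭)
  open import Data.List.Relation.Binary.Permutation.Propositional using (_↭_)
  import Data.List.Relation.Binary.Permutation.Propositional.Properties as ↭
  open import Data.List.Relation.Unary.All as All using (All; []; _∷_)
  import Data.List.Relation.Unary.All.Properties as All
  open import Data.List.Relation.Unary.AllPairs as AllPairs using (AllPairs; []; _∷_)
  open import Data.List.Relation.Unary.Any as Any using (Any; here; there)
  import Data.List.Relation.Unary.Any.Properties as Any
  import Data.List.Relation.Unary.Unique.DecSetoid.Properties as UniqueDecSetoid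
  open import Data.List.Relation.Unary.Unique.Propositional using (Unique)
  import Data.List.Relation.Unary.Unique.Propositional.Properties as Unique
  open import Data.Nat.Base as ℕ using (_*_; _+_; _<_; _≤_; suc; s≤s; zero; z≤n; ℕ)
  open import Data.Nat.Combinatorics using () renaming (_C_ to _choose_)
  open import Data.Nat.ListAction using () renaming (sum to sumᴸ)
  import Data.Nat.ListAction.Properties as ℕᴸ
  import Data.Nat.Properties as ℕ
  open import Data.Nat.Solver using (module +-*-Solver)
  open import Data.Product.Base using (_,_; _×_; proj₁; proj₂; ∃-syntax)
  open import Data.Rational.Base as ℚ using (0ℚ; ℚ)
  import Data.Rational.Properties as ℚ
  import Data.Rational.Unnormalised.Base as ℚᵘ
  import Data.Rational.Unnormalised.Properties as ℚᵘ
  open import Data.Sum.Base using (inj₁; inj₂)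
  open import Data.Vec.Base as Vec using (Vec; []; _∷_)
  import Data.Vec.Properties as Vec
  open import Defs
  open import Defs using (_÷₀_; fromℕ)
  open import Function.Base using (_∘_; case_of_)
  open import Function.Bundles using (mk⇔)
  open import Level using (0ℓ)
  open import Relation.Binary.Bundles using (DecSetoid; TotalOrder)
  open import Relation.Binary.Construct.Add.Supremum.NonStrict ℚ._≤_ using (_≤⁺_; _≤⊤⁺; [_])
  open import Relation.Binary.PropositionalEquality as ≡ using (_≡_; _≢_; cong; cong₂)
  open import Relation.Nullary.Construct.Add.Supremum using () renaming ([_] to fin)
  open import Relation.Nullary.Decidable using (Dec; _×-dec_; dec-true; does; no; yes)
  open import Relation.Nullary.Negation using (contradiction; ¬_)
  open import Relation.Unary using (Decidable; Pred)
  open FlagPaths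

  open SemiringSum ℕ.+-*-semiring using (sum; ∑-comm; ∑-distrib-+; sum-cong-≗; *-distribˡ-sum; sum-permute) public

  sum-mono : ∀ {n} {f g : Fin n → ℕ} → (∀ i → f i ≤ g i) → sum f ≤ sum g
  sum-mono {zero}  h = z≤n
  sum-mono {suc n} h = ℕ.+-mono-≤ (h zero) (sum-mono (h ∘ suc))

  sum-const : ∀ n k → sum {n} (λ _ → k) ≡ n * k
  sum-const zero    k = ≡.refl
  sum-const (suc n) k = cong (k ℕ.+_) (sum-const n k)

  sum-zero⁻¹ : ∀ {n} (f : Fin n → ℕ) → sum f ≡ 0 → ∀ i → f i ≡ 0
  sum-zero⁻¹ f e zero    = ℕ.m+n≡0⇒m≡0 (f zero) e
  sum-zero⁻¹ f e (suc i) = sum-zero⁻¹ (f ∘ suc) (ℕ.m+n≡0⇒n≡0 (f zero) e) i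

  below-average : ∀ {n} → 0 < n → (f : Fin n → ℕ) → ∀ b → sum f ≤ n * b → ∃[ i ] f i ≤ b
  below-average {suc n} _ f b h with Fin.any? (λ i → f i ℕ.≤? b)
  ... | yes found = found
  ... | no none = contradiction h (ℕ.<⇒≱ (ℕ.<-≤-trans (ℕ.*-monoʳ-< (suc n) (ℕ.n<1+n b))
        (ℕ.≤-trans (ℕ.≤-reflexive (≡.sym (sum-const (suc n) (suc b))))
          (sum-mono {f = λ _ → suc b} {f} λ i → ℕ.≰⇒> (λ fi≤b → none (i , fi≤b))))))

  -- The averaging over cones: `i` is the apex and `j` the flag; `q` is the local coboundary,
  -- present for every apex, and `r` is the cost of the fillings, which is controlled only on
  -- average.
  below-average₂ : ∀ {n} → 0 < n → (f r : Fin n → Fin n → ℕ) (q : Fin n → ℕ) → ∀ b →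
                   (∀ i j → f i j ≤ q j + r i j) → sum (λ i → sum λ j → r i j) ≤ n * b →
                   ∃[ i ] sum (f i) ≤ sum q + b
  below-average₂ {n} n>0 f r q b f≤ r≤ = below-average n>0 (λ i → sum (f i)) (sum q + b) (begin
    sum (λ i → sum (f i))                         ≤⟨ sum-mono (λ i → sum-mono (f≤ i)) ⟩
    sum (λ i → sum λ j → q j + r i j)             ≡⟨ sum-cong-≗ (λ i → ∑-distrib-+ q (r i)) ⟩
    sum (λ i → sum q + sum (r i))                 ≡⟨ ∑-distrib-+ (λ _ → sum q) (λ i → sum (r i)) ⟩
    sum {n} (λ _ → sum q) + sum (λ i → sum (r i)) ≤⟨ ℕ.+-mono-≤ (ℕ.≤-reflexive (sum-const n (sum q))) r≤ ⟩
    n * sum q + n * b                             ≡⟨ ℕ.*-distribˡ-+ n (sum q) b ⟨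
    n * (sum q + b)                               ∎)
    where open ℕ.≤-Reasoning

  sum₂-scale : ∀ {m n} k (f : Fin m → Fin n → ℕ) → sum (λ i → sum λ j → k * f i j) ≡ k * sum (λ i → sum λ j → f i j)
  sum₂-scale k f = ≡.trans (sum-cong-≗ λ i → ≡.sym (*-distribˡ-sum k (f i))) (≡.sym (*-distribˡ-sum k (λ i → sum (f i))))

  sum₂-+ : ∀ {m n} (f g : Fin m → Fin n → ℕ) →
           sum (λ i → sum λ j → f i j + g i j) ≡ sum (λ i → sum λ j → f i j) + sum (λ i → sum λ j → g i j)
  sum₂-+ f g = ≡.trans (sum-cong-≗ λ i → ∑-distrib-+ (f i) (g i)) (∑-distrib-+ (λ i → sum (f i)) (λ i → sum (g i)))

  module _ {a p} {A : Set a} {P : Pred A p} (P? : Decidable P) (f : A → ℕ) where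
    sum-filter : ∀ {n} (g : Fin n → A) →
                 sumᴸ (map f (filter P? (tabulate g))) ≡ sum (λ i → 𝟙 (does (P? (g i))) * f (g i))
    sum-filter {zero}  g = ≡.refl
    sum-filter {suc n} g with P? (g zero)
    ... | yes _ = cong₂ _+_ (≡.sym (ℕ.+-identityʳ _)) (sum-filter (g ∘ suc))
    ... | no  _ = sum-filter (g ∘ suc)

  length-sum : ∀ {a} {A : Set a} (xs : List A) → length xs ≡ sumᴸ (map (λ _ → 1) xs)
  length-sum []       = ≡.refl
  length-sum (x ∷ xs) = cong suc (length-sum xs)

  unique-↭ : ∀ {a} {A : Set a} {xs ys : List A} → Unique xs → Unique ys →
             (∀ {x} → x ∈ xs → x ∈ ys) → (∀ {x} → x ∈ ys → x ∈ xs) → xs ↭ ys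
  unique-↭ u v f g = ∼bag⇒↭ (unique∧set⇒bag u v (mk⇔ f g))

  fold-xor-↭ : ∀ {xs ys} → xs ↭ ys → foldr _xor_ false xs ≡ foldr _xor_ false ys
  fold-xor-↭ _↭_.refl         = ≡.refl
  fold-xor-↭ (_↭_.prep x p)   = cong (x xor_) (fold-xor-↭ p)
  fold-xor-↭ (_↭_.trans p q)  = ≡.trans (fold-xor-↭ p) (fold-xor-↭ q)
  fold-xor-↭ (_↭_.swap {xs} {ys} x y p) = ≡.trans (≡.sym (Bool.xor-assoc x y _))
    (≡.trans (cong₂ _xor_ (Bool.xor-comm x y) (fold-xor-↭ p)) (Bool.xor-assoc y x _))

  fromℕᵘ : ∀ n → ℚ.toℚᵘ (fromℕ n) ℚᵘ.≃ ℚᵘ.mkℚᵘ (ℤ.+ n) 0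
  fromℕᵘ n = ℚ.toℚᵘ-fromℚᵘ (ℚᵘ.mkℚᵘ (ℤ.+ n) 0)

  fromℕ-+ : ∀ m n → fromℕ (m + n) ≡ fromℕ m ℚ.+ fromℕ n
  fromℕ-+ m n = ℚ.toℚᵘ-injective (ℚᵘ.≃-trans (fromℕᵘ (m + n)) (ℚᵘ.≃-trans
    (ℚᵘ.*≡* (cong (ℤ._* ℤ.+ 1) (≡.trans (ℤ.pos-+ m n) (≡.sym (cong₂ ℤ._+_ (ℤ.*-identityʳ (ℤ.+ m)) (ℤ.*-identityʳ (ℤ.+ n)))))))
    (ℚᵘ.≃-sym (ℚᵘ.≃-trans (ℚ.toℚᵘ-homo-+ (fromℕ m) (fromℕ n)) (ℚᵘ.+-cong (fromℕᵘ m) (fromℕᵘ n))))))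

  fromℕ-* : ∀ m n → fromℕ (m * n) ≡ fromℕ m ℚ.* fromℕ n
  fromℕ-* m n = ℚ.toℚᵘ-injective (ℚᵘ.≃-trans (fromℕᵘ (m * n)) (ℚᵘ.≃-trans
    (ℚᵘ.*≡* (cong (ℤ._* ℤ.+ 1) (ℤ.pos-* m n)))
    (ℚᵘ.≃-sym (ℚᵘ.≃-trans (ℚ.toℚᵘ-homo-* (fromℕ m) (fromℕ n)) (ℚᵘ.*-cong (fromℕᵘ m) (fromℕᵘ n))))))

  fromℕ-mono-≤ : ∀ {m n} → m ≤ n → fromℕ m ℚ.≤ fromℕ n
  fromℕ-mono-≤ {m} {n} m≤n = ℚ.toℚᵘ-cancel-≤ (ℚᵘ.≤-respˡ-≃ (ℚᵘ.≃-sym (fromℕᵘ m)) (ℚᵘ.≤-respʳ-≃ (ℚᵘ.≃-sym (fromℕᵘ n))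
    (ℚᵘ.*≤* (ℤ.*-monoʳ-≤-nonNeg (ℤ.+ 1) (ℤ.+≤+ m≤n)))))

  fromℕ-suc-positive : ∀ n → ℚ.Positive (fromℕ (suc n))
  fromℕ-suc-positive n = ℚ.normalize-pos (suc n) 1

  ÷₀-cancel : ∀ p q → ℚ.Positive q → (p ÷₀ q) ℚ.* q ≡ p
  ÷₀-cancel p q pos with q ℚ.≟ 0ℚ
  ... | yes ≡.refl = contradiction pos λ ()
  ... | no  q≢0 = ≡.trans (ℚ.*-assoc p _ q) (≡.trans (cong (p ℚ.*_) (ℚ.*-inverseˡ q {{ℚ.≢-nonZero q≢0}})) (ℚ.*-identityʳ p))

  reciprocal : ℕ → ℚ
  reciprocal n = ℚ.1ℚ ÷₀ fromℕ (suc n)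

  reciprocal-positive : ∀ n → 0ℚ ℚ.< reciprocal n
  reciprocal-positive n = ℚ.*-cancelʳ-<-nonNeg (fromℕ (suc n)) {{ℚ.pos⇒nonNeg (fromℕ (suc n)) {{fromℕ-suc-positive n}}}}
    (≡.subst₂ ℚ._<_ (≡.sym (ℚ.*-zeroˡ (fromℕ (suc n)))) (≡.sym (÷₀-cancel ℚ.1ℚ (fromℕ (suc n)) (fromℕ-suc-positive n))) (ℚ.positive⁻¹ ℚ.1ℚ))

  -- Positivity of `d` excludes the default value 0 of `÷₀`, for which the bound would fail.
  reciprocal-≤-÷₀ : ∀ n {w d} → ℚ.Positive d → d ℚ.≤ fromℕ (suc n) ℚ.* w → reciprocal n ℚ.≤ w ÷₀ d
  reciprocal-≤-÷₀ n {w} {d} d>0 d≤cw = ℚ.*-cancelʳ-≤-pos c {{c>0}} (ℚ.*-cancelʳ-≤-pos d {{d>0}} (begin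
    reciprocal n ℚ.* c ℚ.* d     ≡⟨ cong (ℚ._* d) (÷₀-cancel ℚ.1ℚ c c>0) ⟩
    ℚ.1ℚ ℚ.* d                   ≡⟨ ℚ.*-identityˡ d ⟩
    d                            ≤⟨ d≤cw ⟩
    c ℚ.* w                      ≡⟨ cong (c ℚ.*_) (÷₀-cancel w d d>0) ⟨
    c ℚ.* ((w ÷₀ d) ℚ.* d)       ≡⟨ ℚ.*-assoc c (w ÷₀ d) d ⟨
    c ℚ.* (w ÷₀ d) ℚ.* d         ≡⟨ cong (ℚ._* d) (ℚ.*-comm c (w ÷₀ d)) ⟩
    (w ÷₀ d) ℚ.* c ℚ.* d         ∎))
    where
    open ℚ.≤-Reasoning
    c = fromℕ (suc n)
    c>0 = fromℕ-suc-positive n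

  -- All weights of faces of one dimension have the same denominator; clearing it turns comparisons
  -- of weights into comparisons of natural numbers.
  sum-quotients : ∀ {a} {A : Set a} (f : A → ℕ) {d} → ℚ.Positive d → (xs : List A) →
                  foldr ℚ._+_ 0ℚ (map (λ x → fromℕ (f x) ÷₀ d) xs) ℚ.* d ≡ fromℕ (sumᴸ (map f xs))
  sum-quotients f {d} pos []       = ℚ.*-zeroˡ d
  sum-quotients f {d} pos (x ∷ xs) = ≡.trans (ℚ.*-distribʳ-+ d (fromℕ (f x) ÷₀ d) _)
    (≡.trans (cong₂ ℚ._+_ (÷₀-cancel (fromℕ (f x)) d pos) (sum-quotients f pos xs)) (≡.sym (fromℕ-+ (f x) _)))

  lookup-injective : ∀ {a r} {A : Set a} {R : A → A → Set r} → (∀ {x y} → R x y → R y x) → {xs : List A} →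
                     AllPairs (λ x y → ¬ R x y) xs → ∀ i j → R (lookup xs i) (lookup xs j) → i ≡ j
  lookup-injective s (p ∷ ps) zero    zero    r = ≡.refl
  lookup-injective s (p ∷ ps) zero    (suc j) r = contradiction r (All.lookup p (Membership.∈-lookup j))
  lookup-injective s (p ∷ ps) (suc i) zero    r = contradiction (s r) (All.lookup p (Membership.∈-lookup i))
  lookup-injective s (p ∷ ps) (suc i) (suc j) r = cong suc (lookup-injective s ps i j r)

  bits-unique : ∀ n → Unique (bits n)
  bits-unique zero    = [] ∷ []
  bits-unique (suc n) = Unique.cartesianProductWith⁺ _∷_ Vec.∷-injective
    (((λ ()) ∷ []) ∷ [] ∷ []) (bits-unique n)

  ∈-bits : ∀ {n} (s : Vec Bool n) → s ∈ bits n
  ∈-bits {n} s = Any.map (λ {v} h → ≡.sym (lookup-ext h))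
    (vectors-complete _≡_ (false ∷ true ∷ []) (Vec.lookup s) λ i → both (Vec.lookup s i))
    where
    lookup-ext : ∀ {n} {u v : Vec Bool n} → (∀ i → Vec.lookup u i ≡ Vec.lookup v i) → u ≡ v
    lookup-ext {u = u} {v} h = ≡.trans (≡.sym (Vec.tabulate∘lookup u)) (≡.trans (Vec.tabulate-cong h) (Vec.tabulate∘lookup v))

    both : ∀ b → Any (_≡ b) (false ∷ true ∷ [])
    both false = here ≡.refl
    both true  = there (here ≡.refl)

  ∈-subset : ∀ {n} (s : Subset n) v → does (v Subset.∈? s) ≡ Vec.lookup s v
  ∈-subset (true  ∷ s) zero    = ≡.refl
  ∈-subset (false ∷ s) zero    = ≡.refl
  ∈-subset (b ∷ s)     (suc v) = ∈-subset s v

  ∣∣-sum : ∀ {n} (s : Subset n) → ∣ s ∣ ≡ sum (λ v → 𝟙 (Vec.lookup s v))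
  ∣∣-sum []          = ≡.refl
  ∣∣-sum (true  ∷ s) = cong suc (∣∣-sum s)
  ∣∣-sum (false ∷ s) = ∣∣-sum s

  ∣∣-members : ∀ {n} (s : Subset n) → ∣ s ∣ ≡ length (filter (Subset._∈? s) (allFin n))
  ∣∣-members {n} s = ≡.trans (∣∣-sum s) (≡.sym (≡.trans (length-sum (filter (Subset._∈? s) (allFin n)))
    (≡.trans (sum-filter (Subset._∈? s) (λ _ → 1) (λ i → i))
      (sum-cong-≗ λ v → ≡.trans (ℕ.*-identityʳ _) (cong 𝟙 (∈-subset s v))))))

  ∣∣-count : ∀ {n} (s : Subset n) {xs} → Unique xs → (∀ {v} → v ∈ xs → v ∈ˢ s) → (∀ {v} → v ∈ˢ s → v ∈ xs) →
             ∣ s ∣ ≡ length xs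
  ∣∣-count {n} s u f g = ≡.trans (∣∣-members s) (↭.↭-length (unique-↭ (Unique.filter⁺ (Subset._∈? s) (Unique.allFin⁺ n)) u
    (λ v∈ → g (proj₂ (Membership.∈-filter⁻ (Subset._∈? s) {xs = allFin n} v∈)))
    (λ v∈ → Membership.∈-filter⁺ (Subset._∈? s) (Membership.∈-allFin _) (f v∈))))

  -- A complex whose simplices of type β ⊆ {0,1,2} are the cosets x ⋂_{i ∈ β} K_i.
  record FlagComplex (G : FiniteGroup) (K : Fin 3 → DecSubgroup (FiniteGroup.group G)) (X : SimplicialComplex) : Set where
    open FiniteGroup G
    open SimplicialComplex X
    field
      simplex                : Subset 3 → Carrier → Subset size
      simplex-face           : ∀ β x → Face (simplex β x)
      ∣simplex∣              : ∀ β x → ∣ simplex β x ∣ ≡ ∣ β ∣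
      simplex-injective      : ∀ β γ x y → simplex β x ≡ simplex γ y → β ≡ γ
      simplex-⊆              : ∀ β γ x → β ⊆ γ → simplex β x ⊆ simplex γ x
      simplex-⊆⁻             : ∀ β γ x y → simplex β x ⊆ simplex γ y → β ⊆ γ
      simplex-cong           : ∀ β {x y} → (∀ i → i ∈ˢ β → DecSubgroup.Member (K i) (x ⁻¹ ∙ y)) → simplex β x ≡ simplex β y
      simplex-cong⁻          : ∀ β {x y} → simplex β x ≡ simplex β y → ∀ i → i ∈ˢ β → DecSubgroup.Member (K i) (x ⁻¹ ∙ y)
      below-simplex          : ∀ s γ x → s ⊆ simplex γ x → ∃[ β ] s ≡ simplex β x
      face-simplex           : ∀ {s} → Face s → ∃[ β ] ∃[ x ] s ≡ simplex β x
      full-simplex-injective : ∀ {x y} → simplex full x ≡ simplex full y → x ≈ y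

  -- Simplices of the coset complex

  module CosetSimplices (G : FiniteGroup) (K : Fin 3 → DecSubgroup (FiniteGroup.group G)) where
    open FiniteGroup G
    open CosetComplex G K public hiding (cosetComplex)
    X : SimplicialComplex
    X = cosetComplex G K

    open SimplicialComplex X public using (Face; Face?) renaming (size to N)
    private module K i = DecSubgroup (K i)

    shift : ∀ i {x y z} → K.Member i (x ⁻¹ ∙ y) → K.Member i (y ⁻¹ ∙ z) → K.Member i (x ⁻¹ ∙ z)
    shift i {x} {y} {z} p q = K.resp i (trans (assoc _ _ _)
      (∙-congˡ (trans (sym (assoc _ _ _)) (trans (∙-congʳ (inverseʳ y)) (identityˡ z))))) (K.∙-mem i p q)

    flip-mem : ∀ i {x y} → K.Member i (x ⁻¹ ∙ y) → K.Member i (y ⁻¹ ∙ x)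
    flip-mem i {x} {y} p = K.resp i (trans (⁻¹-anti-homo-∙ _ _) (∙-congˡ (⁻¹-involutive x))) (K.⁻¹-mem i p)
      where open import Algebra.Properties.Group group using (⁻¹-anti-homo-∙; ⁻¹-involutive)

    self-mem : ∀ i {x y} → x ≈ y → K.Member i (x ⁻¹ ∙ y)
    self-mem i {x} x≈y = K.resp i (trans (sym (inverseˡ x)) (∙-congˡ x≈y)) (K.ε-mem i)

    cosetSetoid : DecSetoid 0ℓ 0ℓ
    cosetSetoid = record
      { Carrier = Coset
      ; _≈_     = _≈ᶜ_
      ; isDecEquivalence = record
        { isEquivalence = record
          { refl  = λ {(i , g)} → ≡.refl , self-mem i refl
          ; sym   = λ { {i , g} (≡.refl , p) → ≡.refl , flip-mem i p }
          ; trans = λ { {i , g} (≡.refl , p) (≡.refl , q) → ≡.refl , shift i p q } }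
        ; _≟_ = _≈ᶜ?_ } }
    private module C = DecSetoid cosetSetoid

    vertex-injective : ∀ u v → vertex u ≈ᶜ vertex v → u ≡ v
    vertex-injective = lookup-injective C.sym
      (UniqueDecSetoid.deduplicate-! cosetSetoid (cartesianProduct (allFin 3) elements))

    vertex-of : ∀ i x → Any (_≈ᶜ (i , x)) vertices
    vertex-of i x = Any.deduplicate⁺ _≈ᶜ?_ (λ v≈u u≈ → C.trans v≈u u≈)
      (Any.map (λ { {j , y} (≡.refl , x≈y) → ≡.refl , self-mem j (sym x≈y) })
        (Any.cartesianProduct⁺ (Membership.∈-allFin i) (complete x)))

    vtx : Fin 3 → Carrier → Fin N
    vtx i x = Any.index (vertex-of i x)

    vtx-coset : ∀ i x → vertex (vtx i x) ≈ᶜ (i , x)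
    vtx-coset i x = Any.lookup-index (vertex-of i x)

    type : Fin N → Fin 3
    type v = proj₁ (vertex v)

    type-vtx : ∀ i x → type (vtx i x) ≡ i
    type-vtx i x = proj₁ (vtx-coset i x)

    ∈-vtx : ∀ i x → x ∈ᶜ vertex (vtx i x)
    ∈-vtx i x = proj₂ (vtx-coset i x)

    vtx-unique : ∀ {v x} → x ∈ᶜ vertex v → v ≡ vtx (type v) x
    vtx-unique {v} {x} x∈v = vertex-injective v (vtx (type v) x) (C.trans {vertex v} {type v , x} (≡.refl , x∈v) (C.sym (vtx-coset (type v) x)))

    vtx-cong : ∀ i {x y} → K.Member i (x ⁻¹ ∙ y) → vtx i x ≡ vtx i y
    vtx-cong i {x} {y} p = vertex-injective (vtx i x) (vtx i y) (C.trans (vtx-coset i x) (C.trans {i , x} {i , y} (≡.refl , p) (C.sym (vtx-coset i y))))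

    vtx-coset-≡ : ∀ i {x y} → vtx i x ≡ vtx i y → K.Member i (x ⁻¹ ∙ y)
    vtx-coset-≡ i {x} {y} e = proj₂ (C.trans {i , x} {vertex (vtx i x)} {i , y} (C.sym (vtx-coset i x))
      (≡.subst (λ v → vertex v ≈ᶜ (i , y)) (≡.sym e) (vtx-coset i y)))

    simplex : Subset 3 → Carrier → Subset N
    simplex β x = Vec.tabulate λ v → Vec.lookup β (type v) ∧ does (x ∈ᶜ? vertex v)

    ∈-simplex⁺ : ∀ β x i → i ∈ˢ β → vtx i x ∈ˢ simplex β x
    ∈-simplex⁺ β x i i∈β = Vec.lookup⇒[]= (vtx i x) _ (≡.trans (Vec.lookup∘tabulate _ (vtx i x))
      (cong₂ _∧_ (≡.trans (cong (Vec.lookup β) (type-vtx i x)) (Vec.[]=⇒lookup i∈β)) (dec-true (x ∈ᶜ? _) (∈-vtx i x))))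

    ∈-simplex⁻ : ∀ β x {v} → v ∈ˢ simplex β x → type v ∈ˢ β × x ∈ᶜ vertex v
    ∈-simplex⁻ β x {v} v∈ with Vec.lookup β (type v) in eq | x ∈ᶜ? vertex v
                             | ≡.trans (≡.sym (Vec.lookup∘tabulate _ v)) (Vec.[]=⇒lookup v∈)
    ... | true  | yes x∈v | _ = Vec.lookup⇒[]= _ β eq , x∈v
    ... | true  | no  _   | ()
    ... | false | _       | ()

    vtx∈-simplex⁻ : ∀ β x i {y} → vtx i y ∈ˢ simplex β x → i ∈ˢ β × K.Member i (y ⁻¹ ∙ x)
    vtx∈-simplex⁻ β x i {y} v∈ = let t∈β , x∈v = ∈-simplex⁻ β x v∈ in
      ≡.subst (_∈ˢ β) (type-vtx i y) t∈β ,
      vtx-coset-≡ i (≡.trans (vtx-unique x∈v) (cong (λ j → vtx j x) (type-vtx i y)))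

    simplex-⊆ : ∀ β γ x → β ⊆ γ → simplex β x ⊆ simplex γ x
    simplex-⊆ β γ x β⊆γ v∈ = let t∈β , x∈v = ∈-simplex⁻ β x v∈ in
      ≡.subst (_∈ˢ simplex γ x) (≡.sym (vtx-unique x∈v)) (∈-simplex⁺ γ x _ (β⊆γ t∈β))

    simplex-⊆⁻ : ∀ β γ x y → simplex β x ⊆ simplex γ y → β ⊆ γ
    simplex-⊆⁻ β γ x y s⊆ {i} i∈β = proj₁ (vtx∈-simplex⁻ γ y i (s⊆ (∈-simplex⁺ β x i i∈β)))

    simplex-injective : ∀ β γ x y → simplex β x ≡ simplex γ y → β ≡ γ
    simplex-injective β γ x y e = Subset.⊆-antisym
      (simplex-⊆⁻ β γ x y (≡.subst (simplex β x ⊆_) e (λ v∈ → v∈)))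
      (simplex-⊆⁻ γ β y x (≡.subst (_⊆ simplex β x) e (λ v∈ → v∈)))

    simplex-cong : ∀ β {x y} → (∀ i → i ∈ˢ β → K.Member i (x ⁻¹ ∙ y)) → simplex β x ≡ simplex β y
    simplex-cong β {x} {y} h = Subset.⊆-antisym (half h) (half λ i i∈β → flip-mem i (h i i∈β))
      where
      half : ∀ {x y} → (∀ i → i ∈ˢ β → K.Member i (x ⁻¹ ∙ y)) → simplex β x ⊆ simplex β y
      half {x} {y} h {v} v∈ = let t∈β , x∈v = ∈-simplex⁻ β x v∈ in
        ≡.subst (_∈ˢ simplex β y) (≡.sym (≡.trans (vtx-unique x∈v) (vtx-cong (type v) (h _ t∈β)))) (∈-simplex⁺ β y _ t∈β)

    simplex-face : ∀ β x → Face (simplex β x)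
    simplex-face β x u v u∈ v∈ u≢v = let _ , x∈u = ∈-simplex⁻ β x u∈ ; _ , x∈v = ∈-simplex⁻ β x v∈ in
      (λ e → u≢v (≡.trans (vtx-unique x∈u) (≡.trans (cong (λ i → vtx i x) e) (≡.sym (vtx-unique x∈v))))) ,
      x , x∈u , x∈v

    ∣simplex∣ : ∀ β x → ∣ simplex β x ∣ ≡ ∣ β ∣
    ∣simplex∣ β x = ≡.trans
      (∣∣-count (simplex β x) {map (λ i → vtx i x) types}
        (Unique.map⁺ (λ {i} {j} e → ≡.trans (≡.sym (type-vtx i x)) (≡.trans (cong type e) (type-vtx j x)))
          (Unique.filter⁺ (Subset._∈? β) (Unique.allFin⁺ 3)))
        (λ v∈ → let i , i∈ , e = Membership.∈-map⁻ (λ i → vtx i x) v∈ in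
           ≡.subst (_∈ˢ simplex β x) (≡.sym e) (∈-simplex⁺ β x i (proj₂ (Membership.∈-filter⁻ (Subset._∈? β) {xs = allFin 3} i∈))))
        (λ {v} v∈ → let t∈β , x∈v = ∈-simplex⁻ β x v∈ in ≡.subst (_∈ map (λ i → vtx i x) types) (≡.sym (vtx-unique x∈v))
           (Membership.∈-map⁺ (λ i → vtx i x) (Membership.∈-filter⁺ (Subset._∈? β) (Membership.∈-allFin _) t∈β))))
      (≡.trans (List.length-map (λ i → vtx i x) types) (≡.sym (∣∣-members β)))
      where types = filter (Subset._∈? β) (allFin 3)

    below-simplex : ∀ s γ x → s ⊆ simplex γ x → ∃[ β ] s ≡ simplex β x
    below-simplex s γ x s⊆ = β , Subset.⊆-antisym
      (λ {v} v∈ → let _ , x∈v = ∈-simplex⁻ γ x (s⊆ v∈) in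
        ≡.subst (_∈ˢ simplex β x) (≡.sym (vtx-unique x∈v)) (∈-simplex⁺ β x _ (mem⁺ (≡.subst (_∈ˢ s) (vtx-unique x∈v) v∈))))
      (λ {v} v∈ → let t∈β , x∈v = ∈-simplex⁻ β x v∈ in ≡.subst (_∈ˢ s) (≡.sym (vtx-unique x∈v)) (mem⁻ t∈β))
      where
      β : Subset 3
      β = Vec.tabulate λ i → Vec.lookup s (vtx i x)
      mem⁺ : ∀ {i} → vtx i x ∈ˢ s → i ∈ˢ β
      mem⁺ {i} h = Vec.lookup⇒[]= i β (≡.trans (Vec.lookup∘tabulate (λ i → Vec.lookup s (vtx i x)) i) (Vec.[]=⇒lookup h))
      mem⁻ : ∀ {i} → i ∈ˢ β → vtx i x ∈ˢ s
      mem⁻ {i} h = Vec.lookup⇒[]= _ s (≡.trans (≡.sym (Vec.lookup∘tabulate (λ i → Vec.lookup s (vtx i x)) i)) (Vec.[]=⇒lookup h))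

    module Flag (K₁-product : ∀ {g} → K.Member 1F g → ∃[ h ] ∃[ k ]
                   ((K.Member 0F h × K.Member 1F h) × (K.Member 1F k × K.Member 2F k) × g ≈ h ∙ k))
                (trivial-intersection : ∀ {g} → (∀ i → K.Member i g) → g ≈ ε) where

      module _ {s} (s-face : Face s) where
        -- A type that does not occur in `s` imposes no condition, so faces of all dimensions are
        -- treated alike.
        Through : Carrier → Fin 3 → Set
        Through x i = ∀ v → v ∈ˢ s → type v ≡ i → x ∈ᶜ vertex v

        Present : Fin 3 → Set
        Present i = ∃[ v ] (v ∈ˢ s × type v ≡ i)

        present? : ∀ i → Dec (Present i)
        present? i = Fin.any? λ v → (v Subset.∈? s) ×-dec (type v Fin.≟ i)

        through : ∀ {x i} ((v , _) : Present i) → x ∈ᶜ vertex v → Through x i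
        through {x} (v , v∈ , ≡.refl) x∈v w w∈ e with v Fin.≟ w
        ... | yes ≡.refl = x∈v
        ... | no  v≢w    = contradiction (≡.sym e) (proj₁ (s-face v w v∈ w∈ v≢w))

        absent : ∀ {x i} → ¬ Present i → Through x i
        absent none v v∈ e = contradiction (v , v∈ , e) none

        representative : ∀ v → proj₂ (vertex v) ∈ᶜ vertex v
        representative v = self-mem (type v) refl

        pair : ∀ i j → i ≢ j → ∃[ x ] (Through x i × Through x j)
        pair i j i≢j with present? i | present? j
        ... | yes p@(u , u∈ , ≡.refl) | yes q@(v , v∈ , ≡.refl) =
          let _ , x , x∈u , x∈v = s-face u v u∈ v∈ (λ { ≡.refl → i≢j ≡.refl }) in x , through p x∈u , through q x∈v
        ... | yes p@(u , _)           | no q = proj₂ (vertex u) , through p (representative u) , absent q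
        ... | no p                    | yes q@(v , _) = proj₂ (vertex v) , absent p , through q (representative v)
        ... | no p                    | no q = ε , absent p , absent q

        ∈ᶜ-move : ∀ {x h} u → x ∈ᶜ u → K.Member (proj₁ u) h → (x ∙ h) ∈ᶜ u
        ∈ᶜ-move (i , g) x∈u h∈ = K.resp i (assoc _ _ _) (K.∙-mem i x∈u h∈)

        -- If y lies in the cosets of types 0 and 1 and z in those of types 1 and 2, then y⁻¹z = hk
        -- with h in K₀ ∩ K₁ and k in K₁ ∩ K₂, and yh = zk⁻¹ lies in all of them.
        common-flag : ∃[ x ] (∀ i → Through x i)
        common-flag with present? 1F
        ... | no q = let x , x₀ , x₂ = pair 0F 2F (λ ()) in x , λ where
              0F → x₀
              1F → absent q
              2F → x₂
        ... | yes q@(v , v∈ , type≡1) with y , y₀ , y₁ ← pair 0F 1F (λ ()) | z , z₁ , z₂ ← pair 1F 2F (λ ())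
              with h , k , (h∈₀ , h∈₁) , (k∈₁ , k∈₂) , e ←
                   K₁-product (≡.subst (λ i → K.Member i (y ⁻¹ ∙ z)) type≡1
                     (shift (type v) (flip-mem (type v) (y₁ v v∈ type≡1)) (z₁ v v∈ type≡1))) =
          y ∙ h , λ where
            0F w w∈ e → ∈ᶜ-move (vertex w) (y₀ w w∈ e) (≡.subst (λ i → K.Member i h) (≡.sym e) h∈₀)
            1F w w∈ e → ∈ᶜ-move (vertex w) (y₁ w w∈ e) (≡.subst (λ i → K.Member i h) (≡.sym e) h∈₁)
            2F w w∈ e′ → ∈ᶜ-resp (vertex w) (zk⁻¹≈yh e)
              (∈ᶜ-move (vertex w) (z₂ w w∈ e′) (≡.subst (λ i → K.Member i (k ⁻¹)) (≡.sym e′) (K.⁻¹-mem 2F k∈₂)))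
          where
          zk⁻¹≈yh : ∀ {y z h k} → y ⁻¹ ∙ z ≈ h ∙ k → z ∙ k ⁻¹ ≈ y ∙ h
          zk⁻¹≈yh {y} {z} {h} {k} e = trans
            (trans (∙-congʳ (trans (sym (identityˡ z)) (trans (∙-congʳ (sym (inverseʳ y))) (trans (assoc _ _ _) (∙-congˡ e)))))
              (trans (∙-congʳ (sym (assoc _ _ _))) (assoc _ _ _)))
            (trans (∙-congˡ (inverseʳ k)) (identityʳ _))

        face⊆ : ∃[ x ] s ⊆ simplex full x
        face⊆ = let x , h = common-flag in x , λ {v} v∈ →
          ≡.subst (_∈ˢ simplex full x) (≡.sym (vtx-unique (h (type v) v v∈ ≡.refl))) (∈-simplex⁺ full x (type v) Subset.∈⊤)

        face-simplex : ∃[ β ] ∃[ x ] s ≡ simplex β x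
        face-simplex = let x , s⊆ = face⊆ ; β , e = below-simplex s full x s⊆ in β , x , e

      pure : IsPure 2 X
      pure {s} s-face = let x , s⊆ = face⊆ s-face in
        simplex full x , (s⊆ , simplex-face full x , ∣simplex∣ full x) ,
        ℕ.≤-trans (Subset.p⊆q⇒∣p∣≤∣q∣ s⊆) (ℕ.≤-reflexive (∣simplex∣ full x))

      full-simplex-injective : ∀ {x y} → simplex full x ≡ simplex full y → x ≈ y
      full-simplex-injective {x} {y} e = trans (sym (identityʳ x)) (trans (∙-congˡ (sym (trivial-intersection mem)))
        (trans (sym (assoc _ _ _)) (trans (∙-congʳ (inverseʳ x)) (identityˡ y))))
        where
        mem : ∀ i → K.Member i (x ⁻¹ ∙ y)
        mem i = proj₂ (vtx∈-simplex⁻ full y i (≡.subst (vtx i x ∈ˢ_) e (∈-simplex⁺ full x i Subset.∈⊤)))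

      flagComplex : FlagComplex G K X
      flagComplex = record
        { simplex = simplex ; simplex-face = simplex-face ; ∣simplex∣ = ∣simplex∣
        ; simplex-injective = simplex-injective ; simplex-⊆ = simplex-⊆ ; simplex-⊆⁻ = simplex-⊆⁻
        ; simplex-cong = simplex-cong
        ; simplex-cong⁻ = λ β {x} {y} e i i∈β → proj₂ (vtx∈-simplex⁻ β y i (≡.subst (vtx i x ∈ˢ_) e (∈-simplex⁺ β x i i∈β)))
        ; below-simplex = below-simplex ; face-simplex = face-simplex
        ; full-simplex-injective = full-simplex-injective }

  opaque
    subsets : Subset 3 → ℕ → List (Subset 3)
    subsets γ m = filter (λ β → (β Subset.⊆? γ) ×-dec (∣ β ∣ ℕ.≟ m)) (bits 3)

    subsets-unique : ∀ γ m → Unique (subsets γ m)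
    subsets-unique γ m = Unique.filter⁺ (λ β → (β Subset.⊆? γ) ×-dec (∣ β ∣ ℕ.≟ m)) (bits-unique 3)

    ∈-subsets⁺ : ∀ {β} γ m → β ⊆ γ → ∣ β ∣ ≡ m → β ∈ subsets γ m
    ∈-subsets⁺ γ m β⊆γ e = Membership.∈-filter⁺ (λ β → (β Subset.⊆? γ) ×-dec (∣ β ∣ ℕ.≟ m)) (∈-bits _) ((λ {v} → β⊆γ {v}) , e)

    ∈-subsets⁻ : ∀ {β} γ m → β ∈ subsets γ m → β ⊆ γ × ∣ β ∣ ≡ m
    ∈-subsets⁻ γ m β∈ = proj₂ (Membership.∈-filter⁻ (λ β → (β Subset.⊆? γ) ×-dec (∣ β ∣ ℕ.≟ m)) {xs = bits 3} β∈)

  -- Cochains as functions of vertex sets, and weights as sums over flags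

  module Faces (X : SimplicialComplex) where
    open SimplicialComplex X
    open Expansion X hiding (_∈_; _∉_; _∈?_; _∉?_)
    open Weighted 2

    face? : ∀ m (s : Subset size) → Dec (Face s × ∣ s ∣ ≡ m)
    face? m s = Face? s ×-dec (∣ s ∣ ℕ.≟ m)

    is-face : ∀ {m} (τ : Fin (#faces m)) → Face (face τ) × ∣ face τ ∣ ≡ m
    is-face {m} τ = proj₂ (Membership.∈-filter⁻ (face? m) {xs = bits size} (Membership.∈-lookup τ))

    face-injective : ∀ {m} {σ τ : Fin (#faces m)} → face σ ≡ face τ → σ ≡ τ
    face-injective {m} {σ} {τ} = lookup-injective ≡.sym (Unique.filter⁺ (face? m) (bits-unique size)) σ τ

    face∈ : ∀ {m s} → Face s → ∣ s ∣ ≡ m → s ∈ faces m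
    face∈ {m} s-face e = Membership.∈-filter⁺ (face? m) (∈-bits _) (s-face , e)

    face-index : ∀ {m s} → Face s → ∣ s ∣ ≡ m → Fin (#faces m)
    face-index s-face e = Any.index (face∈ s-face e)

    face-face-index : ∀ {m s} (s-face : Face s) (e : ∣ s ∣ ≡ m) → face (face-index s-face e) ≡ s
    face-face-index s-face e = ≡.sym (Any.lookup-index (face∈ s-face e))

    lookup-dec : ∀ {m} (φ : Cochain m) {s} → Dec (∃[ τ ] face {m} τ ≡ s) → Bool
    lookup-dec φ (yes (τ , _)) = Vec.lookup φ τ
    lookup-dec φ (no _)        = false

    face-dec : ∀ m s → Dec (∃[ τ ] face {m} τ ≡ s)
    face-dec m s = Fin.any? λ τ → Vec.≡-dec Bool._≟_ (face τ) s

    -- The extension of `φ` by 0 to all vertex sets, which can be evaluated at a simplex without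
    -- reference to its position in the list of faces.
    value : ∀ {m} → Cochain m → Subset size → Bool
    value {m} φ s = lookup-dec φ (face-dec m s)

    value-face : ∀ {m} (φ : Cochain m) τ → value φ (face τ) ≡ Vec.lookup φ τ
    value-face {m} φ τ = any-witness (face-dec m (face τ))
      where
      any-witness : (d : Dec (∃[ τ′ ] face {m} τ′ ≡ face τ)) → lookup-dec φ d ≡ Vec.lookup φ τ
      any-witness (yes (τ′ , e)) = cong (Vec.lookup φ) (face-injective e)
      any-witness (no none)      = contradiction (τ , ≡.refl) none

    value-tabulate : ∀ {m} (f : Subset size → Bool) {s} → Face s → ∣ s ∣ ≡ m → value {m} (Vec.tabulate (f ∘ face)) s ≡ f s
    value-tabulate {m} f {s} s-face e = ≡.subst (λ s → value {m} (Vec.tabulate (f ∘ face)) s ≡ f s) (face-face-index s-face e)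
      (≡.trans (value-face (Vec.tabulate (f ∘ face)) τ) (Vec.lookup∘tabulate (f ∘ face) τ))
      where τ = face-index s-face e

    value-⊕ : ∀ {m} (φ ψ : Cochain m) {s} → Face s → ∣ s ∣ ≡ m → value (φ ⊕ ψ) s ≡ value φ s xor value ψ s
    value-⊕ φ ψ {s} s-face e = ≡.subst (λ s → value (φ ⊕ ψ) s ≡ value φ s xor value ψ s) (face-face-index s-face e)
      (≡.trans (value-face (φ ⊕ ψ) τ) (≡.trans (Vec.lookup-zipWith _xor_ τ φ ψ)
        (≡.sym (cong₂ _xor_ (value-face φ τ) (value-face ψ τ)))))
      where τ = face-index s-face e

    subfaces : ∀ m (s : Subset size) → List (Fin (#faces m))
    subfaces m s = filter (λ τ → face τ Subset.⊆? s) (allFin (#faces m))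

    d-value : ∀ {m} (φ : Cochain m) {s} → Face s → ∣ s ∣ ≡ suc m →
              value (d φ) s ≡ foldr _xor_ false (map (Vec.lookup φ) (subfaces m s))
    d-value {m} φ {s} s-face e = ≡.subst (λ s → value (d φ) s ≡ foldr _xor_ false (map (Vec.lookup φ) (subfaces m s)))
      (face-face-index s-face e) (≡.trans (value-face (d φ) σ) (Vec.lookup∘tabulate _ σ))
      where σ = face-index s-face e

    -- Double counting of the pairs of a face in the support of `φ` and a triangle above it: the
    -- weight counts them by faces, the right side by triangles.
    weight-sum : ∀ {m} (φ : Cochain m) → ℚ.Positive (fromℕ ((3 choose m) * #faces 3)) →
                 weight φ ℚ.* fromℕ ((3 choose m) * #faces 3) ≡
                 fromℕ (sum λ (σ : Fin (#faces 3)) → sumᴸ (map (λ τ → 𝟙 (Vec.lookup φ τ)) (subfaces m (face σ))))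
    weight-sum {m} φ pos = ≡.trans (sum-quotients degree pos support) (cong fromℕ (begin
      sumᴸ (map degree support)
        ≡⟨ sum-filter (λ τ → Vec.lookup φ τ Bool.≟ true) degree (λ τ → τ) ⟩
      sum (λ τ → 𝟙 (does (Vec.lookup φ τ Bool.≟ true)) * degree τ)
        ≡⟨ sum-cong-≗ (λ τ → ≡.trans (cong₂ (λ b k → 𝟙 b * k) (does-true (Vec.lookup φ τ)) (degree-sum τ))
             (*-distribˡ-sum (𝟙 (Vec.lookup φ τ)) (λ σ → 𝟙 (does (face τ Subset.⊆? face σ))))) ⟩
      sum (λ τ → sum (λ σ → 𝟙 (Vec.lookup φ τ) * 𝟙 (does (face τ Subset.⊆? face σ))))
        ≡⟨ ∑-comm (λ τ σ → 𝟙 (Vec.lookup φ τ) * 𝟙 (does (face τ Subset.⊆? face σ))) ⟩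
      sum (λ σ → sum (λ τ → 𝟙 (Vec.lookup φ τ) * 𝟙 (does (face τ Subset.⊆? face σ))))
        ≡⟨ sum-cong-≗ (λ σ → ≡.trans (sum-cong-≗ λ τ → ℕ.*-comm (𝟙 (Vec.lookup φ τ)) _)
             (≡.sym (sum-filter (λ τ → face τ Subset.⊆? face σ) (λ τ → 𝟙 (Vec.lookup φ τ)) (λ τ → τ)))) ⟩
      sum (λ σ → sumᴸ (map (λ τ → 𝟙 (Vec.lookup φ τ)) (subfaces m (face σ)))) ∎))
      where
      open ≡.≡-Reasoning
      degree : Fin (#faces m) → ℕ
      degree τ = length (filter (face τ Subset.⊆?_) (faces 3))

      support : List (Fin (#faces m))
      support = filter (λ τ → Vec.lookup φ τ Bool.≟ true) (allFin (#faces m))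

      does-true : ∀ b → does (b Bool.≟ true) ≡ b
      does-true false = ≡.refl
      does-true true  = ≡.refl

      degree-sum : ∀ τ → degree τ ≡ sum (λ σ → 𝟙 (does (face τ Subset.⊆? face σ)))
      degree-sum τ = ≡.trans (cong (λ xs → length (filter (face τ Subset.⊆?_) xs)) (≡.sym (List.tabulate-lookup (faces 3))))
        (≡.trans (length-sum (filter (face τ Subset.⊆?_) (tabulate (lookup (faces 3)))))
          (≡.trans (sum-filter (face τ Subset.⊆?_) (λ _ → 1) (lookup (faces 3)))
            (sum-cong-≗ λ σ → ℕ.*-identityʳ (𝟙 (does (face τ Subset.⊆? face σ))))))

  module FaceWeights {G : FiniteGroup} {K : Fin 3 → DecSubgroup (FiniteGroup.group G)} {X : SimplicialComplex}
                     (flags : FlagComplex G K X) where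
    open FiniteGroup G
    open FlagComplex flags public
    open SimplicialComplex X public
    open Expansion X public hiding (_∈_; _∉_; _∈?_; _∉?_)
    open Weighted 2 public
    open Faces X public renaming (d-value to d-subfaces; weight-sum to weight-subfaces)
    private module K i = DecSubgroup (K i)

    simplex-dim : ∀ {m} β x {τ : Fin (#faces m)} → face τ ≡ simplex β x → ∣ β ∣ ≡ m
    simplex-dim β x {τ} e = ≡.trans (≡.sym (∣simplex∣ β x)) (≡.trans (cong ∣_∣ (≡.sym e)) (proj₂ (is-face τ)))

    subfaces-↭ : ∀ m γ x → map face (subfaces m (simplex γ x)) ↭ map (λ β → simplex β x) (subsets γ m)
    subfaces-↭ m γ x = unique-↭
      (Unique.map⁺ face-injective (Unique.filter⁺ _ (Unique.allFin⁺ _)))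
      (Unique.map⁺ (λ {β} {β′} → simplex-injective β β′ x x) (subsets-unique γ m))
      (λ s∈ → to (Membership.∈-map⁻ face s∈))
      (λ s∈ → from (Membership.∈-map⁻ (λ β → simplex β x) s∈))
      where
      to : ∀ {s} → ∃[ τ ] (τ ∈ subfaces m (simplex γ x) × s ≡ face τ) → s ∈ map (λ β → simplex β x) (subsets γ m)
      to (τ , τ∈ , ≡.refl) =
        let τ⊆ = proj₂ (Membership.∈-filter⁻ (λ τ → face τ Subset.⊆? simplex γ x) {xs = allFin _} τ∈)
            β , e = below-simplex (face τ) γ x τ⊆ in
        ≡.subst (_∈ map (λ β → simplex β x) (subsets γ m)) (≡.sym e) (Membership.∈-map⁺ (λ β → simplex β x)
          (∈-subsets⁺ γ m (simplex-⊆⁻ β γ x x (≡.subst (_⊆ simplex γ x) e (λ {v} → τ⊆ {v}))) (simplex-dim β x {τ} e)))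

      from : ∀ {s} → ∃[ β ] (β ∈ subsets γ m × s ≡ simplex β x) → s ∈ map face (subfaces m (simplex γ x))
      from (β , β∈ , ≡.refl) =
        let β⊆γ , ∣β∣≡m = ∈-subsets⁻ γ m β∈
            f = simplex-face β x ; c = ≡.trans (∣simplex∣ β x) ∣β∣≡m in
        ≡.subst (_∈ map face (subfaces m (simplex γ x))) (face-face-index f c) (Membership.∈-map⁺ face
          (Membership.∈-filter⁺ (λ τ → face τ Subset.⊆? simplex γ x) (Membership.∈-allFin _)
            (≡.subst (_⊆ simplex γ x) (≡.sym (face-face-index f c)) (simplex-⊆ β γ x β⊆γ))))

    values-↭ : ∀ {m} (φ : Cochain m) γ x →
               map (Vec.lookup φ) (subfaces m (simplex γ x)) ↭ map (λ β → value φ (simplex β x)) (subsets γ m)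
    values-↭ {m} φ γ x = ≡.subst₂ _↭_
      (≡.trans (≡.sym (List.map-∘ (subfaces m (simplex γ x)))) (List.map-cong (value-face φ) (subfaces m (simplex γ x))))
      (≡.sym (List.map-∘ (subsets γ m)))
      (↭.map⁺ (value φ) (subfaces-↭ m γ x))

    d-value : ∀ {m} (φ : Cochain m) γ x → ∣ γ ∣ ≡ suc m →
              value (d φ) (simplex γ x) ≡ foldr _xor_ false (map (λ β → value φ (simplex β x)) (subsets γ m))
    d-value {m} φ γ x e = ≡.trans (d-subfaces φ (simplex-face γ x) (≡.trans (∣simplex∣ γ x) e)) (fold-xor-↭ (values-↭ φ γ x))

    M : ℕ
    M = #faces 3

    flag-of : ∀ (σ : Fin M) → ∃[ x ] face σ ≡ simplex full x
    flag-of σ = let β , x , e = face-simplex (proj₁ (is-face σ)) in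
      x , ≡.trans e (cong (λ β → simplex β x) (Subset.∣p∣≡n⇒p≡⊤ {p = β} (simplex-dim β x {σ} e)))

    -- With its inverse `ix` it identifies triangles with group elements. Sums over the group are
    -- taken over `Fin M`, since the list of group elements may contain repetitions.
    el : Fin M → Carrier
    el σ = proj₁ (flag-of σ)

    ix : Carrier → Fin M
    ix x = face-index (simplex-face full x) (∣simplex∣ full x)

    face-ix : ∀ x → face (ix x) ≡ simplex full x
    face-ix x = face-face-index (simplex-face full x) (∣simplex∣ full x)

    el-ix : ∀ x → el (ix x) ≈ x
    el-ix x = full-simplex-injective (≡.trans (≡.sym (proj₂ (flag-of (ix x)))) (face-ix x))

    ix-cong : ∀ {x y} → x ≈ y → ix x ≡ ix y
    ix-cong {x} {y} e = face-injective (≡.trans (face-ix x)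
      (≡.trans (simplex-cong full λ i _ → K.resp i (trans (sym (inverseˡ x)) (∙-congˡ e)) (K.ε-mem i)) (≡.sym (face-ix y))))

    ix-el : ∀ σ → ix (el σ) ≡ σ
    ix-el σ = face-injective (≡.trans (face-ix (el σ)) (≡.sym (proj₂ (flag-of σ))))

    multiplicity : ∀ {m} → Cochain m → Carrier → ℕ
    multiplicity {m} φ x = sumᴸ (map (λ β → 𝟙 (value φ (simplex β x))) (subsets full m))

    weight-sum : ∀ {m} (φ : Cochain m) → ℚ.Positive (fromℕ ((3 choose m) * M)) →
                 weight φ ℚ.* fromℕ ((3 choose m) * M) ≡ fromℕ (sum λ σ → multiplicity φ (el σ))
    weight-sum {m} φ pos = ≡.trans (weight-subfaces φ pos) (cong fromℕ (sum-cong-≗ local))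
      where
      open ≡.≡-Reasoning
      local : ∀ σ → sumᴸ (map (λ τ → 𝟙 (Vec.lookup φ τ)) (subfaces m (face σ))) ≡ multiplicity φ (el σ)
      local σ = begin
        sumᴸ (map (λ τ → 𝟙 (Vec.lookup φ τ)) (subfaces m (face σ)))
          ≡⟨ cong (λ s → sumᴸ (map (λ τ → 𝟙 (Vec.lookup φ τ)) (subfaces m s))) (proj₂ (flag-of σ)) ⟩
        sumᴸ (map (λ τ → 𝟙 (Vec.lookup φ τ)) (subfaces m (simplex full (el σ))))
          ≡⟨ cong sumᴸ (List.map-∘ (subfaces m (simplex full (el σ)))) ⟩
        sumᴸ (map 𝟙 (map (Vec.lookup φ) (subfaces m (simplex full (el σ)))))
          ≡⟨ ℕᴸ.sum-↭ (↭.map⁺ 𝟙 (values-↭ φ full (el σ))) ⟩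
        sumᴸ (map 𝟙 (map (λ β → value φ (simplex β (el σ))) (subsets full m)))
          ≡⟨ cong sumᴸ (List.map-∘ (subsets full m)) ⟨
        multiplicity φ (el σ) ∎

  opaque
    unfolding subsets
    subsets-full-1 : subsets full 1 ≡ ⁅ 2F ⁆ ∷ ⁅ 1F ⁆ ∷ ⁅ 0F ⁆ ∷ []
    subsets-full-1 = ≡.refl

    subsets-full-2 : subsets full 2 ≡ (⁅ 1F ⁆ ∪ ⁅ 2F ⁆) ∷ (⁅ 0F ⁆ ∪ ⁅ 2F ⁆) ∷ (⁅ 0F ⁆ ∪ ⁅ 1F ⁆) ∷ []
    subsets-full-2 = ≡.refl

    subsets-full-3 : subsets full 3 ≡ full ∷ []
    subsets-full-3 = ≡.refl

    subsets-01 : subsets (⁅ 0F ⁆ ∪ ⁅ 1F ⁆) 1 ≡ ⁅ 1F ⁆ ∷ ⁅ 0F ⁆ ∷ []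
    subsets-01 = ≡.refl

    subsets-02 : subsets (⁅ 0F ⁆ ∪ ⁅ 2F ⁆) 1 ≡ ⁅ 2F ⁆ ∷ ⁅ 0F ⁆ ∷ []
    subsets-02 = ≡.refl

    subsets-12 : subsets (⁅ 1F ⁆ ∪ ⁅ 2F ⁆) 1 ≡ ⁅ 2F ⁆ ∷ ⁅ 1F ⁆ ∷ []
    subsets-12 = ≡.refl

    subsets-vertex : ∀ i → subsets ⁅ i ⁆ 0 ≡ ∅ ∷ []
    subsets-vertex 0F = ≡.refl
    subsets-vertex 1F = ≡.refl
    subsets-vertex 2F = ≡.refl

  module Arithmetic where
    open +-*-Solver

    spokes-≤ : ∀ p₁ p₂ p₃ t → (p₂ + t) + ((p₁ + t) + (t + 0)) ≤ (p₁ + (p₂ + p₃)) + 3 * t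
    spokes-≤ p₁ p₂ p₃ t = ℕ.≤-trans (ℕ.m≤m+n _ p₃) (ℕ.≤-reflexive
      (solve 4 (λ p₁ p₂ p₃ t → (p₂ :+ t) :+ ((p₁ :+ t) :+ (t :+ con 0)) :+ p₃ :=
        (p₁ :+ (p₂ :+ p₃)) :+ con 3 :* t) ≡.refl p₁ p₂ p₃ t))

    *-swap : ∀ k m n → k * (m * n) ≡ m * (k * n)
    *-swap = solve 3 (λ k m n → k :* (m :* n) := m :* (k :* n)) ≡.refl

    +-reverse : ∀ p q r → p + (q + (r + 0)) ≡ r + (q + p)
    +-reverse = solve 3 (λ p q r → p :+ (q :+ (r :+ con 0)) := r :+ (q :+ p)) ≡.refl

    -- Dimension zero yields 1 + 3n, one path for each vertex of a triangle. It is weakened to the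
    -- constant of dimension one.
    three-six : ∀ n S → S + 3 * (n * S) ≤ suc (6 * n) * S
    three-six n S = ℕ.≤-trans (ℕ.m≤m+n _ (3 * (n * S))) (ℕ.≤-reflexive
      (solve 2 (λ n S → (S :+ con 3 :* (n :* S)) :+ con 3 :* (n :* S) := (con 1 :+ con 6 :* n) :* S) ≡.refl n S))

    edges-≡ : ∀ q t₀ t₁ t₂ → (q + (t₁ + t₂)) + ((t₀ + t₂) + ((t₀ + t₁) + 0)) ≡ q + 2 * (t₀ + (t₁ + t₂))
    edges-≡ = solve 4 (λ q t₀ t₁ t₂ → (q :+ (t₁ :+ t₂)) :+ ((t₀ :+ t₂) :+ ((t₀ :+ t₁) :+ con 0)) :=
      q :+ con 2 :* (t₀ :+ (t₁ :+ t₂))) ≡.refl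

    -- The origin of 6: three types of fillings, each of which enters for two edges of a triangle.
    fills-≡ : ∀ M k → 2 * (M * k + (M * k + M * k)) ≡ M * (6 * k)
    fills-≡ = solve 2 (λ M k → con 2 :* (M :* k :+ (M :* k :+ M :* k)) := M :* (con 6 :* k)) ≡.refl

    -- The factor 3 compares the denominators: a triangle has three edges, so weights of edges are
    -- over 3M and those of triangles over M. The estimate gives this factor away.
    six-≤ : ∀ n S → S + 6 * (n * S) ≤ suc (6 * n) * (3 * S)
    six-≤ n S = ℕ.≤-trans (ℕ.≤-reflexive (solve 2 (λ n S → S :+ con 6 :* (n :* S) := (con 1 :+ con 6 :* n) :* S) ≡.refl n S))
      (ℕ.*-monoʳ-≤ (suc (6 * n)) (ℕ.m≤m+n S _))

  open Arithmetic

  ℚ-totalOrder : TotalOrder 0ℓ 0ℓ 0ℓ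
  ℚ-totalOrder = record { isTotalOrder = ℚ.≤-isTotalOrder }

  some-true : ∀ {n} (φ : Vec Bool n) → φ ≢ Vec.replicate n false → ∃[ i ] Vec.lookup φ i ≡ true
  some-true []          φ≢0 = contradiction ≡.refl φ≢0
  some-true (true  ∷ φ) φ≢0 = zero , ≡.refl
  some-true (false ∷ φ) φ≢0 = let i , e = some-true φ (φ≢0 ∘ cong (false ∷_)) in suc i , e

  fromℕ-positive : ∀ {n} → 0 < n → ℚ.Positive (fromℕ n)
  fromℕ-positive {suc n} _ = fromℕ-suc-positive n

  -- Expansion from contractibility

  module Expander {G : FiniteGroup} {K : Fin 3 → DecSubgroup (FiniteGroup.group G)} {X : SimplicialComplex}
                  (flags : FlagComplex G K X) where
    open FiniteGroup G
    open FaceWeights flags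
    private module K i = DecSubgroup (K i)

    M>0 : 0 < M
    M>0 = ℕ.≤-<-trans z≤n (Fin.toℕ<n (ix ε))

    module _ (k : ℕ) (choose>0 : 0 < 3 choose suc k) where
      D>0 : 0 < (3 choose suc k) * M
      D>0 = ℕ.*-mono-< choose>0 M>0

      -- Every face lies in a triangle, namely in the flag of any of its representatives, so it
      -- contributes to the sum over flags.
      weight-positive : ∀ (φ : Cochain (suc k)) τ → Vec.lookup φ τ ≡ true → ℚ.Positive (weight φ)
      weight-positive φ τ φτ = ℚ.positive (ℚ.*-cancelʳ-<-nonNeg D {{ℚ.pos⇒nonNeg D {{pos}}}} {0ℚ} {weight φ}
        (≡.subst₂ ℚ._<_ (≡.sym (ℚ.*-zeroˡ D)) (≡.sym (weight-sum φ pos))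
          (ℚ.positive⁻¹ _ {{fromℕ-positive (ℕ.n≢0⇒n>0 total≢0)}})))
        where
        D = fromℕ ((3 choose suc k) * M)
        pos : ℚ.Positive D
        pos = fromℕ-positive D>0

        total≢0 : sum (λ σ → multiplicity φ (el σ)) ≢ 0
        total≢0 e with β , x , τ-simplex ← face-simplex (proj₁ (is-face τ)) = contradiction φτ (λ φτ′ → case ≡.trans (≡.sym φτ′) zero-value of λ ())
          where
          y = el (ix x)

          β∈ : β ∈ subsets full (suc k)
          β∈ = ∈-subsets⁺ full (suc k) (λ _ → Subset.∈⊤) (simplex-dim β x {τ} τ-simplex)

          zero-sum : ∀ {A : Set} (f : A → ℕ) {xs x} → x ∈ xs → sumᴸ (map f xs) ≡ 0 → f x ≡ 0
          zero-sum f {x ∷ xs} (here ≡.refl) e = ℕ.m+n≡0⇒m≡0 (f x) e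
          zero-sum f {x ∷ xs} (there x∈)    e = zero-sum f x∈ (ℕ.m+n≡0⇒n≡0 (f x) e)

          𝟙-zero : ∀ b → 𝟙 b ≡ 0 → b ≡ false
          𝟙-zero false _ = ≡.refl

          zero-value : Vec.lookup φ τ ≡ false
          zero-value = ≡.trans (≡.sym (value-face φ τ)) (≡.trans (cong (value φ) (≡.trans τ-simplex
              (simplex-cong β λ i _ → K.resp i (trans (sym (inverseˡ x)) (∙-congˡ (sym (el-ix x)))) (K.ε-mem i))))
            (𝟙-zero _ (zero-sum (λ β → 𝟙 (value φ (simplex β y))) β∈ (sum-zero⁻¹ _ e (ix x)))))

      nonzero : ∀ (φ : Cochain (suc k)) → φ ≢ Vec.replicate (#faces (suc k)) false → ℚ.Positive (weight φ)
      nonzero φ φ≢0 = let τ , φτ = some-true φ φ≢0 in weight-positive φ τ φτ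

      d-zero : d (Vec.replicate (#faces k) false) ≡ Vec.replicate (#faces (suc k)) false
      d-zero = ≡.trans (Vec.tabulate-cong λ σ → fold-false (subfaces k (face σ))) (tabulate-const (#faces (suc k)))
        where
        fold-false : ∀ xs → foldr _xor_ false (map (Vec.lookup (Vec.replicate (#faces k) false)) xs) ≡ false
        fold-false []       = ≡.refl
        fold-false (τ ∷ xs) = cong₂ _xor_ (Vec.lookup-replicate τ false) (fold-false xs)

        tabulate-const : ∀ n → Vec.tabulate {n = n} (λ _ → false) ≡ Vec.replicate n false
        tabulate-const zero    = ≡.refl
        tabulate-const (suc n) = cong (false ∷_) (tabulate-const n)

      ⊕-zero : ∀ {n} (φ ψ : Vec Bool n) → Vec.zipWith _xor_ φ ψ ≡ Vec.replicate n false → φ ≡ ψ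
      ⊕-zero []          []          e = ≡.refl
      ⊕-zero (false ∷ φ) (false ∷ ψ) e = cong (false ∷_) (⊕-zero φ ψ (Vec.∷-injectiveʳ e))
      ⊕-zero (true  ∷ φ) (true  ∷ ψ) e = cong (true ∷_) (⊕-zero φ ψ (Vec.∷-injectiveʳ e))
      ⊕-zero (false ∷ φ) (true  ∷ ψ) ()
      ⊕-zero (true  ∷ φ) (false ∷ ψ) ()

      private
        module ℚ-Extrema = Extrema ℚ-totalOrder

      d∈ : ∀ ψ → d ψ ∈ coboundaries k
      d∈ ψ = Membership.∈-map⁺ d (∈-bits ψ)

      -- The minimum is over finitely many weights of cochains φ + ψ with ψ a coboundary. None of
      -- these cochains vanishes, as φ would then equal ψ.
      distance-positive : ∀ (φ : Cochain (suc k)) → ¬ φ ∈ coboundaries k → ℚ.Positive (distanceToB φ)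
      distance-positive φ φ∉B = ℚ.positive (ℚ.≰⇒> λ d≤0 → proj₂ lower (ℚ.≤-antisym (proj₁ lower) d≤0))
        where
        strict : ∀ {p} → ℚ.Positive p → 0ℚ ℚ.≤ p × 0ℚ ≢ p
        strict {p} pos = ℚ.<⇒≤ (ℚ.positive⁻¹ p {{pos}}) , ℚ.<⇒≢ (ℚ.positive⁻¹ p {{pos}})

        lower = ℚ-Extrema.v<min⁺ {0ℚ} {weight φ} {map (λ ψ → weight (φ ⊕ ψ)) (coboundaries k)}
          -- The starting value `weight φ` of the minimum has to be positive as well; the zero
          -- cochain is excluded as the coboundary of zero.
          (strict (nonzero φ λ { ≡.refl → φ∉B (≡.subst (_∈ coboundaries k) d-zero (d∈ (Vec.replicate (#faces k) false))) }))
          (All.map⁺ (All.tabulate λ {ψ} ψ∈B → strict (nonzero (φ ⊕ ψ) λ e →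
             φ∉B (≡.subst (_∈ coboundaries k) (≡.sym (⊕-zero φ ψ e)) ψ∈B))))

      Exp-bound : ∀ c → (∀ (φ : Cochain (suc k)) → ∃[ ψ ] weight (φ ⊕ d ψ) ℚ.≤ fromℕ (suc c) ℚ.* weight (d φ)) →
                  fin (reciprocal c) ≤⁺ Weighted.Exp 2 k
      -- The starting value is `⊤⁺`, which is also the result if every cochain is a coboundary.
      Exp-bound c close = Extrema.v≤min⁺ ≤⁺-totalOrder {fin (reciprocal c)} (fin (reciprocal c) ≤⊤⁺)
        (All.map⁺ (All.map⁺ (All.tabulate λ {φ} φ∈ →
          let ψ , h = close φ in
          [ reciprocal-≤-÷₀ c {weight (d φ)} {distanceToB φ}
              (distance-positive φ (proj₂ (Membership.∈-filter⁻ (λ φ → Expansion._∉?_ X φ (coboundaries k)) {xs = cochains (suc k)} φ∈)))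
              (ℚ.≤-trans (ℚ-Extrema.min≤v⁺ (weight φ) (map (λ ψ → weight (φ ⊕ ψ)) (coboundaries k))
                 (inj₂ (Any.map⁺ (Any.map (λ { ≡.refl → ℚ.≤-refl }) (d∈ ψ))))) h) ])))

    compare-weights : ∀ D → 0 < D → ∀ c {v w a b} → v ℚ.* fromℕ D ≡ fromℕ a → w ℚ.* fromℕ D ≡ fromℕ b → a ≤ suc c * b →
                      v ℚ.≤ fromℕ (suc c) ℚ.* w
    compare-weights D D>0 c {v} {w} {a} {b} e f a≤cb = ℚ.*-cancelʳ-≤-pos (fromℕ D) {{fromℕ-positive D>0}} (begin
      v ℚ.* fromℕ D                        ≡⟨ e ⟩
      fromℕ a                              ≤⟨ fromℕ-mono-≤ a≤cb ⟩
      fromℕ (suc c * b)                    ≡⟨ fromℕ-* (suc c) b ⟩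
      fromℕ (suc c) ℚ.* fromℕ b            ≡⟨ cong (fromℕ (suc c) ℚ.*_) f ⟨
      fromℕ (suc c) ℚ.* (w ℚ.* fromℕ D)    ≡⟨ ℚ.*-assoc (fromℕ (suc c)) w (fromℕ D) ⟨
      fromℕ (suc c) ℚ.* w ℚ.* fromℕ D      ∎)
      where open ℚ.≤-Reasoning

    scale : ∀ w k m s → w ℚ.* fromℕ m ≡ fromℕ s → w ℚ.* fromℕ (k * m) ≡ fromℕ (k * s)
    scale w k m s e = begin
      w ℚ.* fromℕ (k * m)              ≡⟨ cong (w ℚ.*_) (≡.trans (fromℕ-* k m) (ℚ.*-comm (fromℕ k) (fromℕ m))) ⟩
      w ℚ.* (fromℕ m ℚ.* fromℕ k)      ≡⟨ ℚ.*-assoc w (fromℕ m) (fromℕ k) ⟨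
      w ℚ.* fromℕ m ℚ.* fromℕ k        ≡⟨ cong (ℚ._* fromℕ k) e ⟩
      fromℕ s ℚ.* fromℕ k              ≡⟨ ℚ.*-comm (fromℕ s) (fromℕ k) ⟩
      fromℕ k ℚ.* fromℕ s              ≡⟨ fromℕ-* k s ⟨
      fromℕ (k * s)                    ∎
      where open ≡.≡-Reasoning

    leftShift rightShift : Carrier → Permutation M M
    leftShift c = permutation (λ σ → ix (c ∙ el σ)) (λ σ → ix (c ⁻¹ ∙ el σ))
      (λ σ → ≡.trans (ix-cong (trans (∙-congˡ (el-ix _)) (trans (sym (assoc _ _ _)) (trans (∙-congʳ (inverseʳ c)) (identityˡ _))))) (ix-el σ))
      (λ σ → ≡.trans (ix-cong (trans (∙-congˡ (el-ix _)) (trans (sym (assoc _ _ _)) (trans (∙-congʳ (inverseˡ c)) (identityˡ _))))) (ix-el σ))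
    rightShift c = permutation (λ σ → ix (el σ ∙ c)) (λ σ → ix (el σ ∙ c ⁻¹))
      (λ σ → ≡.trans (ix-cong (trans (∙-congʳ (el-ix _)) (trans (assoc _ _ _) (trans (∙-congˡ (inverseˡ c)) (identityʳ _))))) (ix-el σ))
      (λ σ → ≡.trans (ix-cong (trans (∙-congʳ (el-ix _)) (trans (assoc _ _ _) (trans (∙-congˡ (inverseʳ c)) (identityʳ _))))) (ix-el σ))

    gap : Fin M → Fin M → Fin M
    gap γ χ = ix (el γ ⁻¹ ∙ el χ)

    module Averaging {A : Set} (Q : A → Carrier → ℕ) (Q-resp : ∀ φ {x y} → x ≈ y → Q φ x ≡ Q φ y) where
      open Covering group Q Q-resp

      sum-total : ∀ φ ys → sum (λ γ → total φ (el γ) ys) ≡ length ys * sum (λ σ → Q φ (el σ))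
      sum-total φ []       = sum-const-zero M
        where
        sum-const-zero : ∀ n → sum {n} (λ _ → 0) ≡ 0
        sum-const-zero n = ≡.trans (sum-const n 0) (ℕ.*-zeroʳ n)
      sum-total φ (y ∷ ys) = ≡.trans (∑-distrib-+ (λ γ → Q φ (el γ ∙ y)) (λ γ → total φ (el γ) ys))
        (cong₂ _+_ (≡.sym (≡.trans (sum-permute (λ σ → Q φ (el σ)) (rightShift y))
          (sum-cong-≗ λ γ → Q-resp φ (el-ix (el γ ∙ y))))) (sum-total φ ys))

      -- For a fixed apex γ the gap a = γ⁻¹χ runs through all flags once. After this substitution
      -- the list depends on a alone, and for fixed a the sum over γ of each of its translates is
      -- the full sum of `Q`.
      average : ∀ n φ (L : Fin M → List Carrier) → (∀ a → length (L a) ≤ n) →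
                sum (λ γ → sum λ χ → total φ (el γ) (L (gap γ χ))) ≤ M * (n * sum (λ σ → Q φ (el σ)))
      average n φ L short = begin
        sum (λ γ → sum λ χ → total φ (el γ) (L (gap γ χ)))
          ≡⟨ sum-cong-≗ (λ γ → sum-permute (λ a → total φ (el γ) (L a)) (leftShift (el γ ⁻¹))) ⟨
        sum (λ γ → sum λ a → total φ (el γ) (L a))
          ≡⟨ ∑-comm (λ γ a → total φ (el γ) (L a)) ⟩
        sum (λ a → sum λ γ → total φ (el γ) (L a))
          ≤⟨ sum-mono {f = λ a → sum λ γ → total φ (el γ) (L a)} (λ a → ℕ.≤-trans (ℕ.≤-reflexive (sum-total φ (L a))) (ℕ.*-monoˡ-≤ _ (short a))) ⟩
        sum {M} (λ a → n * sum (λ σ → Q φ (el σ)))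
          ≡⟨ sum-const M _ ⟩
        M * (n * sum (λ σ → Q φ (el σ))) ∎
        where open ℕ.≤-Reasoning

    module _ {n : ℕ} (contractible : Flags.Contractible G K n) where
      open Flags G K
      open Contractible contractible

      c : ℕ
      c = 6 * n

      el-gap : ∀ γ χ → el γ ∙ el (gap γ χ) ≈ el χ
      el-gap γ χ = trans (∙-congˡ (el-ix _)) (trans (sym (assoc _ _ _)) (trans (∙-congʳ (inverseʳ _)) (identityˡ _)))

      -- Dimension zero: the paths from a fixed flag compare φ with a constant.
      module _ (φ : Cochain 1) where
        Φ : VertexCochain
        Φ = record
          { at  = λ i x → value φ (simplex ⁅ i ⁆ x)
          ; inv = λ i {x} {y} h → cong (value φ) (simplex-cong ⁅ i ⁆ λ j j∈ →
              ≡.subst (λ j → K.Member j (x ⁻¹ ∙ y)) (≡.sym (Subset.x∈⁅y⁆⇒x≡y i j∈)) h) }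
        open VertexCochain Φ

        private
          module Av = Averaging D D-resp

          S = sum λ σ → D Φ (el σ)

          L : Fin M → List Carrier
          L a = proj₁ (short (el a))

          -- A cochain on the empty face. Its coboundary is the constant vertex cochain, so B⁰
          -- consists of the constants.
          constant : Bool → Cochain 0
          constant b = Vec.tabulate {n = #faces 0} λ _ → b

          far : Fin M → Fin M → ℕ
          far γ χ = V.total Φ (el γ) (L (gap γ χ))

          far-bound : ∀ γ χ → 𝟙 (at 0F (el γ) xor at 0F (el χ)) ≤ far γ χ
          far-bound γ χ = ℕ.≤-trans (ℕ.≤-reflexive (cong (λ b → 𝟙 (at 0F (el γ) xor b))
              (at-resp 0F (sym (trans (∙-congˡ (path-to (el (gap γ χ)))) (el-gap γ χ))))))
            (proj₂ (proj₂ (short (el (gap γ χ)))) Φ (el γ))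

          value-d-constant : ∀ b i x → value (d (constant b)) (simplex ⁅ i ⁆ x) ≡ b
          value-d-constant b i x = ≡.trans (d-value (constant b) ⁅ i ⁆ x (Subset.∣⁅x⁆∣≡1 i))
            (≡.trans (cong (λ bs → foldr _xor_ false (map (λ β → value (constant b) (simplex β x)) bs)) (subsets-vertex i))
              (≡.trans (Bool.xor-identityʳ _) (value-tabulate (λ _ → b) (simplex-face ∅ x) (∣simplex∣ ∅ x))))

          shifted : Bool → Cochain 1
          shifted b = φ ⊕ d (constant b)

          value-shifted : ∀ b i x → value (shifted b) (simplex ⁅ i ⁆ x) ≡ at i x xor b
          value-shifted b i x = ≡.trans
            (value-⊕ φ (d (constant b)) (simplex-face ⁅ i ⁆ x) (≡.trans (∣simplex∣ ⁅ i ⁆ x) (Subset.∣⁅x⁆∣≡1 i)))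
            (cong (value φ (simplex ⁅ i ⁆ x) xor_) (value-d-constant b i x))

          multiplicity-shifted : ∀ b x → multiplicity (shifted b) x ≡
            𝟙 (at 2F x xor b) + (𝟙 (at 1F x xor b) + (𝟙 (at 0F x xor b) + 0))
          multiplicity-shifted b x = ≡.trans
            (cong (λ bs → sumᴸ (map (λ β → 𝟙 (value (shifted b) (simplex β x))) bs)) subsets-full-1)
            (cong₂ _+_ (cong 𝟙 (value-shifted b 2F x)) (cong₂ _+_ (cong 𝟙 (value-shifted b 1F x))
              (cong (λ b → 𝟙 b + 0) (value-shifted b 0F x))))

          -- The paths control only vertices of type 0. The other two vertices of χ are compared
          -- with its vertex of type 0 along two of the three edges counted by `D`; the third edge
          -- is slack.
          multiplicity-bound : ∀ γ χ → multiplicity (shifted (at 0F (el γ))) (el χ) ≤ D Φ (el χ) + 3 * far γ χ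
          multiplicity-bound γ χ = begin
            multiplicity (shifted b) x
              ≡⟨ multiplicity-shifted b x ⟩
            𝟙 (at 2F x xor b) + (𝟙 (at 1F x xor b) + (𝟙 (at 0F x xor b) + 0))
              ≤⟨ ℕ.+-mono-≤ (spoke 2F) (ℕ.+-mono-≤ (spoke 1F) (ℕ.+-monoˡ-≤ 0
                   (ℕ.≤-trans (ℕ.≤-reflexive (cong 𝟙 (Bool.xor-comm (at 0F x) b))) (far-bound γ χ)))) ⟩
            (p₂ + t) + ((p₁ + t) + (t + 0))
              ≤⟨ spokes-≤ p₁ p₂ p₃ t ⟩
            D Φ x + 3 * t ∎
            where
            open ℕ.≤-Reasoning
            x = el χ
            b = at 0F (el γ)
            t = far γ χ
            p₁ = 𝟙 (at 0F x xor at 1F x)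
            p₂ = 𝟙 (at 0F x xor at 2F x)
            p₃ = 𝟙 (at 1F x xor at 2F x)
            spoke : ∀ i → 𝟙 (at i x xor b) ≤ 𝟙 (at 0F x xor at i x) + t
            spoke i = ℕ.≤-trans (ℕ.≤-reflexive (cong 𝟙 (xor-identity 3 (λ { (u ∷ v ∷ b ∷ []) → v xor b })
                (λ { (u ∷ v ∷ b ∷ []) → (u xor v) xor (b xor u) }) (at 0F x ∷ at i x ∷ b ∷ []))))
              (ℕ.≤-trans (𝟙-xor (at 0F x xor at i x) (b xor at 0F x)) (ℕ.+-monoʳ-≤ _ (far-bound γ χ)))

          far-total : sum (λ γ → sum λ χ → 3 * far γ χ) ≤ M * (3 * (n * S))
          far-total = ℕ.≤-trans (ℕ.≤-reflexive (sum₂-scale 3 far))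
            (ℕ.≤-trans (ℕ.*-monoʳ-≤ 3 (Av.average n Φ L λ a → proj₁ (proj₂ (short (el a)))))
              (ℕ.≤-reflexive (*-swap 3 M (n * S))))

          value-d : ∀ β γ → subsets (⁅ β ⁆ ∪ ⁅ γ ⁆) 1 ≡ ⁅ γ ⁆ ∷ ⁅ β ⁆ ∷ [] → ∣ ⁅ β ⁆ ∪ ⁅ γ ⁆ ∣ ≡ 2 →
                    ∀ x → value (d φ) (simplex (⁅ β ⁆ ∪ ⁅ γ ⁆) x) ≡ at β x xor at γ x
          value-d β γ e card x = ≡.trans (d-value φ (⁅ β ⁆ ∪ ⁅ γ ⁆) x card)
            (≡.trans (cong (λ bs → foldr _xor_ false (map (λ β → value φ (simplex β x)) bs)) e)
              (xor-identity 2 (λ { (u ∷ v ∷ []) → v xor (u xor false) }) (λ { (u ∷ v ∷ []) → u xor v }) (at β x ∷ at γ x ∷ [])))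

          multiplicity-d : ∀ x → multiplicity (d φ) x ≡ D Φ x
          multiplicity-d x = ≡.trans
            (cong (λ bs → sumᴸ (map (λ β → 𝟙 (value (d φ) (simplex β x))) bs)) subsets-full-2)
            (≡.trans (cong₂ _+_ (cong 𝟙 (value-d 1F 2F subsets-12 ≡.refl x)) (cong₂ _+_ (cong 𝟙 (value-d 0F 2F subsets-02 ≡.refl x))
              (cong (λ b → 𝟙 b + 0) (value-d 0F 1F subsets-01 ≡.refl x))))
              (+-reverse (𝟙 (at 1F x xor at 2F x)) (𝟙 (at 0F x xor at 2F x)) (𝟙 (at 0F x xor at 1F x))))

        private
          D₁>0 : 0 < 3 * M
          D₁>0 = ℕ.*-mono-< {0} {3} (s≤s z≤n) M>0

          weight-d : weight (d φ) ℚ.* fromℕ (3 * M) ≡ fromℕ S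
          weight-d = ≡.trans (weight-sum (d φ) (fromℕ-positive D₁>0)) (cong fromℕ (sum-cong-≗ λ σ → multiplicity-d (el σ)))

          best : ∃[ γ ] sum (λ χ → multiplicity (shifted (at 0F (el γ))) (el χ)) ≤ S + 3 * (n * S)
          best = below-average₂ M>0 (λ γ χ → multiplicity (shifted (at 0F (el γ))) (el χ))
            (λ γ χ → 3 * far γ χ) (λ χ → D Φ (el χ)) (3 * (n * S)) multiplicity-bound far-total

        close-constant : ∃[ ψ ] weight (φ ⊕ d ψ) ℚ.≤ fromℕ (suc c) ℚ.* weight (d φ)
        close-constant = constant b , compare-weights (3 * M) D₁>0 c (weight-sum (shifted b) (fromℕ-positive D₁>0)) weight-d
          (ℕ.≤-trans (proj₂ best) (three-six n S))
          where b = at 0F (el (proj₁ best))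

      vertex-index : Fin 3 → Carrier → Fin (#faces 1)
      vertex-index i x = face-index (simplex-face ⁅ i ⁆ x) (≡.trans (∣simplex∣ ⁅ i ⁆ x) (Subset.∣⁅x⁆∣≡1 i))

      face-vertex-index : ∀ i x → face (vertex-index i x) ≡ simplex ⁅ i ⁆ x
      face-vertex-index i x = face-face-index (simplex-face ⁅ i ⁆ x) (≡.trans (∣simplex∣ ⁅ i ⁆ x) (Subset.∣⁅x⁆∣≡1 i))

      only : ∀ i {x y} → K.Member i (x ⁻¹ ∙ y) → ∀ j → j ∈ˢ ⁅ i ⁆ → K.Member j (x ⁻¹ ∙ y)
      only i {x} {y} h j j∈ = ≡.subst (λ j → K.Member j (x ⁻¹ ∙ y)) (≡.sym (Subset.x∈⁅y⁆⇒x≡y i j∈)) h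

      vertex-index-cong : ∀ i {x y} → K.Member i (x ⁻¹ ∙ y) → vertex-index i x ≡ vertex-index i y
      vertex-index-cong i {x} {y} h = face-injective (≡.trans (face-vertex-index i x)
        (≡.trans (simplex-cong ⁅ i ⁆ (only i h)) (≡.sym (face-vertex-index i y))))

      singleton-type : Subset 3 → Fin 3
      singleton-type (true ∷ _)          = 0F
      singleton-type (false ∷ true ∷ _)  = 1F
      singleton-type (false ∷ false ∷ _) = 2F

      singleton-type-⁅⁆ : ∀ i → singleton-type ⁅ i ⁆ ≡ i
      singleton-type-⁅⁆ 0F = ≡.refl
      singleton-type-⁅⁆ 1F = ≡.refl
      singleton-type-⁅⁆ 2F = ≡.refl

      vertex-type : Fin (#faces 1) → Fin 3
      vertex-type τ = singleton-type (proj₁ (face-simplex (proj₁ (is-face τ))))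

      -- A cone path leads to a flag, whereas the integral must be a function of the vertex. Hence
      -- one flag is singled out at every vertex.
      rep : Fin (#faces 1) → Carrier
      rep τ = proj₁ (proj₂ (face-simplex (proj₁ (is-face τ))))

      rep-simplex : ∀ i x → simplex ⁅ i ⁆ x ≡
                    simplex (proj₁ (face-simplex (proj₁ (is-face (vertex-index i x))))) (rep (vertex-index i x))
      rep-simplex i x = ≡.trans (≡.sym (face-vertex-index i x)) (proj₂ (proj₂ (face-simplex (proj₁ (is-face (vertex-index i x))))))

      singleton-rep : ∀ i x → ⁅ i ⁆ ≡ proj₁ (face-simplex (proj₁ (is-face (vertex-index i x))))
      singleton-rep i x = simplex-injective ⁅ i ⁆ _ x (rep (vertex-index i x)) (rep-simplex i x)

      vertex-type-index : ∀ i x → vertex-type (vertex-index i x) ≡ i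
      vertex-type-index i x = ≡.trans (cong singleton-type (≡.sym (singleton-rep i x))) (singleton-type-⁅⁆ i)

      rep∈ : ∀ i x → K.Member i (x ⁻¹ ∙ rep (vertex-index i x))
      rep∈ i x = simplex-cong⁻ ⁅ i ⁆ (≡.trans (rep-simplex i x)
        (cong (λ β → simplex β (rep (vertex-index i x))) (≡.sym (singleton-rep i x)))) i (Subset.x∈⁅x⁆ i)

      translate-mem : ∀ i g {x y} → K.Member i (x ⁻¹ ∙ y) → K.Member i ((g ⁻¹ ∙ x) ⁻¹ ∙ (g ⁻¹ ∙ y))
      translate-mem i g {x} {y} = K.resp i (sym (trans (∙-congʳ (⁻¹-anti-homo-∙ (g ⁻¹) x))
        (trans (∙-congʳ (∙-congˡ (⁻¹-involutive g))) (trans (assoc _ _ _)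
          (∙-congˡ (trans (sym (assoc _ _ _)) (trans (∙-congʳ (inverseʳ g)) (identityˡ y))))))))
        where open import Algebra.Properties.Group group using (⁻¹-anti-homo-∙; ⁻¹-involutive)

      -- Dimension one: integrate φ along the paths from a fixed flag.
      module _ (φ : Cochain 2) where
        Ψ : EdgeCochain
        Ψ = record
          { at  = λ i j x → value φ (simplex (⁅ i ⁆ ∪ ⁅ j ⁆) x)
          ; inv = λ i j {x} {y} h h′ → cong (value φ) (simplex-cong (⁅ i ⁆ ∪ ⁅ j ⁆) λ k k∈ →
              case Subset.x∈p∪q⁻ ⁅ i ⁆ ⁅ j ⁆ k∈ of λ { (inj₁ k∈i) → only i h k k∈i ; (inj₂ k∈j) → only j h′ k k∈j }) }
        open EdgeCochain Ψ using (at)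

        private
          module Av = Averaging (λ φ x → 𝟙 (∂ φ x)) ∂-resp

          S = sum λ σ → 𝟙 (∂ Ψ (el σ))

          module _ (γ : Fin M) where
            g = el γ

            -- The path leads from the apex to the vertex of type 0 of g ∙ ρ, and `root` goes on to
            -- that of type `i`, which is x K_i. The representative is taken at g⁻¹x, so that the
            -- cones at different apices are translates of each other.
            integral : Fin 3 → Carrier → Bool
            integral i x = cost (path ρ) Ψ g xor root Ψ i (g ∙ ρ)
              where ρ = rep (vertex-index i (g ⁻¹ ∙ x))

            integral-cong : ∀ i {x y} → K.Member i (x ⁻¹ ∙ y) → integral i x ≡ integral i y
            integral-cong i {x} {y} h = cong (λ τ → cost (path (rep τ)) Ψ g xor root Ψ i (g ∙ rep τ))
              (vertex-index-cong i (translate-mem i g h))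

            cone : Cochain 1
            cone = Vec.tabulate λ τ → integral (vertex-type τ) (rep τ)

            value-cone : ∀ i x → value cone (simplex ⁅ i ⁆ x) ≡ integral i x
            value-cone i x = ≡.trans (cong (value cone) (≡.sym (face-vertex-index i x)))
              (≡.trans (value-face cone τ) (≡.trans (Vec.lookup∘tabulate (λ τ → integral (vertex-type τ) (rep τ)) τ)
                (≡.trans (cong (λ j → integral j (rep τ)) (vertex-type-index i x)) (≡.sym (integral-cong i (rep∈ i x))))))
              where τ = vertex-index i x

            value-d-cone : ∀ i j → subsets (⁅ i ⁆ ∪ ⁅ j ⁆) 1 ≡ ⁅ j ⁆ ∷ ⁅ i ⁆ ∷ [] → ∣ ⁅ i ⁆ ∪ ⁅ j ⁆ ∣ ≡ 2 →
                           ∀ x → value (d cone) (simplex (⁅ i ⁆ ∪ ⁅ j ⁆) x) ≡ integral i x xor integral j x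
            value-d-cone i j e card x = ≡.trans (d-value cone (⁅ i ⁆ ∪ ⁅ j ⁆) x card)
              (≡.trans (cong (λ bs → foldr _xor_ false (map (λ β → value cone (simplex β x)) bs)) e)
              (≡.trans (cong₂ _xor_ (value-cone j x) (cong (_xor false) (value-cone i x)))
                (xor-identity 2 (λ { (u ∷ v ∷ []) → v xor (u xor false) }) (λ { (u ∷ v ∷ []) → u xor v }) (integral i x ∷ integral j x ∷ []))))

            shifted : Cochain 2
            shifted = φ ⊕ d cone

            value-shifted : ∀ i j → subsets (⁅ i ⁆ ∪ ⁅ j ⁆) 1 ≡ ⁅ j ⁆ ∷ ⁅ i ⁆ ∷ [] → ∣ ⁅ i ⁆ ∪ ⁅ j ⁆ ∣ ≡ 2 →
                            ∀ x → value shifted (simplex (⁅ i ⁆ ∪ ⁅ j ⁆) x) ≡ at i j x xor (integral i x xor integral j x)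
            value-shifted i j e card x = ≡.trans
              (value-⊕ φ (d cone) (simplex-face (⁅ i ⁆ ∪ ⁅ j ⁆) x) (≡.trans (∣simplex∣ (⁅ i ⁆ ∪ ⁅ j ⁆) x) card))
              (cong (at i j x xor_) (value-d-cone i j e card x))

          area-of : ∀ i a → E.Covered n (λ φ g → 𝟙 (cost (path (el a) ∙ₚ step i (el a ⁻¹ ∙ rep (vertex-index i (el a)))) φ g
                                                   xor cost (path (rep (vertex-index i (el a)))) φ g))
          area-of i a = Homotopic.area (filling i (el a) (rep (vertex-index i (el a))) (rep∈ i (el a)))

          L : Fin 3 → Fin M → List Carrier
          L i a = proj₁ (area-of i a)

          fill : Fin 3 → Fin M → Fin M → ℕ
          fill i γ χ = E.total Ψ (el γ) (L i (gap γ χ))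

          radial : Fin M → Fin M → Bool
          radial γ χ = cost (path (el (gap γ χ))) Ψ (el γ)

          -- Translated back by the apex, χ and the representative of its vertex of type `i` differ
          -- by an element of K_i. The two ways to reach this vertex are therefore compared by the
          -- filling along one step.
          fill-bound : ∀ i γ χ → 𝟙 ((radial γ χ xor root Ψ i (el χ)) xor integral γ i (el χ)) ≤ fill i γ χ
          fill-bound i γ χ = ℕ.≤-trans (ℕ.≤-reflexive (cong 𝟙 (≡.trans
              (cong₂ (λ r w → (radial γ χ xor r) xor w) start-eq integral-eq)
              (xor-identity 4 (λ { (p ∷ r ∷ k ∷ r′ ∷ []) → (p xor r) xor (k xor r′) })
                (λ { (p ∷ r ∷ k ∷ r′ ∷ []) → (p xor (r xor r′)) xor k })
                (radial γ χ ∷ root Ψ i (g′ ∙ end (path h)) ∷ cost (path ρ) Ψ g′ ∷ root Ψ i (g′ ∙ end (path h) ∙ (h ⁻¹ ∙ ρ)) ∷ [])))))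
            (proj₂ (proj₂ (area-of i a)) Ψ g′)
            where
            g′ = el γ
            a = gap γ χ
            h = el a
            ρ = rep (vertex-index i h)

            start-eq : root Ψ i (el χ) ≡ root Ψ i (g′ ∙ end (path h))
            start-eq = root-resp Ψ i (sym (trans (∙-congˡ (path-to h)) (el-gap γ χ)))

            end-eq : g′ ∙ ρ ≈ g′ ∙ end (path h) ∙ (h ⁻¹ ∙ ρ)
            end-eq = trans (∙-congˡ (trans (sym (identityˡ ρ)) (trans (∙-congʳ (sym (inverseʳ h))) (assoc _ _ _))))
              (trans (sym (assoc _ _ _)) (∙-congʳ (∙-congˡ (sym (path-to h)))))

            gap-eq : vertex-index i (g′ ⁻¹ ∙ el χ) ≡ vertex-index i h
            gap-eq = vertex-index-cong i (K.resp i (trans (sym (inverseˡ _)) (∙-congˡ (sym (el-ix (g′ ⁻¹ ∙ el χ))))) (K.ε-mem i))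

            integral-eq : integral γ i (el χ) ≡ cost (path ρ) Ψ g′ xor root Ψ i (g′ ∙ end (path h) ∙ (h ⁻¹ ∙ ρ))
            integral-eq = ≡.trans (cong (λ τ → cost (path (rep τ)) Ψ g′ xor root Ψ i (g′ ∙ rep τ)) gap-eq)
              (cong (cost (path ρ) Ψ g′ xor_) (root-resp Ψ i end-eq))

          -- Here `c` is the value on an edge of χ, `a` and `b` are the values on the edges from its
          -- vertex of type 0 to the ends, `x` and `y` the integrals, and `p` is the sum along the
          -- path to χ, which cancels. The defect `q` is dφ on χ for the edge of types 1 and 2, and
          -- 0 for the edges at the vertex of type 0.
          edge-bound : ∀ q p r s {a b c x y} → 𝟙 ((p xor a) xor x) ≤ r → 𝟙 ((p xor b) xor y) ≤ s →
                       c ≡ q xor (a xor b) → 𝟙 (c xor (x xor y)) ≤ 𝟙 q + (r + s)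
          edge-bound q p r s {a} {b} {c} {x} {y} h h′ ≡.refl = ℕ.≤-trans (ℕ.≤-reflexive (cong 𝟙
              (xor-identity 6 (λ { (q ∷ p ∷ a ∷ b ∷ x ∷ y ∷ []) → (q xor (a xor b)) xor (x xor y) })
                (λ { (q ∷ p ∷ a ∷ b ∷ x ∷ y ∷ []) → q xor (((p xor a) xor x) xor ((p xor b) xor y)) })
                (q ∷ p ∷ a ∷ b ∷ x ∷ y ∷ []))))
            (ℕ.≤-trans (𝟙-xor q _) (ℕ.+-monoʳ-≤ (𝟙 q) (ℕ.≤-trans (𝟙-xor ((p xor a) xor x) _) (ℕ.+-mono-≤ h h′))))

          fills : Fin M → Fin M → ℕ
          fills γ χ = fill 0F γ χ + (fill 1F γ χ + fill 2F γ χ)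

          multiplicity-bound : ∀ γ χ → multiplicity (shifted γ) (el χ) ≤ 𝟙 (∂ Ψ (el χ)) + 2 * fills γ χ
          multiplicity-bound γ χ = ℕ.≤-trans (ℕ.≤-reflexive (≡.trans
              (cong (λ bs → sumᴸ (map (λ β → 𝟙 (value (shifted γ) (simplex β x))) bs)) subsets-full-2)
              (cong₂ _+_ (cong 𝟙 (value-shifted γ 1F 2F subsets-12 ≡.refl x)) (cong₂ _+_ (cong 𝟙 (value-shifted γ 0F 2F subsets-02 ≡.refl x))
                (cong (λ b → 𝟙 b + 0) (value-shifted γ 0F 1F subsets-01 ≡.refl x))))))
            (ℕ.≤-trans
              (ℕ.+-mono-≤ (edge-bound (∂ Ψ x) p (fill 1F γ χ) (fill 2F γ χ) (fill-bound 1F γ χ) (fill-bound 2F γ χ)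
                  (xor-identity 3 (λ { (u ∷ v ∷ w ∷ []) → w }) (λ { (u ∷ v ∷ w ∷ []) → (u xor (v xor w)) xor (u xor v) })
                    (at 0F 1F x ∷ at 0F 2F x ∷ at 1F 2F x ∷ [])))
                (ℕ.+-mono-≤ (edge-bound false p (fill 0F γ χ) (fill 2F γ χ) (fill-bound 0F γ χ) (fill-bound 2F γ χ) ≡.refl)
                  (ℕ.+-monoˡ-≤ 0 (edge-bound false p (fill 0F γ χ) (fill 1F γ χ) (fill-bound 0F γ χ) (fill-bound 1F γ χ) ≡.refl))))
              (ℕ.≤-reflexive (edges-≡ (𝟙 (∂ Ψ x)) (fill 0F γ χ) (fill 1F γ χ) (fill 2F γ χ))))
            where
            x = el χ
            p = radial γ χ

          fill-total : ∀ i → sum (λ γ → sum λ χ → fill i γ χ) ≤ M * (n * S)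
          fill-total i = Av.average n Ψ (L i) λ a → proj₁ (proj₂ (area-of i a))

          fills-total : sum (λ γ → sum λ χ → 2 * fills γ χ) ≤ M * (6 * (n * S))
          fills-total = ℕ.≤-trans (ℕ.≤-reflexive (≡.trans (sum₂-scale 2 fills) (cong (2 *_)
              (≡.trans (sum₂-+ (fill 0F) (λ γ χ → fill 1F γ χ + fill 2F γ χ))
                (cong (sum (λ γ → sum (fill 0F γ)) +_) (sum₂-+ (fill 1F) (fill 2F)))))))
            (ℕ.≤-trans (ℕ.*-monoʳ-≤ 2 (ℕ.+-mono-≤ (fill-total 0F) (ℕ.+-mono-≤ (fill-total 1F) (fill-total 2F))))
              (ℕ.≤-reflexive (fills-≡ M (n * S))))

          best : ∃[ γ ] sum (λ χ → multiplicity (shifted γ) (el χ)) ≤ S + 6 * (n * S)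
          best = below-average₂ M>0 (λ γ χ → multiplicity (shifted γ) (el χ)) (λ γ χ → 2 * fills γ χ)
            (λ χ → 𝟙 (∂ Ψ (el χ))) (6 * (n * S)) multiplicity-bound fills-total

          value-d : ∀ x → value (d φ) (simplex full x) ≡ ∂ Ψ x
          value-d x = ≡.trans (d-value φ full x ≡.refl)
            (≡.trans (cong (λ bs → foldr _xor_ false (map (λ β → value φ (simplex β x)) bs)) subsets-full-2)
              (xor-identity 3 (λ { (u ∷ v ∷ w ∷ []) → w xor (v xor (u xor false)) }) (λ { (u ∷ v ∷ w ∷ []) → u xor (v xor w) })
                (at 0F 1F x ∷ at 0F 2F x ∷ at 1F 2F x ∷ [])))

          multiplicity-d : ∀ x → multiplicity (d φ) x ≡ 𝟙 (∂ Ψ x)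
          multiplicity-d x = ≡.trans
            (cong (λ bs → sumᴸ (map (λ β → 𝟙 (value (d φ) (simplex β x))) bs)) subsets-full-3)
            (≡.trans (ℕ.+-identityʳ _) (cong 𝟙 (value-d x)))

          D₁>0 : 0 < 3 * M
          D₁>0 = ℕ.*-mono-< {0} {3} (s≤s z≤n) M>0

          D₂>0 : 0 < 1 * M
          D₂>0 = ℕ.*-mono-< {0} {1} (s≤s z≤n) M>0

          weight-d : weight (d φ) ℚ.* fromℕ (3 * M) ≡ fromℕ (3 * S)
          weight-d = scale (weight (d φ)) 3 M S (≡.trans (cong (λ D → weight (d φ) ℚ.* fromℕ D) (≡.sym (ℕ.*-identityˡ M)))
            (≡.trans (weight-sum (d φ) (fromℕ-positive D₂>0)) (cong fromℕ (sum-cong-≗ λ σ → multiplicity-d (el σ)))))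

        close-cone : ∃[ ψ ] weight (φ ⊕ d ψ) ℚ.≤ fromℕ (suc c) ℚ.* weight (d φ)
        close-cone = cone (proj₁ best) , compare-weights (3 * M) D₁>0 c {w = weight (d φ)} {total} {3 * S}
          (weight-sum (shifted (proj₁ best)) (fromℕ-positive D₁>0)) weight-d total-≤
          where
          total : ℕ
          total = sum λ χ → multiplicity (shifted (proj₁ best)) (el χ)

          total-≤ : total ≤ suc c * (3 * S)
          total-≤ = ℕ.≤-trans (proj₂ best) (six-≤ n S)

      Exp₀ : fin (reciprocal c) ≤⁺ Weighted.Exp 2 0
      Exp₀ = Exp-bound 0 (s≤s z≤n) c close-constant

      Exp₁ : fin (reciprocal c) ≤⁺ Weighted.Exp 2 1
      Exp₁ = Exp-bound 1 (s≤s z≤n) c close-cone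

open import Algebra.Bundles using (CommutativeRing)
import Algebra.Properties.CommutativeMonoid.Sum as MonoidSum
import Algebra.Properties.Group as GroupProperties
open import Data.Fin.Base using (Fin)
open import Data.Fin.Patterns using (0F; 1F; 2F)
open import Data.Fin.Permutation using (permutation)
open import Data.Nat.Base as ℕ using (suc; s≤s; zero; ℕ)
open import Data.Nat.Divisibility using (_∤_; divides)
import Data.Nat.Properties as ℕ
open import Data.Product.Base using (_,_; _×_; proj₁; proj₂; Σ-syntax; ∃-syntax)
open import Data.Rational.Base as ℚ using (0ℚ; ℚ)
open import Data.Sum.Base using (_⊎_; inj₁; inj₂)
open import Defs
open import Function.Bundles using (Inverse)
open import Relation.Binary.Construct.Add.Supremum.NonStrict ℚ._≤_ using (_≤⁺_)
open import Relation.Binary.PropositionalEquality as ≡ using (_≡_)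
open import Relation.Nullary.Construct.Add.Supremum using ([_])
open import Relation.Nullary.Negation using (¬_)
open CommutatorRelations
open FlagPaths
open UniformFilling using (ChartedGroup; module ChartFacts; bound-n; contraction)
open LinkChart
open AveragedCones

-- Invertibility of 2, and the conclusion

module _ {q : ℕ} (F : FiniteField q) where
  open FiniteField F
  private
    module 𝔽 = CommutativeRing commutativeRing
    module Σ = MonoidSum 𝔽.+-commutativeMonoid
    open Inverse enumeration using (to; from; inverseˡ; inverseʳ; from-cong)

  -- Translation by 1 permutes the field, so the sum s of all elements satisfies s = s + q · 1.
  characteristic : Σ.sum {q} (λ _ → 1#) ≈ 0#
  characteristic = GroupProperties.identityʳ-unique 𝔽.+-group s _ (begin
    s + Σ.sum {q} (λ _ → 1#)        ≈⟨ Σ.∑-distrib-+ to (λ _ → 1#) ⟨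
    Σ.sum (λ i → to i + 1#)         ≈⟨ Σ.sum-cong-≋ (λ i → to-from (to i + 1#)) ⟨
    Σ.sum (λ i → to (from (to i + 1#))) ≈⟨ Σ.sum-permute to (permutation (λ i → from (to i + 1#)) (λ i → from (to i + - 1#)) (cancel (𝔽.-‿inverseˡ 1#)) (cancel (𝔽.-‿inverseʳ 1#))) ⟨
    s ∎)
    where
    open import Relation.Binary.Reasoning.Setoid setoid
    s = Σ.sum to

    to-from : ∀ x → to (from x) ≈ x
    to-from x = inverseˡ ≡.refl

    cancel : ∀ {a b} → a + b ≈ 0# → ∀ i → from (to (from (to i + a)) + b) ≡ i
    cancel {a} {b} e i = ≡.trans (from-cong (trans (+-congʳ (to-from _))
      (trans (+-assoc _ _ _) (trans (+-congˡ e) (+-identityʳ _))))) (inverseʳ refl)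

  sum-ones : ∀ k → 1# + 1# ≈ 0# → Σ.sum {k ℕ.* 2} (λ _ → 1#) ≈ 0#
  sum-ones zero    e = refl
  sum-ones (suc k) e = trans (sym (+-assoc _ _ _)) (trans (+-cong e (sum-ones k e)) (+-identityˡ 0#))

  parity : ∀ n → Σ[ k ∈ ℕ ] (n ≡ k ℕ.* 2 ⊎ n ≡ suc (k ℕ.* 2))
  parity zero = 0 , inj₁ ≡.refl
  parity (suc n) with parity n
  ... | k , inj₁ e = k , inj₂ (≡.cong suc e)
  ... | k , inj₂ e = suc k , inj₁ (≡.cong suc e)

  -- If 1 + 1 = 0, then q · 1 = 1 for odd q, against `characteristic`.
  two≉0 : 2 ∤ q → ¬ 1# + 1# ≈ 0#
  two≉0 odd e with parity q
  ... | k , inj₁ q≡2k = odd (divides k q≡2k)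
  ... | k , inj₂ ≡.refl = 1≉0 (trans (sym (trans (+-congˡ (sum-ones k e)) (+-identityʳ 1#))) characteristic)

  charted : 2 ∤ q → ChartedGroup
  charted odd = record
    { R = commutativeRing ; G = Link.G-link F ; K = Link.K-link F ; chart = LinkCoordinates.chart F
    ; half = proj₁ inv
    ; half+half≈1 = trans (sym (trans (distribʳ (proj₁ inv) 1# 1#) (+-cong (*-identityˡ _) (*-identityˡ _)))) (proj₂ inv) }
    where inv = invertible (1# + 1#) (two≉0 odd)

module _ (G : FiniteGroup) (K : Fin 3 → DecSubgroup (FiniteGroup.group G)) where
  open FiniteGroup G using (_≈_; _∙_; ε)
  open DecSubgroup using (Member)

  coset-expander : (∀ {g} → Member (K 1F) g → ∃[ h ] ∃[ k ]
                     ((Member (K 0F) h × Member (K 1F) h) × (Member (K 1F) k × Member (K 2F) k) × g ≈ h ∙ k)) →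
                   (∀ {g} → (∀ i → Member (K i) g) → g ≈ ε) → ∀ {n} → Flags.Contractible G K n →
                   ([ reciprocal (6 ℕ.* n) ] ≤⁺ Exp 2 (cosetComplex G K) 0 × [ reciprocal (6 ℕ.* n) ] ≤⁺ Exp 2 (cosetComplex G K) 1)
                   × IsCoboundaryExpander 2 (reciprocal (6 ℕ.* n)) (cosetComplex G K)
  coset-expander K₁-product trivial-intersection {n} contractible = (e₀ , e₁) , pure , λ where
      0 _ → e₀
      1 _ → e₁
      (suc (suc _)) (s≤s (s≤s ()))
    where
    open CosetSimplices.Flag G K K₁-product trivial-intersection
    e₀ = Expander.Exp₀ flagComplex contractible
    e₁ = Expander.Exp₁ flagComplex contractible

theorem1p22 : ∃[ ε ] (0ℚ ℚ.< ε ×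
    (∀ (q : ℕ) → IsPrimePower q → 2 ∤ q → (F : FiniteField q) →
    ([ ε ] ≤⁺ Exp 2 (X-link F) 0 × [ ε ] ≤⁺ Exp 2 (X-link F) 1)
    × IsCoboundaryExpander 2 ε (X-link F)))
theorem1p22 = reciprocal (6 ℕ.* bound-n) , reciprocal-positive (6 ℕ.* bound-n) , λ q _ odd F →
  coset-expander (Link.G-link F) (Link.K-link F)
    (λ {g} → ChartFacts.K₁-product (LinkCoordinates.chart F) {g})
    (λ {g} → ChartFacts.trivial-intersection (LinkCoordinates.chart F) {g})
    {bound-n} (contraction (charted F odd))
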